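{- There exist deterministic algorithms $\mathcal A_1,\mathcal A_2,\mathcal A_3$ that, given as input a non-empty set $X\subseteq\{0,1\}^n$ of size $M$ and a parameter $s$, run in $O(\mathrm{poly}(n,s)\cdot M^{\omega\lceil s/3\rceil})$ time, use $O(M^{2\lceil s/3\rceil})$ space, and have the following behaviour. 1. The output of $\mathcal A_1$ is $z_1,\dots,z_s\in X$ such that $\mathrm{sumPD}(z_1,\dots,z_s)=\mathrm{OptSum}(X,s)$. 2. The output of $\mathcal A_2$ is $z_1,\dots,z_s\in X$ such that $\mathrm{minPD}(z_1,\dots,z_s)=\mathrm{OptMin}(X,s)$. 3. As long as $|X|\ge s$, the output of $\mathcal A_3$ is a set $\{z_1,\dots,z_s\}\subseteq X$ such that $\mathrm{sumPD}(z_1,\dots,z_s)=\mathrm{OptSum}_{\neq}(X,s)$.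
   Context: $\omega\le 2.38$ is the matrix multiplication exponent. $d_H$ is Hamming distance. For $z_1,\dots,z_s\in\{0,1\}^n$, $\mathrm{sumPD}(z_1,\dots,z_s)=\sum_{i<j}d_H(z_i,z_j)$ and $\mathrm{minPD}(z_1,\dots,z_s)=\min_{i<j}d_H(z_i,z_j)$. $\mathrm{OptSum}(X,s)$ is the maximum of $\mathrm{sumPD}$ over multisets of $s$ elements (with multiplicity) of $X$; $\mathrm{OptSum}_{\neq}(X,s)$ is the maximum of $\mathrm{sumPD}$ over sets of $s$ distinct elements of $X$; $\mathrm{OptMin}(X,s)$ is the maximum of $\mathrm{minPD}$ over sets of $s$ elements of $X$. If $|X|<s$, multisets are allowed in the minPD problem (so that $\mathrm{OptMin}(X,s)=0$). -}

module Defs where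

open import Data.Bool.Base using (Bool; true; false; if_then_else_; _xor_)
import Data.Bool.Properties as Bool
open import Data.Fin.Base using (Fin; toℕ)
open import Data.Fin.Properties using (toℕ-injective)
open import Data.List.Base as List using (List; []; _∷_; [_]; _++_; cartesianProductWith; filter)
open import Data.List.Extrema.Nat using (max; min)
open import Data.Nat.Base
open import Data.Nat.ListAction using (sum)
open import Data.Nat.DivMod using (_/_; _%_)
open import Data.Nat.Properties using (≡ᵇ⇒≡)
open import Data.Product.Base using (∃; ∃₂; ∃-syntax; _×_; _,_)
open import Data.Rational.Base as ℚ using (ℚ)
import Data.Rational.Properties as ℚ
open import Algebra.Properties.CommutativeMonoid.Sum ℚ.+-0-commutativeMonoid
  using () renaming (sum to ∑)
open import Data.Vec.Base as Vec using (Vec; []; _∷_; lookup; toList; zipWith)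
open import Data.Vec.Properties using (≡-dec)
open import Data.Vec.Relation.Unary.AllPairs using (allPairs?)
open import Data.Vec.Relation.Unary.Unique.Propositional using (Unique)
open import Relation.Binary.PropositionalEquality
  using (_≡_; _≢_; refl; sym; trans; cong; cong₂)
open import Relation.Nullary using (Dec; contradiction)
open import Relation.Nullary.Decidable using (¬?)

------------------------------------------------------------------------
-- Dispersion

Cube : ℕ → Set
Cube n = Vec Bool n

private
  variable
    n M s : ℕ

d_H : Cube n → Cube n → ℕ
d_H x y = Vec.sum (zipWith (λ a b → if a xor b then 1 else 0) x y)

-- The distances d_H(zᵢ, zⱼ), i < j, with repetitions.
pairDistances : Vec (Cube n) s → List ℕ
pairDistances []       = []
pairDistances (z ∷ zs) = toList (Vec.map (d_H z) zs) ++ pairDistances zs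

sumPD : Vec (Cube n) s → ℕ
sumPD zs = sum (pairDistances zs)

-- As d_H ≤ n, the first argument of min only matters when s ≤ 1, where it
-- makes the minimum over no pairs equal to n.
minPD : Vec (Cube n) s → ℕ
minPD {n = n} zs = min n (pairDistances zs)

-- Multisets and sets of size s are represented by their orderings; sumPD and
-- minPD do not depend on the ordering.
multisets : Vec (Cube n) M → ∀ s → List (Vec (Cube n) s)
multisets X zero    = [ [] ]
multisets X (suc s) = cartesianProductWith _∷_ (toList X) (multisets X s)

unique? : (zs : Vec (Cube n) s) → Dec (Unique zs)
unique? = allPairs? (λ x y → ¬? (≡-dec Bool._≟_ x y))

sets : Vec (Cube n) M → ∀ s → List (Vec (Cube n) s)
sets X s = filter unique? (multisets X s)

OptSum : Vec (Cube n) M → ℕ → ℕ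
OptSum X s = max 0 (List.map sumPD (multisets X s))

OptSum≢ : Vec (Cube n) M → ℕ → ℕ
OptSum≢ X s = max 0 (List.map sumPD (sets X s))

OptMin : Vec (Cube n) M → ℕ → ℕ
OptMin {M = M} X s =
  max 0 (List.map minPD (if s ≤ᵇ M then sets X s else multisets X s))

------------------------------------------------------------------------
-- The matrix multiplication exponent, by arithmetic complexity over ℚ

Matrix : ℕ → Set
Matrix N = Fin N → Fin N → ℚ

_·_ : ∀ {N} → Matrix N → Matrix N → Matrix N
(A · B) i j = ∑ (λ k → A i k ℚ.* B k j)

data ArithOp : Set where
  add sub mul : ArithOp

-- What an instruction of a straight-line program may refer to after g
-- instructions: entries of the two input matrices, scalars, earlier results.
data Operand (N g : ℕ) : Set where
  entryA entryB : Fin N → Fin N → Operand N g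
  scalar        : ℚ → Operand N g
  result        : Fin g → Operand N g

-- Straight-line programs with g arithmetic operations.
data SLP (N : ℕ) : ℕ → Set where
  []      : SLP N 0
  _▷_⟨_⟩_ : ∀ {g} → SLP N g → Operand N g → ArithOp → Operand N g → SLP N (suc g)

⟦_⟧ᵃ : ArithOp → ℚ → ℚ → ℚ
⟦ add ⟧ᵃ = ℚ._+_
⟦ sub ⟧ᵃ = ℚ._-_
⟦ mul ⟧ᵃ = ℚ._*_

module _ {N : ℕ} (A B : Matrix N) where

  value : ∀ {g} → Vec ℚ g → Operand N g → ℚ
  value vs (entryA i j) = A i j
  value vs (entryB i j) = B i j
  value vs (scalar c)   = c
  value vs (result k)   = lookup vs k

  -- The latest result comes first.
  results : ∀ {g} → SLP N g → Vec ℚ g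
  results []              = []
  results (P ▷ a ⟨ ⊙ ⟩ b) = ⟦ ⊙ ⟧ᵃ (value vs a) (value vs b) ∷ vs
    where vs = results P

-- N × N matrices can be multiplied with g arithmetic operations.
MultipliableWith : ℕ → ℕ → Set
MultipliableWith N g =
  ∃₂ λ (P : SLP N g) (out : Fin N → Fin N → Operand N g) →
    ∀ A B i j → value A B (results A B P) (out i j) ≡ (A · B) i j

-- Multiplication takes O(N^(p/q)) arithmetic operations.
MultExponent : (p q : ℕ) → Set
MultExponent p q =
  ∃[ C ] ∀ N → ∃[ g ] (MultipliableWith N g × g ^ q ≤ C * N ^ p)

-- ω, the infimum of these exponents, is represented by its upper cut: the
-- rationals p/q that exceed some exponent p′/q′.
ω<_/_ : (p q : ℕ) → Set
ω< p / q =
  ∃₂ λ p′ q′ → NonZero q′ × MultExponent p′ q′ × p′ * q < p * q′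

------------------------------------------------------------------------
-- Word RAM with structured control flow

Reg : Set
Reg = ℕ

data WordOp : Set where
  add monus mul quot rem : WordOp

data Command : Set where
  _≔_     : Reg → ℕ → Command
  _≔_⟨_⟩_ : Reg → Reg → WordOp → Reg → Command
  -- load r a:    r becomes the content of the memory cell with address a
  -- store a r:   the memory cell with address a becomes r
  -- input r i j: r becomes bit j of the i-th input vector
  load    : Reg → Reg → Command
  store   : Reg → Reg → Command
  input   : Reg → Reg → Reg → Command
  emit    : Reg → Command
  _⨾_     : Command → Command → Command
  cond    : Reg → Command → Command → Command
  while   : Reg → Command → Command

⟦_⟧ʷ : WordOp → ℕ → ℕ → ℕ
⟦ add   ⟧ʷ m n       = m + n
⟦ monus ⟧ʷ m n       = m ∸ n
⟦ mul   ⟧ʷ m n       = m * n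
⟦ quot  ⟧ʷ m zero    = 0
⟦ quot  ⟧ʷ m (suc n) = m / suc n
⟦ rem   ⟧ʷ m zero    = m
⟦ rem   ⟧ʷ m (suc n) = m % suc n

_[_↦_] : (ℕ → ℕ) → ℕ → ℕ → (ℕ → ℕ)
(f [ i ↦ v ]) j = if j ≡ᵇ i then v else f j

record State : Set where
  constructor ⟨_,_,_⟩
  field
    reg    : ℕ → ℕ
    mem    : ℕ → ℕ
    output : List ℕ

open State public

initReg : (n s M : ℕ) → ℕ → ℕ
initReg n s M 0 = n
initReg n s M 1 = s
initReg n s M 2 = M
initReg n s M _ = 0

initial : (n s M : ℕ) → State
initial n s M = ⟨ initReg n s M , (λ _ → 0) , [] ⟩

bit : Bool → ℕ
bit b = if b then 1 else 0

-- A machine whose words are the numbers below W, that has S memory cells in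
-- addition to its registers, and that has random read-only access to X.
-- Exceeding W or S blocks the execution.
module Machine (W S : ℕ) {n M : ℕ} (X : Vec (Cube n) M) where

  -- c , σ ⇓[ t ] σ′: started in σ, the command c halts in σ′ after t steps.
  data _,_⇓[_]_ : Command → State → ℕ → State → Set where

    const : ∀ {ρ μ o r v} → v < W →
            (r ≔ v) , ⟨ ρ , μ , o ⟩ ⇓[ 1 ] ⟨ ρ [ r ↦ v ] , μ , o ⟩

    arith : ∀ {ρ μ o r a ⊙ b} → ⟦ ⊙ ⟧ʷ (ρ a) (ρ b) < W →
            (r ≔ a ⟨ ⊙ ⟩ b) , ⟨ ρ , μ , o ⟩
              ⇓[ 1 ] ⟨ ρ [ r ↦ ⟦ ⊙ ⟧ʷ (ρ a) (ρ b) ] , μ , o ⟩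

    load  : ∀ {ρ μ o r a} → ρ a < S →
            load r a , ⟨ ρ , μ , o ⟩ ⇓[ 1 ] ⟨ ρ [ r ↦ μ (ρ a) ] , μ , o ⟩

    store : ∀ {ρ μ o a r} → ρ a < S →
            store a r , ⟨ ρ , μ , o ⟩ ⇓[ 1 ] ⟨ ρ , μ [ ρ a ↦ ρ r ] , o ⟩

    input : ∀ {ρ μ o r a b} (i : Fin M) (j : Fin n) → ρ a ≡ toℕ i → ρ b ≡ toℕ j →
            input r a b , ⟨ ρ , μ , o ⟩
              ⇓[ 1 ] ⟨ ρ [ r ↦ bit (lookup (lookup X i) j) ] , μ , o ⟩

    emit  : ∀ {ρ μ o r} →
            emit r , ⟨ ρ , μ , o ⟩ ⇓[ 1 ] ⟨ ρ , μ , o ++ [ ρ r ] ⟩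

    seq   : ∀ {c d σ σ′ σ″ t u} → c , σ ⇓[ t ] σ′ → d , σ′ ⇓[ u ] σ″ →
            (c ⨾ d) , σ ⇓[ t + u ] σ″

    then′ : ∀ {c d r σ σ′ t} → reg σ r ≢ 0 → c , σ ⇓[ t ] σ′ →
            cond r c d , σ ⇓[ suc t ] σ′

    else′ : ∀ {c d r σ σ′ t} → reg σ r ≡ 0 → d , σ ⇓[ t ] σ′ →
            cond r c d , σ ⇓[ suc t ] σ′

    again : ∀ {c r σ σ′ σ″ t u} → reg σ r ≢ 0 →
            c , σ ⇓[ t ] σ′ → while r c , σ′ ⇓[ u ] σ″ →
            while r c , σ ⇓[ suc (t + u) ] σ″

    done  : ∀ {c r σ} → reg σ r ≡ 0 → while r c , σ ⇓[ 1 ] σ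

  deterministic : ∀ {c σ t t′ σ₁ σ₂} → c , σ ⇓[ t ] σ₁ → c , σ ⇓[ t′ ] σ₂ →
                  t ≡ t′ × σ₁ ≡ σ₂
  deterministic (const _) (const _) = refl , refl
  deterministic (arith _) (arith _) = refl , refl
  deterministic (load _)  (load _)  = refl , refl
  deterministic (store _) (store _) = refl , refl
  deterministic (input i j p q) (input i′ j′ p′ q′)
    with refl ← toℕ-injective {i = i} {i′} (trans (sym p) p′)
       | refl ← toℕ-injective {i = j} {j′} (trans (sym q) q′) = refl , refl
  deterministic emit emit = refl , refl
  deterministic (seq p q) (seq p′ q′)
    with refl , refl ← deterministic p p′
    with refl , refl ← deterministic q q′ = refl , refl
  deterministic (then′ _ p) (then′ _ p′)
    with refl , refl ← deterministic p p′ = refl , refl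
  deterministic (then′ z _) (else′ z′ _) = contradiction z′ z
  deterministic (else′ z _) (then′ z′ _) = contradiction z z′
  deterministic (else′ _ p) (else′ _ p′)
    with refl , refl ← deterministic p p′ = refl , refl
  deterministic (again _ p q) (again _ p′ q′)
    with refl , refl ← deterministic p p′
    with refl , refl ← deterministic q q′ = refl , refl
  deterministic (again z _ _) (done z′) = contradiction z′ z
  deterministic (done z) (again z′ _ _) = contradiction z z′
  deterministic (done _) (done _) = refl , refl

------------------------------------------------------------------------
-- Algorithms with the resource bounds

⌈_/3⌉ : ℕ → ℕ
⌈ s /3⌉ = (s + 2) / 3

-- The output tape presenting z₁, …, zₛ, bit by bit.
encode : Vec (Cube n) s → List ℕ
encode zs = List.map bit (List.concatMap toList (toList zs))

Behaviour : Set₁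
Behaviour = ∀ {n M} → Vec (Cube n) M → (s : ℕ) → List ℕ → Set

-- On every input the algorithm halts with an output satisfying Q, within
--   time        t ≤ C (1 + n + s)^C · M^((p/q)⌈s/3⌉),
--   space       S = C · M^(2⌈s/3⌉) memory cells, and
--   words below W = (2 + n + s + M + M^⌈s/3⌉)^C, i.e. of length logarithmic
--               in the sizes of the input and of the memory.
RunsWith : (p q : ℕ) → Command → Behaviour → Set
RunsWith p q 𝒜 Q =
  ∃[ C ] ∀ {n M} .{{_ : NonZero M}} (X : Vec (Cube n) M) → Unique X → ∀ s →
    let W = (2 + n + s + M + M ^ ⌈ s /3⌉) ^ C
        S = C * M ^ (2 * ⌈ s /3⌉)
        open Machine W S X
    in ∃₂ λ t σ →
         𝒜 , initial n s M ⇓[ t ] σ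
         × t ^ q ≤ (C * (1 + n + s) ^ C) ^ q * M ^ (p * ⌈ s /3⌉)
         × Q X s (output σ)

-- A solution splits into three blocks of at most ⌈s/3⌉ vectors, so that a block
-- is one of at most N = M^⌈s/3⌉ vertices. Once the total distance, the labels of
-- the three edges and a lower bound on the distances are guessed, the solutions
-- are the triangles of a tripartite graph, in which the edge from block p to the
-- next one carries the distances within block p and between the two blocks. The
-- number of triangles is the trace of a product of three 0/1 matrices. A
-- straight-line program for products of β × β matrices with g instructions yields
-- 2 g products of linear forms. Its recursive use on matrices of size β^L ≥ N
-- computes the trace, up to a factor D^L, with (2 g)^L leaves, and a depth first
-- traversal modulo a number that exceeds the result needs only O(N²) cells. For
-- large β the gap between p/q and ω absorbs all constant factors. A triangle of
-- the best candidate is finally located by bisecting the three vertex sets.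
module Submission where

open import Data.Bool.Base using (Bool; true; false; if_then_else_; T)
import Data.Bool.Properties as Bool
open import Data.Fin.Base using (Fin; toℕ; fromℕ<; zero; suc; remQuot; combine)
open import Data.Fin.Properties using (toℕ-fromℕ<; fromℕ<-toℕ; toℕ<n; toℕ-injective; injective⇒≤; combine-remQuot)
import Data.Fin.Properties as Fin
open import Data.Integer.Base as ℤ using (ℤ; +_; -[1+_])
import Data.Integer.Properties as ℤ
import Data.Integer.Tactic.RingSolver as ℤSolver
open import Data.List.Base as List using (List; []; _∷_; [_]; _++_)
open import Data.List.Extrema.Nat using (max; max≈v⁺; max≤v⁺; v≤min⁺; min≤xs; min≤⊤)
import Data.List.Membership.Propositional as List
open import Data.List.Membership.Propositional.Properties using (∈-cartesianProductWith⁺; ∈-cartesianProductWith⁻; ∈-filter⁺; ∈-filter⁻; ∈-map⁺)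
open import Data.List.Properties using (++-assoc; ++-identityʳ; map-++)
open import Data.List.Relation.Unary.All using ([]; _∷_)
import Data.List.Relation.Unary.All as ListAll
import Data.List.Relation.Unary.All.Properties as ListAll
open import Data.List.Relation.Unary.Any using (here)
open import Data.Nat.Base
import Data.Nat.Coprimality as Coprimality
open import Data.Nat.DivMod
open import Data.Nat.Divisibility using (divides-refl)
open import Data.Nat.ListAction using (sum)
open import Data.Nat.ListAction.Properties using (sum-++)
open import Data.Nat.Properties
open import Data.Nat.Tactic.RingSolver using (solve-∀)
open import Data.Product.Base using (∃₂; ∃-syntax; Σ; _×_; _,_; proj₁; proj₂)
open import Data.Rational.Base as ℚ using (ℚ; 0ℚ; 1ℚ)
import Data.Rational.Properties as ℚ
import Data.Rational.Solver as ℚSolver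
import Data.Rational.Unnormalised.Base as ℚᵘ
import Data.Rational.Unnormalised.Properties as ℚᵘ
open import Data.Sum.Base using (_⊎_; inj₁; inj₂; [_,_]′)
open import Data.Unit.Base using (⊤; tt)
open import Data.Vec.Base as Vec using (Vec; []; _∷_; lookup; toList; zipWith; head; tail)
open import Data.Vec.Membership.Propositional using (_∈_)
open import Data.Vec.Membership.Propositional.Properties using (∈-toList⁺; ∈-toList⁻; ∈-lookup)
open import Data.Vec.Properties using (lookup-map)
open import Data.Vec.Relation.Unary.All using (All)
import Data.Vec.Relation.Unary.All as VecAll
import Data.Vec.Relation.Unary.All.Properties as AllProperties
open import Data.Vec.Relation.Unary.AllPairs using ([]; _∷_)
open import Data.Vec.Relation.Unary.Any using (index; here; there)
open import Data.Vec.Relation.Unary.Any.Properties using (lookup-index)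
open import Data.Vec.Relation.Unary.Unique.Propositional using (Unique)
open import Defs
open import Function.Base using (_∘_; id; case_of_)
open import Relation.Binary.PropositionalEquality using (_≡_; _≢_; refl; sym; trans; cong; cong₂; subst; subst₂; module ≡-Reasoning)
open import Relation.Nullary using (¬_; yes; no; contradiction)
open import Algebra.Properties.CommutativeMonoid.Sum ℚ.+-0-commutativeMonoid using () renaming (sum to ∑)

-- Loop programs and their compilation

-- The base size is chosen with (8 g)^q ≤ β^p. Of the factor 8, one 2 comes from the two products
-- per instruction, one 2 per level pays for the work at inner nodes and for decoding L digits per
-- entry, and one 2 per level pays for the L β rounds of bisection, because L ≤ 2^L. The number of
-- candidates is polynomial in n and s, since every label is below V = n s² + 1 and at most n + 1
-- lower bounds occur; the third edge label follows from the total and the other two. The machine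
-- has no recursion and only short words. The path to the current node is therefore a single word,
-- which serves as the stack, and the rational coefficients are scaled to integers and stored as
-- residues. The trace tells only that a triangle exists, hence the bisection. L depends on the
-- input and is determined at run time, while β and the coefficients are part of the program text.
-- Bisection and output are carried out even if no candidate has succeeded, so that safety and
-- termination must not rely on a solution; the claim of optimality is then vacuous.

infixl 7 _⊗_ _⊘_ _⊛_
infixl 6 _⊕_ _⊖_
infixr 2 _⍮_

-- Variables are named by de Bruijn levels, which are also the registers that
-- hold them; temporaries live in the registers above.
data Exp (Γ : ℕ) : Set where
  var : (ℓ : ℕ) {_ : T (ℓ <ᵇ Γ)} → Exp Γ
  lit : ℕ → Exp Γ
  _⊕_ _⊖_ _⊗_ _⊘_ _⊛_ : Exp Γ → Exp Γ → Exp Γ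
  cell : Exp Γ → Exp Γ
  inp : Exp Γ → Exp Γ → Exp Γ

data Stm (Γ : ℕ) : Set where
  skip  : Stm Γ
  put   : (ℓ : ℕ) {_ : T (ℓ <ᵇ Γ)} → Exp Γ → Stm Γ
  write : Exp Γ → Exp Γ → Stm Γ
  say   : Exp Γ → Stm Γ
  _⍮_   : Stm Γ → Stm Γ → Stm Γ
  when  : Exp Γ → Stm Γ → Stm Γ → Stm Γ
  new   : Exp Γ → Stm (suc Γ) → Stm Γ
  for   : Exp Γ → Stm (suc Γ) → Stm Γ

-- The machine cannot copy registers, so a cleared register is added. `tmp` may coincide with `r`,
-- but not with `a`.
moveTo : ℕ → ℕ → ℕ → Command
moveTo tmp r a = (tmp ≔ 0) ⨾ (r ≔ a ⟨ add ⟩ tmp)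

-- Stack discipline: the value ends up in register `d`, and no register below `d` is touched.
compileExp : ∀ {Γ} → ℕ → Exp Γ → Command
compileExp d (var ℓ) = moveTo d d ℓ
compileExp d (lit x) = d ≔ x
compileExp d (e ⊕ f) = compileExp d e ⨾ (compileExp (suc d) f ⨾ (d ≔ d ⟨ add ⟩ suc d))
compileExp d (e ⊖ f) = compileExp d e ⨾ (compileExp (suc d) f ⨾ (d ≔ d ⟨ monus ⟩ suc d))
compileExp d (e ⊗ f) = compileExp d e ⨾ (compileExp (suc d) f ⨾ (d ≔ d ⟨ mul ⟩ suc d))
compileExp d (e ⊘ f) = compileExp d e ⨾ (compileExp (suc d) f ⨾ (d ≔ d ⟨ quot ⟩ suc d))
compileExp d (e ⊛ f) = compileExp d e ⨾ (compileExp (suc d) f ⨾ (d ≔ d ⟨ rem ⟩ suc d))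
compileExp d (cell e) = compileExp d e ⨾ load d d
compileExp d (inp e f) = compileExp d e ⨾ (compileExp (suc d) f ⨾ input d d (suc d))

compile : ∀ {Γ} → Stm Γ → Command
compile {Γ} skip = Γ ≔ 0
compile {Γ} (put ℓ e) = compileExp Γ e ⨾ moveTo (suc Γ) ℓ Γ
compile {Γ} (write a e) = compileExp Γ a ⨾ (compileExp (suc Γ) e ⨾ store Γ (suc Γ))
compile {Γ} (say e) = compileExp Γ e ⨾ emit Γ
compile (c ⍮ d) = compile c ⨾ compile d
compile {Γ} (when e c d) = compileExp Γ e ⨾ cond Γ (compile c) (compile d)
compile {Γ} (new e c) = compileExp Γ e ⨾ compile c
-- The counter is decremented before the body, which thus sees the bound minus one first and 0 last.
compile {Γ} (for e c) =
  compileExp Γ e ⨾ while Γ ((suc Γ ≔ 1) ⨾ ((Γ ≔ Γ ⟨ monus ⟩ suc Γ) ⨾ compile c))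

-- Environments list the newest variable first, whereas levels count from the oldest one; hence the
-- comparison with the length of the tail.
look : ∀ {Γ} → Vec ℕ Γ → ℕ → ℕ
look []              ℓ = 0
look {suc Γ} (x ∷ v) ℓ = if ℓ ≡ᵇ Γ then x else look v ℓ

upd : ∀ {Γ} → Vec ℕ Γ → ℕ → ℕ → Vec ℕ Γ
upd []              ℓ y = []
upd {suc Γ} (x ∷ v) ℓ y = if ℓ ≡ᵇ Γ then y ∷ v else x ∷ upd v ℓ y

cost : ∀ {Γ} → Exp Γ → ℕ
cost (var _) = 2
cost (lit _) = 1
cost (e ⊕ f) = cost e + (cost f + 1)
cost (e ⊖ f) = cost e + (cost f + 1)
cost (e ⊗ f) = cost e + (cost f + 1)
cost (e ⊘ f) = cost e + (cost f + 1)
cost (e ⊛ f) = cost e + (cost f + 1)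
cost (cell e) = cost e + 1
cost (inp e f) = cost e + (cost f + 1)

Memory : Set
Memory = ℕ → ℕ

-- A program logic with running times

module Logic (W S : ℕ) {n M : ℕ} (X : Vec (Cube n) M) where
  open Machine W S X

  -- The default 0 makes the meaning of expressions total, so that values can be named without a
  -- proof of safety.
  bitAt : ℕ → ℕ → ℕ
  bitAt i j with i <? M | j <? n
  ... | yes p | yes q = bit (lookup (lookup X (fromℕ< p)) (fromℕ< q))
  ... | _     | _     = 0

  bitAt-toℕ : ∀ i j → bitAt (toℕ i) (toℕ j) ≡ bit (lookup (lookup X i) j)
  bitAt-toℕ i j with toℕ i <? M | toℕ j <? n
  ... | yes p | yes q rewrite fromℕ<-toℕ i p | fromℕ<-toℕ j q = refl
  ... | no ¬p | _     = contradiction (toℕ<n i) ¬p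
  ... | yes _ | no ¬q = contradiction (toℕ<n j) ¬q

  bitAt≤1 : ∀ i j → bitAt i j ≤ 1
  bitAt≤1 i j with i <? M | j <? n
  ... | yes p | yes q = bit≤1 (lookup (lookup X (fromℕ< p)) (fromℕ< q))
    where
    bit≤1 : ∀ b → bit b ≤ 1
    bit≤1 false = z≤n
    bit≤1 true  = ≤-refl
  ... | yes _ | no _  = z≤n
  ... | no _  | _     = z≤n

  ⟦_⟧ : ∀ {Γ} → Exp Γ → Vec ℕ Γ → Memory → ℕ
  ⟦ var ℓ ⟧ v μ = look v ℓ
  ⟦ lit x ⟧ v μ = x
  ⟦ e ⊕ f ⟧ v μ = ⟦ e ⟧ v μ + ⟦ f ⟧ v μ
  ⟦ e ⊖ f ⟧ v μ = ⟦ e ⟧ v μ ∸ ⟦ f ⟧ v μ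
  ⟦ e ⊗ f ⟧ v μ = ⟦ e ⟧ v μ * ⟦ f ⟧ v μ
  ⟦ e ⊘ f ⟧ v μ = ⟦ quot ⟧ʷ (⟦ e ⟧ v μ) (⟦ f ⟧ v μ)
  ⟦ e ⊛ f ⟧ v μ = ⟦ rem ⟧ʷ (⟦ e ⟧ v μ) (⟦ f ⟧ v μ)
  ⟦ cell e ⟧ v μ = μ (⟦ e ⟧ v μ)
  ⟦ inp e f ⟧ v μ = bitAt (⟦ e ⟧ v μ) (⟦ f ⟧ v μ)

  -- Truncated subtraction, quotients and remainders cannot overflow.
  Safe : ∀ {Γ} → Exp Γ → Vec ℕ Γ → Memory → Set
  Safe (var ℓ) v μ = ⊤
  Safe (lit x) v μ = x < W
  Safe (e ⊕ f) v μ = Safe e v μ × Safe f v μ × ⟦ e ⊕ f ⟧ v μ < W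
  Safe (e ⊖ f) v μ = Safe e v μ × Safe f v μ
  Safe (e ⊗ f) v μ = Safe e v μ × Safe f v μ × ⟦ e ⊗ f ⟧ v μ < W
  Safe (e ⊘ f) v μ = Safe e v μ × Safe f v μ
  Safe (e ⊛ f) v μ = Safe e v μ × Safe f v μ
  Safe (cell e) v μ = Safe e v μ × ⟦ e ⟧ v μ < S
  Safe (inp e f) v μ = Safe e v μ × Safe f v μ × ⟦ e ⟧ v μ < M × ⟦ f ⟧ v μ < n

  Post : ℕ → Set₁
  Post Γ = ℕ → Vec ℕ Γ → Memory → List ℕ → Set

  -- wp c Q t: started after t steps, c runs safely and ends with Q.
  mutual
    wp : ∀ {Γ} → Stm Γ → Post Γ → Post Γ
    wp skip Q t v μ o = Q (suc t) v μ o
    wp (put ℓ e) Q t v μ o = Safe e v μ × Q (cost e + 2 + t) (upd v ℓ (⟦ e ⟧ v μ)) μ o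
    wp (write a e) Q t v μ o =
      Safe a v μ × Safe e v μ × ⟦ a ⟧ v μ < S
      × Q (cost a + (cost e + 1) + t) v (μ [ ⟦ a ⟧ v μ ↦ ⟦ e ⟧ v μ ]) o
    wp (say e) Q t v μ o = Safe e v μ × Q (cost e + 1 + t) v μ (o ++ [ ⟦ e ⟧ v μ ])
    wp (c ⍮ d) Q = wp c (wp d Q)
    wp (when e c d) Q t v μ o =
      Safe e v μ
      × (⟦ e ⟧ v μ ≢ 0 → wp c Q (cost e + 1 + t) v μ o)
      × (⟦ e ⟧ v μ ≡ 0 → wp d Q (cost e + 1 + t) v μ o)
    wp (new e c) Q t v μ o =
      Safe e v μ × wp c (λ t′ v′ → Q t′ (tail v′)) (cost e + t) (⟦ e ⟧ v μ ∷ v) μ o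
    wp (for e c) Q t v μ o = Safe e v μ × iter c Q (⟦ e ⟧ v μ) (cost e + t) v μ o

    iter : ∀ {Γ} → Stm (suc Γ) → Post Γ → ℕ → Post Γ
    iter c Q zero    t v μ o = Q (suc t) v μ o
    -- The 3 steps are the loop test and the two assignments that decrement the counter. The body
    -- has to return the counter unchanged.
    iter c Q (suc j) t v μ o =
      wp c (λ t′ v′ μ′ o′ → head v′ ≡ j × iter c Q j t′ (tail v′) μ′ o′) (3 + t) (j ∷ v) μ o

  private
    variable
      Γ : ℕ

  -- Only registers in scope are tied to the environment; those from Γ on may hold leftovers of
  -- temporaries.
  record Fits (ρ : ℕ → ℕ) (v : Vec ℕ Γ) (μ : Memory) : Set where
    field
      agree  : ∀ {ℓ} → ℓ < Γ → ρ ℓ ≡ look v ℓ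
      small  : ∀ ℓ → look v ℓ < W
      smallᵐ : ∀ a → μ a < W

  open Fits

  private
    ≡ᵇ-refl : ∀ m → (m ≡ᵇ m) ≡ true
    ≡ᵇ-refl zero    = refl
    ≡ᵇ-refl (suc m) = ≡ᵇ-refl m

    ≢⇒≡ᵇ-false : ∀ m k → m ≢ k → (m ≡ᵇ k) ≡ false
    ≢⇒≡ᵇ-false zero    zero    m≢k = contradiction refl m≢k
    ≢⇒≡ᵇ-false zero    (suc k) m≢k = refl
    ≢⇒≡ᵇ-false (suc m) zero    m≢k = refl
    ≢⇒≡ᵇ-false (suc m) (suc k) m≢k = ≢⇒≡ᵇ-false m k (m≢k ∘ cong suc)

  upd-≡ : ∀ (f : ℕ → ℕ) i x → (f [ i ↦ x ]) i ≡ x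
  upd-≡ f i x rewrite ≡ᵇ-refl i = refl

  upd-≢ : ∀ (f : ℕ → ℕ) {i j} x → j ≢ i → (f [ i ↦ x ]) j ≡ f j
  upd-≢ f {i} {j} x j≢i rewrite ≢⇒≡ᵇ-false j i j≢i = refl

  upd-< : ∀ {f : ℕ → ℕ} {i x b} → (∀ j → f j < b) → x < b → ∀ j → (f [ i ↦ x ]) j < b
  upd-< {i = i} f< x< j with j ≡ᵇ i
  ... | true  = x<
  ... | false = f< j

  private
    record Below (d : ℕ) (ρ ρ′ : ℕ → ℕ) : Set where
      constructor below
      field keeps : ∀ {r} → r < d → ρ′ r ≡ ρ r

    open Below

    below-upd : ∀ {d r} ρ x → d ≤ r → Below d ρ (ρ [ r ↦ x ])
    below-upd ρ x d≤r = below λ i<d → upd-≢ ρ x (<⇒≢ (<-≤-trans i<d d≤r))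

    below-≤ : ∀ {d d′ ρ ρ′} → d ≤ d′ → Below d′ ρ ρ′ → Below d ρ ρ′
    below-≤ d≤d′ b = below λ r<d → keeps b (<-≤-trans r<d d≤d′)

    below-trans : ∀ {d ρ ρ′ ρ″} → Below d ρ ρ′ → Below d ρ′ ρ″ → Below d ρ ρ″
    below-trans b b′ = below λ r<d → trans (keeps b′ r<d) (keeps b r<d)

    retime : ∀ (Q : Post Γ) {t t′ v μ o} → t ≡ t′ → Q t v μ o → Q t′ v μ o
    retime Q refl q = q

    fits-below : ∀ {d ρ ρ′} {v : Vec ℕ Γ} {μ} → Γ ≤ d → Below d ρ ρ′ → Fits ρ v μ → Fits ρ′ v μ
    fits-below Γ≤d eq fits = record
      { agree  = λ ℓ<Γ → trans (keeps eq (<-≤-trans ℓ<Γ Γ≤d)) (agree fits ℓ<Γ)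
      ; small  = small fits
      ; smallᵐ = smallᵐ fits
      }

    look-upd-≡ : ∀ (v : Vec ℕ Γ) {ℓ} x → ℓ < Γ → look (upd v ℓ x) ℓ ≡ x
    look-upd-≡ {suc Γ} (y ∷ v) {ℓ} x ℓ<Γ with ℓ ≟ Γ
    ... | yes refl rewrite ≡ᵇ-refl Γ | ≡ᵇ-refl Γ = refl
    ... | no ℓ≢Γ rewrite ≢⇒≡ᵇ-false ℓ Γ ℓ≢Γ | ≢⇒≡ᵇ-false ℓ Γ ℓ≢Γ =
      look-upd-≡ v x (≤∧≢⇒< (≤-pred ℓ<Γ) ℓ≢Γ)

    look-upd-≢ : ∀ (v : Vec ℕ Γ) {ℓ k} x → k ≢ ℓ → look (upd v ℓ x) k ≡ look v k
    look-upd-≢ [] x k≢ℓ = refl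
    look-upd-≢ {suc Γ} (y ∷ v) {ℓ} {k} x k≢ℓ with ℓ ≟ Γ
    ... | yes refl rewrite ≡ᵇ-refl Γ | ≢⇒≡ᵇ-false k Γ k≢ℓ = refl
    ... | no ℓ≢Γ rewrite ≢⇒≡ᵇ-false ℓ Γ ℓ≢Γ with k ≡ᵇ Γ
    ...   | true  = refl
    ...   | false = look-upd-≢ v x k≢ℓ

    look-upd-< : ∀ (v : Vec ℕ Γ) ℓ x k → (∀ j → look v j < W) → x < W → look (upd v ℓ x) k < W
    look-upd-< [] ℓ x k v< x< = v< k
    look-upd-< {suc Γ} (y ∷ v) ℓ x k v< x< with k ≟ ℓ
    ... | no k≢ℓ = subst (_< W) (sym (look-upd-≢ (y ∷ v) x k≢ℓ)) (v< k)
    ... | yes refl with ℓ <? suc Γ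
    ...   | yes ℓ<Γ = subst (_< W) (sym (look-upd-≡ (y ∷ v) x ℓ<Γ)) x<
    ...   | no ℓ≮Γ = subst (_< W) (sym (out (y ∷ v) ℓ≮Γ)) (v< k)
      where
      out : ∀ {Γ} (v : Vec ℕ Γ) {ℓ} → ¬ ℓ < Γ → look (upd v ℓ x) ℓ ≡ look v ℓ
      out [] _ = refl
      out {suc Γ} (y ∷ v) {ℓ} ℓ≮ rewrite ≢⇒≡ᵇ-false ℓ Γ (λ { refl → ℓ≮ ≤-refl })
        | ≢⇒≡ᵇ-false ℓ Γ (λ { refl → ℓ≮ ≤-refl }) = out v (ℓ≮ ∘ m≤n⇒m≤1+n)

    fits-tail : ∀ {ρ x} {v : Vec ℕ Γ} {μ} → Fits ρ (x ∷ v) μ → Fits ρ v μ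
    fits-tail {Γ} {x = x} {v} fits = record
      { agree  = λ {ℓ} ℓ<Γ → trans (agree fits (m≤n⇒m≤1+n ℓ<Γ)) (skips ℓ (<⇒≢ ℓ<Γ))
      ; small  = λ ℓ → go ℓ
      ; smallᵐ = smallᵐ fits
      }
      where
      skips : ∀ ℓ → ℓ ≢ Γ → look (x ∷ v) ℓ ≡ look v ℓ
      skips ℓ ℓ≢Γ rewrite ≢⇒≡ᵇ-false ℓ Γ ℓ≢Γ = refl
      out : ∀ {Γ} (v : Vec ℕ Γ) {ℓ} → Γ ≤ ℓ → look v ℓ ≡ 0
      out [] _ = refl
      out {suc Γ} (y ∷ v) {ℓ} Γ≤ rewrite ≢⇒≡ᵇ-false ℓ Γ (>⇒≢ Γ≤) = out v (<⇒≤ Γ≤)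
      go : ∀ ℓ → look v ℓ < W
      go ℓ with ℓ ≟ Γ
      ... | no ℓ≢Γ = subst (_< W) (skips ℓ ℓ≢Γ) (small fits ℓ)
      ... | yes refl = subst (_< W) (sym (out v ≤-refl)) (≤-<-trans z≤n (small fits 0))

    fits-head : ∀ {ρ x} {v : Vec ℕ Γ} {μ} → Fits ρ (x ∷ v) μ → ρ Γ ≡ x
    fits-head {Γ} fits with agree fits {Γ} ≤-refl
    ... | eq rewrite ≡ᵇ-refl Γ = eq

    fits-cons : ∀ {ρ x} {v : Vec ℕ Γ} {μ} → Fits ρ v μ → ρ Γ ≡ x → x < W → Fits ρ (x ∷ v) μ
    fits-cons {Γ} {ρ} {x} {v} fits ρΓ≡x x<W = record
      { agree = ag ; small = sm ; smallᵐ = smallᵐ fits }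
      where
      ag : ∀ {ℓ} → ℓ < suc Γ → ρ ℓ ≡ look (x ∷ v) ℓ
      ag {ℓ} ℓ≤Γ with ℓ ≟ Γ
      ... | yes refl rewrite ≡ᵇ-refl Γ = ρΓ≡x
      ... | no ℓ≢Γ rewrite ≢⇒≡ᵇ-false ℓ Γ ℓ≢Γ = agree fits (≤∧≢⇒< (≤-pred ℓ≤Γ) ℓ≢Γ)
      sm : ∀ ℓ → look (x ∷ v) ℓ < W
      sm ℓ with ℓ ≡ᵇ Γ
      ... | true  = x<W
      ... | false = small fits ℓ

    module _ (W>1 : 1 < W) where

      move : ∀ {tmp r a ρ μ o} → a ≢ tmp → ρ a < W →
             moveTo tmp r a , ⟨ ρ , μ , o ⟩ ⇓[ 2 ] ⟨ (ρ [ tmp ↦ 0 ]) [ r ↦ ρ a ] , μ , o ⟩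
      move {tmp} {r} {a} {ρ} {μ} {o} a≢ ρa<W =
        seq (const (<-trans z<s W>1))
          (subst (λ x → (r ≔ a ⟨ add ⟩ tmp) , ⟨ ρ [ tmp ↦ 0 ] , μ , o ⟩
                        ⇓[ 1 ] ⟨ (ρ [ tmp ↦ 0 ]) [ r ↦ x ] , μ , o ⟩) eq
            (arith (subst (_< W) (sym eq) ρa<W)))
        where
        eq : (ρ [ tmp ↦ 0 ]) a + (ρ [ tmp ↦ 0 ]) tmp ≡ ρ a
        eq rewrite upd-≢ ρ 0 a≢ | upd-≡ ρ tmp 0 = +-identityʳ (ρ a)

      EvalsTo : (d : ℕ) (c : Command) (u : ℕ) (ρ : ℕ → ℕ) (μ : Memory) (o : List ℕ) (x : ℕ) → Set
      EvalsTo d c u ρ μ o x =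
        (∃[ ρ′ ] (c , ⟨ ρ , μ , o ⟩ ⇓[ u ] ⟨ ρ′ , μ , o ⟩ × ρ′ d ≡ x × Below d ρ ρ′)) × x < W

      quot≤ : ∀ x y → ⟦ quot ⟧ʷ x y ≤ x
      quot≤ x zero    = z≤n
      quot≤ x (suc y) = m/n≤m x (suc y)

      rem≤ : ∀ x y → ⟦ rem ⟧ʷ x y ≤ x
      rem≤ x zero    = ≤-refl
      rem≤ x (suc y) = m%n≤m x (suc y)

      -- Preservation of all registers below `d` is what allows a binary operation to keep its first
      -- operand in `d` while the second one is evaluated from `suc d` on.
      eval : ∀ d {ρ} {v : Vec ℕ Γ} {μ} o (e : Exp Γ) → Γ ≤ d → Fits ρ v μ → Safe e v μ →
             EvalsTo d (compileExp d e) (cost e) ρ μ o (⟦ e ⟧ v μ)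

      binary : ∀ d {ρ} {v : Vec ℕ Γ} {μ} o (e f : Exp Γ) ⊙ → Γ ≤ d → Fits ρ v μ →
               Safe e v μ → Safe f v μ →
               (⟦ e ⟧ v μ < W → ⟦ ⊙ ⟧ʷ (⟦ e ⟧ v μ) (⟦ f ⟧ v μ) < W) →
               EvalsTo d (compileExp d e ⨾ (compileExp (suc d) f ⨾ (d ≔ d ⟨ ⊙ ⟩ suc d)))
                       (cost e + (cost f + 1)) ρ μ o (⟦ ⊙ ⟧ʷ (⟦ e ⟧ v μ) (⟦ f ⟧ v μ))
      binary d {ρ} {v} {μ} o e f ⊙ Γ≤d fits s₁ s₂ bnd
        with (ρ₁ , run₁ , eq₁ , bel₁) , lt₁ ← eval d o e Γ≤d fits s₁
        with (ρ₂ , run₂ , eq₂ , bel₂) , lt₂ ← eval (suc d) o f (m≤n⇒m≤1+n Γ≤d) (fits-below Γ≤d bel₁ fits) s₂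
        = (_ , seq run₁ (seq run₂ (arith (subst (_< W) (sym value≡) (bnd lt₁))))
             , trans (upd-≡ ρ₂ d _) value≡
             , below-trans (below-trans bel₁ (below-≤ (n≤1+n d) bel₂)) (below-upd ρ₂ _ ≤-refl))
          , bnd lt₁
        where
        value≡ : ⟦ ⊙ ⟧ʷ (ρ₂ d) (ρ₂ (suc d)) ≡ ⟦ ⊙ ⟧ʷ (⟦ e ⟧ v μ) (⟦ f ⟧ v μ)
        value≡ = cong₂ ⟦ ⊙ ⟧ʷ (trans (keeps bel₂ ≤-refl) eq₁) eq₂

      eval {Γ} d {ρ} {v} {μ} o (var ℓ {ok}) Γ≤d fits s =
        (_ , move (<⇒≢ (<-≤-trans ℓ<Γ Γ≤d)) (subst (_< W) (sym ag) (small fits ℓ))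
           , trans (upd-≡ (ρ [ d ↦ 0 ]) d _) ag
           , below-trans (below-upd ρ 0 ≤-refl) (below-upd _ _ ≤-refl)) , small fits ℓ
        where
        ℓ<Γ = <ᵇ⇒< ℓ Γ ok
        ag : ρ ℓ ≡ look v ℓ
        ag = agree fits ℓ<Γ
      eval d {ρ} o (lit x) Γ≤d fits s = (_ , const s , upd-≡ ρ d x , below-upd _ x ≤-refl) , s
      eval d o (e ⊕ f) Γ≤d fits (s₁ , s₂ , s) = binary d o e f add Γ≤d fits s₁ s₂ (λ _ → s)
      eval d {v = v} {μ} o (e ⊖ f) Γ≤d fits (s₁ , s₂) =
        binary d o e f monus Γ≤d fits s₁ s₂ (≤-<-trans (m∸n≤m (⟦ e ⟧ v μ) (⟦ f ⟧ v μ)))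
      eval d o (e ⊗ f) Γ≤d fits (s₁ , s₂ , s) = binary d o e f mul Γ≤d fits s₁ s₂ (λ _ → s)
      eval d {v = v} {μ} o (e ⊘ f) Γ≤d fits (s₁ , s₂) =
        binary d o e f quot Γ≤d fits s₁ s₂ (≤-<-trans (quot≤ (⟦ e ⟧ v μ) (⟦ f ⟧ v μ)))
      eval d {v = v} {μ} o (e ⊛ f) Γ≤d fits (s₁ , s₂) =
        binary d o e f rem Γ≤d fits s₁ s₂ (≤-<-trans (rem≤ (⟦ e ⟧ v μ) (⟦ f ⟧ v μ)))
      eval d {μ = μ} o (cell e) Γ≤d fits (s , s′)
        with (ρ₁ , run₁ , eq₁ , bel₁) , _ ← eval d o e Γ≤d fits s
        = (_ , seq run₁ (load (subst (_< S) (sym eq₁) s′))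
             , trans (upd-≡ ρ₁ d _) (cong μ eq₁)
             , below-trans bel₁ (below-upd ρ₁ _ ≤-refl)) , smallᵐ fits _
      eval d {ρ} {v} {μ} o (inp e f) Γ≤d fits (s₁ , s₂ , i< , j<)
        with (ρ₁ , run₁ , eq₁ , bel₁) , lt₁ ← eval d o e Γ≤d fits s₁
        with (ρ₂ , run₂ , eq₂ , bel₂) , lt₂ ← eval (suc d) o f (m≤n⇒m≤1+n Γ≤d) (fits-below Γ≤d bel₁ fits) s₂
        = (_ , seq run₁ (seq run₂ (input i j (trans (trans (keeps bel₂ ≤-refl) eq₁) (sym toℕi)) (trans eq₂ (sym toℕj))))
             , trans (upd-≡ ρ₂ d _)
                 (trans (sym (bitAt-toℕ i j)) (cong₂ bitAt toℕi toℕj))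
             , below-trans (below-trans bel₁ (below-≤ (n≤1+n d) bel₂)) (below-upd ρ₂ _ ≤-refl))
          , ≤-<-trans (bitAt≤1 (⟦ e ⟧ v μ) (⟦ f ⟧ v μ)) W>1
        where
        i = fromℕ< i<
        j = fromℕ< j<
        toℕi = toℕ-fromℕ< i<
        toℕj = toℕ-fromℕ< j<

      Runs : ∀ {Γ} (c : Command) (Q : Post Γ) (t : ℕ) (ρ : ℕ → ℕ) (μ : Memory) (o : List ℕ) → Set
      Runs {Γ} c Q t ρ μ o =
        ∃[ u ] ∃[ ρ′ ] ∃[ v′ ] ∃[ μ′ ] ∃[ o′ ]
          (c , ⟨ ρ , μ , o ⟩ ⇓[ u ] ⟨ ρ′ , μ′ , o′ ⟩ × Fits {Γ} ρ′ v′ μ′ × Q (u + t) v′ μ′ o′)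

      -- The clock of `wp` runs forward from `t`, whereas the machine adds up the times of
      -- subderivations; `retime` reconciles the two.
      sound : ∀ (c : Stm Γ) {Q t ρ} {v : Vec ℕ Γ} {μ o} → Fits ρ v μ → wp c Q t v μ o →
              Runs (compile c) Q t ρ μ o

      soundIter : ∀ (c : Stm (suc Γ)) {Q t ρ} {v : Vec ℕ Γ} {μ o} j → j < W → Fits ρ v μ → ρ Γ ≡ j →
                  iter c Q j t v μ o →
                  Runs (while Γ ((suc Γ ≔ 1) ⨾ ((Γ ≔ Γ ⟨ monus ⟩ suc Γ) ⨾ compile c))) Q t ρ μ o

      sound skip {ρ = ρ} fits q =
        _ , _ , _ , _ , _ , const (<-trans z<s W>1) , fits-below ≤-refl (below-upd ρ 0 ≤-refl) fits , q
      sound {Γ} (put ℓ {ok} e) {Q} {t} {v = v} {μ} {o} fits (s , q)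
        with (ρ₁ , run₁ , eq₁ , bel₁) , lt₁ ← eval Γ o e ≤-refl fits s
        = _ , _ , upd v ℓ (⟦ e ⟧ v μ) , _ , _
          , seq run₁ (move (<⇒≢ ≤-refl) (subst (_< W) (sym eq₁) lt₁))
          , record { agree = ag ; small = λ k → look-upd-< v ℓ _ k (small fits) lt₁ ; smallᵐ = smallᵐ fits }
          , q
        where
        ag : ∀ {k} → k < Γ → ((ρ₁ [ suc Γ ↦ 0 ]) [ ℓ ↦ ρ₁ Γ ]) k ≡ look (upd v ℓ (⟦ e ⟧ v μ)) k
        ag {k} k<Γ with k ≟ ℓ
        ... | yes refl = trans (upd-≡ (ρ₁ [ suc Γ ↦ 0 ]) k _) (trans eq₁ (sym (look-upd-≡ v _ k<Γ)))
        ... | no k≢ℓ = trans (upd-≢ (ρ₁ [ suc Γ ↦ 0 ]) _ k≢ℓ) (trans (upd-≢ ρ₁ 0 (<⇒≢ (m≤n⇒m≤1+n k<Γ)))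
                         (trans (keeps bel₁ k<Γ) (trans (agree fits k<Γ) (sym (look-upd-≢ v _ k≢ℓ)))))
      sound {Γ} (write a e) {Q} {t} {v = v} {μ} {o} fits (s₁ , s₂ , a<S , q)
        with (ρ₁ , run₁ , eq₁ , bel₁) , lt₁ ← eval Γ o a ≤-refl fits s₁
        with (ρ₂ , run₂ , eq₂ , bel₂) , lt₂ ← eval (suc Γ) o e (n≤1+n _) (fits-below ≤-refl bel₁ fits) s₂
        = _ , _ , v , _ , _ , seq run₁ (seq run₂ (store (subst (_< S) (sym eqa) a<S)))
          , record { agree = λ k<Γ → trans (keeps bel₂ (m≤n⇒m≤1+n k<Γ)) (trans (keeps bel₁ k<Γ) (agree fits k<Γ))
                   ; small = small fits
                   ; smallᵐ = upd-< (smallᵐ fits) (subst (_< W) (sym eq₂) lt₂) }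
          , subst₂ (λ x y → Q _ v (μ [ x ↦ y ]) o) (sym eqa) (sym eq₂) q
        where
        eqa = trans (keeps bel₂ ≤-refl) eq₁
      sound {Γ} (say e) {Q} {t} {v = v} {μ} {o} fits (s , q)
        with (ρ₁ , run₁ , eq₁ , bel₁) , lt₁ ← eval Γ o e ≤-refl fits s
        = _ , _ , v , _ , _ , seq run₁ emit , fits-below ≤-refl bel₁ fits
          , subst (λ x → Q _ v μ (o ++ [ x ])) (sym eq₁) q
      sound (c ⍮ d) {Q} {t} fits q
        with u₁ , _ , _ , _ , _ , run₁ , fits₁ , q₁ ← sound c fits q
        with u₂ , _ , _ , _ , _ , run₂ , fits₂ , q₂ ← sound d fits₁ q₁
        = _ , _ , _ , _ , _ , seq run₁ run₂ , fits₂
          , retime Q (trans (sym (+-assoc u₂ u₁ t)) (cong (_+ t) (+-comm u₂ u₁))) q₂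
      sound {Γ} (when e c d) {Q} {t} {v = v} {μ} {o} fits (s , q₁ , q₂)
        with (ρ₁ , run₁ , eq₁ , bel₁) , lt₁ ← eval Γ o e ≤-refl fits s
        with ⟦ e ⟧ v μ ≟ 0
      ... | no ≢0
        with u , _ , _ , _ , _ , run , fits′ , q ← sound c (fits-below ≤-refl bel₁ fits) (q₁ ≢0)
        = _ , _ , _ , _ , _ , seq run₁ (then′ (λ eq → ≢0 (trans (sym eq₁) eq)) run) , fits′
          , retime Q (eqt u) q
        where
        eqt : ∀ u → u + (cost e + 1 + t) ≡ cost e + suc u + t
        eqt u = trans (sym (+-assoc u (cost e + 1) t)) (cong (_+ t)
          (trans (+-comm u (cost e + 1)) (+-assoc (cost e) 1 u)))
      ... | yes ≡0
        with u , _ , _ , _ , _ , run , fits′ , q ← sound d (fits-below ≤-refl bel₁ fits) (q₂ ≡0)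
        = _ , _ , _ , _ , _ , seq run₁ (else′ (trans eq₁ ≡0) run) , fits′
          , retime Q (eqt u) q
        where
        eqt : ∀ u → u + (cost e + 1 + t) ≡ cost e + suc u + t
        eqt u = trans (sym (+-assoc u (cost e + 1) t)) (cong (_+ t)
          (trans (+-comm u (cost e + 1)) (+-assoc (cost e) 1 u)))
      sound {Γ} (new e c) {Q} {t} {v = v} {μ} {o} fits (s , q)
        with (ρ₁ , run₁ , eq₁ , bel₁) , lt₁ ← eval Γ o e ≤-refl fits s
        with u , _ , x ∷ v′ , _ , _ , run , fits′ , q′ ←
               sound c (fits-cons (fits-below ≤-refl bel₁ fits) eq₁ lt₁) q
        = _ , _ , v′ , _ , _ , seq run₁ run , fits-tail fits′
          , retime Q (trans (sym (+-assoc u (cost e) t)) (cong (_+ t) (+-comm u (cost e)))) q′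
      sound {Γ} (for e c) {Q} {t} {v = v} {μ} {o} fits (s , q)
        with (ρ₁ , run₁ , eq₁ , bel₁) , lt₁ ← eval Γ o e ≤-refl fits s
        with u , _ , v′ , _ , _ , run , fits′ , q′ ←
               soundIter c _ lt₁ (fits-below ≤-refl bel₁ fits) eq₁ q
        = _ , _ , v′ , _ , _ , seq run₁ run , fits′
          , retime Q (trans (sym (+-assoc u (cost e) t)) (cong (_+ t) (+-comm u (cost e)))) q′

      soundIter c zero _ fits eq q = _ , _ , _ , _ , _ , done eq , fits , q
      soundIter {Γ} c {Q} {t} {ρ} {v} {μ} {o} (suc j) j<W fits eq q =
        next (sound c {ρ = countDown} (fits-cons (fits-below ≤-refl bel fits) eqd (<⇒≤ j<W)) q)
        where
        countDown = (ρ [ suc Γ ↦ 1 ]) [ Γ ↦ (ρ [ suc Γ ↦ 1 ]) Γ ∸ (ρ [ suc Γ ↦ 1 ]) (suc Γ) ]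
        bel : Below Γ ρ countDown
        bel = below-trans (below-upd ρ 1 (n≤1+n Γ)) (below-upd (ρ [ suc Γ ↦ 1 ]) _ ≤-refl)
        eqd′ : (ρ [ suc Γ ↦ 1 ]) Γ ∸ (ρ [ suc Γ ↦ 1 ]) (suc Γ) ≡ j
        eqd′ = cong₂ _∸_ (trans (upd-≢ ρ {suc Γ} {Γ} 1 (<⇒≢ ≤-refl)) eq) (upd-≡ ρ (suc Γ) 1)
        eqd : countDown Γ ≡ j
        eqd = trans (upd-≡ (ρ [ suc Γ ↦ 1 ]) Γ _) eqd′
        next : Runs (compile c) (λ t′ v′ μ′ o′ → head v′ ≡ j × iter c Q j t′ (tail v′) μ′ o′) (3 + t)
                    countDown μ o →
               Runs (while Γ ((suc Γ ≔ 1) ⨾ ((Γ ≔ Γ ⟨ monus ⟩ suc Γ) ⨾ compile c))) Q t ρ μ o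
        next (u₁ , ρ₁ , x ∷ v₁ , _ , _ , run₁ , fits₁ , x≡j , q₁)
          with u₂ , _ , v₂ , _ , _ , run₂ , fits₂ , q₂ ←
                 soundIter c j (<⇒≤ j<W) (fits-tail fits₁) (trans (fits-head fits₁) x≡j) q₁
          = _ , _ , v₂ , _ , _
            , again (λ z → case trans (sym eq) z of λ ())
                (seq (const W>1) (seq (arith (subst (_< W) (sym eqd′) (<⇒≤ j<W))) run₁)) run₂
            , fits₂
            , retime Q (eqt u₁ u₂) q₂
          where
          eqt : ∀ u₁ u₂ → u₂ + (u₁ + (3 + t)) ≡ suc (1 + (1 + u₁) + u₂) + t
          eqt u₁ u₂ = solve-∀′ u₁ u₂ t
            where
            solve-∀′ : ∀ a b t → b + (a + (3 + t)) ≡ suc (1 + (1 + a) + b) + t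
            solve-∀′ = solve-∀

  soundness : 1 < W → ∀ (c : Stm Γ) (Q : Post Γ) {ρ} {v : Vec ℕ Γ} {μ o} → Fits ρ v μ → wp c Q 0 v μ o →
              ∃[ t ] ∃[ σ ] (compile c , ⟨ ρ , μ , o ⟩ ⇓[ t ] σ × (∃[ v′ ] Q t v′ (mem σ) (output σ)))
  soundness W>1 c Q fits q with t , _ , v′ , _ , _ , run , _ , q′ ← sound W>1 c fits q =
    t , _ , run , v′ , retime Q (+-identityʳ t) q′

  wp-mono : ∀ (c : Stm Γ) (Q Q′ : Post Γ) {t v μ o} →
            (∀ {t v μ o} → Q t v μ o → Q′ t v μ o) → wp c Q t v μ o → wp c Q′ t v μ o

  iter-mono : ∀ (c : Stm (suc Γ)) j (Q Q′ : Post Γ) {t v μ o} →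
              (∀ {t v μ o} → Q t v μ o → Q′ t v μ o) → iter c Q j t v μ o → iter c Q′ j t v μ o

  wp-mono skip Q Q′ f q = f q
  wp-mono (put ℓ e) Q Q′ f (s , q) = s , f q
  wp-mono (write a e) Q Q′ f (s₁ , s₂ , s , q) = s₁ , s₂ , s , f q
  wp-mono (say e) Q Q′ f (s , q) = s , f q
  wp-mono (c ⍮ d) Q Q′ f q = wp-mono c (wp d Q) (wp d Q′) (wp-mono d Q Q′ f) q
  wp-mono (when e c d) Q Q′ f (s , q₁ , q₂) =
    s , (λ z → wp-mono c Q Q′ f (q₁ z)) , (λ z → wp-mono d Q Q′ f (q₂ z))
  wp-mono (new e c) Q Q′ f (s , q) =
    s , wp-mono c (λ t v → Q t (tail v)) (λ t v → Q′ t (tail v)) f q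
  wp-mono (for e c) Q Q′ {v = v} {μ} f (s , q) = s , iter-mono c (⟦ e ⟧ v μ) Q Q′ f q

  iter-mono c zero Q Q′ f q = f q
  iter-mono c (suc j) Q Q′ f q =
    wp-mono c (λ t v μ o → head v ≡ j × iter c Q j t (tail v) μ o)
              (λ t v μ o → head v ≡ j × iter c Q′ j t (tail v) μ o)
      (λ (eq , q′) → eq , iter-mono c j Q Q′ f q′) q

  -- The records keep `wp` and `iter` from unfolding, so that unification can read off the program
  -- and the postcondition.
  record Wp {Γ} (c : Stm Γ) (Q : Post Γ) (t : ℕ) (v : Vec ℕ Γ) (μ : Memory) (o : List ℕ) : Set where
    constructor ⟪_⟫
    field run : wp c Q t v μ o

  record Iter {Γ} (c : Stm (suc Γ)) (Q : Post Γ) (j t : ℕ) (v : Vec ℕ Γ) (μ : Memory) (o : List ℕ) : Set where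
    constructor ⟪_⟫
    field run : iter c Q j t v μ o

  monoW : ∀ {c : Stm Γ} {Q Q′ t v μ o} → Wp c Q t v μ o →
          (∀ {t v μ o} → Q t v μ o → Q′ t v μ o) → Wp c Q′ t v μ o
  monoW {c = c} {Q} {Q′} ⟪ q ⟫ f = ⟪ wp-mono c Q Q′ f q ⟫

  monoI : ∀ {c : Stm (suc Γ)} {Q Q′ j t v μ o} → Iter c Q j t v μ o →
          (∀ {t v μ o} → Q t v μ o → Q′ t v μ o) → Iter c Q′ j t v μ o
  monoI {c = c} {Q} {Q′} {j} ⟪ q ⟫ f = ⟪ iter-mono c j Q Q′ f q ⟫

  seqW : ∀ {c d : Stm Γ} {Q Q′ t v μ o} → Wp c Q t v μ o →
         (∀ {t v μ o} → Q t v μ o → Wp d Q′ t v μ o) → Wp (c ⍮ d) Q′ t v μ o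
  seqW {c = c} {d} {Q} {Q′} ⟪ q ⟫ f = ⟪ wp-mono c Q (wp d Q′) (λ q′ → Wp.run (f q′)) q ⟫

  putW : ∀ {ℓ} {ok : T (ℓ <ᵇ Γ)} {e : Exp Γ} {d Q t v μ o} → Safe e v μ →
         Wp d Q (cost e + 2 + t) (upd v ℓ (⟦ e ⟧ v μ)) μ o → Wp (put ℓ {ok} e ⍮ d) Q t v μ o
  putW s ⟪ q ⟫ = ⟪ s , q ⟫

  newW : ∀ {e : Exp Γ} {c Q t v μ o} → Safe e v μ →
         Wp c (λ t′ v′ → Q t′ (tail v′)) (cost e + t) (⟦ e ⟧ v μ ∷ v) μ o → Wp (new e c) Q t v μ o
  newW s ⟪ q ⟫ = ⟪ s , q ⟫

  -- Naming the value keeps the terms small in long chains of declarations.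
  newAs : ∀ {e : Exp Γ} {c Q t v μ o} x → Safe e v μ → ⟦ e ⟧ v μ ≡ x →
          Wp c (λ t′ v′ → Q t′ (tail v′)) (cost e + t) (x ∷ v) μ o → Wp (new e c) Q t v μ o
  newAs x s refl ⟪ q ⟫ = ⟪ s , q ⟫

  whenW : ∀ {e : Exp Γ} {c d Q t v μ o} → Safe e v μ →
          (⟦ e ⟧ v μ ≢ 0 → Wp c Q (cost e + 1 + t) v μ o) →
          (⟦ e ⟧ v μ ≡ 0 → Wp d Q (cost e + 1 + t) v μ o) → Wp (when e c d) Q t v μ o
  whenW s f g = ⟪ s , (λ z → Wp.run (f z)) , (λ z → Wp.run (g z)) ⟫

  forI : ∀ {e : Exp Γ} {c Q t v μ o} → Safe e v μ →
         Iter c Q (⟦ e ⟧ v μ) (cost e + t) v μ o → Wp (for e c) Q t v μ o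
  forI s ⟪ q ⟫ = ⟪ s , q ⟫

  stop : ∀ {c : Stm (suc Γ)} {Q t v μ o} → Q (suc t) v μ o → Iter c Q zero t v μ o
  stop q = ⟪ q ⟫

  step : ∀ {c : Stm (suc Γ)} {Q R j t v μ o} → Wp c R (3 + t) (j ∷ v) μ o →
         (∀ {t v μ o} → R t v μ o → head v ≡ j × Iter c Q j t (tail v) μ o) →
         Iter c Q (suc j) t v μ o
  step {c = c} {Q} {R} {j} ⟪ q ⟫ f =
    ⟪ wp-mono c R (λ t v μ o → head v ≡ j × iter c Q j t (tail v) μ o)
        (λ r → proj₁ (f r) , Iter.run (proj₂ (f r))) q ⟫

  -- Loops count down, so the first argument is the number of iterations that remain.
  Invariant : ℕ → Set₁
  Invariant Γ = ℕ → Vec ℕ Γ → Memory → List ℕ → Set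

  Maintains : Stm (suc Γ) → Invariant Γ → ℕ → ℕ → Set
  Maintains c I T j = ∀ {t v μ o} → I (suc j) v μ o →
    Wp c (λ t′ v′ μ′ o′ → t′ ≤ T + t × head v′ ≡ j × I j (tail v′) μ′ o′) t (j ∷ v) μ o

  iter-rule : ∀ (c : Stm (suc Γ)) (I : Invariant Γ) T k →
              (∀ {j} → j < k → Maintains c I T j) → ∀ {t v μ o} → I k v μ o →
              Iter c (λ t′ v′ μ′ o′ → t′ ≤ k * (T + 3) + suc t × I 0 v′ μ′ o′) k t v μ o
  iter-rule c I T zero maintains {t} i = stop (≤-refl , i)
  iter-rule c I T (suc k) maintains {t} i =
    step (maintains ≤-refl i) λ {t′} (t≤ , eq , i′) → eq ,
      monoI (iter-rule c I T k (λ j<k → maintains (m≤n⇒m≤1+n j<k)) i′)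
        λ (t′≤ , i″) → ≤-trans t′≤
          (≤-trans (+-monoʳ-≤ (k * (T + 3)) (s≤s t≤)) (≤-reflexive (shuffle (k * (T + 3)) T t))) , i″
    where
    shuffle : ∀ a T t → a + suc (T + (3 + t)) ≡ T + 3 + a + suc t
    shuffle = solve-∀

  forW : ∀ {e : Exp Γ} {c : Stm (suc Γ)} (I : Invariant Γ) T {v μ} →
         Safe e v μ → (∀ {j} → j < ⟦ e ⟧ v μ → Maintains c I T j) →
         ∀ {t o} → I (⟦ e ⟧ v μ) v μ o →
         Wp (for e c) (λ t′ v′ μ′ o′ → t′ ≤ ⟦ e ⟧ v μ * (T + 3) + suc (cost e) + t × I 0 v′ μ′ o′) t v μ o
  forW {e = e} {c} I T {v} {μ} safe maintains {t} i =
    forI safe (monoI (iter-rule c I T (⟦ e ⟧ v μ) maintains i)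
      λ (t≤ , i′) → ≤-trans t≤ (≤-reflexive (shuffle (⟦ e ⟧ v μ * (T + 3)) (cost e) t)) , i′)
    where
    shuffle : ∀ a b t → a + suc (b + t) ≡ a + suc b + t
    shuffle = solve-∀

-- The program

next : Fin 3 → Fin 3
next zero             = suc zero
next (suc zero)       = suc (suc zero)
next (suc (suc zero)) = zero

-- Registers: 0 n, 1 s, 2 M, 3 one, 4 β, 5 E = β², 6 R, 7 start of the arrays,
-- 8–10 block lengths, 11–13 vertex counts, 14 L, 15 β^L, 16 E^L, 17 modulus,
-- 18 initial box width, 19 number of traversal steps, 20 V, 21 L β,
-- 22 τ, 23–25 label targets, 26–28 box corner, 29–31 box widths, 32 verdict.

-- The coefficients of the base algorithm are pos c - neg c, c < 3 R β².
module Program (β R D : ℕ) (pos neg : ℕ → ℕ) where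

  E tableSize : ℕ
  E = β * β
  tableSize = R * 3 * E

  -- One base E digit of the array index 43 is split into two base β digits, which extend the row 44
  -- and the column 45; 46 is the weight of these digits.
  decodeBody : Stm 48
  decodeBody =
      put 44 (var 44 ⊕ ((var 43 ⊛ var 5) ⊘ var 4) ⊗ var 46)
    ⍮ put 45 (var 45 ⊕ ((var 43 ⊛ var 5) ⊛ var 4) ⊗ var 46)
    ⍮ put 43 (var 43 ⊘ var 5)
    ⍮ put 46 (var 46 ⊗ var 4)

  distanceBody : Stm 56
  distanceBody =
    -- The exclusive or of two bits is the parity of their sum.
    put 54 (var 54 ⊕ ((inp (var 47 ⊛ var 2) (var 55) ⊕ inp (var 52 ⊛ var 2) (var 55)) ⊛ (var 3 ⊕ var 3)))

  -- Register 49 collects distances, 50 the shortfalls below the guessed lower bound in 22.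
  partnerBody : Stm 54
  partnerBody = new (var 3 ⊖ var 3)
    (   for (var 0) distanceBody
      ⍮ put 49 (var 49 ⊕ var 54)
      ⍮ put 50 (var 50 ⊕ (var 22 ⊖ var 54))
      ⍮ put 52 (var 52 ⊘ var 2))

  headBody : Stm 52
  headBody =
      put 48 (var 48 ⊖ var 3)
    ⍮ new (var 47 ⊘ var 2) (for (var 48) partnerBody)
    ⍮ put 47 (var 47 ⊘ var 2)

  -- A product of truncated differences is non-zero exactly when all the strict inequalities hold.
  -- The box restricts only the row vertex, which suffices because each of the three vertex sets
  -- indexes the rows of one matrix.
  testEntry : Stm 52
  testEntry =
    when ((var 36 ⊖ var 44) ⊗ (var 37 ⊖ var 45)
            ⊗ ((var 44 ⊕ var 3) ⊖ var 38) ⊗ ((var 38 ⊕ var 39) ⊖ var 44))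
      (when ((var 49 ⊖ var 40) ⊕ (var 40 ⊖ var 49) ⊕ var 50) skip (put 51 (var 3)))
      skip

  entryBody : Stm 43
  entryBody =
    new (var 42) (new (var 3 ⊖ var 3) (new (var 3 ⊖ var 3) (new (var 3)
      (   for (var 14) decodeBody
        ⍮ new (var 44 ⊕ var 36 ⊗ var 45) (new (var 34 ⊕ var 35) (new (var 3 ⊖ var 3) (new (var 3 ⊖ var 3)
            (   for (var 34) headBody
              ⍮ new (var 3 ⊖ var 3) (testEntry ⍮ write (var 41 ⊕ var 42) (var 51))))))))))

  fillEntries : Stm 42
  fillEntries = for (var 16) entryBody

  blockLength vertices corner width target : ∀ {Γ} → Fin 3 → Exp (33 + Γ)
  blockLength zero             = var 8
  blockLength (suc zero)       = var 9
  blockLength (suc (suc zero)) = var 10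
  vertices zero             = var 11
  vertices (suc zero)       = var 12
  vertices (suc (suc zero)) = var 13
  corner zero             = var 26
  corner (suc zero)       = var 27
  corner (suc (suc zero)) = var 28
  width zero             = var 29
  width (suc zero)       = var 30
  width (suc (suc zero)) = var 31
  target zero             = var 23
  target (suc zero)       = var 24
  target (suc (suc zero)) = var 25

  -- At every level the three arrays of length q occupy the cells from base + 3 q up to base + 6 q.
  -- As E ≥ 2, the arrays of length q / E of a child end where those of its parent begin, or
  -- earlier. Hence all levels of the current path coexist in base + 6 E^L cells.
  arrayOffset : ∀ {Γ} → Fin 3 → Exp (33 + Γ)
  arrayOffset zero             = var 7 ⊕ lit 3 ⊗ var 16
  arrayOffset (suc zero)       = var 7 ⊕ lit 4 ⊗ var 16
  arrayOffset (suc (suc zero)) = var 7 ⊕ lit 5 ⊗ var 16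

  fill : Fin 3 → Stm 34
  fill p =
    new (blockLength p) (new (blockLength (next p)) (new (vertices p) (new (vertices (next p))
      (new (corner p) (new (width p) (new (target p) (new (arrayOffset p) fillEntries)))))))

  combineBody : Stm 42
  combineBody =
    put 40 ((var 40 ⊕ cell ((var 36 ⊗ lit 3 ⊕ var 39 ⊘ var 34) ⊗ var 5 ⊕ var 41)
                    ⊗ cell (var 7 ⊕ lit 3 ⊗ (var 34 ⊗ var 5) ⊕ (var 39 ⊗ var 5 ⊕ var 41))) ⊛ var 17)

  expandBody : Stm 40
  expandBody = new (var 3 ⊖ var 3)
    (for (var 5) combineBody ⍮ write (var 7 ⊕ lit 3 ⊗ var 34 ⊕ var 39) (var 40))

  descend : Stm 39
  descend =
      put 34 (var 34 ⊘ var 5)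
    ⍮ for (lit 3 ⊗ var 34) expandBody
    ⍮ put 35 (var 35 ⊗ var 6 ⊕ var 36)
    ⍮ put 36 (var 3 ⊖ var 3)

  leaf : Stm 39
  leaf =
      put 37 ((var 37 ⊕ cell (var 7 ⊕ lit 3) ⊗ cell (var 7 ⊕ lit 4) ⊗ cell (var 7 ⊕ lit 5)) ⊛ var 17)
    -- A leaf counts as having no children left, which makes the next iteration ascend.
    ⍮ put 36 (var 6)

  ascend : Stm 39
  ascend =
      put 36 (var 35 ⊛ var 6 ⊕ var 3)
    ⍮ put 35 (var 35 ⊘ var 6)
    ⍮ put 34 (var 34 ⊗ var 5)

  -- A depth first traversal of the recursion tree: 34 is the length of the
  -- current arrays, 36 the next child, and 35 the path to the current node,
  -- read in base R.
  traverseBody : Stm 39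
  traverseBody = when (var 6 ⊖ var 36) (when (var 34 ⊖ var 3) descend leaf) ascend

  traverse : Stm 34
  traverse =
    new (var 16) (new (var 3 ⊖ var 3) (new (var 3 ⊖ var 3) (new (var 3 ⊖ var 3)
      (for (var 19) traverseBody ⍮ put 32 (var 37)))))

  detect : Stm 34
  detect = fill zero ⍮ fill (suc zero) ⍮ fill (suc (suc zero)) ⍮ traverse

  candidate : Exp 34 → Stm 34
  candidate τ₀ =
      put 22 (τ₀ ⊕ var 33 ⊘ (var 20 ⊗ var 20 ⊗ var 20))
    ⍮ put 23 ((var 33 ⊘ var 20) ⊛ var 20)
    ⍮ put 24 (var 33 ⊛ var 20)
    ⍮ put 25 ((((var 33 ⊘ (var 20 ⊗ var 20)) ⊛ var 20) ⊖ var 23) ⊖ var 24)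

  searchBody : Exp 34 → Stm 34
  searchBody τ₀ = when (var 32) skip (candidate τ₀ ⍮ detect)

  -- The countdown visits the candidates from the largest one on, and a verdict disables all later
  -- iterations. So the first hit is the lexicographically greatest one.
  search : Exp 33 → Exp 34 → Stm 33
  search count τ₀ = for (count ⊗ (var 20 ⊗ var 20 ⊗ var 20)) (searchBody τ₀)

  setCorner setWidth : Fin 3 → Exp 34 → Stm 34
  setCorner zero             = put 26
  setCorner (suc zero)       = put 27
  setCorner (suc (suc zero)) = put 28
  setWidth zero             = put 29
  setWidth (suc zero)       = put 30
  setWidth (suc (suc zero)) = put 31

  -- If the lower half contains no triangle, the corner moves on to the upper half, which needs no
  -- test of its own.
  bisectBody : Fin 3 → Stm 34
  bisectBody p =
      setWidth p (width p ⊘ (var 3 ⊕ var 3))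
    ⍮ detect
    ⍮ when (var 32) skip (setCorner p (corner p ⊕ width p))

  bisect : Fin 3 → Stm 33
  bisect p = for (var 21) (bisectBody p)

  reportBody : Stm 36
  -- The loop variable decreases, so it is reversed to output the first bit first.
  reportBody = say (inp (var 33 ⊛ var 2) ((var 0 ⊖ var 3) ⊖ var 35))

  reportVectors : Stm 35
  reportVectors = for (var 0) reportBody ⍮ put 33 (var 33 ⊘ var 2)

  report : Fin 3 → Stm 33
  report p = new (corner p) (for (blockLength p) reportVectors)

  -- Register 17 grows by D E³ because the scaled trace is at most (D E³)^L; `powers` finally adds 1
  -- to exceed it. Register 18 grows by 2^β, so that it stays a power of two and an upper bound of
  -- β^L.
  grow : Stm 22
  grow =
      put 14 (var 3 ⊕ var 14)
    ⍮ put 15 (var 4 ⊗ var 15)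
    ⍮ put 16 (var 16 ⊗ var 5)
    ⍮ put 17 (lit (D * (E * E * E)) ⊗ var 17)
    ⍮ put 18 (lit (2 ^ β) ⊗ var 18)
    ⍮ put 19 (var 6 ⊗ ((var 3 ⊕ var 3) ⊕ var 19))

  growBody : Stm 22
  growBody = when (var 11 ⊖ var 15) grow skip

  powers : Stm 21
  powers =
      for (var 8) (put 11 (var 2 ⊗ var 11))
    ⍮ for (var 9) (put 12 (var 2 ⊗ var 12))
    ⍮ for (var 10) (put 13 (var 2 ⊗ var 13))
    -- As L < β^L, that many rounds are always enough; the surplus ones do nothing.
    ⍮ for (var 11) growBody
    ⍮ put 17 (var 3 ⊕ var 17)

  -- The recursion takes place outside the program, which receives a fixed sequence of writes with
  -- literal coefficients. Modulo m, the factor m - 1 stands for -1, so that `pos c` minus `neg c`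
  -- is stored without negative numbers.
  fillTable : ℕ → Stm 22
  fillTable zero    = skip
  fillTable (suc c) =
      fillTable c
    ⍮ write (lit c) ((lit (pos c) ⊕ (var 17 ⊖ var 3) ⊗ lit (neg c)) ⊛ var 17)

  solve : Exp 33 → Exp 34 → Stm 33
  solve count τ₀ =
      search count τ₀
    ⍮ bisect zero ⍮ bisect (suc zero) ⍮ bisect (suc (suc zero))
    ⍮ report zero ⍮ report (suc zero) ⍮ report (suc (suc zero))

  withVerdict : Exp 33 → Exp 34 → Stm 22
  withVerdict count τ₀ =
    new 𝟘 (new 𝟘 (new 𝟘 (new 𝟘 (new 𝟘 (new 𝟘 (new 𝟘
      (new (var 18) (new (var 18) (new (var 18) (new 𝟘 (solve count τ₀)))))))))))
    where
    𝟘 : ∀ {Γ} → Exp (22 + Γ)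
    𝟘 = var 3 ⊖ var 3

  initialised : Exp 33 → Exp 34 → Stm 21
  initialised count τ₀ =
    powers ⍮ new (var 14 ⊗ var 4) (fillTable tableSize ⍮ withVerdict count τ₀)

  main : Exp 33 → Exp 34 → Stm 3
  main count τ₀ =
    new (lit 1) (new (lit β) (new (lit E) (new (lit R) (new (lit tableSize)
      (new ((var 1 ⊕ lit 2) ⊘ lit 3) (new ((var 1 ⊕ lit 1) ⊘ lit 3) (new (var 1 ⊘ lit 3)
        (new (var 3) (new (var 3) (new (var 3)
          (new (var 3 ⊖ var 3) (new (var 3) (new (var 3) (new (var 3) (new (var 3) (new (var 3)
            (new (var 3 ⊕ var 0 ⊗ var 1 ⊗ var 1)
              (initialised count τ₀))))))))))))))))))

-- Bounds on machine words

sumBelow : ℕ → (ℕ → ℕ) → ℕ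
sumBelow zero    f = 0
sumBelow (suc k) f = f k + sumBelow k f

-- A time bound along the costliest branch of loop-free code. Loops contribute 0 here, since `forW`
-- accounts for them.
size : ∀ {Γ} → Stm Γ → ℕ
size skip         = 1
size (put _ e)    = cost e + 2
size (write a e)  = cost a + (cost e + 1)
size (say e)      = cost e + 1
size (c ⍮ d)      = size d + size c
size (when e c d) = size c ⊔ size d + (cost e + 1)
size (new e c)    = size c + cost e
size (for e c)    = 0

^-distribʳ-* : ∀ k m n → (m * n) ^ k ≡ m ^ k * n ^ k
^-distribʳ-* zero    m n = refl
^-distribʳ-* (suc k) m n = trans (cong (m * n *_) (^-distribʳ-* k m n)) (regroup m n (m ^ k) (n ^ k))
  where
  regroup : ∀ a b c d → a * b * (c * d) ≡ a * c * (b * d)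
  regroup = solve-∀

-- x ≼ j is a bound that is stable under sums and products.
module Magnitudes (B : ℕ) (2≤B : 2 ≤ B) where

  infix 4 _≼_
  record _≼_ (x j : ℕ) : Set where
    constructor ≼-intro
    field ≼-elim : x ≤ B ^ j

  open _≼_ public

  private instance
    B≢0 : NonZero B
    B≢0 = >-nonZero (<-≤-trans z<s 2≤B)

  ≼-raise : ∀ {x i j} → i ≤ j → x ≼ i → x ≼ j
  ≼-raise i≤j (≼-intro p) = ≼-intro (≤-trans p (^-monoʳ-≤ B i≤j))

  ≼-≤ : ∀ {x y j} → x ≤ y → y ≼ j → x ≼ j
  ≼-≤ x≤y (≼-intro p) = ≼-intro (≤-trans x≤y p)

  ≼-base : ∀ {x} → x ≤ B → x ≼ 1
  ≼-base x≤B = ≼-intro (≤-trans x≤B (≤-reflexive (sym (*-identityʳ B))))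

  ≼-+ : ∀ {x y i j} → x ≼ i → y ≼ j → x + y ≼ suc (i ⊔ j)
  ≼-+ {x} {y} {i} {j} p q = ≼-intro (begin
    x + y                       ≤⟨ +-mono-≤ (≼-elim (≼-raise (m≤m⊔n i j) p)) (≼-elim (≼-raise (m≤n⊔m i j) q)) ⟩
    B ^ (i ⊔ j) + B ^ (i ⊔ j)   ≡⟨ cong (λ z → B ^ (i ⊔ j) + z) (+-identityʳ _) ⟨
    2 * B ^ (i ⊔ j)             ≤⟨ *-monoˡ-≤ (B ^ (i ⊔ j)) 2≤B ⟩
    B * B ^ (i ⊔ j)             ∎)
    where open ≤-Reasoning

  ≼-* : ∀ {x y i j} → x ≼ i → y ≼ j → x * y ≼ i + j
  ≼-* {x} {y} {i} {j} (≼-intro p) (≼-intro q) =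
    ≼-intro (≤-trans (*-mono-≤ p q) (≤-reflexive (sym (^-distribˡ-+-* B i j))))

  ≼-∸ : ∀ {x j} y → x ≼ j → x ∸ y ≼ j
  ≼-∸ {x} y = ≼-≤ (m∸n≤m x y)

  private
    n<B^n : ∀ n → n < B ^ n
    n<B^n zero    = z<s
    n<B^n (suc n) = ≤-trans (+-mono-≤ (m^n>0 B n) (n<B^n n))
      (≤-trans (≤-reflexive (cong (λ z → B ^ n + z) (sym (+-identityʳ (B ^ n))))) (*-monoˡ-≤ (B ^ n) 2≤B))

  ≼-constant : ∀ x → x ≼ x
  ≼-constant x = ≼-intro (<⇒≤ (n<B^n x))

  ≼-^ : ∀ {x j} k → x ≼ j → x ^ k ≼ j * k
  ≼-^ {x} {j} k (≼-intro p) = ≼-intro (≤-trans (^-monoˡ-≤ k p) (≤-reflexive (^-*-assoc B j k)))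

-- All values computed are products and sums of few numbers up to B, so a fixed exponent leaves room
-- for every intermediate result, and `fits` checks each exponent by evaluation.
module Bounds (B W : ℕ) (5≤B : 5 ≤ B) (B^<W : B ^ 12 < W) where

  open Magnitudes B (≤-trans (s≤s (s≤s z≤n)) 5≤B) public

  ≼-lit : ∀ x {_ : T (x ≤ᵇ 5)} → x ≼ 1
  ≼-lit x {p} = ≼-base (≤-trans (≤ᵇ⇒≤ x 5 p) 5≤B)

  fits : ∀ {x j} {_ : T (j ≤ᵇ 12)} → x ≼ j → x < W
  fits {j = j} {p} q = ≤-<-trans (≼-elim (≼-raise (≤ᵇ⇒≤ j 12 p) q)) B^<W

  1<W : 1 < W
  1<W = fits (≼-lit 1)

-- The recursion over the trilinear form

-- Predecessors are stored so that divisors are successors by computation and their non-zeroness is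
-- found by instance search.
record Constants : Set where
  field
    n s M′ β′ E′ R′ base k₀ k₁ k₂ N₀ N₁ N₂ L P EL m′ w₀ J V′ LB : ℕ

  M β E R m V : ℕ
  M = suc M′
  β = suc β′
  E = suc E′
  R = suc R′
  m = suc m′
  V = suc V′

  globals : Vec ℕ 22
  globals = LB ∷ V ∷ J ∷ w₀ ∷ m ∷ EL ∷ P ∷ L ∷ N₂ ∷ N₁ ∷ N₀ ∷ k₂ ∷ k₁ ∷ k₀ ∷ base ∷ R ∷ E ∷ β ∷ 1
    ∷ M ∷ s ∷ n ∷ []

record Query : Set where
  constructor query
  field
    τ : ℕ
    α lo w : Fin 3 → ℕ

module _ (c : Constants) where
  open Constants c

  frame : Query → ℕ → Vec ℕ 33
  frame (query τ α lo w) verdict =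
    verdict ∷ w (suc (suc zero)) ∷ w (suc zero) ∷ w zero
      ∷ lo (suc (suc zero)) ∷ lo (suc zero) ∷ lo zero
      ∷ α (suc (suc zero)) ∷ α (suc zero) ∷ α zero ∷ τ ∷ globals

  -- `f` is the concatenation of the three arrays, so the quotient of `y` by `q` selects which of
  -- the three linear forms of product `r` applies.
  child : (tab : ℕ → ℕ) (r q : ℕ) (f : ℕ → ℕ) → ℕ → ℕ
  child tab r q f y =
    sumBelow E (λ e → tab ((r * 3 + ⟦ quot ⟧ʷ y q) * E + e) * f (y * E + e)) % m

  arrayLength : ℕ → ℕ
  arrayLength zero    = 1
  arrayLength (suc h) = arrayLength h * E

  -- The arrays are reduced at every level, the sum over the leaves is not; it matters only modulo
  -- m.
  formValue : (tab : ℕ → ℕ) → ℕ → (ℕ → ℕ) → ℕ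
  formValue tab zero    f = f 0 * f 1 * f 2
  formValue tab (suc h) f = sumBelow R λ r → formValue tab h (child tab r (arrayLength h) f)

  arrayLength>0 : ∀ h → 0 < arrayLength h
  arrayLength>0 zero    = z<s
  arrayLength>0 (suc h) = *-mono-≤ (arrayLength>0 h) (s≤s z≤n)

  -- Each child takes one iteration to descend and one to ascend, besides those of its subtree.
  steps : ℕ → ℕ
  steps zero    = 1
  steps (suc h) = R * (2 + steps h)

  descendTime traverseTime : ℕ → ℕ
  descendTime q = 3 * q * (E * 49 + 33) + 100
  traverseTime zero    = 200
  traverseTime (suc h) = R * (descendTime (arrayLength h) + traverseTime h + 300)

-- The accumulator plus the outstanding terms is constant modulo m; this is the loop invariant when
-- one term is added and reduced.
sumBelow-mod-step : ∀ acc x rest total m .{{_ : NonZero m}} →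
  (acc + (x + rest)) % m ≡ total % m → ((acc + x) % m + rest) % m ≡ total % m
sumBelow-mod-step acc x rest total m eq = begin
  ((acc + x) % m + rest) % m           ≡⟨ %-distribˡ-+ ((acc + x) % m) rest m ⟩
  ((acc + x) % m % m + rest % m) % m   ≡⟨ cong (λ z → (z + rest % m) % m) (m%n%n≡m%n (acc + x) m) ⟩
  ((acc + x) % m + rest % m) % m       ≡⟨ %-distribˡ-+ (acc + x) rest m ⟨
  (acc + x + rest) % m                 ≡⟨ cong (_% m) (+-assoc acc x rest) ⟩
  (acc + (x + rest)) % m               ≡⟨ eq ⟩
  total % m                            ∎
  where open ≡-Reasoning

%-congˡ-+ : ∀ {x y} z m .{{_ : NonZero m}} → x % m ≡ y % m → (x + z) % m ≡ (y + z) % m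
%-congˡ-+ {x} {y} z m eq = begin
  (x + z) % m           ≡⟨ %-distribˡ-+ x z m ⟩
  (x % m + z % m) % m   ≡⟨ cong (λ u → (u + z % m) % m) eq ⟩
  (y % m + z % m) % m   ≡⟨ %-distribˡ-+ y z m ⟨
  (y + z) % m           ∎
  where open ≡-Reasoning

%-extract : ∀ {x y m} .{{_ : NonZero m}} → x < m → (x + 0) % m ≡ y % m → x ≡ y % m
%-extract {x} {y} {m} x<m eq = trans (sym (m<n⇒m%n≡m x<m)) (trans (cong (_% m) (sym (+-identityʳ x))) eq)

slack : ∀ a b {_ : T (a ≤ᵇ b)} {t} → a + t ≤ b + t
slack a b {p} {t} = +-monoˡ-≤ t (≤ᵇ⇒≤ a b p)

residue : (m′ : ℕ) (pos neg : ℕ → ℕ) → ℕ → ℕ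
residue m′ pos neg i = (pos i + m′ * neg i) % suc m′

record Setting : Set where
  field
    W S B D : ℕ
    pos neg : ℕ → ℕ
    c : Constants
    X : Vec (Cube (Constants.n c)) (Constants.M c)
  open Constants c
  field
    5≤B : 5 ≤ B
    B^<W : B ^ 12 < W
    1<E : 1 < E
    1<m : 1 < m
    E≡ : E ≡ β * β
    base≡ : base ≡ R * 3 * E
    EL≡ : EL ≡ arrayLength c L
    J≡ : J ≡ steps c L
    w₀≡ : w₀ ≡ 2 ^ LB
    n≤B : n ≤ B
    m≤B : m ≤ B
    E≤B : E ≤ B
    V≤B : V ≤ B
    w₀≤B : w₀ ≤ B
    blockLengths≤B : k₀ ≤ B × k₁ ≤ B × k₂ ≤ B
    vertices≤B : N₀ ≤ B × N₁ ≤ B × N₂ ≤ B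
    β^L≤B : β ^ L ≤ B
    R^L≤B : R ^ suc L ≤ B
    arrays≤B : base + 6 * EL ≤ B
    arrays≤S : base + 6 * EL ≤ S

  tab : ℕ → ℕ
  tab = residue m′ pos neg

  tab< : ∀ i → tab i < m
  tab< i = m%n<n (pos i + m′ * neg i) m

module Traversal (σ : Setting) (query₀ : Query) (verdict₀ counter : ℕ) where

  open Setting σ
  open Constants c
  open Bounds B W 5≤B B^<W using (_≼_; ≼-base; ≼-+; ≼-*; ≼-lit; fits)
  open Logic W S X using (Safe; Post; upd-≡; upd-≢; Wp; ⟪_⟫; Iter; monoW; seqW; putW; newAs; whenW; forI; stop; step; Invariant; Maintains; forW)
  open Program β R D pos neg using (combineBody; expandBody; descend; leaf; ascend; traverseBody; traverse)

  U : Vec ℕ 34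
  U = counter ∷ frame c query₀ verdict₀

  Table : Memory → Set
  Table μ = ∀ {i} → i < base → μ i ≡ tab i

  Holds : ℕ → (ℕ → ℕ) → Memory → Set
  Holds q f μ = ∀ {y} → y < 3 * q → μ (base + 3 * q + y) ≡ f y

  private
    base≤B : base ≤ B
    base≤B = ≤-trans (m≤m+n base _) arrays≤B

    EL≤B : EL ≤ B
    EL≤B = ≤-trans (m≤n*m EL 6) (≤-trans (m≤n+m _ base) arrays≤B)

    R≤B : R ≤ B
    R≤B = ≤-trans (≤-reflexive (sym (*-identityʳ R))) (≤-trans (^-monoʳ-≤ R {1} {suc L} (s≤s z≤n)) R^L≤B)

    ≼m : ∀ {x} → x < m → x ≼ 1
    ≼m x<m = ≼-base (≤-trans (<⇒≤ x<m) m≤B)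

  module Expand {μ₀ : Memory} {o₀ : List ℕ} {f : ℕ → ℕ} (q r path acc j : ℕ) .{{_ : NonZero q}}
    (r<R : r < R) (q*E≤EL : q * E ≤ EL) (table : Table μ₀)
    (f< : ∀ y → f y < m) (holds : Holds (q * E) f μ₀) where

    V₀ : Vec ℕ 39
    V₀ = j ∷ acc ∷ r ∷ path ∷ q ∷ U

    quot≡ : ∀ y → ⟦ quot ⟧ʷ y q ≡ y / q
    quot≡ y = quotW y q
      where
      quotW : ∀ y q .{{_ : NonZero q}} → ⟦ quot ⟧ʷ y q ≡ y / q
      quotW y (suc q) = refl

    tabIndex : ℕ → ℕ → ℕ
    tabIndex y e = (r * 3 + ⟦ quot ⟧ʷ y q) * E + e

    term : ℕ → ℕ → ℕ
    term y e = tab (tabIndex y e) * f (y * E + e)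

    srcIndex< : ∀ {y e} → y < 3 * q → e < E → y * E + e < 3 * (q * E)
    srcIndex< {y} {e} y< e< = begin-strict
      y * E + e       <⟨ +-monoʳ-< (y * E) e< ⟩
      y * E + E       ≡⟨ +-comm (y * E) E ⟩
      suc y * E       ≤⟨ *-monoˡ-≤ E y< ⟩
      3 * q * E       ≡⟨ *-assoc 3 q E ⟩
      3 * (q * E)     ∎
      where open ≤-Reasoning

    tabIndex< : ∀ {y e} → y < 3 * q → e < E → tabIndex y e < base
    tabIndex< {y} {e} y< e< = begin-strict
      (r * 3 + ⟦ quot ⟧ʷ y q) * E + e   ≡⟨ cong (λ z → (r * 3 + z) * E + e) (quot≡ y) ⟩
      (r * 3 + y / q) * E + e           <⟨ +-monoʳ-< ((r * 3 + y / q) * E) e< ⟩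
      (r * 3 + y / q) * E + E           ≡⟨ +-comm _ E ⟩
      suc (r * 3 + y / q) * E           ≡⟨ cong (_* E) (+-suc (r * 3) (y / q)) ⟨
      (r * 3 + suc (y / q)) * E         ≤⟨ *-monoˡ-≤ E (+-monoʳ-≤ (r * 3) (m<n*o⇒m/o<n {y} {3} {q} y<)) ⟩
      (r * 3 + 3) * E                   ≡⟨ cong (_* E) (+-comm (r * 3) 3) ⟩
      suc r * 3 * E                     ≤⟨ *-monoˡ-≤ E (*-monoˡ-≤ 3 r<R) ⟩
      R * 3 * E                         ≡⟨ base≡ ⟨
      base                              ∎
      where open ≤-Reasoning

    src< : ∀ {x} → x < 3 * (q * E) → base + 3 * (q * E) + x < base + 6 * EL
    src< {x} x< = begin-strict
      base + 3 * (q * E) + x             <⟨ +-monoʳ-< (base + 3 * (q * E)) x< ⟩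
      base + 3 * (q * E) + 3 * (q * E)   ≡⟨ six base (q * E) ⟩
      base + 6 * (q * E)                 ≤⟨ +-monoʳ-≤ base (*-monoʳ-≤ 6 q*E≤EL) ⟩
      base + 6 * EL                      ∎
      where
      open ≤-Reasoning
      six : ∀ b x → b + 3 * x + 3 * x ≡ b + 6 * x
      six = solve-∀

    module Combine {μ : Memory} (y : ℕ) (y< : y < 3 * q) (table′ : Table μ) (holds′ : Holds (q * E) f μ) where

      Inv : Invariant 41
      Inv k v μ′ o = ∃[ sum ] (v ≡ sum ∷ y ∷ V₀ × μ′ ≡ μ × o ≡ o₀ × sum < m
        × (sum + sumBelow k (term y)) % m ≡ sumBelow E (term y) % m)

      maintains : ∀ {e} → e < E → Maintains combineBody Inv (size combineBody) e
      maintains {e} e<E (sum , refl , refl , refl , sum< , eq) =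
        ⟪ safe , ≤-refl , refl , _ , refl , refl , refl , m%n<n (sum + _) m
        , trans (cong (λ z → ((sum + z) % m + sumBelow e (term y)) % m) cells≡)
            (sumBelow-mod-step sum (term y e) (sumBelow e (term y)) (sumBelow E (term y)) m eq) ⟫
        where
        ti< : tabIndex y e < base
        ti< = tabIndex< y< e<E

        si< : y * E + e < 3 * (q * E)
        si< = srcIndex< y< e<E

        cells≡ : μ (tabIndex y e) * μ (base + 3 * (q * E) + (y * E + e)) ≡ term y e
        cells≡ = cong₂ _*_ (table′ ti<) (holds′ si<)

        tab≼ : μ (tabIndex y e) ≼ 1
        tab≼ = subst (_≼ 1) (sym (table′ ti<)) (≼m (tab< _))

        src≼ : μ (base + 3 * (q * E) + (y * E + e)) ≼ 1
        src≼ = subst (_≼ 1) (sym (holds′ si<)) (≼m (f< _))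

        below : ∀ {x} → x ≤ base → x ≼ 1
        below x≤ = ≼-base (≤-trans x≤ base≤B)

        withinArrays : ∀ {x} → x ≤ base + 3 * (q * E) + (y * E + e) → x ≼ 1
        withinArrays x≤ = ≼-base (≤-trans x≤ (≤-trans (<⇒≤ (src< si<)) arrays≤B))

        r3≤ : (r * 3 + ⟦ quot ⟧ʷ y q) * E ≤ base
        r3≤ = ≤-trans (m≤m+n _ e) (<⇒≤ ti<)

        safe : Safe {42} ((var 40 ⊕ cell ((var 36 ⊗ lit 3 ⊕ var 39 ⊘ var 34) ⊗ var 5 ⊕ var 41)
                    ⊗ cell (var 7 ⊕ lit 3 ⊗ (var 34 ⊗ var 5) ⊕ (var 39 ⊗ var 5 ⊕ var 41))) ⊛ var 17)
                 (e ∷ sum ∷ y ∷ V₀) μ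
        safe = (_
          , ((((((_ , fits (≼-lit 3) , fits (below (≤-trans (m≤m+n (r * 3) _) (≤-trans (m≤m*n _ E) r3≤))))
                , _ , fits (below (≤-trans (m≤m*n _ E) r3≤))) , _ , fits (below r3≤)) , _ , fits (below (<⇒≤ ti<)))
              , <-≤-trans ti< (≤-trans (m≤m+n base _) arrays≤S))
            , (((_ , (fits (≼-lit 3) ,
                (_ , _ , fits (withinArrays (≤-trans (m≤n*m (q * E) 3) (≤-trans (m≤n+m _ base) (m≤m+n _ _)))))
                     , fits (withinArrays (≤-trans (m≤n+m _ base) (m≤m+n _ _)))) , fits (withinArrays (m≤m+n _ _)))
               , ((_ , _ , fits (withinArrays (≤-trans (m≤m+n _ e) (m≤n+m _ (base + 3 * (q * E))))))
                 , _ , fits (withinArrays (m≤n+m _ (base + 3 * (q * E))))) , fits (withinArrays ≤-refl))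
              , <-≤-trans (src< si<) arrays≤S)
            , fits (≼-* tab≼ src≼))
          , fits (≼-+ (≼m sum<) (≼-* tab≼ src≼))) , _

    -- The loop fills from the top, so entries from `k` on are present. The second part protects the
    -- table below and the arrays of the parent above.
    Filled : ℕ → Memory → Set
    Filled k μ = (∀ {y} → k ≤ y → y < 3 * q → μ (base + 3 * q + y) ≡ child c tab r q f y)
      × (∀ {a} → a < base + 3 * q ⊎ base + 6 * q ≤ a → μ a ≡ μ₀ a)

    q≤q*E : q ≤ q * E
    q≤q*E = m≤m*n q E

    2q≤q*E : 2 * q ≤ q * E
    2q≤q*E = ≤-trans (*-monoˡ-≤ q 1<E) (≤-reflexive (*-comm E q))

    table-kept : ∀ {k μ} → Filled k μ → Table μ
    table-kept (_ , keep) i< = trans (keep (inj₁ (<-≤-trans i< (m≤m+n base _)))) (table i<)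

    6q≤3q*E : 6 * q ≤ 3 * (q * E)
    6q≤3q*E = ≤-trans (≤-reflexive (*-assoc 3 2 q)) (*-monoʳ-≤ 3 2q≤q*E)

    holds-kept : ∀ {k μ} → Filled k μ → Holds (q * E) f μ
    holds-kept (_ , keep) y< =
      trans (keep (inj₂ (≤-trans (+-monoʳ-≤ base 6q≤3q*E) (m≤m+n _ _)))) (holds y<)

    dest< : ∀ {y} → y < 3 * q → base + 3 * q + y < base + 6 * EL
    dest< {y} y< = <-≤-trans (+-monoʳ-< (base + 3 * q) y<)
      (≤-trans (≤-reflexive (six base q)) (+-monoʳ-≤ base (*-monoʳ-≤ 6 (≤-trans q≤q*E q*E≤EL))))
      where
      six : ∀ b x → b + 3 * x + 3 * x ≡ b + 6 * x
      six = solve-∀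

    InvE : Invariant 39
    InvE k v μ o = v ≡ V₀ × o ≡ o₀ × Filled k μ

    expandTime : ℕ
    expandTime = E * (size combineBody + 3) + 30

    maintainsE : ∀ {y} → y < 3 * q → Maintains expandBody InvE expandTime y
    maintainsE {y} y< {t} {μ = μ} (refl , refl , filled) =
      newAs 0 _ refl (seqW (forW Inv (size combineBody) _ maintains
                     (0 , refl , refl , refl , z<s , refl))
        λ { (t≤ , sum , refl , refl , refl , sum< , eq) →
          ⟪ ((_ , (fits (≼-lit 3) , _ , fits (withinArrays (≤-trans (m≤n+m _ base) (m≤m+n _ y)))) ,
              fits (withinArrays (m≤m+n _ y)))
              , _ , fits (withinArrays ≤-refl))
          , _ , <-≤-trans (dest< y<) arrays≤S
          , time≤ t≤ , refl , refl , refl , extended sum (%-extract {y = sumBelow E (term y)} sum< eq) ⟫ })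
      where
      open Combine y y< (table-kept filled) (holds-kept filled)

      withinArrays : ∀ {x} → x ≤ base + 3 * q + y → x ≼ 1
      withinArrays x≤ = ≼-base (≤-trans x≤ (≤-trans (<⇒≤ (dest< y<)) arrays≤B))

      time≤ : ∀ {t′} → t′ ≤ E * (size combineBody + 3) + 3 + (5 + t) → 13 + t′ ≤ expandTime + t
      time≤ {t′} t≤ = ≤-trans (+-monoʳ-≤ 13 t≤)
        (≤-trans (≤-reflexive (arrange (E * (size combineBody + 3)) t))
          (+-monoˡ-≤ t (+-monoʳ-≤ (E * (size combineBody + 3)) (≤ᵇ⇒≤ 21 30 _))))
        where
        arrange : ∀ a t → 13 + (a + 3 + (5 + t)) ≡ a + 21 + t
        arrange = solve-∀

      extended : ∀ sum → sum ≡ sumBelow E (term y) % m → Filled y (μ [ base + 3 * q + y ↦ sum ])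
      extended sum eq = entries , kept
        where
        entries : ∀ {y′} → y ≤ y′ → y′ < 3 * q →
            (μ [ base + 3 * q + y ↦ sum ]) (base + 3 * q + y′) ≡ child c tab r q f y′
        entries {y′} y≤y′ y′< with y ≟ y′
        ... | yes refl = trans (upd-≡ μ (base + 3 * q + y) sum) eq
        ... | no y≢y′ = trans (upd-≢ μ sum (λ e → y≢y′ (sym (+-cancelˡ-≡ (base + 3 * q) y′ y e))))
                          (proj₁ filled (≤∧≢⇒< y≤y′ y≢y′) y′<)
        kept : ∀ {a} → a < base + 3 * q ⊎ base + 6 * q ≤ a → (μ [ base + 3 * q + y ↦ sum ]) a ≡ μ₀ a
        kept {a} out = trans (upd-≢ μ sum (a≢ out)) (proj₂ filled out)
          where
          a≢ : a < base + 3 * q ⊎ base + 6 * q ≤ a → a ≢ base + 3 * q + y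
          a≢ (inj₁ a<) refl = <⇒≱ a< (m≤m+n _ y)
          a≢ (inj₂ a≥) refl = <⇒≱ (<-≤-trans (+-monoʳ-< (base + 3 * q) y<) (≤-reflexive (six base q))) a≥
            where
            six : ∀ b x → b + 3 * x + 3 * x ≡ b + 6 * x
            six = solve-∀

  module _ {μ₀ : Memory} {o₀ : List ℕ} {f : ℕ → ℕ} {q r path acc j : ℕ} .{{_ : NonZero q}}
    (r<R : r < R) (q*E≤EL : q * E ≤ EL) (path≤ : path * R + r ≤ B) (table : Table μ₀)
    (f< : ∀ y → f y < m) (holds : Holds (q * E) f μ₀) where

    open Expand {μ₀} {o₀} {f} q r path acc j r<R q*E≤EL table f< holds

    q≤EL : q ≤ EL
    q≤EL = ≤-trans q≤q*E q*E≤EL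

    q*E/E≡q : (q * E) / E ≡ q
    q*E/E≡q = m*n/n≡m q E

    descends : ∀ {t} → Wp descend (λ t′ v′ μ′ o′ → t′ ≤ descendTime c q + t
                 × v′ ≡ j ∷ acc ∷ 0 ∷ path * R + r ∷ q ∷ U × o′ ≡ o₀ × Filled 0 μ′)
               t (j ∷ acc ∷ r ∷ path ∷ q * E ∷ U) μ₀ o₀
    descends {t} = putW _ (subst (λ z → Wp rest Q (7 + t) (j ∷ acc ∷ r ∷ path ∷ z ∷ U) μ₀ o₀) (sym q*E/E≡q)
      (seqW (forW InvE expandTime (fits (≼-lit 3) , _ , fits (below3q ≤-refl)) maintainsE
               (refl , refl , (λ y≤ y< → contradiction y< (≤⇒≯ y≤)) , λ _ → refl))
        λ { (t≤ , refl , refl , filled) →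
          ⟪ ((_ , _ , fits (≼-base (≤-trans (m≤m+n _ r) path≤))) , _ , fits (≼-base path≤))
          , _ , time≤ t≤ , refl , refl , filled ⟫ }))
      where
      rest : Stm 39
      rest = for (lit 3 ⊗ var 34) expandBody ⍮ put 35 (var 35 ⊗ var 6 ⊕ var 36) ⍮ put 36 (var 3 ⊖ var 3)
      Q : Post 39
      Q t′ v′ μ′ o′ = t′ ≤ descendTime c q + t × v′ ≡ j ∷ acc ∷ 0 ∷ path * R + r ∷ q ∷ U × o′ ≡ o₀ × Filled 0 μ′
      below3q : ∀ {x} → x ≤ 3 * q → x ≼ 1
      below3q x≤ = ≼-base (≤-trans x≤ (≤-trans (≤-trans (*-monoʳ-≤ 3 q≤EL) (*-monoˡ-≤ EL (≤ᵇ⇒≤ 3 6 _)))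
                     (≤-trans (m≤n+m _ base) arrays≤B)))
      time≤ : ∀ {t′} → t′ ≤ 3 * q * (expandTime + 3) + 5 + (7 + t) → 17 + t′ ≤ descendTime c q + t
      time≤ {t′} t≤ = ≤-trans (+-monoʳ-≤ 17 t≤)
        (≤-trans (≤-reflexive (arrange (3 * q) (E * (size combineBody + 3)) t))
          (+-monoˡ-≤ t (+-monoʳ-≤ (3 * q * (E * (size combineBody + 3) + 33)) (≤ᵇ⇒≤ 29 100 _))))
        where
        arrange : ∀ a b t → 17 + (a * (b + 30 + 3) + 5 + (7 + t)) ≡ a * (b + 33) + 29 + t
        arrange = solve-∀

  leafs : ∀ {μ o f path acc j t} → acc < m → (∀ y → f y < m) → Holds 1 f μ →
          Wp leaf (λ t′ v′ μ′ o′ → t′ ≤ 100 + t × v′ ≡ j ∷ (acc + f 0 * f 1 * f 2) % m ∷ R ∷ path ∷ 1 ∷ U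
                     × μ′ ≡ μ × o′ ≡ o) t (j ∷ acc ∷ 0 ∷ path ∷ 1 ∷ U) μ o
  leafs {μ} {o} {f} {path} {acc} {j} {t} acc< f< holds =
    ⟪ ((_ , (( ((_ , fits (≼-lit 3) , fits (cells 3 (≤ᵇ⇒≤ 3 6 _))) , inArrays 3 (≤ᵇ⇒≤ 4 6 _))
            , ((_ , fits (≼-lit 4) , fits (cells 4 (≤ᵇ⇒≤ 4 6 _))) , inArrays 4 (≤ᵇ⇒≤ 5 6 _))
            , fits (≼-* (≼cell 0 3 (holds z<s)) (≼cell 1 4 (holds (s<s z<s)))))
          , ((_ , fits (≼-lit 5) , fits (cells 5 (≤ᵇ⇒≤ 5 6 _))) , inArrays 5 (≤ᵇ⇒≤ 6 6 _))
          , fits product≼)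
        , fits (≼-+ (≼m acc<) product≼)) , _)
    , _ , slack (size leaf) 100
    , cong (λ z → j ∷ (acc + z) % m ∷ R ∷ path ∷ 1 ∷ U)
        (cong₂ _*_ (cong₂ _*_ (at 0 3 (holds z<s)) (at 1 4 (holds (s<s z<s)))) (at 2 5 (holds (s<s (s<s z<s)))))
    , refl , refl ⟫
    where
    EL≥1 : 1 ≤ EL
    EL≥1 = subst (1 ≤_) (sym EL≡) (arrayLength>0 c L)
    within : ∀ {x} → x ≤ 6 → base + x ≤ base + 6 * EL
    within x≤6 = +-monoʳ-≤ base (≤-trans x≤6 (≤-trans (≤-reflexive (sym (*-identityʳ 6))) (*-monoʳ-≤ 6 EL≥1)))
    cells : ∀ x → x ≤ 6 → base + x ≼ 1
    cells x x≤6 = ≼-base (≤-trans (within x≤6) arrays≤B)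
    inArrays : ∀ x → suc x ≤ 6 → base + x < S
    inArrays x x<6 = <-≤-trans (≤-reflexive (sym (+-suc base x))) (≤-trans (within x<6) arrays≤S)
    at : ∀ y x → μ (base + 3 + y) ≡ f y → {_ : T (3 + y ≡ᵇ x)} → μ (base + x) ≡ f y
    at y x eq {p} = trans (cong μ (trans (cong (λ z → base + z) (sym (≡ᵇ⇒≡ (3 + y) x p))) (sym (+-assoc base 3 y)))) eq
    ≼cell : ∀ y x → μ (base + 3 + y) ≡ f y → {_ : T (3 + y ≡ᵇ x)} → μ (base + x) ≼ 1
    ≼cell y x eq {p} = subst (_≼ 1) (sym (at y x eq {p})) (≼m (f< y))
    product≼ : μ (base + 3) * μ (base + 4) * μ (base + 5) ≼ 3
    product≼ = ≼-* (≼-* (≼cell 0 3 (holds z<s)) (≼cell 1 4 (holds (s<s z<s)))) (≼cell 2 5 (holds (s<s (s<s z<s))))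

  -- The last base R digit of the path is the index of the child that is being left; nothing else
  -- about the parent needs to be restored except the array length.
  ascends : ∀ {μ o q r path acc j t} → r < R → q * E ≤ EL →
            Wp ascend (λ t′ v′ μ′ o′ → t′ ≤ 100 + t × v′ ≡ j ∷ acc ∷ suc r ∷ path ∷ q * E ∷ U
                         × μ′ ≡ μ × o′ ≡ o) t (j ∷ acc ∷ R ∷ path * R + r ∷ q ∷ U) μ o
  ascends {q = q} {r} {path} {acc} {j} {t} r<R q≤ =
    ⟪ (_ , _ , fits (≼-base (≤-trans (≤-trans (≤-reflexive digit≡) r<R) R≤B))) , _
    , (_ , _ , fits (≼-base (≤-trans q≤ EL≤B)))
    , slack (size ascend) 100
    , cong₂ (λ x y → j ∷ acc ∷ x ∷ y ∷ q * E ∷ U) digit≡ path≡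
    , refl , refl ⟫
    where
    digit≡ : (path * R + r) % R + 1 ≡ suc r
    digit≡ = trans (+-comm _ 1) (cong suc (trans (cong (_% R) (+-comm (path * R) r))
      (trans ([m+kn]%n≡m%n r path R) (m<n⇒m%n≡m r<R))))
    path≡ : (path * R + r) / R ≡ path
    path≡ = trans (+-distrib-/-∣ˡ r (divides-refl path))
      (trans (cong₂ _+_ (m*n/n≡m path R) (m<n⇒m/n≡0 r<R)) (+-identityʳ path))

  private
    len : ℕ → ℕ
    len = arrayLength c

    Outside : ℕ → ℕ → Set
    Outside q a = a < base ⊎ base + 3 * q ≤ a

    nonZero-len : ∀ h → NonZero (len h)
    nonZero-len h = >-nonZero (arrayLength>0 c h)

    len-mono : ∀ h d → len h ≤ len (d + h)
    len-mono h zero    = ≤-refl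
    len-mono h (suc d) = ≤-trans (len-mono h d) (m≤m*n (len (d + h)) E)

    len≤EL : ∀ h {d} → d + h ≡ L → len h ≤ EL
    len≤EL h {d} eq = ≤-trans (len-mono h d) (≤-reflexive (trans (cong len eq) (sym EL≡)))

    path-extends : ∀ {d path r} → path < R ^ d → r < R → path * R + r < R ^ suc d
    path-extends {d} {path} {r} p< r< = begin-strict
      path * R + r   <⟨ +-monoʳ-< (path * R) r< ⟩
      path * R + R   ≡⟨ +-comm (path * R) R ⟩
      suc path * R   ≤⟨ *-monoˡ-≤ R p< ⟩
      R ^ d * R      ≡⟨ *-comm (R ^ d) R ⟩
      R * R ^ d      ∎
      where open ≤-Reasoning

    path≤B : ∀ {d path} → d ≤ suc L → path < R ^ d → path ≤ B
    path≤B d≤ p< = ≤-trans (<⇒≤ p<) (≤-trans (^-monoʳ-≤ R d≤) R^L≤B)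

  -- The recursion tree is traversed by one flat loop, so no program point marks the end of a
  -- subtree. Correctness is therefore stated with a continuation: the remaining `j` iterations only
  -- have to work from every state in which the node has just been completed. Such states may have
  -- lost the arrays of descendants, but not those of the node itself.
  Reaches : ℕ → (ℕ → ℕ) → Memory → List ℕ → (path acc j t : ℕ) → Post 38 → ℕ → Set
  Reaches q f μ o path acc j t Q time = ∀ {t′ μ′ acc′} → t′ ≤ time + t →
    (∀ {a} → Outside q a → μ′ a ≡ μ a) → acc′ < m → acc′ % m ≡ acc % m →
    Iter traverseBody Q j t′ (acc′ ∷ R ∷ path ∷ q ∷ U) μ′ o

  mutual
    node : ∀ h {d} → d + h ≡ L → ∀ {t f μ o path acc j Q} → path < R ^ d → acc < m →
           (∀ y → f y < m) → Table μ → Holds (len h) f μ →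
           Reaches (len h) f μ o path (acc + formValue c tab h f) j t Q (traverseTime c h) →
           Iter traverseBody Q (steps c h + j) t (acc ∷ 0 ∷ path ∷ len h ∷ U) μ o
    node zero eq {t} {f} {μ} {o} {path} {acc} {j} path< acc< f< table holds reach =
      step {R = λ t′ v′ μ′ o′ → t′ ≤ 150 + t × v′ ≡ j ∷ (acc + f 0 * f 1 * f 2) % m ∷ R ∷ path ∷ 1 ∷ U ×
          μ′ ≡ μ × o′ ≡ o}
        (whenW _ (λ _ → whenW _ (λ z → contradiction refl z)
                    (λ _ → monoW (leafs acc< f< holds) λ (t≤ , rest) → ≤-trans t≤ (slack 115 150) , rest))
                 (λ ()))
        λ { (t≤ , refl , refl , refl) → refl , reach (≤-trans t≤ (slack 150 200)) (λ _ → refl)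
            (m%n<n total m) (m%n%n≡m%n total m) }
      where total = acc + f 0 * f 1 * f 2
    node (suc h) {d} eq {t} {f} {μ} {o} {path} {acc} {j} path< acc< f< table holds reach =
      children h R refl eq {acc₀ = acc} path< acc< f< table holds
        (cong (_% m) (sym (+-identityʳ acc))) reach

    -- Inner induction on the number `i` of children still to be visited; `acc₀` is the accumulator
    -- with which the node was entered.
    children : ∀ h i {r d} → r + i ≡ R → d + suc h ≡ L → ∀ {t f μ o path acc acc₀ j Q} → path < R ^ d → acc < m →
               (∀ y → f y < m) → Table μ → Holds (len (suc h)) f μ →
               acc % m ≡ (acc₀ + sumBelow r (λ r → formValue c tab h (child c tab r (len h) f))) % m →
               Reaches (len (suc h)) f μ o path (acc₀ + formValue c tab (suc h) f) j t Q
                 (i * (descendTime c (len h) + traverseTime c h + 300)) →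
               Iter traverseBody Q (i * (2 + steps c h) + j) t (acc ∷ r ∷ path ∷ len (suc h) ∷ U) μ o
    children h zero r≡R eq path< acc< f< table holds acc≡ reach
      with refl ← trans (sym (+-identityʳ _)) r≡R
      = reach ≤-refl (λ _ → refl) acc< acc≡
    children h (suc i) {r} {d} r≡R eq {t} {f} {μ} {o} {path} {acc} {acc₀} {j} {Q} path< acc< f< table holds acc≡ reach =
      step {R = λ t′ v′ μ′ o′ → t′ ≤ descendTime c q + (size descend ⊔ size leaf + 20 + t)
                × v′ ≡ j₁ ∷ acc ∷ 0 ∷ path * R + r ∷ q ∷ U × o′ ≡ o × Filled 0 μ′}
        (whenW _
          (λ _ → whenW _
            (λ _ → monoW (descends r<R q*E≤ path′≤B table f< holds)
                     λ (t≤ , rest) → ≤-trans t≤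
                         (+-monoʳ-≤ (descendTime c q) (slack 15 (size descend ⊔ size leaf + 20))) , rest)
            (λ z → contradiction z (m>n⇒m∸n≢0 (≤-trans 1<E (m≤n*m E q)))))
          (λ z → contradiction z (m>n⇒m∸n≢0 r<R)))
        λ { {t₁} {_} {μ₁} (t≤ , refl , refl , filled) → refl ,
          subst (λ k → Iter traverseBody Q k t₁ (acc ∷ 0 ∷ path * R + r ∷ q ∷ U) μ₁ o) count≡
            (node h (trans (sym (+-suc d h)) eq) path′< acc< child< (table-kept filled) (λ y< → proj₁ filled z≤n y<)
              λ {t₂} {μ₂} {acc₂} t₂≤ same acc₂< acc₂≡ →
                step {R = λ t′ v′ μ′ o′ → t′ ≤ 150 + t₂ × v′ ≡ j₂ ∷ acc₂ ∷ suc r ∷ path ∷ q * E ∷ U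
                           × μ′ ≡ μ₂ × o′ ≡ o}
                  (whenW _ (λ z → contradiction (n∸n≡0 R′) z)
                    (λ _ → monoW (ascends r<R q*E≤) λ (t≤ , rest) → ≤-trans t≤ (slack 109 150) , rest))
                  λ { {t₃} (t₃≤ , refl , refl , refl) → refl ,
                    children h i (trans (sym (+-suc r i)) r≡R) eq {acc₀ = acc₀} path< acc₂< f<
                      (λ i< → trans (kept {μ₂ = μ₂} filled same (inj₁ i<)) (table i<))
                      (λ y< → trans (kept {μ₂ = μ₂} filled same (inj₂ (m≤m+n _ _))) (holds y<))
                      (acc-next {acc₂} acc₂≡)
                      λ t₄≤ same′ → reach (total t≤ t₂≤ t₃≤ t₄≤) (λ out →
                          trans (same′ out) (kept {μ₂ = μ₂} filled same out)) }) }
      where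
      q = len h
      instance q≢0 = nonZero-len h
      -- Iterations left after the descent into the child, and after the ascent from it.
      j₁ j₂ : ℕ
      j₁ = suc (steps c h + i * (2 + steps c h) + j)
      j₂ = i * (2 + steps c h) + j
      r<R : r < R
      r<R = subst (r <_) r≡R (m<m+n r z<s)
      q*E≤ : q * E ≤ EL
      q*E≤ = len≤EL (suc h) eq
      path′< : path * R + r < R ^ suc d
      path′< = path-extends {d} path< r<R
      path′≤B : path * R + r ≤ B
      path′≤B = path≤B (s≤s (subst (d ≤_) eq (m≤m+n d (suc h)))) path′<
      open Expand {μ} {o} {f} q r path acc j₁ r<R q*E≤ table f< holds using (Filled; table-kept; 6q≤3q*E)
      child< : ∀ y → child c tab r q f y < m
      child< y = m%n<n (sumBelow E (λ e → tab ((r * 3 + ⟦ quot ⟧ʷ y q) * E + e) * f (y * E + e))) m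
      count≡ : steps c h + suc j₂ ≡ j₁
      count≡ = trans (+-suc (steps c h) j₂) (cong suc (sym (+-assoc (steps c h) (i * (2 + steps c h)) j)))
      kept : ∀ {μ₁ μ₂ k} → Filled k μ₁ → (∀ {a} → Outside q a → μ₂ a ≡ μ₁ a) →
             ∀ {a} → Outside (q * E) a → μ₂ a ≡ μ a
      kept filled same (inj₁ a<) =
        trans (same (inj₁ a<)) (proj₂ filled (inj₁ (<-≤-trans a< (m≤m+n base _))))
      kept filled same (inj₂ a≥) =
        trans (same (inj₂ (≤-trans (+-monoʳ-≤ base (*-monoʳ-≤ 3 (m≤m*n q E))) a≥)))
          (proj₂ filled (inj₂ (≤-trans (+-monoʳ-≤ base 6q≤3q*E) a≥)))
      F : ℕ → ℕ
      F r = formValue c tab h (child c tab r q f)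
      acc-next : ∀ {acc₂} → acc₂ % m ≡ (acc + F r) % m → acc₂ % m ≡ (acc₀ + (F r + sumBelow r F)) % m
      acc-next eq₂ = trans eq₂ (trans (%-congˡ-+ {acc} {acc₀ + sumBelow r F} (F r) m acc≡)
        (cong (_% m) (trans (+-assoc acc₀ (sumBelow r F) (F r)) (cong (λ z → acc₀ + z) (+-comm (sumBelow r F) (F r))))))
      total : ∀ {t₁ t₂ t₃ t₄} → t₁ ≤ descendTime c q + (size descend ⊔ size leaf + 20 + t) →
              t₂ ≤ traverseTime c h + t₁ → t₃ ≤ 150 + t₂ →
              t₄ ≤ i * (descendTime c q + traverseTime c h + 300) + t₃ →
              t₄ ≤ suc i * (descendTime c q + traverseTime c h + 300) + t
      total {t₁} {t₂} {t₃} {t₄} p₁ p₂ p₃ p₄ = begin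
        t₄                                                   ≤⟨ p₄ ⟩
        I + t₃
          ≤⟨ +-monoʳ-≤ I (≤-trans p₃ (+-monoʳ-≤ 150 (≤-trans p₂ (+-monoʳ-≤ (traverseTime c h) p₁)))) ⟩
        I + (150 + (traverseTime c h + (descendTime c q + (K + t))))
          ≡⟨ arrange I (traverseTime c h) (descendTime c q) K t ⟩
        descendTime c q + traverseTime c h + (150 + K) + I + t
          ≤⟨ +-monoˡ-≤ t (+-monoˡ-≤ I (+-monoʳ-≤ (descendTime c q + traverseTime c h) (≤ᵇ⇒≤ (150 + K) 300 _))) ⟩
        suc i * (descendTime c q + traverseTime c h + 300) + t   ∎
        where
        open ≤-Reasoning
        I = i * (descendTime c q + traverseTime c h + 300)
        K = size descend ⊔ size leaf + 20
        arrange : ∀ a b c k t → a + (150 + (b + (c + (k + t)))) ≡ c + b + (150 + k) + a + t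
        arrange = solve-∀

  traverses : ∀ {μ o f t} → (∀ y → f y < m) → Table μ → Holds EL f μ →
              Wp traverse (λ t′ v′ μ′ o′ → t′ ≤ traverseTime c L + 24 + t
                × v′ ≡ counter ∷ frame c query₀ (formValue c tab L f % m) × Table μ′ × o′ ≡ o)
              t U μ o
  traverses {μ} {o} {f} {t} f< table holds =
    newAs EL _ refl (newAs 0 _ refl (newAs 0 _ refl (newAs 0 _ refl (seqW
      (forI {Q = Q} _ (subst (λ z → Iter traverseBody Q z (19 + t) (0 ∷ 0 ∷ 0 ∷ EL ∷ U) μ o)
        (sym (trans J≡ (sym (+-identityʳ (steps c L)))))
        (subst (λ z → Iter traverseBody Q (steps c L + 0) (19 + t) (0 ∷ 0 ∷ 0 ∷ z ∷ U) μ o) (sym EL≡)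
          (node L {0} refl z<s z<s f< table (subst (λ z → Holds z f μ) EL≡ holds)
            λ {t′} {μ′} {acc′} t≤ same acc′< acc′≡ →
              stop (≤-trans (s≤s t≤) (≤-reflexive (sym (+-suc (traverseTime c L) (19 + t))))
                   , _ , cong (λ z → acc′ ∷ R ∷ 0 ∷ z ∷ U) (sym EL≡)
                   , trans (sym (m<n⇒m%n≡m acc′<)) acc′≡
                   , (λ i< → trans (same (inj₁ i<)) (table i<)) , refl)))))
      λ { (t≤ , _ , refl , refl , table′ , refl) → ⟪ _ ,
          (≤-trans (+-monoʳ-≤ 4 t≤) (≤-reflexive (arrange (traverseTime c L) t)) , refl , table′ , refl) ⟫ }))))
    where
    Q : Post 38
    Q t′ v′ μ′ o′ = t′ ≤ traverseTime c L + (20 + t) × (∃[ acc ]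
      (v′ ≡ acc ∷ R ∷ 0 ∷ EL ∷ U × acc ≡ formValue c tab L f % m × Table μ′ × o′ ≡ o))
    arrange : ∀ a t → 4 + (a + (20 + t)) ≡ a + 24 + t
    arrange = solve-∀

-- The adjacency matrices

module Indexing (β′ E′ : ℕ) where
  private
    β = suc β′
    E = suc E′

  -- The digits of x in base E are the pairs of digits in base β of its row
  -- and of its column.
  row col : ℕ → ℕ → ℕ
  row zero    x = 0
  row (suc h) x = (x % E) / β + β * row h (x / E)
  col zero    x = 0
  col (suc h) x = (x % E) % β + β * col h (x / E)

  module _ (E≡ : E ≡ β * β) where

    digit< : ∀ x → (x % E) / β < β
    digit< x = m<n*o⇒m/o<n {x % E} {β} {β} (subst (x % E <_) E≡ (m%n<n x E))

    private
      digits< : ∀ {a b P} → a < β → b < P → a + β * b < β * P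
      digits< {a} {b} {P} a< b< = begin-strict
        a + β * b   <⟨ +-monoˡ-< (β * b) a< ⟩
        β + β * b   ≡⟨ *-suc β b ⟨
        β * suc b   ≤⟨ *-monoʳ-≤ β b< ⟩
        β * P       ∎
        where open ≤-Reasoning

    row< : ∀ h x → row h x < β ^ h
    row< zero    x = z<s
    row< (suc h) x = digits< (digit< x) (row< h (x / E))

    col< : ∀ h x → col h x < β ^ h
    col< zero    x = z<s
    col< (suc h) x = digits< (m%n<n (x % E) β) (col< h (x / E))

module Labels {n M′ : ℕ} (X : Vec (Cube n) (suc M′)) where

  private
    M = suc M′

  letter : ℕ → Cube n
  letter a = lookup X (a mod M)

  -- A number below M^k is a word of length k over X in base M, least significant letter first.
  letters : ∀ k → ℕ → Vec (Cube n) k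
  letters zero    y = []
  letters (suc k) y = letter y ∷ letters k (y / M)

  -- One recursion serves two sums: `φ` is the identity for the labels and `τ ∸_` for the shortfalls
  -- below τ.
  cross : (ℕ → ℕ) → ℕ → ℕ → ℕ → ℕ
  cross φ zero    a y = 0
  cross φ (suc k) a y = φ (d_H (letter a) (letter y)) + cross φ k a (y / M)

  -- heads φ k l y sums φ over the distances between the k first letters of
  -- the l letters of y and the later ones.
  heads : (ℕ → ℕ) → ℕ → ℕ → ℕ → ℕ
  heads φ zero    l y = 0
  heads φ (suc k) l y = cross φ (l ∸ 1) y (y / M) + heads φ k (l ∸ 1) (y / M)

  cross≤ : ∀ φ b → (∀ x y → φ (d_H {n} x y) ≤ b) → ∀ k a y → cross φ k a y ≤ k * b
  cross≤ φ b φ≤ zero    a y = z≤n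
  cross≤ φ b φ≤ (suc k) a y = +-mono-≤ (φ≤ (letter a) (letter y)) (cross≤ φ b φ≤ k a (y / M))

  heads≤ : ∀ φ b → (∀ x y → φ (d_H {n} x y) ≤ b) → ∀ k l y → heads φ k l y ≤ k * (l * b)
  heads≤ φ b φ≤ zero    l y = z≤n
  heads≤ φ b φ≤ (suc k) l y = +-mono-≤
    (≤-trans (cross≤ φ b φ≤ (l ∸ 1) y (y / M)) (*-monoˡ-≤ b (m∸n≤m l 1)))
    (≤-trans (heads≤ φ b φ≤ k (l ∸ 1) (y / M)) (*-monoʳ-≤ k (*-monoˡ-≤ b (m∸n≤m l 1))))

d_H≤ : ∀ {n} (x y : Cube n) → d_H x y ≤ n
d_H≤ []       []       = z≤n
d_H≤ (a ∷ x) (b ∷ y) = +-mono-≤ (difference≤1 a b) (d_H≤ x y)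
  where
  open import Data.Bool.Base using (_xor_)
  difference≤1 : ∀ a b → (if a xor b then 1 else 0) ≤ 1
  difference≤1 false false = z≤n
  difference≤1 false true  = ≤-refl
  difference≤1 true  false = ≤-refl
  difference≤1 true  true  = z≤n

indicator : ℕ → ℕ → ℕ
indicator zero    _       = 0
indicator (suc _) zero    = 1
indicator (suc _) (suc _) = 0

indicator-01 : ∀ a b → a ≢ 0 → b ≡ 0 → 1 ≡ indicator a b
indicator-01 zero    b       a≢0 _ = contradiction refl a≢0
indicator-01 (suc a) zero    _   _ = refl

indicator-0ˡ : ∀ a b → a ≡ 0 → 0 ≡ indicator a b
indicator-0ˡ zero b _ = refl

indicator-0ʳ : ∀ a b → b ≢ 0 → 0 ≡ indicator a b
indicator-0ʳ zero    b       _   = refl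
indicator-0ʳ (suc a) zero    b≢0 = contradiction refl b≢0
indicator-0ʳ (suc a) (suc b) _   = refl

sumBelow-front : ∀ k f → sumBelow (suc k) f ≡ f 0 + sumBelow k (f ∘ suc)
sumBelow-front zero    f = refl
sumBelow-front (suc k) f = trans (cong (λ z → f (suc k) + z) (sumBelow-front k f))
  (trans (sym (+-assoc (f (suc k)) (f 0) (sumBelow k (f ∘ suc))))
    (trans (cong (_+ sumBelow k (f ∘ suc)) (+-comm (f (suc k)) (f 0)))
      (+-assoc (f 0) (f (suc k)) (sumBelow k (f ∘ suc)))))

sumBelow-cong : ∀ k {f g : ℕ → ℕ} → (∀ {i} → i < k → f i ≡ g i) → sumBelow k f ≡ sumBelow k g
sumBelow-cong zero    eq = refl
sumBelow-cong (suc k) eq = cong₂ _+_ (eq ≤-refl) (sumBelow-cong k (λ i<k → eq (m≤n⇒m≤1+n i<k)))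

module _ (W S : ℕ) {n M′ : ℕ} (X : Vec (Cube n) (suc M′)) where
  open Logic W S X using (bitAt; bitAt-toℕ)
  open Labels X using (letter)

  private
    M = suc M′

  bitAt-letter : ∀ a (j : Fin n) → bitAt (a % M) (toℕ j) ≡ bit (lookup (letter a) j)
  bitAt-letter a j = trans (cong (λ z → bitAt z (toℕ j)) (sym (toℕ-fromℕ< (m%n<n a M)))) (bitAt-toℕ (a mod M) j)

  distance-sum : ∀ a b → sumBelow n (λ i → (bitAt (a % M) i + bitAt (b % M) i) % 2) ≡ d_H (letter a) (letter b)
  distance-sum a b = trans (sumBelow-cong n bits) (sums (letter a) (letter b))
    where
    open import Data.Bool.Base using (_xor_)
    at : ∀ {k} → Vec Bool k → ℕ → ℕ
    at []      _       = 0
    at (x ∷ v) zero    = bit x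
    at (x ∷ v) (suc i) = at v i
    at-lookup : ∀ {k} (v : Vec Bool k) (j : Fin k) → at v (toℕ j) ≡ bit (lookup v j)
    at-lookup (x ∷ v) zero    = refl
    at-lookup (x ∷ v) (suc j) = at-lookup v j
    bitAt-at : ∀ a {i} → i < n → bitAt (a % M) i ≡ at (letter a) i
    bitAt-at a {i} i<n = subst (λ z → bitAt (a % M) z ≡ at (letter a) z) (toℕ-fromℕ< i<n)
      (trans (bitAt-letter a (fromℕ< i<n)) (sym (at-lookup (letter a) (fromℕ< i<n))))
    bits : ∀ {i} → i < n → (bitAt (a % M) i + bitAt (b % M) i) % 2 ≡ (at (letter a) i + at (letter b) i) % 2
    bits i<n = cong₂ (λ x y → (x + y) % 2) (bitAt-at a i<n) (bitAt-at b i<n)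
    differ : ∀ x y → (bit x + bit y) % 2 ≡ (if x xor y then 1 else 0)
    differ false false = refl
    differ false true  = refl
    differ true  false = refl
    differ true  true  = refl
    sums : ∀ {k} (u v : Vec Bool k) → sumBelow k (λ i → (at u i + at v i) % 2) ≡ d_H u v
    sums []      []      = refl
    sums {suc k} (x ∷ u) (y ∷ v) = trans (sumBelow-front k (λ i → (at (x ∷ u) i + at (y ∷ v) i) % 2))
      (cong₂ _+_ (differ x y) (sums u v))

module Entry (c : Constants) (X : Vec (Cube (Constants.n c)) (Constants.M c))
  (kp kq Np Nq lo w α τ : ℕ) where
  open Constants c
  open Labels X using (heads)
  open Indexing β′ E′ using (row; col)

  -- For Np = M^kp this concatenates the words of two blocks. Taking the first kp letters as heads
  -- then counts the pairs within the first block and those between the blocks, but none within the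
  -- second one, which belongs to the next edge.
  pairCode : ℕ → ℕ → ℕ
  pairCode i j = i + Np * j

  inRange label : ℕ → ℕ → ℕ
  inRange i j = (Np ∸ i) * (Nq ∸ j) * (i + 1 ∸ lo) * (lo + w ∸ i)
  label i j = heads id kp (kp + kq) (pairCode i j)

  mismatch : ℕ → ℕ → ℕ
  mismatch i j = (label i j ∸ α) + (α ∸ label i j) + heads (τ ∸_) kp (kp + kq) (pairCode i j)

  entry : ℕ → ℕ
  entry x = indicator (inRange (row L x) (col L x)) (mismatch (row L x) (col L x))

record Side (σ : Setting) : Set where
  open Setting σ
  field
    kp kq Np Nq lo w α off : ℕ
    kp≤B : kp ≤ B
    kq≤B : kq ≤ B
    Np≤B : Np ≤ B
    Nq≤B : Nq ≤ B
    lo≤B : lo ≤ B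
    w≤B : w ≤ B
    α≤B : α ≤ B
    off≤B : off + Constants.EL c ≤ B
    off≤S : off + Constants.EL c ≤ S

module Filling (σ : Setting) (query₀ : Query) (τ≤B : Query.τ query₀ ≤ Setting.B σ) (verdict₀ counter : ℕ) (side : Side σ) where

  open Setting σ
  open Constants c
  open Side side
  open Bounds B W 5≤B B^<W using (_≼_; ≼-≤; ≼-base; ≼-+; ≼-*; ≼-∸; ≼-lit; fits)
  open Logic W S X using (bitAt; bitAt≤1; Post; upd-≡; upd-≢; Wp; ⟪_⟫; monoW; seqW; putW; newAs; whenW; Invariant; Maintains; forW)
  open Labels X using (letter; cross; heads; heads≤)
  open Indexing β′ E′ using (row; col; row<; col<)
  open Query query₀ using (τ)
  open Entry c X kp kq Np Nq lo w α τ using (pairCode; inRange; label; mismatch; entry)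
  open Program β R D pos neg
    using (decodeBody; distanceBody; partnerBody; headBody; testEntry; entryBody; fillEntries)

  F : Vec ℕ 42
  F = off ∷ α ∷ w ∷ lo ∷ Nq ∷ Np ∷ kq ∷ kp ∷ counter ∷ frame c query₀ verdict₀

  partnerTime headTime entryTime fillTime : ℕ
  partnerTime = n * (size distanceBody + 3) + 60
  headTime = (kp + kq) * (partnerTime + 3) + 60
  entryTime = L * (size decodeBody + 3) + kp * (headTime + 3) + 200
  fillTime = EL * (entryTime + 3) + 10

  module Partners {μ : Memory} {o : List ℕ} (pw j i y x yu cc h : ℕ) where

    Z₄₇ : Vec ℕ 47
    Z₄₇ = pw ∷ j ∷ i ∷ y ∷ x ∷ F

    module _ (yv e bad lab : ℕ) where

      term : ℕ → ℕ
      term b = (bitAt (yu % M) b + bitAt (yv % M) b) % 2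

      InvD : Invariant 55
      InvD k v μ′ o′ = ∃[ d ] (v ≡ d ∷ e ∷ yv ∷ h ∷ bad ∷ lab ∷ cc ∷ yu ∷ Z₄₇ × μ′ ≡ μ × o′ ≡ o
        × d + sumBelow k term ≡ d_H (letter yu) (letter yv))

      maintainsD : ∀ {b} → b < n → Maintains distanceBody InvD (size distanceBody) b
      maintainsD {b} b<n (d , refl , refl , refl , eq) =
        ⟪ (_ , ((((_ , _) , _ , m%n<n yu M , b<n) , ((_ , _) , _ , m%n<n yv M , b<n)
              , fits (≼-+ (≼-≤ (bitAt≤1 (yu % M) b) (≼-lit 1)) (≼-≤ (bitAt≤1 (yv % M) b) (≼-lit 1))))
            , _ , _ , fits (≼-lit 2))
          , fits (≼-≤ d′≤ (≼-base n≤B)))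
        , ≤-refl , refl , _ , refl , refl , refl
        , trans (+-assoc d (term b) (sumBelow b term)) eq ⟫
        where
        d′≤ : d + term b ≤ n
        d′≤ = ≤-trans (+-monoʳ-≤ d (m≤m+n (term b) (sumBelow b term)))
                (≤-trans (≤-reflexive eq) (d_H≤ (letter yu) (letter yv)))

    module _ (lab₁ bad₁ : ℕ) (lab₁≼ : lab₁ ≼ 4) (bad₁≼ : bad₁ ≼ 4) where

      InvP : Invariant 53
      InvP k v μ′ o′ = ∃[ yv ] ∃[ bad ] ∃[ lab ] (v ≡ yv ∷ h ∷ bad ∷ lab ∷ cc ∷ yu ∷ Z₄₇ × μ′ ≡ μ × o′ ≡ o
        × lab + cross id k yu yv ≡ lab₁ × bad + cross (τ ∸_) k yu yv ≡ bad₁)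

      maintainsP : ∀ {e k} → e < k → Maintains partnerBody InvP partnerTime e
      maintainsP {e} e<k {t} (yv , bad , lab , refl , refl , refl , eqL , eqB) =
        newAs 0 _ refl (seqW (forW (InvD yv e bad lab) (size distanceBody) _ (maintainsD yv e bad lab)
                       (0 , refl , refl , refl , distance-sum W S X yu yv))
          λ { (t≤ , d , refl , refl , refl , eqd) → let eqd′ = trans (sym (+-identityʳ d)) eqd in
            ⟪ (_ , _ , fits (≼-≤ (labs≤ d eqd′) lab₁≼))
            , (_ , _ , fits (≼-≤ (bads≤ d eqd′) bad₁≼)) , _
            , time≤ t≤ , refl , _ , _ , _ , refl , refl , refl , labs d eqd′ , bads d eqd′ ⟫ })
        where
        labs : ∀ d → d ≡ d_H (letter yu) (letter yv) → (lab + d) + cross id e yu (yv / M) ≡ lab₁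
        labs d refl = trans (+-assoc lab d _) eqL
        bads : ∀ d → d ≡ d_H (letter yu) (letter yv) → (bad + (τ ∸ d)) + cross (τ ∸_) e yu (yv / M) ≡ bad₁
        bads d refl = trans (+-assoc bad (τ ∸ d) _) eqB
        labs≤ : ∀ d → d ≡ d_H (letter yu) (letter yv) → lab + d ≤ lab₁
        labs≤ d eq = ≤-trans (m≤m+n _ _) (≤-reflexive (labs d eq))
        bads≤ : ∀ d → d ≡ d_H (letter yu) (letter yv) → bad + (τ ∸ d) ≤ bad₁
        bads≤ d eq = ≤-trans (m≤m+n _ _) (≤-reflexive (bads d eq))
        time≤ : ∀ {t′} → t′ ≤ n * (size distanceBody + 3) + 3 + (5 + t) → 24 + t′ ≤ partnerTime + t
        time≤ {t′} t≤ = ≤-trans (+-monoʳ-≤ 24 t≤)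
          (≤-trans (≤-reflexive (arrange (n * (size distanceBody + 3)) t))
            (+-monoˡ-≤ t (+-monoʳ-≤ (n * (size distanceBody + 3)) (≤ᵇ⇒≤ 32 60 _))))
          where
          arrange : ∀ a t → 24 + (a + 3 + (5 + t)) ≡ a + 32 + t
          arrange = solve-∀

  module Heads {μ : Memory} {o : List ℕ} (pw j i y x : ℕ) (lab₀ bad₀ : ℕ) (lab₀≼ : lab₀ ≼ 4) (bad₀≼ : bad₀ ≼ 4) where

    Z : Vec ℕ 47
    Z = pw ∷ j ∷ i ∷ y ∷ x ∷ F

    InvH : Invariant 51
    InvH k v μ′ o′ = ∃[ yu ] ∃[ cc ] ∃[ lab ] ∃[ bad ] (v ≡ bad ∷ lab ∷ cc ∷ yu ∷ Z × μ′ ≡ μ × o′ ≡ o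
      × cc ≤ kp + kq × lab + heads id k cc yu ≡ lab₀ × bad + heads (τ ∸_) k cc yu ≡ bad₀)

    maintainsH : ∀ {h k} → h < k → Maintains headBody InvH headTime h
    maintainsH {h} h<k {t} (yu , cc , lab , bad , refl , refl , refl , cc≤ , eqL , eqB) =
      putW _ (seqW {Q = QP} (newAs (yu / M) _ refl
          (monoW (forW (InvP lab₁ bad₁ (small id lab lab₀≼ eqL) (small (τ ∸_) bad bad₀≼ eqB)) partnerTime _
                 (maintainsP lab₁ bad₁ (small id lab lab₀≼ eqL) (small (τ ∸_) bad bad₀≼ eqB))
                 (yu / M , bad , lab , refl , refl , refl , refl , refl))
                 λ { (t≤ , yv , bad′ , lab′ , refl , rest) → t≤ , bad′ , lab′ , yv , refl , rest }))
        λ { (t≤ , bad′ , lab′ , yv , refl , refl , refl , eqL′ , eqB′) →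
          ⟪ _ , time≤ t≤ , refl , yu / M , cc ∸ 1 , lab′ , bad′ , refl , refl , refl
            , ≤-trans (m∸n≤m cc 1) cc≤
            , trans (cong (_+ heads id h (cc ∸ 1) (yu / M)) (trans (sym (+-identityʳ lab′)) eqL′))
                (trans (+-assoc lab _ _) eqL)
            , trans (cong (_+ heads (τ ∸_) h (cc ∸ 1) (yu / M)) (trans (sym (+-identityʳ bad′)) eqB′))
                (trans (+-assoc bad _ _) eqB) ⟫ })
      where
      open Partners {μ} {o} pw j i y x yu (cc ∸ 1) h
      lab₁ bad₁ : ℕ
      lab₁ = lab + cross id (cc ∸ 1) yu (yu / M)
      bad₁ = bad + cross (τ ∸_) (cc ∸ 1) yu (yu / M)
      QP : Post 52
      QP t′ v′ μ′ o′ = t′ ≤ (cc ∸ 1) * (partnerTime + 3) + 3 + (12 + t) × (∃[ bad′ ] ∃[ lab′ ] ∃[ yv ]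
        (v′ ≡ h ∷ bad′ ∷ lab′ ∷ cc ∸ 1 ∷ yu ∷ Z × μ′ ≡ μ × o′ ≡ o
          × lab′ + cross id 0 yu yv ≡ lab₁ × bad′ + cross (τ ∸_) 0 yu yv ≡ bad₁))
      small : ∀ φ a {b} → b ≼ 4 → a + (cross φ (cc ∸ 1) yu (yu / M) + heads φ h (cc ∸ 1) (yu / M)) ≡ b →
              a + cross φ (cc ∸ 1) yu (yu / M) ≼ 4
      small φ a b≼ eq = ≼-≤ (≤-trans (+-monoʳ-≤ a (m≤m+n _ _)) (≤-reflexive eq)) b≼
      time≤ : ∀ {t′} → t′ ≤ (cc ∸ 1) * (partnerTime + 3) + 3 + (12 + t) → 7 + t′ ≤ headTime + t
      time≤ {t′} t≤ = ≤-trans (+-monoʳ-≤ 7 t≤)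
        (≤-trans (≤-reflexive (arrange ((cc ∸ 1) * (partnerTime + 3)) t))
          (+-monoˡ-≤ t (+-mono-≤ (*-monoˡ-≤ (partnerTime + 3) (≤-trans (m∸n≤m cc 1) cc≤)) (≤ᵇ⇒≤ 22 60 _))))
        where
        arrange : ∀ a t → 7 + (a + 3 + (12 + t)) ≡ a + 22 + t
        arrange = solve-∀

  module Entries {μ₀ : Memory} {o₀ : List ℕ} where

    module _ (x : ℕ) {μ : Memory} where

      -- What is still missing of the row and of the column is `pw` times the row and the column of
      -- the undecoded rest `y`.
      InvY : Invariant 47
      InvY k v μ′ o′ = ∃[ y ] ∃[ i ] ∃[ j ] ∃[ pw ] (v ≡ pw ∷ j ∷ i ∷ y ∷ x ∷ F × μ′ ≡ μ × o′ ≡ o₀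
        × pw * β ^ k ≡ β ^ L × i + pw * row k y ≡ row L x × j + pw * col k y ≡ col L x)

      maintainsY : ∀ {h k} → h < k → Maintains decodeBody InvY (size decodeBody) h
      maintainsY {h} h<k {t} (y , i , j , pw , refl , refl , refl , eqP , eqI , eqJ) =
        ⟪ (_ , (_ , _ , fits (≼-≤ (≤-trans (m≤n+m _ i) (part≤ eqI′)) (≼-base (<⇒≤ (<-≤-trans (row< E≡ L x) β^L≤B)))))
            , fits (≼-≤ (part≤ eqI′) (≼-base (<⇒≤ (<-≤-trans (row< E≡ L x) β^L≤B)))))
        , (_ , (_ , _ , fits (≼-≤ (≤-trans (m≤n+m _ j) (part≤ eqJ′)) (≼-base (<⇒≤ (<-≤-trans (col< E≡ L x) β^L≤B)))))
            , fits (≼-≤ (part≤ eqJ′) (≼-base (<⇒≤ (<-≤-trans (col< E≡ L x) β^L≤B)))))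
        , _
        , (_ , _ , fits (≼-base (≤-trans (m≤m*n (pw * β) (β ^ h) {{>-nonZero (m^n>0 β h)}})
                    (≤-trans (≤-reflexive (trans (*-assoc pw β (β ^ h)) eqP)) β^L≤B))))
        , ≤-refl , refl , y / E , _ , _ , pw * β , refl , refl , refl
        , trans (*-assoc pw β (β ^ h)) eqP , eqI′ , eqJ′ ⟫
        where
        part≤ : ∀ {a b d} → a + b ≡ d → a ≤ d
        part≤ {a} {b} refl = m≤m+n a b
        arrange : ∀ i a p b r → i + a * p + p * b * r ≡ i + p * (a + b * r)
        arrange = solve-∀
        eqI′ : i + ((y % E) / β) * pw + pw * β * row h (y / E) ≡ row L x
        eqI′ = trans (arrange i ((y % E) / β) pw β (row h (y / E))) eqI
        eqJ′ : j + ((y % E) % β) * pw + pw * β * col h (y / E) ≡ col L x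
        eqJ′ = trans (arrange j ((y % E) % β) pw β (col h (y / E))) eqJ

    Filled : ℕ → Memory → Set
    Filled k μ = (∀ {x} → k ≤ x → x < EL → μ (off + x) ≡ entry x)
      × (∀ {a} → a < off ⊎ off + EL ≤ a → μ a ≡ μ₀ a)

    InvX : Invariant 42
    InvX k v μ o = v ≡ F × o ≡ o₀ × Filled k μ

    small-heads : ∀ φ → (∀ x y → φ (d_H {n} x y) ≤ B) → ∀ y → heads φ kp (kp + kq) y ≼ 4
    small-heads φ φ≤B y = ≼-≤ (heads≤ φ B φ≤B kp (kp + kq) y)
      (≼-* (≼-base kp≤B) (≼-* (≼-+ (≼-base kp≤B) (≼-base kq≤B)) (≼-base ≤-refl)))

    maintainsX : ∀ {x} → x < EL → Maintains entryBody InvX entryTime x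
    maintainsX {x} x<EL {t} {μ = μ} (refl , refl , filled) =
      newAs x _ refl (newAs 0 _ refl (newAs 0 _ refl (newAs 1 _ refl (seqW
        (forW (InvY x) (size decodeBody) _ (maintainsY x)
          (x , 0 , 0 , 1 , refl , refl , refl , +-identityʳ (β ^ L) , +-identityʳ (row L x) , +-identityʳ (col L x)))
        λ { {t₁} (t₁≤ , y , i , j , pw , refl , refl , refl , _ , eqI , eqJ) →
          afterDecode t₁≤ (trans (sym (+-identityʳ i)) (trans (cong (λ z → i + z) (sym (*-zeroʳ pw))) eqI))
                          (trans (sym (+-identityʳ j)) (trans (cong (λ z → j + z) (sym (*-zeroʳ pw))) eqJ)) }))))
      where
      Q : Post 42
      Q t′ v′ μ′ o′ = t′ ≤ entryTime + t × v′ ≡ F × o′ ≡ o₀ × Filled x μ′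
      Q′ : Post 47
      Q′ t′ v′ μ′ o′ = t′ ≤ entryTime + t × head (tail (tail (tail (tail v′)))) ≡ x ×
          InvX x (tail (tail (tail (tail (tail v′))))) μ′ o′
      afterDecode : ∀ {t₁ pw j i y} → t₁ ≤ L * (size decodeBody + 3) + 3 + (14 + t) → i ≡ row L x → j ≡ col L x →
        Wp (new (var 44 ⊕ var 36 ⊗ var 45) (new (var 34 ⊕ var 35) (new (var 3 ⊖ var 3) (new (var 3 ⊖ var 3)
            (   for (var 34) headBody
              ⍮ new (var 3 ⊖ var 3) (testEntry ⍮ write (var 41 ⊕ var 42) (var 51)))))))
          Q′ t₁ (pw ∷ j ∷ i ∷ y ∷ x ∷ F) μ o₀
      afterDecode {t₁} {pw} {j} {i} {y} t₁≤ refl refl =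
        newAs (pairCode i j) (_ , (_ , _ , fits (≼-* (≼-base Np≤B) j≼)) , fits yu≼) refl
          (newAs (kp + kq) (_ , _ , fits (≼-+ (≼-base kp≤B) (≼-base kq≤B))) refl
            (newAs 0 _ refl (newAs 0 _ refl (seqW
              (forW InvH headTime _ maintainsH
                (pairCode i j , kp + kq , 0 , 0 , refl , refl , refl , ≤-refl , refl , refl))
              λ { {t₂} (t₂≤ , yu , cc , lab , bad , refl , refl , refl , _ , eqL , eqB) →
                afterLabel t₂≤ (trans (sym (+-identityʳ lab)) eqL) (trans (sym (+-identityʳ bad)) eqB) }))))
        where
        lab₀ bad₀ : ℕ
        lab₀ = label i j
        bad₀ = heads (τ ∸_) kp (kp + kq) (pairCode i j)
        lab₀≼ : lab₀ ≼ 4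
        lab₀≼ = small-heads id (λ u v → ≤-trans (d_H≤ u v) n≤B) (pairCode i j)
        bad₀≼ : bad₀ ≼ 4
        bad₀≼ = small-heads (τ ∸_) (λ u v → ≤-trans (m∸n≤m τ (d_H u v)) τ≤B) (pairCode i j)
        open Heads {μ} {o₀} pw j i y x lab₀ bad₀ lab₀≼ bad₀≼
        i≼ : i ≼ 1
        i≼ = ≼-base (<⇒≤ (<-≤-trans (row< E≡ L x) β^L≤B))
        j≼ : j ≼ 1
        j≼ = ≼-base (<⇒≤ (<-≤-trans (col< E≡ L x) β^L≤B))
        yu≼ : pairCode i j ≼ 3
        yu≼ = ≼-+ i≼ (≼-* (≼-base Np≤B) j≼)
        Q₅₁ : Post 51
        Q₅₁ t′ v′ μ′ o′ = Q′ t′ (tail (tail (tail (tail v′)))) μ′ o′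
        afterLabel : ∀ {t₂ yu cc lab bad} → t₂ ≤ kp * (headTime + 3) + 3 + (23 + t₁) → lab ≡ lab₀ → bad ≡ bad₀ →
          Wp (new (var 3 ⊖ var 3) (testEntry ⍮ write (var 41 ⊕ var 42) (var 51)))
            Q₅₁ t₂ (bad ∷ lab ∷ cc ∷ yu ∷ Z) μ o₀
        afterLabel {t₂} {yu} {cc} t₂≤ refl refl = newAs 0 _ refl (seqW {Q = Q₅₂} tested
          λ { {t₃} (t₃≤ , refl , refl , refl) →
            ⟪ (_ , _ , fits (≼-base (≤-trans (<⇒≤ off<) off≤B))) , _ , <-≤-trans off< off≤S
            , time≤ t₃≤ , refl , refl , refl , extended ⟫ })
          where
          off< : off + x < off + EL
          off< = +-monoʳ-< off x<EL
          Q₅₂ : Post 52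
          Q₅₂ t′ v′ μ′ o′ = t′ ≤ 80 + t₂ × v′ ≡ entry x ∷ bad₀ ∷ lab₀ ∷ cc ∷ yu ∷ Z × μ′ ≡ μ × o′ ≡ o₀
          c₂ : (Np ∸ i) * (Nq ∸ j) ≼ 2
          c₂ = ≼-* (≼-∸ i (≼-base Np≤B)) (≼-∸ j (≼-base Nq≤B))
          c₃ : (Np ∸ i) * (Nq ∸ j) * (i + 1 ∸ lo) ≼ 4
          c₃ = ≼-* c₂ (≼-∸ lo (≼-+ i≼ (≼-lit 1)))
          c₄ : inRange i j ≼ 6
          c₄ = ≼-* c₃ (≼-∸ i (≼-+ (≼-base lo≤B) (≼-base w≤B)))
          d₁ : (lab₀ ∸ α) + (α ∸ lab₀) ≼ 5
          d₁ = ≼-+ (≼-∸ α lab₀≼) (≼-∸ lab₀ (≼-base α≤B))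
          tested : Wp testEntry Q₅₂ (5 + t₂) (0 ∷ bad₀ ∷ lab₀ ∷ cc ∷ yu ∷ Z) μ o₀
          tested = whenW ((((_ , _ , fits c₂) , (((_ , _ , fits (≼-+ i≼ (≼-lit 1)))) , _) , fits c₃)
                           , ((_ , _ , fits (≼-+ (≼-base lo≤B) (≼-base w≤B))) , _) , fits c₄))
            (λ in≢0 → whenW ((_ , _ , fits d₁) , _ , fits (≼-+ d₁ bad₀≼))
               (λ bad≢0 → ⟪ slack 51 80 , cong (λ z → z ∷ bad₀ ∷ lab₀ ∷ cc ∷ yu ∷ Z)
                   (indicator-0ʳ (inRange i j) (mismatch i j) bad≢0) , refl , refl ⟫)
               (λ bad≡0 → ⟪ _ , slack 54 80 , cong (λ z → z ∷ bad₀ ∷ lab₀ ∷ cc ∷ yu ∷ Z)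
                   (indicator-01 (inRange i j) (mismatch i j) in≢0 bad≡0) , refl , refl ⟫))
            (λ in≡0 → ⟪ slack 36 80 , cong (λ z → z ∷ bad₀ ∷ lab₀ ∷ cc ∷ yu ∷ Z)
                (indicator-0ˡ (inRange i j) (mismatch i j) in≡0) , refl , refl ⟫)
          time≤ : ∀ {t₃} → t₃ ≤ 80 + t₂ → 8 + t₃ ≤ entryTime + t
          time≤ {t₃} t₃≤ = ≤-trans (+-monoʳ-≤ 8 (≤-trans t₃≤ (+-monoʳ-≤ 80 (≤-trans t₂≤
              (+-monoʳ-≤ (kp * (headTime + 3) + 3) (+-monoʳ-≤ 23 t₁≤))))))
            (≤-trans (≤-reflexive (arrange (L * (size decodeBody + 3)) (kp * (headTime + 3)) t))
              (+-monoˡ-≤ t (+-monoʳ-≤ (L * (size decodeBody + 3) + kp * (headTime + 3)) (≤ᵇ⇒≤ 131 200 _))))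
            where
            arrange : ∀ a b t → 8 + (80 + (b + 3 + (23 + (a + 3 + (14 + t))))) ≡ a + b + 131 + t
            arrange = solve-∀
          extended : Filled x (μ [ off + x ↦ entry x ])
          extended = entries , kept
            where
            entries : ∀ {x′} → x ≤ x′ → x′ < EL → (μ [ off + x ↦ entry x ]) (off + x′) ≡ entry x′
            entries {x′} x≤ x< with x ≟ x′
            ... | yes refl = upd-≡ μ (off + x) (entry x)
            ... | no x≢ = trans (upd-≢ μ (entry x) (λ e → x≢ (sym (+-cancelˡ-≡ off x′ x e))))
                            (proj₁ filled (≤∧≢⇒< x≤ x≢) x<)
            kept : ∀ {a} → a < off ⊎ off + EL ≤ a → (μ [ off + x ↦ entry x ]) a ≡ μ₀ a
            kept {a} out = trans (upd-≢ μ (entry x) (a≢ out)) (proj₂ filled out)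
              where
              a≢ : a < off ⊎ off + EL ≤ a → a ≢ off + x
              a≢ (inj₁ a<) refl = <⇒≱ a< (m≤m+n off x)
              a≢ (inj₂ a≥) refl = <⇒≱ off< a≥

  fills : ∀ {μ o t} → Wp fillEntries (λ t′ v′ μ′ o′ → t′ ≤ fillTime + t × v′ ≡ F × o′ ≡ o
            × (∀ {x} → x < EL → μ′ (off + x) ≡ entry x)
            × (∀ {a} → a < off ⊎ off + EL ≤ a → μ′ a ≡ μ a)) t F μ o
  fills {μ} {o} {t} = monoW (forW InvX entryTime _ maintainsX
      (refl , refl , (λ x≤ x< → contradiction x< (≤⇒≯ x≤)) , λ _ → refl))
    λ (t≤ , eq , eqo , entries , kept) →
      ≤-trans t≤ (+-monoˡ-≤ t (+-monoʳ-≤ (EL * (entryTime + 3)) (≤ᵇ⇒≤ 3 10 _))) , eq , eqo , entries z≤n , kept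
    where open Entries {μ} {o}

-- Deciding one query

module Solver (σ : Setting) where

  open Setting σ
  open Constants c
  open Bounds B W 5≤B B^<W using (_≼_; ≼-base; ≼-lit; fits)
  open Logic W S X using (Post; Wp; monoW; seqW; newAs)
  open Program β R D pos neg using (fill; detect)

  length# vertices# : Fin 3 → ℕ
  length# zero             = k₀
  length# (suc zero)       = k₁
  length# (suc (suc zero)) = k₂
  vertices# zero             = N₀
  vertices# (suc zero)       = N₁
  vertices# (suc (suc zero)) = N₂

  record Sized (q : Query) : Set where
    constructor sized
    field
      τ≤ : Query.τ q ≤ B
      α≤ : ∀ p → Query.α q p ≤ B
      lo≤ : ∀ p → Query.lo q p ≤ B
      w≤ : ∀ p → Query.w q p ≤ B

  fillPartTime : Fin 3 → ℕ
  fillPartTime p = EL * (L * 49 + length# p * ((length# p + length# (next p))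
      * (n * 31 + 60 + 3) + 60 + 3) + 200 + 3) + 50

  detectTime : ℕ
  detectTime = fillPartTime zero + fillPartTime (suc zero) + fillPartTime (suc (suc zero)) + traverseTime c L + 24

  entryOf : Query → Fin 3 → ℕ → ℕ
  entryOf (query τ α lo w) p = Entry.entry c X (length# p) (length# (next p))
    (vertices# p) (vertices# (next p)) (lo p) (w p) (α p) τ

  -- The three matrices as they lie in memory one after another, which is the form in which the
  -- traversal takes its input.
  combined : Query → ℕ → ℕ
  combined q y with y <? EL | y <? 2 * EL
  ... | yes _ | _     = entryOf q zero y
  ... | no _  | yes _ = entryOf q (suc zero) (y ∸ EL)
  ... | no _  | no _  = entryOf q (suc (suc zero)) (y ∸ 2 * EL)

  Verdict : Query → ℕ
  Verdict q = formValue c tab L (combined q) % m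

  Table : Memory → Set
  Table μ = ∀ {i} → i < base → μ i ≡ tab i

  offset# : Fin 3 → ℕ
  offset# zero             = base + 3 * EL
  offset# (suc zero)       = base + 4 * EL
  offset# (suc (suc zero)) = base + 5 * EL

  module _ (q : Query) (q-sized : Sized q) (verdict counter : ℕ) where

    open Query q
    open Sized q-sized

    U : Vec ℕ 34
    U = counter ∷ frame c q verdict

    offset≤ : ∀ p → offset# p + EL ≤ base + 6 * EL
    offset≤ zero = ≤-trans (≤-reflexive (trans (+-assoc base (3 * EL) EL) (cong (λ z → base + z) (+-comm (3 * EL) EL))))
      (+-monoʳ-≤ base (*-monoˡ-≤ EL (≤ᵇ⇒≤ 4 6 _)))
    offset≤ (suc zero) = ≤-trans
        (≤-reflexive (trans (+-assoc base (4 * EL) EL) (cong (λ z → base + z) (+-comm (4 * EL) EL))))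
      (+-monoʳ-≤ base (*-monoˡ-≤ EL (≤ᵇ⇒≤ 5 6 _)))
    offset≤ (suc (suc zero)) = ≤-reflexive
        (trans (+-assoc base (5 * EL) EL) (cong (λ z → base + z) (+-comm (5 * EL) EL)))

    length≤B : ∀ p → length# p ≤ B
    length≤B zero             = proj₁ blockLengths≤B
    length≤B (suc zero)       = proj₁ (proj₂ blockLengths≤B)
    length≤B (suc (suc zero)) = proj₂ (proj₂ blockLengths≤B)

    vertices≤B′ : ∀ p → vertices# p ≤ B
    vertices≤B′ zero             = proj₁ vertices≤B
    vertices≤B′ (suc zero)       = proj₁ (proj₂ vertices≤B)
    vertices≤B′ (suc (suc zero)) = proj₂ (proj₂ vertices≤B)

    side : Fin 3 → Side σ
    side p = record
      { kp = length# p ; kq = length# (next p) ; Np = vertices# p ; Nq = vertices# (next p)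
      ; lo = lo p ; w = w p ; α = α p ; off = offset# p
      ; kp≤B = length≤B p ; kq≤B = length≤B (next p) ; Np≤B = vertices≤B′ p ; Nq≤B = vertices≤B′ (next p)
      ; lo≤B = lo≤ p ; w≤B = w≤ p ; α≤B = α≤ p
      ; off≤B = ≤-trans (offset≤ p) arrays≤B ; off≤S = ≤-trans (offset≤ p) arrays≤S }

    module Part (p : Fin 3) where
      open Filling σ q τ≤ verdict counter (side p) using (entryTime; fillTime; fills) public

    FillPost : Fin 3 → (t : ℕ) (μ : Memory) (o : List ℕ) → Post 34
    FillPost p t μ o t′ v′ μ′ o′ = t′ ≤ fillPartTime p + t × v′ ≡ U × o′ ≡ o
      × (∀ {x} → x < EL → μ′ (offset# p + x) ≡ entryOf q p x)
      × (∀ {a} → a < offset# p ⊎ offset# p + EL ≤ a → μ′ a ≡ μ a)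

    private
      time≤ : ∀ p {t k t′} → k ≤ 40 → t′ ≤ Part.fillTime p + (k + t) → t′ ≤ fillPartTime p + t
      time≤ p {t} {k} k≤ t′≤ = ≤-trans t′≤ (≤-trans (≤-reflexive (sym (+-assoc (Part.fillTime p) k t)))
        (+-monoˡ-≤ t (≤-trans (+-monoʳ-≤ (Part.fillTime p) k≤)
            (≤-reflexive (+-assoc (EL * (Part.entryTime p + 3)) 10 40)))))

    within : ∀ x → x ≤ 5 → base + x * EL ≤ base + 6 * EL
    within x x≤5 = +-monoʳ-≤ base (*-monoˡ-≤ EL (≤-trans x≤5 (≤ᵇ⇒≤ 5 6 _)))

    prodOK : ∀ x → x ≤ 5 → x * EL ≼ 1
    prodOK x x≤5 = ≼-base (≤-trans (m≤n+m _ base) (≤-trans (within x x≤5) arrays≤B))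

    sumOK : ∀ x → x ≤ 5 → base + x * EL ≼ 1
    sumOK x x≤5 = ≼-base (≤-trans (within x x≤5) arrays≤B)

    fillsPart : ∀ p {t μ o} → Wp (fill p) (FillPost p t μ o) t U μ o
    fillsPart zero =
      newAs (length# zero) _ refl
          (newAs (length# (suc zero)) _ refl (newAs (vertices# zero) _ refl (newAs (vertices# (suc zero)) _ refl
      (newAs (lo zero) _ refl (newAs (w zero) _ refl (newAs (α zero) _ refl
      (newAs (offset# zero) (_ , ((fits (≼-lit 3) , _ , fits (prodOK 3 (≤ᵇ⇒≤ 3 5 _))) ,
          fits (sumOK 3 (≤ᵇ⇒≤ 3 5 _)))) refl
        (monoW (Part.fills zero) λ { (t≤ , refl , refl , rest) → time≤ zero (≤ᵇ⇒≤ 21 40 _) t≤ , refl ,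
            refl , rest }))))))))
    fillsPart (suc zero) =
      newAs (length# (suc zero)) _ refl (newAs (length# (suc (suc zero))) _ refl
          (newAs (vertices# (suc zero)) _ refl (newAs (vertices# (suc (suc zero))) _ refl
      (newAs (lo (suc zero)) _ refl (newAs (w (suc zero)) _ refl (newAs (α (suc zero)) _ refl
      (newAs (offset# (suc zero)) (_ , ((fits (≼-lit 4) , _ , fits (prodOK 4 (≤ᵇ⇒≤ 4 5 _))) ,
          fits (sumOK 4 (≤ᵇ⇒≤ 4 5 _)))) refl
        (monoW (Part.fills (suc zero)) λ { (t≤ , refl , refl , rest) → time≤ (suc zero) (≤ᵇ⇒≤ 21 40 _) t≤ ,
            refl , refl , rest }))))))))
    fillsPart (suc (suc zero)) =
      newAs (length# (suc (suc zero))) _ refl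
          (newAs (length# zero) _ refl (newAs (vertices# (suc (suc zero))) _ refl (newAs (vertices# zero) _ refl
      (newAs (lo (suc (suc zero))) _ refl (newAs (w (suc (suc zero))) _ refl (newAs (α (suc (suc zero))) _ refl
      (newAs (offset# (suc (suc zero))) (_ , ((fits (≼-lit 5) , _ , fits (prodOK 5 ≤-refl)) ,
          fits (sumOK 5 ≤-refl))) refl
        (monoW (Part.fills (suc (suc zero))) λ { (t≤ , refl , refl , rest) →
            time≤ (suc (suc zero)) (≤ᵇ⇒≤ 21 40 _) t≤ , refl , refl , rest }))))))))

    combined-holds : ∀ {μ} → (∀ p {x} → x < EL → μ (offset# p + x) ≡ entryOf q p x) →
                     ∀ {y} → y < 3 * EL → μ (base + 3 * EL + y) ≡ combined q y
    combined-holds {μ} at {y} y< with y <? EL | y <? 2 * EL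
    ... | yes y<EL | _ = at zero y<EL
    ... | no y≮ | yes y<2 = trans (cong μ (shift 1 y (≤-trans (≤-reflexive (*-identityˡ EL)) (≮⇒≥ y≮))))
            (trans (cong (λ z → μ (base + 4 * EL + (y ∸ z))) (*-identityˡ EL))
              (at (suc zero) (+-cancelʳ-< EL (y ∸ EL) EL
                  (subst₂ _<_ (sym (m∸n+n≡m (≮⇒≥ y≮))) (cong (λ z → EL + z) (+-identityʳ EL)) y<2))))
      where
      shift : ∀ k y → k * EL ≤ y → base + 3 * EL + y ≡ base + (3 + k) * EL + (y ∸ k * EL)
      shift k y le = trans (cong (λ z → base + 3 * EL + z) (sym (m+[n∸m]≡n le))) (arrange base EL k (y ∸ k * EL))
        where
        arrange : ∀ b e k z → b + 3 * e + (k * e + z) ≡ b + (3 + k) * e + z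
        arrange = solve-∀
    ... | no y≮ | no y≮2 = trans (cong μ (shift 2 y (≮⇒≥ y≮2)))
            (at (suc (suc zero)) (+-cancelʳ-< (2 * EL) (y ∸ 2 * EL) EL
                (subst (_< 3 * EL) (sym (m∸n+n≡m (≮⇒≥ y≮2))) y<)))
      where
      shift : ∀ k y → k * EL ≤ y → base + 3 * EL + y ≡ base + (3 + k) * EL + (y ∸ k * EL)
      shift k y le = trans (cong (λ z → base + 3 * EL + z) (sym (m+[n∸m]≡n le))) (arrange base EL k (y ∸ k * EL))
        where
        arrange : ∀ b e k z → b + 3 * e + (k * e + z) ≡ b + (3 + k) * e + z
        arrange = solve-∀

    entryOf<m : ∀ p x → entryOf q p x < m
    entryOf<m p x = ≤-<-trans (indicator≤1 _ _) 1<m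
      where
      indicator≤1 : ∀ a b → indicator a b ≤ 1
      indicator≤1 zero    b       = z≤n
      indicator≤1 (suc a) zero    = ≤-refl
      indicator≤1 (suc a) (suc b) = z≤n

    combined<m : ∀ y → combined q y < m
    combined<m y with y <? EL | y <? 2 * EL
    ... | yes _ | _     = entryOf<m zero y
    ... | no _  | yes _ = entryOf<m (suc zero) (y ∸ EL)
    ... | no _  | no _  = entryOf<m (suc (suc zero)) (y ∸ 2 * EL)

    open Traversal σ q verdict counter using (traverses)

    detects : ∀ {t μ o} → Table μ → Wp detect (λ t′ v′ μ′ o′ → t′ ≤ detectTime + t
                × v′ ≡ counter ∷ frame c q (Verdict q) × Table μ′ × o′ ≡ o) t U μ o
    detects {t} table =
      seqW (fillsPart zero) λ { {μ = μ₁} (t₁≤ , refl , refl , filled₁ , kept₁) →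
      seqW (fillsPart (suc zero)) λ { {μ = μ₂} (t₂≤ , refl , refl , filled₂ , kept₂) →
      seqW (fillsPart (suc (suc zero))) λ { {μ = μ₃} (t₃≤ , refl , refl , filled₃ , kept₃) →
      monoW (traverses combined<m
          (λ i< → trans (kept₃ (inj₁ (below 5 i<)))
              (trans (kept₂ (inj₁ (below 4 i<))) (trans (kept₁ (inj₁ (below 3 i<))) (table i<))))
          (combined-holds {μ₃} λ { zero {x} x< → trans (kept₃ (inj₁ (apart {3} {5} (≤ᵇ⇒≤ 4 5 _) x<)))
              (trans (kept₂ (inj₁ (apart {3} {4} ≤-refl x<))) (filled₁ x<))
                                 ; (suc zero) x< → trans (kept₃ (inj₁ (apart {4} {5} ≤-refl x<))) (filled₂ x<)
                                 ; (suc (suc zero)) x< → filled₃ x< }))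
        λ { (t₄≤ , refl , table′ , refl) → total t₁≤ t₂≤ t₃≤ t₄≤ , refl , table′ , refl } } } }
      where
      below : ∀ k {i} → i < base → i < base + k * EL
      below k i< = <-≤-trans i< (m≤m+n base _)
      apart : ∀ {j k x} → j < k → x < EL → base + j * EL + x < base + k * EL
      apart {j} {k} {x} j<k x< = <-≤-trans (+-monoʳ-< (base + j * EL) x<)
        (≤-trans (≤-reflexive (trans (+-assoc base (j * EL) EL) (cong (λ z → base + z) (+-comm (j * EL) EL))))
          (+-monoʳ-≤ base (*-monoˡ-≤ EL j<k)))
      total : ∀ {t₁ t₂ t₃ t₄} → t₁ ≤ fillPartTime zero + t → t₂ ≤ fillPartTime (suc zero) + t₁ →
              t₃ ≤ fillPartTime (suc (suc zero)) + t₂ → t₄ ≤ traverseTime c L + 24 + t₃ → t₄ ≤ detectTime + t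
      total {t₁} {t₂} {t₃} {t₄} p₁ p₂ p₃ p₄ = ≤-trans p₄ (≤-trans (+-monoʳ-≤ (traverseTime c L + 24) (≤-trans p₃
        (+-monoʳ-≤ (fillPartTime (suc (suc zero))) (≤-trans p₂ (+-monoʳ-≤ (fillPartTime (suc zero)) p₁)))))
        (≤-reflexive (arrange (fillPartTime zero) (fillPartTime (suc zero)) (fillPartTime (suc (suc zero)))
            (traverseTime c L) t)))
        where
        arrange : ∀ a b c d t → d + 24 + (c + (b + (a + t))) ≡ a + b + c + d + 24 + t
        arrange = solve-∀

-- Search and bisection

triple : (x y z : ℕ) → Fin 3 → ℕ
triple x y z zero             = x
triple x y z (suc zero)       = y
triple x y z (suc (suc zero)) = z

adjust : (Fin 3 → ℕ) → Fin 3 → ℕ → Fin 3 → ℕ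
adjust f zero x zero             = x
adjust f zero x (suc zero)       = f (suc zero)
adjust f zero x (suc (suc zero)) = f (suc (suc zero))
adjust f (suc zero) x zero             = f zero
adjust f (suc zero) x (suc zero)       = x
adjust f (suc zero) x (suc (suc zero)) = f (suc (suc zero))
adjust f (suc (suc zero)) x zero             = f zero
adjust f (suc (suc zero)) x (suc zero)       = f (suc zero)
adjust f (suc (suc zero)) x (suc (suc zero)) = x

adjust-≡ : ∀ f p x → adjust f p x p ≡ x
adjust-≡ f zero             x = refl
adjust-≡ f (suc zero)       x = refl
adjust-≡ f (suc (suc zero)) x = refl

adjust-≢ : ∀ f p x {i} → i ≢ p → adjust f p x i ≡ f i
adjust-≢ f zero             x {zero}           i≢p = contradiction refl i≢p
adjust-≢ f zero             x {suc zero}       i≢p = refl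
adjust-≢ f zero             x {suc (suc zero)} i≢p = refl
adjust-≢ f (suc zero)       x {zero}           i≢p = refl
adjust-≢ f (suc zero)       x {suc zero}       i≢p = contradiction refl i≢p
adjust-≢ f (suc zero)       x {suc (suc zero)} i≢p = refl
adjust-≢ f (suc (suc zero)) x {zero}           i≢p = refl
adjust-≢ f (suc (suc zero)) x {suc zero}       i≢p = refl
adjust-≢ f (suc (suc zero)) x {suc (suc zero)} i≢p = contradiction refl i≢p

adjust-all : ∀ {P : ℕ → Set} f p x → (∀ i → P (f i)) → P x → ∀ i → P (adjust f p x i)
adjust-all f zero             x all px zero             = px
adjust-all f zero             x all px (suc zero)       = all (suc zero)
adjust-all f zero             x all px (suc (suc zero)) = all (suc (suc zero))
adjust-all f (suc zero)       x all px zero             = all zero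
adjust-all f (suc zero)       x all px (suc zero)       = px
adjust-all f (suc zero)       x all px (suc (suc zero)) = all (suc (suc zero))
adjust-all f (suc (suc zero)) x all px zero             = all zero
adjust-all f (suc (suc zero)) x all px (suc zero)       = all (suc zero)
adjust-all f (suc (suc zero)) x all px (suc (suc zero)) = px

-- The candidate κ encodes the excess of τ over τ₀, the total label and the
-- first two labels, in this order of significance.
candidateQuery : Constants → ℕ → ℕ → Query
candidateQuery c τ₀ κ = query (τ₀ + κ / (V * V * V))
    (triple ((κ / V) % V) (κ % V) (((κ / (V * V)) % V ∸ (κ / V) % V) ∸ κ % V))
    (triple 0 0 0) (triple w₀ w₀ w₀)
  where open Constants c

module Searching (σ : Setting) (countE : Exp 33) (τ₀E : Exp 34) (count τ₀ : ℕ) (τ₀+count≤B : τ₀ + count ≤ Setting.B σ) where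

  open Setting σ
  open Constants c
  open Bounds B W 5≤B B^<W using (_≼_; ≼-base; ≼-+; ≼-*; ≼-lit; fits)
  open Logic W S X using (bitAt; ⟦_⟧; Safe; Post; Wp; ⟪_⟫; monoW; seqW; newW; whenW; Invariant; Maintains; forW)
  open Program β R D pos neg using (corner; width; target; searchBody; search; setCorner; setWidth; bisectBody; bisect; reportBody; reportVectors; report; solve)
  open Solver σ using (length#; Sized; sized; detectTime; Verdict; Table; detects)

  candidateQ : ℕ → Query
  candidateQ = candidateQuery c τ₀

  K : ℕ
  K = count * (V * V * V)

  candidate-sized : ∀ {κ} → κ < K → Sized (candidateQ κ)
  candidate-sized {κ} κ<K = sized
    (≤-trans (+-monoʳ-≤ τ₀ (<⇒≤ (m<n*o⇒m/o<n {κ} {count} {V * V * V} κ<K))) τ₀+count≤B)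
    (λ { zero → rem≤ (κ / V) ; (suc zero) → rem≤ κ
       ; (suc (suc zero)) → ≤-trans (m∸n≤m _ (κ % V)) (≤-trans (m∸n≤m _ ((κ / V) % V)) (rem≤ (κ / (V * V)))) })
    (λ { zero → z≤n ; (suc zero) → z≤n ; (suc (suc zero)) → z≤n })
    (λ { zero → w₀≤B ; (suc zero) → w₀≤B ; (suc (suc zero)) → w₀≤B })
    where
    rem≤ : ∀ x → x % V ≤ B
    rem≤ x = ≤-trans (<⇒≤ (m%n<n x V)) V≤B

  Misses : ℕ → Set
  Misses k = ∀ {κ} → k ≤ κ → κ < K → Verdict (candidateQ κ) ≡ 0

  record Hits (κ : ℕ) : Set where
    constructor hits
    field
      κ<K : κ < K
      positive : Verdict (candidateQ κ) ≢ 0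
      greatest : Misses (suc κ)

  module _ (count-value : ∀ q v μ → ⟦ countE ⟧ (frame c q v) μ ≡ count)
           (count-safe : ∀ q v μ → Safe countE (frame c q v) μ)
           (τ₀-value : ∀ k q v μ → ⟦ τ₀E ⟧ (k ∷ frame c q v) μ ≡ τ₀)
           (τ₀-safe : ∀ k q v μ → Safe τ₀E (k ∷ frame c q v) μ) where

    Outcome : ℕ → (τ : ℕ) (α : Fin 3 → ℕ) → ℕ → Set
    Outcome k τ α verdict =
      (verdict ≡ 0 × Misses k)
        ⊎ (verdict ≢ 0 × (∃[ κ ] (Hits κ × query τ α (triple 0 0 0) (triple w₀ w₀ w₀) ≡ candidateQ κ)))

    start : ℕ → (Fin 3 → ℕ) → Query
    start τ α = query τ α (triple 0 0 0) (triple w₀ w₀ w₀)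

    SearchInv : List ℕ → Invariant 33
    SearchInv o₀ k v μ o = ∃[ τ ] ∃[ α ] ∃[ verdict ] (v ≡ frame c (start τ α) verdict × Table μ × o ≡ o₀
      × Sized (start τ α) × Outcome k τ α verdict)

    searchTime : ℕ
    searchTime = detectTime + (cost τ₀E + 90)

    searchStep : ∀ {o₀ κ} → κ < K → Maintains (searchBody τ₀E) (SearchInv o₀) searchTime κ
    searchStep {o₀} {κ} κ<K {t} {μ = μ} (τ , α , verdict , refl , table , refl , q-sized , outcome) = whenW _
      (λ found → ⟪ slack′ , refl , τ , α , verdict , refl , table , refl , q-sized , continue found outcome ⟫)
      (λ none → seqW {Q = Q} ⟪ (τ₀-safe κ (start τ α) verdict μ ,
          (_ , ((_ , _ , fits V²≼) , _ , fits V³≼)) , fits (≼-base τ≤))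
            , _ , _ , ((((_ , (_ , _ , fits V²≼)) , _) , _) , _)
            , ≤-reflexive (arrange (cost τ₀E) t)
            , cong (λ z → κ ∷ frame c (query (z + κ / (V * V * V)) (Query.α (candidateQ κ)) (triple 0 0 0)
                (triple w₀ w₀ w₀)) verdict)
                (τ₀-value κ (start τ α) verdict μ)
            , refl , refl ⟫
        λ { (t₁≤ , refl , refl , refl) →
          monoW (detects (candidateQ κ) (candidate-sized κ<K) verdict κ table)
            λ { (t₂≤ , refl , table′ , refl) → total t₁≤ t₂≤ , refl , _ , _ , _ , refl , table′ , refl ,
                candidate-sized κ<K
                , decide none outcome } })
      where
      Q : Post 34
      Q t′ v′ μ′ o′ = t′ ≤ cost τ₀E + 53 + t × v′ ≡ κ ∷ frame c (candidateQ κ) verdict × μ′ ≡ μ × o′ ≡ o₀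
      arrange : ∀ a t → 36 + (a + 12 + 2 + (3 + t)) ≡ a + 53 + t
      arrange = solve-∀
      slack′ : 1 + (3 + t) ≤ searchTime + t
      slack′ = +-monoˡ-≤ t (≤-trans (≤ᵇ⇒≤ 4 90 _) (≤-trans (m≤n+m 90 (cost τ₀E)) (m≤n+m _ detectTime)))
      total : ∀ {t₁ t₂} → t₁ ≤ cost τ₀E + 53 + t → t₂ ≤ detectTime + t₁ → t₂ ≤ searchTime + t
      total p₁ p₂ = ≤-trans p₂ (≤-trans
          (+-monoʳ-≤ detectTime (≤-trans p₁ (+-monoˡ-≤ t (+-monoʳ-≤ (cost τ₀E) (≤ᵇ⇒≤ 53 90 _)))))
        (≤-reflexive (sym (+-assoc detectTime _ t))))
      τ≤ : ⟦ τ₀E ⟧ (κ ∷ frame c (start τ α) verdict) μ + κ / (V * V * V) ≤ B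
      τ≤ = subst (λ z → z + κ / (V * V * V) ≤ B) (sym (τ₀-value κ (start τ α) verdict μ))
          (Sized.τ≤ (candidate-sized κ<K))
      V²≼ : V * V ≼ 2
      V²≼ = ≼-* (≼-base V≤B) (≼-base V≤B)
      V³≼ : V * V * V ≼ 3
      V³≼ = ≼-* V²≼ (≼-base V≤B)
      continue : verdict ≢ 0 → Outcome (suc κ) τ α verdict → Outcome κ τ α verdict
      continue found (inj₁ (none , _)) = contradiction none found
      continue found (inj₂ hit) = inj₂ hit
      decide : verdict ≡ 0 → Outcome (suc κ) τ α verdict →
               Outcome κ (Query.τ (candidateQ κ)) (Query.α (candidateQ κ)) (Verdict (candidateQ κ))
      decide none (inj₂ (found , _)) = contradiction none found
      decide none (inj₁ (_ , misses)) with Verdict (candidateQ κ) ≟ 0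
      ... | yes zero′ = inj₁ (zero′ , λ {κ′} κ≤ κ< → case κ ≟ κ′ of λ
              { (yes refl) → zero′ ; (no κ≢) → misses (≤∧≢⇒< κ≤ κ≢) κ< })
      ... | no nonzero = inj₂ (nonzero , κ , hits κ<K nonzero misses , refl)

    searches : ∀ {t μ o} → Table μ →
      Wp (search countE τ₀E) (λ t′ v′ μ′ o′ → t′ ≤ K * (searchTime + 3) + (cost countE + 20) + t ×
          SearchInv o 0 v′ μ′ o′)
        t (frame c (start 0 (triple 0 0 0)) 0) μ o
    searches {t} {μ} {o} table = monoW
        (forW (SearchInv o) searchTime (count-safe q₀ 0 μ , ((_ , _ , fits V²≼) , _ , fits V³≼) ,
            fits {j = 4} (subst (_≼ 4) (sym K≡) (≼-* (≼-base count≤B) V³≼)))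
          (λ {j} κ< → searchStep (subst (j <_) K≡ κ<))
          (0 , triple 0 0 0 , 0 , refl , table , refl ,
              sized z≤n (λ { zero → z≤n ; (suc zero) → z≤n ; (suc (suc zero)) → z≤n })
              (λ { zero → z≤n ; (suc zero) → z≤n ; (suc (suc zero)) → z≤n })
              (λ { zero → w₀≤B ; (suc zero) → w₀≤B ; (suc (suc zero)) → w₀≤B })
            , inj₁ (refl , λ {κ} K≤ <K → contradiction <K (≤⇒≯ (subst (_≤ κ) K≡ K≤)))))
        λ (t≤ , rest) → ≤-trans t≤
            (+-monoˡ-≤ t (+-mono-≤ (≤-reflexive (cong (_* (searchTime + 3)) K≡))
            (≤-trans (≤-reflexive (arrange (cost countE))) (+-monoʳ-≤ (cost countE) (≤ᵇ⇒≤ 10 20 _))))) , rest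
      where
      q₀ = start 0 (triple 0 0 0)
      V²≼ : V * V ≼ 2
      V²≼ = ≼-* (≼-base V≤B) (≼-base V≤B)
      V³≼ : V * V * V ≼ 3
      V³≼ = ≼-* V²≼ (≼-base V≤B)
      count≤B : count ≤ B
      count≤B = ≤-trans (m≤n+m count τ₀) τ₀+count≤B
      K≡ : ⟦ countE ⟧ (frame c q₀ 0) μ * (V * V * V) ≡ K
      K≡ = cong (_* (V * V * V)) (count-value q₀ 0 μ)
      arrange : ∀ a → suc (a + (8 + 1)) ≡ a + 10
      arrange = solve-∀

  -- Bisection is sound for this reason alone. It is a hypothesis here because it rests on the
  -- meaning of verdicts as traces, which is independent of the program.
  Splits : Set
  Splits = ∀ τ α lo w p h → Sized (query τ α lo w) → w p ≡ h + h → Verdict (query τ α lo w) ≢ 0 →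
    Verdict (query τ α lo (adjust w p h)) ≡ 0 → Verdict (query τ α (adjust lo p (lo p + h)) (adjust w p h)) ≢ 0

  width-value : ∀ p k q v μ → ⟦ width {1} p ⟧ (k ∷ frame c q v) μ ≡ Query.w q p
  width-value zero             k q v μ = refl
  width-value (suc zero)       k q v μ = refl
  width-value (suc (suc zero)) k q v μ = refl

  corner-value : ∀ p k q v μ → ⟦ corner {1} p ⟧ (k ∷ frame c q v) μ ≡ Query.lo q p
  corner-value zero             k q v μ = refl
  corner-value (suc zero)       k q v μ = refl
  corner-value (suc (suc zero)) k q v μ = refl

  setsWidth : ∀ p {k τ α lo w verdict t μ o} →
    Wp (setWidth p (width p ⊘ (var 3 ⊕ var 3)))
      (λ t′ v′ μ′ o′ → t′ ≤ 10 + t × v′ ≡ k ∷ frame c (query τ α lo (adjust w p (w p / 2))) verdict × μ′ ≡ μ × o′ ≡ o)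
      t (k ∷ frame c (query τ α lo w) verdict) μ o
  setsWidth zero             = ⟪ (_ , _ , _ , fits (≼-lit 2)) , ≤-refl , refl , refl , refl ⟫
  setsWidth (suc zero)       = ⟪ (_ , _ , _ , fits (≼-lit 2)) , ≤-refl , refl , refl , refl ⟫
  setsWidth (suc (suc zero)) = ⟪ (_ , _ , _ , fits (≼-lit 2)) , ≤-refl , refl , refl , refl ⟫

  setsCorner : ∀ p {k τ α lo w verdict t μ o} → lo p ≤ B → w p ≤ B →
    Wp (setCorner p (corner p ⊕ width p))
      (λ t′ v′ μ′ o′ → t′ ≤ 7 + t × v′ ≡ k ∷ frame c (query τ α (adjust lo p (lo p + w p)) w) verdict × μ′ ≡ μ × o′ ≡ o)
      t (k ∷ frame c (query τ α lo w) verdict) μ o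
  setsCorner zero             lo≤ w≤ = ⟪ (_ , _ , fits (≼-+ (≼-base lo≤) (≼-base w≤))) , ≤-refl , refl , refl , refl ⟫
  setsCorner (suc zero)       lo≤ w≤ = ⟪ (_ , _ , fits (≼-+ (≼-base lo≤) (≼-base w≤))) , ≤-refl , refl , refl , refl ⟫
  setsCorner (suc (suc zero)) lo≤ w≤ = ⟪ (_ , _ , fits (≼-+ (≼-base lo≤) (≼-base w≤))) , ≤-refl , refl , refl , refl ⟫

  -- The bisection also runs after an unsuccessful search and must be safe then, too. So `H`, the
  -- success of the search, guards only the claim about verdicts, while the bounds on corners and
  -- widths hold unconditionally.
  module Bisection (splits : Splits) (H : Set) (τ : ℕ) (α : Fin 3 → ℕ) (τ≤ : τ ≤ B) (α≤ : ∀ p → α p ≤ B) where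

    record Box (p : Fin 3) (lo₀ w₁ : Fin 3 → ℕ) (k : ℕ) (lo w : Fin 3 → ℕ) : Set where
      constructor box
      field
        lo≤ : ∀ i → lo i ≤ B
        w≤ : ∀ i → w i ≤ B
        here-w : w p ≡ 2 ^ k
        here-lo : lo p + 2 ^ k ≤ w₀
        elsewhere : ∀ {i} → i ≢ p → lo i ≡ lo₀ i × w i ≡ w₁ i
        hit : H → Verdict (query τ α lo w) ≢ 0

    BisectInv : List ℕ → Fin 3 → (lo₀ w₁ : Fin 3 → ℕ) → Invariant 33
    BisectInv o₀ p lo₀ w₁ k v μ o = ∃[ lo ] ∃[ w ] ∃[ verdict ]
      (v ≡ frame c (query τ α lo w) verdict × Table μ × o ≡ o₀ × Box p lo₀ w₁ k lo w)

    bisectTime : ℕ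
    bisectTime = detectTime + 60

    bisectStep : ∀ {o₀ p lo₀ w₁ k} → Maintains (bisectBody p) (BisectInv o₀ p lo₀ w₁) bisectTime k
    bisectStep {o₀} {p} {lo₀} {w₁} {k} {t} {μ = μ} (lo , w , verdict , refl , table , refl ,
        box lo≤ w≤ here-w here-lo elsewhere hit) =
      seqW (setsWidth p {α = α} {lo} {w}) λ { {t₁} (t₁≤ , refl , refl , refl) →
      seqW (detects (query τ α lo w′) (sized τ≤ α≤ lo≤ w′≤) verdict k table) λ
          { {t₂} {μ = μ₂} (t₂≤ , refl , table′ , refl) →
      whenW _
        (λ found → ⟪ time₁ t₁≤ t₂≤ , refl , lo , w′ , _ , refl , table′ , refl
            , box lo≤ w′≤ half-w (≤-trans (+-monoʳ-≤ (lo p) 2^k≤) here-lo)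
                (λ i≢ → proj₁ (elsewhere i≢) , trans (adjust-≢ w p h i≢) (proj₂ (elsewhere i≢))) (λ _ → found) ⟫)
        (λ none → monoW (setsCorner p {α = α} {lo} {w′} (lo≤ p) (w′≤ p)) λ { (t₃≤ , refl , refl , refl) →
            time₂ t₁≤ t₂≤ t₃≤ , refl , _ , w′ , _ , refl , table′ , refl
            , box (adjust-all {_≤ B} lo p _ lo≤
                (≤-trans (subst (λ z → lo p + z ≤ w₀) (sym half-w)
                (≤-trans (+-monoʳ-≤ (lo p) 2^k≤) here-lo)) w₀≤B))
                w′≤ half-w
                (subst (λ z → z + 2 ^ k ≤ w₀) (sym (adjust-≡ lo p _))
                  (subst (λ z → lo p + z + 2 ^ k ≤ w₀) (sym half-w)
                      (≤-trans (≤-reflexive (trans (+-assoc (lo p) (2 ^ k) (2 ^ k))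
                      (cong (λ z → lo p + z) double))) here-lo)))
                (λ i≢ → trans (adjust-≢ lo p _ i≢) (proj₁ (elsewhere i≢)) ,
                    trans (adjust-≢ w p h i≢) (proj₂ (elsewhere i≢)))
                (λ hyp → subst (λ z → Verdict (query τ α (adjust lo p (lo p + z)) w′) ≢ 0) (sym (adjust-≡ w p h))
                  (splits τ α lo w p h (sized τ≤ α≤ lo≤ w≤)
                      (trans here-w (trans (sym double) (cong₂ _+_ (sym h≡) (sym h≡)))) (hit hyp) none)) }) } }
      where
      h : ℕ
      h = w p / 2
      w′ : Fin 3 → ℕ
      w′ = adjust w p h
      double : 2 ^ k + 2 ^ k ≡ 2 ^ suc k
      double = cong (λ z → 2 ^ k + z) (sym (+-identityʳ (2 ^ k)))
      h≡ : h ≡ 2 ^ k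
      h≡ = trans (cong (_/ 2) (trans here-w (*-comm 2 (2 ^ k)))) (m*n/n≡m (2 ^ k) 2)
      half-w : w′ p ≡ 2 ^ k
      half-w = trans (adjust-≡ w p h) h≡
      2^k≤ : 2 ^ k ≤ 2 ^ suc k
      2^k≤ = ≤-trans (m≤m+n (2 ^ k) (2 ^ k)) (≤-reflexive double)
      w′≤ : ∀ i → w′ i ≤ B
      w′≤ = adjust-all {_≤ B} w p h w≤ (≤-trans (m/n≤m (w p) 2) (w≤ p))
      time₁ : ∀ {t₁ t₂} → t₁ ≤ 10 + t → t₂ ≤ detectTime + t₁ → 4 + t₂ ≤ bisectTime + t
      time₁ {t₁} {t₂} p₁ p₂ = ≤-trans (+-monoʳ-≤ 4 (≤-trans p₂ (+-monoʳ-≤ detectTime p₁)))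
        (≤-trans (≤-reflexive (arrange detectTime t)) (+-monoˡ-≤ t (+-monoʳ-≤ detectTime (≤ᵇ⇒≤ 14 60 _))))
        where
        arrange : ∀ a t → 4 + (a + (10 + t)) ≡ a + 14 + t
        arrange = solve-∀
      time₂ : ∀ {t₁ t₂ t₃} → t₁ ≤ 10 + t → t₂ ≤ detectTime + t₁ → t₃ ≤ 7 + (3 + t₂) → t₃ ≤ bisectTime + t
      time₂ {t₁} {t₂} {t₃} p₁ p₂ p₃ = ≤-trans p₃ (≤-trans (+-monoʳ-≤ 10 (≤-trans p₂ (+-monoʳ-≤ detectTime p₁)))
        (≤-trans (≤-reflexive (arrange detectTime t)) (+-monoˡ-≤ t (+-monoʳ-≤ detectTime (≤ᵇ⇒≤ 20 60 _)))))
        where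
        arrange : ∀ a t → 10 + (a + (10 + t)) ≡ a + 20 + t
        arrange = solve-∀

    bisects : ∀ p {lo w verdict t μ o} → Table μ → Box p lo w LB lo w →
      Wp (bisect p) (λ t′ v′ μ′ o′ → t′ ≤ LB * (bisectTime + 3) + 3 + t × BisectInv o p lo w 0 v′ μ′ o′)
        t (frame c (query τ α lo w) verdict) μ o
    bisects p {lo} {w} {verdict} {o = o} table b =
      forW (BisectInv o p lo w) bisectTime _ (λ _ → bisectStep) (lo , w , verdict , refl , table , refl , b)

  open Labels X using (letter; letters)

  -- What a loop with `j` iterations left still has to output.
  lastBits : ℕ → ℕ → List ℕ
  lastBits a zero    = []
  lastBits a (suc j) = bitAt (a % M) (n ∸ 1 ∸ j) ∷ lastBits a j

  lastBits-letter : ∀ a → lastBits a n ≡ List.map bit (toList (letter a))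
  lastBits-letter a = go (letter a) ≤-refl λ j → trans (cong (bitAt (a % M)) (cong (_+ toℕ j) (n∸n≡0 n)))
      (bitAt-letter W S X a j)
    where
    go : ∀ {k} (v : Vec Bool k) → k ≤ n → (∀ (j : Fin k) → bitAt (a % M) (n ∸ k + toℕ j) ≡ bit (lookup v j)) →
         lastBits a k ≡ List.map bit (toList v)
    go []      _ eq = refl
    go {suc k} (x ∷ v) k<n eq = cong₂ _∷_
      (trans (cong (bitAt (a % M)) (trans (∸-+-assoc n 1 k) (sym (+-identityʳ (n ∸ suc k))))) (eq zero))
      (go v (<⇒≤ k<n) λ j → trans (cong (bitAt (a % M)) (shift (toℕ j))) (eq (suc j)))
      where
      shift : ∀ j → n ∸ k + j ≡ n ∸ suc k + suc j
      shift j = trans (cong (_+ j) (+-∸-assoc 1 k<n)) (sym (+-suc (n ∸ suc k) j))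

  reportTime : ℕ → ℕ
  reportTime k = k * (n * (size reportBody + 3) + 23) + 5

  module _ (q : Query) (verdict : ℕ) {μ₀ : Memory} where

    BitsInv : ℕ → ℕ → List ℕ → Invariant 35
    BitsInv y e target j v μ o = v ≡ e ∷ y ∷ frame c q verdict × μ ≡ μ₀ × o ++ lastBits y j ≡ target

    bitStep : ∀ {y e target j} → j < n → Maintains reportBody (BitsInv y e target) (size reportBody) j
    bitStep {y} {e} {target} {j} j<n {o = o} (refl , refl , eq) =
      ⟪ ((_ , _) , _ , m%n<n y M , ≤-<-trans (m∸n≤m (n ∸ 1) j) (pred< j<n))
      , ≤-refl , refl , refl , refl , trans (++-assoc o _ _) eq ⟫
      where
      pred< : ∀ {n j} → j < n → n ∸ 1 < n
      pred< {suc n} _ = ≤-refl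

    VectorsInv : List ℕ → Invariant 34
    VectorsInv target k v μ o = ∃[ y ] (v ≡ y ∷ frame c q verdict × μ ≡ μ₀ × o ++ encode (letters k y) ≡ target)

    vectorStep : ∀ {target k} → Maintains reportVectors (VectorsInv target) (n * (size reportBody + 3) + 20) k
    vectorStep {target} {k} {t} {o = o} (y , refl , refl , eq) =
      seqW (forW (BitsInv y k (o ++ lastBits y n)) (size reportBody) _ bitStep (refl , refl , refl))
        λ { {o = o′} (t≤ , refl , refl , eqo) →
          ⟪ _ , ≤-trans (+-monoʳ-≤ 7 t≤) (≤-trans (≤-reflexive (arrange (n * (size reportBody + 3)) t))
                  (+-monoˡ-≤ t (+-monoʳ-≤ (n * (size reportBody + 3)) (≤ᵇ⇒≤ 10 20 _))))
              , refl , y / M , refl , refl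
              , trans (cong (_++ encode (letters k (y / M)))
                  (trans (sym (++-identityʳ o′)) (trans eqo (cong (o ++_) (lastBits-letter y)))))
                  (trans (++-assoc o _ _) (trans (cong (o ++_)
                    (sym (map-++ bit (toList (letter y))
                        (List.concatMap toList (toList (letters k (y / M))))))) eq)) ⟫ }
      where
      arrange : ∀ a t → 7 + (a + 3 + t) ≡ a + 10 + t
      arrange = solve-∀

    reports : ∀ p {t o} → Wp (report p) (λ t′ v′ μ′ o′ → t′ ≤ reportTime (length# p) + t ×
        v′ ≡ frame c q verdict × μ′ ≡ μ₀
                × o′ ≡ o ++ encode (letters (length# p) (Query.lo q p))) t (frame c q verdict) μ₀ o
    reports p {t} {o} = byPart p
      where
      goal : Fin 3 → List ℕ
      goal p = o ++ encode (letters (length# p) (Query.lo q p))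
      finish : ∀ p {t′ v′ μ′ o′} → t′ ≤ length# p * (n * (size reportBody + 3) + 20 + 3) + 3 + (2 + t) ×
          VectorsInv (goal p) 0 v′ μ′ o′ →
        t′ ≤ reportTime (length# p) + t × tail v′ ≡ frame c q verdict × μ′ ≡ μ₀ × o′ ≡ goal p
      finish p {o′ = o′} (t≤ , y , refl , refl , eq) =
        ≤-trans t≤ (≤-reflexive (arrange′ (length# p) (n * (size reportBody + 3)) t)) , refl , refl ,
            trans (sym (++-identityʳ o′)) eq
        where
        arrange′ : ∀ k a t → k * (a + 20 + 3) + 3 + (2 + t) ≡ k * (a + 23) + 5 + t
        arrange′ = solve-∀
      byPart : ∀ p → Wp (report p) (λ t′ v′ μ′ o′ → t′ ≤ reportTime (length# p) + t × v′ ≡ frame c q verdict × μ′ ≡ μ₀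
                × o′ ≡ goal p) t (frame c q verdict) μ₀ o
      byPart zero = newW _ (monoW (forW (VectorsInv (goal zero)) (n * (size reportBody + 3) + 20) _ (λ _ →
          vectorStep) (Query.lo q zero , refl , refl , refl)) (finish zero))
      byPart (suc zero) = newW _
          (monoW (forW (VectorsInv (goal (suc zero))) (n * (size reportBody + 3) + 20) _ (λ _ → vectorStep)
          (Query.lo q (suc zero) , refl , refl , refl)) (finish (suc zero)))
      byPart (suc (suc zero)) = newW _
          (monoW (forW (VectorsInv (goal (suc (suc zero)))) (n * (size reportBody + 3) + 20) _ (λ _ →
          vectorStep) (Query.lo q (suc (suc zero)) , refl , refl , refl)) (finish (suc (suc zero))))

  module Solving (count-value : ∀ q v μ → ⟦ countE ⟧ (frame c q v) μ ≡ count)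
                 (count-safe : ∀ q v μ → Safe countE (frame c q v) μ)
                 (τ₀-value : ∀ k q v μ → ⟦ τ₀E ⟧ (k ∷ frame c q v) μ ≡ τ₀)
                 (τ₀-safe : ∀ k q v μ → Safe τ₀E (k ∷ frame c q v) μ)
                 (splits : Splits) where

    -- Boxes of width 1 pin the vertices of the triangle to the corners, and these are what is
    -- reported.
    record Result (τ : ℕ) (α lo : Fin 3 → ℕ) : Set where
      constructor result
      field
        κ : ℕ
        κ<K : κ < K
        greatest : Misses (suc κ)
        τ≡ : τ ≡ Query.τ (candidateQ κ)
        α≡ : ∀ p → α p ≡ Query.α (candidateQ κ) p
        w : Fin 3 → ℕ
        w≡1 : ∀ p → w p ≡ 1
        found : Verdict (query τ α lo w) ≢ 0

    solveTime : ℕ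
    solveTime = K * (detectTime + (cost τ₀E + 90) + 3) + (cost countE + 20) + 3 * (LB * (detectTime + 60 + 3) + 3)
      + (reportTime k₀ + reportTime k₁ + reportTime k₂)

    solves : ∀ {t μ o} → Table μ →
      Wp (solve countE τ₀E) (λ t′ v′ μ′ o′ → t′ ≤ solveTime + t
          × (∃[ τ ] ∃[ α ] ∃[ lo ] (o′ ≡ ((o ++ encode (letters k₀ (lo zero))) ++ encode (letters k₁ (lo (suc zero))))
                  ++ encode (letters k₂ (lo (suc (suc zero))))
              × (Misses 0 ⊎ Result τ α lo))))
        t (frame c (query 0 (triple 0 0 0) (triple 0 0 0) (triple w₀ w₀ w₀)) 0) μ o
    solves {t} {μ} {o} table =
      seqW (searches count-value count-safe τ₀-value τ₀-safe table)
        λ { {t₁} (t₁≤ , τ , α , verdict , refl , table₁ , refl , q-sized , outcome) → after t₁≤ table₁ q-sized outcome }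
      where
      bisection : ℕ
      bisection = LB * (detectTime + 60 + 3) + 3
      Q : Post 33
      Q t′ v′ μ′ o′ = t′ ≤ solveTime + t
          × (∃[ τ ] ∃[ α ] ∃[ lo ] (o′ ≡ ((o ++ encode (letters k₀ (lo zero))) ++ encode (letters k₁ (lo (suc zero))))
                  ++ encode (letters k₂ (lo (suc (suc zero))))
              × (Misses 0 ⊎ Result τ α lo)))
      after : ∀ {t₁ τ α verdict μ₁} → t₁ ≤ K * (detectTime + (cost τ₀E + 90) + 3) + (cost countE + 20) + t → Table μ₁ →
        Sized (query τ α (triple 0 0 0) (triple w₀ w₀ w₀)) →
        (verdict ≡ 0 × Misses 0) ⊎ (verdict ≢ 0 ×
            (∃[ κ ] (Hits κ × query τ α (triple 0 0 0) (triple w₀ w₀ w₀) ≡ candidateQ κ))) →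
        Wp (bisect zero ⍮ bisect (suc zero) ⍮ bisect (suc (suc zero)) ⍮ report zero ⍮ report
            (suc zero) ⍮ report (suc (suc zero)))
          Q t₁ (frame c (query τ α (triple 0 0 0) (triple w₀ w₀ w₀)) verdict) μ₁ o
      after {t₁} {τ} {α} {verdict} t₁≤ table₁ (sized τ≤ α≤ lo≤ w≤) outcome =
        seqW (bisects zero table₁ (box lo≤ w≤ w₀≡ (≤-reflexive (sym w₀≡)) (λ _ → refl , refl) hit₀))
          λ { (t₂≤ , lo₂ , w₂ , _ , refl , table₂ , refl , box lo₂≤ w₂≤ w₂≡ _ elsewhere₂ hit₂) →
        seqW (bisects (suc zero) table₂ (box lo₂≤ w₂≤ (trans (proj₂ (elsewhere₂ {suc zero} λ ())) w₀≡)
            (subst (λ z → z + 2 ^ LB ≤ w₀) (sym (proj₁ (elsewhere₂ {suc zero} λ ())))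
                (≤-reflexive (sym w₀≡))) (λ _ → refl , refl) hit₂))
          λ { (t₃≤ , lo₃ , w₃ , _ , refl , table₃ , refl , box lo₃≤ w₃≤ w₃≡ _ elsewhere₃ hit₃) →
        seqW (bisects (suc (suc zero)) table₃ (box lo₃≤ w₃≤
            (trans (proj₂ (elsewhere₃ {suc (suc zero)} λ ())) (trans (proj₂ (elsewhere₂ {suc (suc zero)} λ ())) w₀≡))
            (subst (λ z → z + 2 ^ LB ≤ w₀)
                (sym (trans (proj₁ (elsewhere₃ {suc (suc zero)} λ ()))
                (proj₁ (elsewhere₂ {suc (suc zero)} λ ()))))
              (≤-reflexive (sym w₀≡))) (λ _ → refl , refl) hit₃))
          λ { (t₄≤ , lo₄ , w₄ , verdict₄ , refl , table₄ , refl , box _ _ w₄≡ _ elsewhere₄ hit₄) →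
        seqW (reports (query τ α lo₄ w₄) verdict₄ zero) λ { (t₅≤ , refl , refl , refl) →
        seqW (reports (query τ α lo₄ w₄) verdict₄ (suc zero)) λ { (t₆≤ , refl , refl , refl) →
        monoW (reports (query τ α lo₄ w₄) verdict₄ (suc (suc zero))) λ { (t₇≤ , refl , refl , refl) →
          total t₂≤ t₃≤ t₄≤ t₅≤ t₆≤ t₇≤ , τ , α , lo₄ , refl
          , conclude outcome w₄ hit₄
              (λ { zero → trans (proj₂ (elsewhere₄ {zero} λ ())) (trans (proj₂ (elsewhere₃ {zero} λ ())) w₂≡)
                 ; (suc zero) → trans (proj₂ (elsewhere₄ {suc zero} λ ())) w₃≡
                 ; (suc (suc zero)) → w₄≡ }) } } } } } }
        where
        open Bisection splits (verdict ≢ 0) τ α τ≤ α≤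
        hit₀ : verdict ≢ 0 → Verdict (query τ α (triple 0 0 0) (triple w₀ w₀ w₀)) ≢ 0
        hit₀ found = case outcome of λ
          { (inj₁ (none , _)) → contradiction none found
          ; (inj₂ (_ , κ , h , eq)) → subst (λ q → Verdict q ≢ 0) (sym eq) (Hits.positive h) }
        conclude : (verdict ≡ 0 × Misses 0) ⊎ (verdict ≢ 0 ×
            (∃[ κ ] (Hits κ × query τ α (triple 0 0 0) (triple w₀ w₀ w₀) ≡ candidateQ κ))) →
          ∀ {lo} w → (verdict ≢ 0 → Verdict (query τ α lo w) ≢ 0) → (∀ p → w p ≡ 1) → Misses 0 ⊎ Result τ α lo
        conclude (inj₁ (_ , misses)) w hit w≡1 = inj₁ misses
        conclude (inj₂ (found , κ , hits κ<K _ greatest , eq)) w hit w≡1 =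
          inj₂ (result κ κ<K greatest (cong Query.τ eq) (λ p → cong (λ q → Query.α q p) eq) w w≡1 (hit found))
        total : ∀ {t₂ t₃ t₄ t₅ t₆ t₇} → t₂ ≤ bisection + t₁ → t₃ ≤ bisection + t₂ → t₄ ≤ bisection + t₃ →
            t₅ ≤ reportTime k₀ + t₄ →
          t₆ ≤ reportTime k₁ + t₅ → t₇ ≤ reportTime k₂ + t₆ → t₇ ≤ solveTime + t
        total p₂ p₃ p₄ p₅ p₆ p₇ = ≤-trans p₇ (≤-trans (+-monoʳ-≤ (reportTime k₂) (≤-trans p₆ (+-monoʳ-≤ (reportTime k₁)
          (≤-trans p₅ (+-monoʳ-≤ (reportTime k₀) (≤-trans p₄ (+-monoʳ-≤ bisection (≤-trans p₃ (+-monoʳ-≤ bisection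
            (≤-trans p₂ (+-monoʳ-≤ bisection t₁≤)))))))))))
          (≤-reflexive (arrange (K * (detectTime + (cost τ₀E + 90) + 3) + (cost countE + 20)) bisection
              (reportTime k₀) (reportTime k₁) (reportTime k₂) t)))
          where
          arrange : ∀ a b c d e t → e + (d + (c + (b + (b + (b + (a + t)))))) ≡ a + 3 * b + (c + d + e) + t
          arrange = solve-∀

-- The trace of a product of three matrices

sumℤ : ℕ → (ℕ → ℤ) → ℤ
sumℤ zero    f = ℤ.0ℤ
sumℤ (suc k) f = f k ℤ.+ sumℤ k f

sumℤ-cong : ∀ k {f g} → (∀ {i} → i < k → f i ≡ g i) → sumℤ k f ≡ sumℤ k g
sumℤ-cong zero    eq = refl
sumℤ-cong (suc k) eq = cong₂ ℤ._+_ (eq ≤-refl) (sumℤ-cong k (λ i<k → eq (m≤n⇒m≤1+n i<k)))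

sumℤ-zero : ∀ k → sumℤ k (λ _ → ℤ.0ℤ) ≡ ℤ.0ℤ
sumℤ-zero zero    = refl
sumℤ-zero (suc k) = trans (ℤ.+-identityˡ _) (sumℤ-zero k)

sumℤ-+ : ∀ k f g → sumℤ k (λ i → f i ℤ.+ g i) ≡ sumℤ k f ℤ.+ sumℤ k g
sumℤ-+ zero    f g = refl
sumℤ-+ (suc k) f g = trans (cong (λ z → f k ℤ.+ g k ℤ.+ z) (sumℤ-+ k f g))
    (interchange (f k) (g k) (sumℤ k f) (sumℤ k g))
  where
  interchange : ∀ a b c d → (a ℤ.+ b) ℤ.+ (c ℤ.+ d) ≡ (a ℤ.+ c) ℤ.+ (b ℤ.+ d)
  interchange = ℤSolver.solve-∀

sumℤ-swap : ∀ k l (F : ℕ → ℕ → ℤ) → sumℤ k (λ i → sumℤ l (F i)) ≡ sumℤ l (λ j → sumℤ k (λ i → F i j))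
sumℤ-swap zero    l F = sym (sumℤ-zero l)
sumℤ-swap (suc k) l F = trans (cong (λ z → sumℤ l (F k) ℤ.+ z) (sumℤ-swap k l F))
  (sym (sumℤ-+ l (F k) (λ j → sumℤ k (λ i → F i j))))

sumℤ-*ˡ : ∀ k c f → c ℤ.* sumℤ k f ≡ sumℤ k (λ i → c ℤ.* f i)
sumℤ-*ˡ zero    c f = ℤ.*-zeroʳ c
sumℤ-*ˡ (suc k) c f = trans (ℤ.*-distribˡ-+ c (f k) (sumℤ k f)) (cong (λ z → c ℤ.* f k ℤ.+ z) (sumℤ-*ˡ k c f))

sumℤ-*ʳ : ∀ k c f → sumℤ k f ℤ.* c ≡ sumℤ k (λ i → f i ℤ.* c)
sumℤ-*ʳ k c f = trans (ℤ.*-comm (sumℤ k f) c) (trans (sumℤ-*ˡ k c f) (sumℤ-cong k λ _ → ℤ.*-comm c _))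

sumℤ-pos : ∀ k f → sumℤ k (λ i → + f i) ≡ + sumBelow k f
sumℤ-pos zero    f = refl
sumℤ-pos (suc k) f = cong (λ z → + f k ℤ.+ z) (sumℤ-pos k f)

module TrilinearForm (E R : ℕ) where

  Coefficients : Set
  Coefficients = ℕ → ℕ → ℤ

  -- The lowest base E digit comprises the last digits of row and column, so fixing it selects a
  -- submatrix whose indices are the remaining digits.
  block : {A : Set} → (ℕ → A) → ℕ → ℕ → A
  block A e x = A (x * E + e)

  mix : Coefficients → ℕ → (ℕ → ℤ) → ℕ → ℤ
  mix u r A x = sumℤ E (λ e → u r e ℤ.* block A e x)

  -- The h-th tensor power of a bilinear algorithm with R products, written symmetrically as a
  -- trilinear form with coefficient families `u`, `v` and `w`.
  form : (u v w : Coefficients) → ℕ → (A B C : ℕ → ℤ) → ℤ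
  form u v w zero    A B C = A 0 ℤ.* B 0 ℤ.* C 0
  form u v w (suc h) A B C = sumℤ R (λ r → form u v w h (mix u r A) (mix v r B) (mix w r C))

  -- By cyclic symmetry, linearity has to be proved in the first argument only.
  form-rotate : ∀ u v w h A B C → form u v w h A B C ≡ form v w u h B C A
  form-rotate u v w zero A B C = rotate (A 0) (B 0) (C 0)
    where
    rotate : ∀ a b c → a ℤ.* b ℤ.* c ≡ b ℤ.* c ℤ.* a
    rotate = ℤSolver.solve-∀
  form-rotate u v w (suc h) A B C = sumℤ-cong R λ {r} _ → form-rotate u v w h (mix u r A) (mix v r B) (mix w r C)

  form-cong : ∀ u v w h {A A′} B C → (∀ x → A x ≡ A′ x) → form u v w h A B C ≡ form u v w h A′ B C
  form-cong u v w zero    B C eq = cong (λ z → z ℤ.* B 0 ℤ.* C 0) (eq 0)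
  form-cong u v w (suc h) B C eq = sumℤ-cong R λ {r} _ → form-cong u v w h (mix v r B) (mix w r C)
    λ x → sumℤ-cong E λ {e} _ → cong (u r e ℤ.*_) (eq (x * E + e))

  form-linear : ∀ u v w h k (c : ℕ → ℤ) (A : ℕ → ℕ → ℤ) B C →
    form u v w h (λ x → sumℤ k (λ i → c i ℤ.* A i x)) B C ≡ sumℤ k (λ i → c i ℤ.* form u v w h (A i) B C)
  form-linear u v w zero k c A B C = begin
    sumℤ k (λ i → c i ℤ.* A i 0) ℤ.* B 0 ℤ.* C 0     ≡⟨ ℤ.*-assoc (sumℤ k (λ i → c i ℤ.* A i 0)) (B 0) (C 0) ⟩
    sumℤ k (λ i → c i ℤ.* A i 0) ℤ.* (B 0 ℤ.* C 0)   ≡⟨ sumℤ-*ʳ k (B 0 ℤ.* C 0) (λ i → c i ℤ.* A i 0) ⟩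
    sumℤ k (λ i → c i ℤ.* A i 0 ℤ.* (B 0 ℤ.* C 0))   ≡⟨ sumℤ-cong k (λ {i} _ → regroup (c i) (A i 0) (B 0) (C 0)) ⟩
    sumℤ k (λ i → c i ℤ.* (A i 0 ℤ.* B 0 ℤ.* C 0))   ∎
    where
    open ≡-Reasoning
    regroup : ∀ a b c d → a ℤ.* b ℤ.* (c ℤ.* d) ≡ a ℤ.* (b ℤ.* c ℤ.* d)
    regroup = ℤSolver.solve-∀
  form-linear u v w (suc h) k c A B C = begin
    sumℤ R (λ r → form u v w h (mix u r (λ x → sumℤ k (λ i → c i ℤ.* A i x))) (mix v r B) (mix w r C))
      ≡⟨ sumℤ-cong R (λ {r} _ → form-cong u v w h (mix v r B) (mix w r C) (mix-sum r)) ⟩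
    sumℤ R (λ r → form u v w h (λ x → sumℤ k (λ i → c i ℤ.* mix u r (A i) x)) (mix v r B) (mix w r C))
      ≡⟨ sumℤ-cong R (λ {r} _ → form-linear u v w h k c (λ i → mix u r (A i)) (mix v r B) (mix w r C)) ⟩
    sumℤ R (λ r → sumℤ k (λ i → c i ℤ.* form u v w h (mix u r (A i)) (mix v r B) (mix w r C)))
      ≡⟨ sumℤ-swap R k _ ⟩
    sumℤ k (λ i → sumℤ R (λ r → c i ℤ.* form u v w h (mix u r (A i)) (mix v r B) (mix w r C)))
      ≡⟨ sumℤ-cong k (λ {i} _ → sym (sumℤ-*ˡ R (c i) _)) ⟩
    sumℤ k (λ i → c i ℤ.* form u v w (suc h) (A i) B C) ∎
    where
    open ≡-Reasoning
    exchange : ∀ a b c → a ℤ.* (b ℤ.* c) ≡ b ℤ.* (a ℤ.* c)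
    exchange = ℤSolver.solve-∀
    mix-sum : ∀ r x → mix u r (λ x → sumℤ k (λ i → c i ℤ.* A i x)) x ≡ sumℤ k (λ i → c i ℤ.* mix u r (A i) x)
    mix-sum r x = begin
      sumℤ E (λ e → u r e ℤ.* sumℤ k (λ i → c i ℤ.* A i (x * E + e)))
        ≡⟨ sumℤ-cong E (λ {e} _ → sumℤ-*ˡ k (u r e) _) ⟩
      sumℤ E (λ e → sumℤ k (λ i → u r e ℤ.* (c i ℤ.* A i (x * E + e))))
        ≡⟨ sumℤ-swap E k _ ⟩
      sumℤ k (λ i → sumℤ E (λ e → u r e ℤ.* (c i ℤ.* A i (x * E + e))))
        ≡⟨ sumℤ-cong k (λ {i} _ → sumℤ-cong E (λ {e} _ → exchange (u r e) (c i) (A i (x * E + e)))) ⟩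
      sumℤ k (λ i → sumℤ E (λ e → c i ℤ.* (u r e ℤ.* A i (x * E + e))))
        ≡⟨ sumℤ-cong k (λ {i} _ → sym (sumℤ-*ˡ E (c i) _)) ⟩
      sumℤ k (λ i → c i ℤ.* mix u r (A i) x) ∎

  form-mix : ∀ u v w h r A B C →
    form u v w h (mix u r A) B C ≡ sumℤ E (λ e → u r e ℤ.* form u v w h (block A e) B C)
  form-mix u v w h r A B C = form-linear u v w h E (u r) (block A) B C

  module _ (u v w : Coefficients) (D : ℕ) (δ : ℕ → ℕ → ℕ → ℕ)
    (identity : ∀ {e f g} → e < E → f < E → g < E → sumℤ R (λ r → u r e ℤ.* v r f ℤ.* w r g) ≡ + (D * δ e f g)) where

    -- For the structure constants of matrix multiplication this is the trace of a product,
    -- evaluated blockwise. All terms are natural numbers, so nothing cancels and a non-zero value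
    -- exhibits a triangle.
    count : ℕ → (a b c : ℕ → ℕ) → ℕ
    count zero    a b c = a 0 * b 0 * c 0
    count (suc h) a b c = sumBelow E λ e → sumBelow E λ f → sumBelow E λ g →
      δ e f g * count h (block a e) (block b f) (block c g)

    -- Multilinearity pulls all coefficients out of the three mixtures; the sum over `r` then meets
    -- exactly the products that `identity` evaluates.
    expand : ∀ h A B C → form u v w (suc h) A B C ≡
      sumℤ E λ e → sumℤ E λ f → sumℤ E λ g → + (D * δ e f g) ℤ.* form u v w h (block A e) (block B f) (block C g)
    expand h A B C = begin
      sumℤ R (λ r → form u v w h (mix u r A) (mix v r B) (mix w r C))
        ≡⟨ sumℤ-cong R (λ {r} _ → all-mixed r) ⟩
      sumℤ R (λ r → sumℤ E λ e → sumℤ E λ f → sumℤ E λ g → u r e ℤ.* v r f ℤ.* w r g ℤ.* F e f g)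
        ≡⟨ sumℤ-swap R E _ ⟩
      sumℤ E (λ e → sumℤ R λ r → sumℤ E λ f → sumℤ E λ g → u r e ℤ.* v r f ℤ.* w r g ℤ.* F e f g)
        ≡⟨ sumℤ-cong E (λ _ → sumℤ-swap R E _) ⟩
      sumℤ E (λ e → sumℤ E λ f → sumℤ R λ r → sumℤ E λ g → u r e ℤ.* v r f ℤ.* w r g ℤ.* F e f g)
        ≡⟨ sumℤ-cong E (λ _ → sumℤ-cong E λ _ → sumℤ-swap R E _) ⟩
      sumℤ E (λ e → sumℤ E λ f → sumℤ E λ g → sumℤ R λ r → u r e ℤ.* v r f ℤ.* w r g ℤ.* F e f g)
        ≡⟨ sumℤ-cong E (λ {e} e< → sumℤ-cong E λ {f} f< → sumℤ-cong E λ {g} g< →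
             trans (sym (sumℤ-*ʳ R (F e f g) (λ r → u r e ℤ.* v r f ℤ.* w r g)))
                 (cong (ℤ._* F e f g) (identity e< f< g<))) ⟩
      sumℤ E (λ e → sumℤ E λ f → sumℤ E λ g → + (D * δ e f g) ℤ.* F e f g) ∎
      where
      open ≡-Reasoning
      F : ℕ → ℕ → ℕ → ℤ
      F e f g = form u v w h (block A e) (block B f) (block C g)
      second : ∀ r A → form u v w h A (mix v r B) (mix w r C) ≡ sumℤ E λ f →
          v r f ℤ.* form u v w h A (block B f) (mix w r C)
      second r A = trans (form-rotate u v w h A (mix v r B) (mix w r C)) (trans (form-mix v w u h r B (mix w r C) A)
        (sumℤ-cong E λ {f} _ → cong (v r f ℤ.*_) (sym (form-rotate u v w h A (block B f) (mix w r C)))))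
      third : ∀ r A B → form u v w h A B (mix w r C) ≡ sumℤ E λ g → w r g ℤ.* form u v w h A B (block C g)
      third r A B = trans (sym (form-rotate w u v h (mix w r C) A B)) (trans (form-mix w u v h r C A B)
        (sumℤ-cong E λ {g} _ → cong (w r g ℤ.*_) (form-rotate w u v h (block C g) A B)))
      all-mixed : ∀ r → form u v w h (mix u r A) (mix v r B) (mix w r C)
        ≡ sumℤ E λ e → sumℤ E λ f → sumℤ E λ g → u r e ℤ.* v r f ℤ.* w r g ℤ.* F e f g
      all-mixed r = trans (form-mix u v w h r A (mix v r B) (mix w r C)) (sumℤ-cong E λ {e} _ →
        trans (cong (u r e ℤ.*_) (second r (block A e))) (trans (sumℤ-*ˡ E (u r e) _) (sumℤ-cong E λ {f} _ →
          trans (cong (λ z → u r e ℤ.* (v r f ℤ.* z)) (third r (block A e) (block B f)))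
            (trans (cong (u r e ℤ.*_) (sumℤ-*ˡ E (v r f) _)) (trans (sumℤ-*ˡ E (u r e) _)
              (sumℤ-cong E λ {g} _ → regroup (u r e) (v r f) (w r g) (F e f g)))))))
        where
        regroup : ∀ a b c d → a ℤ.* (b ℤ.* (c ℤ.* d)) ≡ a ℤ.* b ℤ.* c ℤ.* d
        regroup = ℤSolver.solve-∀

    form-count : ∀ h a b c → form u v w h (+_ ∘ a) (+_ ∘ b) (+_ ∘ c) ≡ + (D ^ h * count h a b c)
    form-count zero    a b c = trans (sym (trans (ℤ.pos-* (a 0 * b 0) (c 0)) (cong (ℤ._* + c 0) (ℤ.pos-* (a 0) (b 0)))))
      (cong +_ (sym (+-identityʳ _)))
    form-count (suc h) a b c = begin
      form u v w (suc h) (+_ ∘ a) (+_ ∘ b) (+_ ∘ c) ≡⟨ expand h (+_ ∘ a) (+_ ∘ b) (+_ ∘ c) ⟩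
      (sumℤ E λ e → sumℤ E λ f → sumℤ E λ g → + (D * δ e f g) ℤ.* form u v w h (+_ ∘ block a e)
          (+_ ∘ block b f) (+_ ∘ block c g))
        ≡⟨ sumℤ-cong E (λ {e} _ → sumℤ-cong E λ {f} _ → sumℤ-cong E λ {g} _ → summand e f g) ⟩
      (sumℤ E λ e → sumℤ E λ f → sumℤ E λ g → + (D * D ^ h) ℤ.* + (δ e f g * F e f g))
        ≡⟨ sumℤ-cong E (λ {e} _ → sumℤ-cong E λ {f} _ → sym (sumℤ-*ˡ E (+ (D * D ^ h)) _)) ⟩
      (sumℤ E λ e → sumℤ E λ f → + (D * D ^ h) ℤ.* sumℤ E λ g → + (δ e f g * F e f g))
        ≡⟨ sumℤ-cong E (λ {e} _ → sym (sumℤ-*ˡ E (+ (D * D ^ h)) _)) ⟩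
      (sumℤ E λ e → + (D * D ^ h) ℤ.* sumℤ E λ f → sumℤ E λ g → + (δ e f g * F e f g))
        ≡⟨ sym (sumℤ-*ˡ E (+ (D * D ^ h)) _) ⟩
      + (D * D ^ h) ℤ.* (sumℤ E λ e → sumℤ E λ f → sumℤ E λ g → + (δ e f g * F e f g))
        ≡⟨ cong (+ (D * D ^ h) ℤ.*_)
            (trans (sumℤ-cong E λ {e} _ → trans (sumℤ-cong E λ {f} _ → sumℤ-pos E _) (sumℤ-pos E _))
            (sumℤ-pos E _)) ⟩
      + (D * D ^ h) ℤ.* + count (suc h) a b c ≡⟨ sym (ℤ.pos-* (D * D ^ h) _) ⟩
      + (D ^ suc h * count (suc h) a b c) ∎
      where
      open ≡-Reasoning
      F : ℕ → ℕ → ℕ → ℕ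
      F e f g = count h (block a e) (block b f) (block c g)
      regroup : ∀ d x p y → d * x * (p * y) ≡ d * p * (x * y)
      regroup = solve-∀
      summand : ∀ e f g → + (D * δ e f g) ℤ.* form u v w h (+_ ∘ block a e) (+_ ∘ block b f) (+_ ∘ block c g)
        ≡ + (D * D ^ h) ℤ.* + (δ e f g * F e f g)
      summand e f g = trans (cong (+ (D * δ e f g) ℤ.*_) (form-count h (block a e) (block b f) (block c g)))
        (trans (sym (ℤ.pos-* (D * δ e f g) (D ^ h * F e f g))) (trans (cong +_ (regroup D (δ e f g) (D ^ h) (F e f g)))
          (ℤ.pos-* (D * D ^ h) (δ e f g * F e f g))))

-- Congruence of integers

module Congruence (m′ : ℕ) where
  private
    m = suc m′

  infix 4 _≈_
  -- With an explicit multiplier, each closure property is a single ring identity.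
  record _≈_ (a b : ℤ) : Set where
    constructor congruent
    field
      k : ℤ
      difference : a ≡ b ℤ.+ k ℤ.* + m

  ≈-refl : ∀ {a} → a ≈ a
  ≈-refl {a} = congruent ℤ.0ℤ (sym (trans (cong (λ z → a ℤ.+ z) (ℤ.*-zeroˡ (+ m))) (ℤ.+-identityʳ a)))

  ≈-trans : ∀ {a b c} → a ≈ b → b ≈ c → a ≈ c
  ≈-trans {c = c} (congruent k refl) (congruent l refl) = congruent (l ℤ.+ k) (regroup c l k (+ m))
    where
    regroup : ∀ c l k m → c ℤ.+ l ℤ.* m ℤ.+ k ℤ.* m ≡ c ℤ.+ (l ℤ.+ k) ℤ.* m
    regroup = ℤSolver.solve-∀

  ≈-+ : ∀ {a b c d} → a ≈ b → c ≈ d → a ℤ.+ c ≈ b ℤ.+ d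
  ≈-+ {b = b} {d = d} (congruent k refl) (congruent l refl) = congruent (k ℤ.+ l) (regroup b d k l (+ m))
    where
    regroup : ∀ b d k l m → b ℤ.+ k ℤ.* m ℤ.+ (d ℤ.+ l ℤ.* m) ≡ b ℤ.+ d ℤ.+ (k ℤ.+ l) ℤ.* m
    regroup = ℤSolver.solve-∀

  ≈-* : ∀ {a b c d} → a ≈ b → c ≈ d → a ℤ.* c ≈ b ℤ.* d
  ≈-* {b = b} {d = d} (congruent k refl) (congruent l refl) =
    congruent (b ℤ.* l ℤ.+ k ℤ.* d ℤ.+ k ℤ.* l ℤ.* + m) (regroup b d k l (+ m))
    where
    regroup : ∀ b d k l m → (b ℤ.+ k ℤ.* m) ℤ.* (d ℤ.+ l ℤ.* m) ≡ b ℤ.* d ℤ.+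
        (b ℤ.* l ℤ.+ k ℤ.* d ℤ.+ k ℤ.* l ℤ.* m) ℤ.* m
    regroup = ℤSolver.solve-∀

  ≈-sum : ∀ k {f : ℕ → ℕ} {g : ℕ → ℤ} → (∀ {i} → i < k → + f i ≈ g i) → + sumBelow k f ≈ sumℤ k g
  ≈-sum zero    eq = ≈-refl
  ≈-sum (suc k) eq = ≈-+ (eq ≤-refl) (≈-sum k (λ i<k → eq (m≤n⇒m≤1+n i<k)))

  ≈-% : ∀ x → + (x % m) ≈ + x
  ≈-% x = congruent (ℤ.- + (x / m)) (trans (regroup (+ (x % m)) (+ (x / m)) (+ m))
    (cong (λ z → z ℤ.+ ℤ.- + (x / m) ℤ.* + m)
      (trans (cong (λ z → + (x % m) ℤ.+ z) (sym (ℤ.pos-* (x / m) m))) (cong +_ (sym (m≡m%n+[m/n]*n x m))))))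
    where
    regroup : ∀ a b m → a ≡ a ℤ.+ b ℤ.* m ℤ.+ ℤ.- b ℤ.* m
    regroup = ℤSolver.solve-∀

  -- Depending on the sign of the multiplier, the multiple of m is added to one side or to the
  -- other, which leaves an equation between natural numbers.
  ≈⇒% : ∀ {x y} → + x ≈ + y → x % m ≡ y % m
  ≈⇒% {x} {y} (congruent (+ k) eq) = trans
      (cong (_% m) (ℤ.+-injective (trans eq (cong (λ z → + y ℤ.+ z) (sym (ℤ.pos-* k m))))))
    ([m+kn]%n≡m%n y k m)
  ≈⇒% {x} {y} (congruent -[1+ k ] eq) = sym (trans (cong (_% m) (ℤ.+-injective (sym y≡))) ([m+kn]%n≡m%n x (suc k) m))
    where
    regroup : ∀ y k m → y ℤ.+ ℤ.- k ℤ.* m ℤ.+ k ℤ.* m ≡ y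
    regroup = ℤSolver.solve-∀
    y≡ : + (x + suc k * m) ≡ + y
    y≡ = trans (cong₂ ℤ._+_ eq (ℤ.pos-* (suc k) m)) (regroup (+ y) (+ suc k) (+ m))

-- Non-zero traces and triangles

sumBelow-witness : ∀ k f → sumBelow k f ≢ 0 → ∃[ i ] (i < k × f i ≢ 0)
sumBelow-witness zero    f ≢0 = contradiction refl ≢0
sumBelow-witness (suc k) f ≢0 with f k ≟ 0
... | no fk≢0  = k , ≤-refl , fk≢0
... | yes fk≡0 with i , i<k , fi≢0 ← sumBelow-witness k f (λ eq → ≢0 (cong₂ _+_ fk≡0 eq)) = i , m≤n⇒m≤1+n i<k , fi≢0

sumBelow-≢0 : ∀ k f {i} → i < k → f i ≢ 0 → sumBelow k f ≢ 0
sumBelow-≢0 (suc k) f {i} i<k fi≢0 eq with i ≟ k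
... | yes refl = fi≢0 (m+n≡0⇒m≡0 (f k) eq)
... | no i≢k   = sumBelow-≢0 k f (≤∧≢⇒< (≤-pred i<k) i≢k) fi≢0 (m+n≡0⇒n≡0 (f k) eq)

sumBelow-≤ : ∀ k f b → (∀ i → f i ≤ b) → sumBelow k f ≤ k * b
sumBelow-≤ zero    f b f≤ = z≤n
sumBelow-≤ (suc k) f b f≤ = +-mono-≤ (f≤ k) (sumBelow-≤ k f b f≤)

*-≢0 : ∀ {a b} → a ≢ 0 → b ≢ 0 → a * b ≢ 0
*-≢0 {a} a≢0 b≢0 eq with m*n≡0⇒m≡0∨n≡0 a eq
... | inj₁ a≡0 = a≢0 a≡0
... | inj₂ b≡0 = b≢0 b≡0

*-≢0ˡ : ∀ {a b} → a * b ≢ 0 → a ≢ 0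
*-≢0ˡ ab≢0 refl = ab≢0 refl

*-≢0ʳ : ∀ {a b} → a * b ≢ 0 → b ≢ 0
*-≢0ʳ {a} ab≢0 refl = ab≢0 (*-zeroʳ a)

agrees : ℕ → ℕ → ℕ
agrees x y = if x ≡ᵇ y then 1 else 0

agrees-≢0 : ∀ {x y} → agrees x y ≢ 0 → x ≡ y
agrees-≢0 {zero}  {zero}  _  = refl
agrees-≢0 {zero}  {suc y} ne = contradiction refl ne
agrees-≢0 {suc x} {zero}  ne = contradiction refl ne
agrees-≢0 {suc x} {suc y} ne = cong suc (agrees-≢0 ne)

agrees-refl : ∀ {x y} → x ≡ y → agrees x y ≢ 0
agrees-refl {zero}  refl = λ ()
agrees-refl {suc x} refl = agrees-refl {x} refl

agrees≤1 : ∀ x y → agrees x y ≤ 1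
agrees≤1 zero    zero    = ≤-refl
agrees≤1 zero    (suc y) = z≤n
agrees≤1 (suc x) zero    = z≤n
agrees≤1 (suc x) (suc y) = agrees≤1 x y

-- The structure constants of the trace of a product of three β × β matrices.
linked : (β : ℕ) .{{_ : NonZero β}} → ℕ → ℕ → ℕ → ℕ
linked β e f g = agrees (e % β) (f / β) * agrees (f % β) (g / β) * agrees (g % β) (e / β)

module Counting (β′ E′ R : ℕ) (E≡ : suc E′ ≡ suc β′ * suc β′) where
  private
    β = suc β′
    E = suc E′
  open Indexing β′ E′ using (row; col)
  open TrilinearForm E R using (block)

  lengthOf : ℕ → ℕ
  lengthOf zero    = 1
  lengthOf (suc h) = lengthOf h * E

  Chain : ℕ → (x y z : ℕ) → Set
  Chain h x y z = col h x ≡ row h y × col h y ≡ row h z × col h z ≡ row h x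

  record Closed (h : ℕ) (a b c : ℕ → ℕ) : Set where
    constructor closed
    field
      {x y z} : ℕ
      x< : x < lengthOf h
      y< : y < lengthOf h
      z< : z < lengthOf h
      ax : a x ≢ 0
      by : b y ≢ 0
      cz : c z ≢ 0
      chain : Chain h x y z

  private
    extend< : ∀ {h x e} → x < lengthOf h → e < E → x * E + e < lengthOf (suc h)
    extend< {h} {x} {e} x< e< = begin-strict
      x * E + e          <⟨ +-monoʳ-< (x * E) e< ⟩
      x * E + E          ≡⟨ +-comm (x * E) E ⟩
      suc x * E          ≤⟨ *-monoˡ-≤ E x< ⟩
      lengthOf h * E     ∎
      where open ≤-Reasoning

    last-digit : ∀ x {e} → e < E → (x * E + e) % E ≡ e
    last-digit x {e} e< = trans (cong (_% E) (+-comm (x * E) e)) (trans ([m+kn]%n≡m%n e x E) (m<n⇒m%n≡m e<))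

    other-digits : ∀ x {e} → e < E → (x * E + e) / E ≡ x
    other-digits x {e} e< = trans (+-distrib-/-∣ˡ e (divides-refl x))
      (trans (cong₂ _+_ (m*n/n≡m x E) (m<n⇒m/n≡0 e<)) (+-identityʳ x))

    row-extend : ∀ h x {e} → e < E → row (suc h) (x * E + e) ≡ e / β + β * row h x
    row-extend h x e< = cong₂ (λ a b → a / β + β * row h b) (last-digit x e<) (other-digits x e<)

    col-extend : ∀ h x {e} → e < E → col (suc h) (x * E + e) ≡ e % β + β * col h x
    col-extend h x e< = cong₂ (λ a b → a % β + β * col h b) (last-digit x e<) (other-digits x e<)

    digits-injective : ∀ {a a′ b b′} → a < β → a′ < β → a + β * b ≡ a′ + β * b′ → a ≡ a′ × b ≡ b′
    digits-injective {a} {a′} {b} {b′} a< a′< eq = a≡ ,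
        *-cancelˡ-≡ b b′ β (+-cancelˡ-≡ a (β * b) (β * b′) (trans eq (cong (_+ β * b′) (sym a≡))))
      where
      low-digit : ∀ a b → a < β → (a + β * b) % β ≡ a
      low-digit a b a< = trans (cong (λ z → (a + z) % β) (*-comm β b)) (trans ([m+kn]%n≡m%n a b β) (m<n⇒m%n≡m a<))
      a≡ : a ≡ a′
      a≡ = trans (sym (low-digit a b a<)) (trans (cong (_% β) eq) (low-digit a′ b′ a′<))

    quot< : ∀ {e} → e < E → e / β < β
    quot< {e} e< = m<n*o⇒m/o<n {e} {β} {β} (subst (e <_) E≡ e<)

  module _ (u v w : ℕ → ℕ → ℤ) (D : ℕ)
    (identity : ∀ {e f g} → e < E → f < E → g < E → sumℤ R (λ r → u r e ℤ.* v r f ℤ.* w r g) ≡ + (D * linked β e f g)) where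

    open TrilinearForm E R using (count)

    cnt : ℕ → (a b c : ℕ → ℕ) → ℕ
    cnt = count u v w D (linked β) identity

    -- A non-zero sum of natural numbers has a non-zero summand. The digits found on each level
    -- extend the indices of the three entries, and the structure constants say that these digits
    -- match.
    count⇒closed : ∀ h a b c → cnt h a b c ≢ 0 → Closed h a b c
    count⇒closed zero a b c ≢0 = closed z<s z<s z<s (*-≢0ˡ {a 0} (*-≢0ˡ {a 0 * b 0} ≢0))
        (*-≢0ʳ {a 0} (*-≢0ˡ {a 0 * b 0} ≢0)) (*-≢0ʳ {a 0 * b 0} ≢0) (refl , refl , refl)
    count⇒closed (suc h) a b c ≢0
      with e , e< , ≢0₁ ← sumBelow-witness E _ ≢0
      with f , f< , ≢0₂ ← sumBelow-witness E _ ≢0₁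
      with g , g< , ≢0₃ ← sumBelow-witness E _ ≢0₂
      with closed {x} {y} {z} x< y< z< ax by cz (xy , yz , zx) ← count⇒closed h (block a e) (block b f) (block c g) (*-≢0ʳ {linked β e f g} ≢0₃)
      = closed (extend< {h} x< e<) (extend< {h} y< f<) (extend< {h} z< g<) ax by cz
          ( join (agrees-≢0 (*-≢0ˡ {agrees (e % β) (f / β)}
              (*-≢0ˡ {agrees (e % β) (f / β) * agrees (f % β) (g / β)} δ≢0))) xy e< f<
          , join (agrees-≢0 (*-≢0ʳ {agrees (e % β) (f / β)}
              (*-≢0ˡ {agrees (e % β) (f / β) * agrees (f % β) (g / β)} δ≢0))) yz f< g<
          , join (agrees-≢0 (*-≢0ʳ {agrees (e % β) (f / β) * agrees (f % β) (g / β)} δ≢0)) zx g< e<)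
      where
      δ≢0 : linked β e f g ≢ 0
      δ≢0 = *-≢0ˡ {linked β e f g} ≢0₃
      join : ∀ {x y e f} → e % β ≡ f / β → col h x ≡ row h y → e < E → f < E →
          col (suc h) (x * E + e) ≡ row (suc h) (y * E + f)
      join {x} {y} p q e< f< = trans (col-extend h x e<)
          (trans (cong₂ (λ a b → a + β * b) p q) (sym (row-extend h y f<)))

    closed⇒count : ∀ h a b c → Closed h a b c → cnt h a b c ≢ 0
    closed⇒count zero a b c (closed {x} {y} {z} x< y< z< ax by cz _)
      with refl ← n<1⇒n≡0 x< | refl ← n<1⇒n≡0 y< | refl ← n<1⇒n≡0 z< = *-≢0 {a 0 * b 0} (*-≢0 {a 0} ax by) cz
    closed⇒count (suc h) a b c (closed {x} {y} {z} x< y< z< ax by cz (xy , yz , zx)) =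
      sumBelow-≢0 E _ (m%n<n x E) (sumBelow-≢0 E _ (m%n<n y E) (sumBelow-≢0 E _ (m%n<n z E)
        (*-≢0 {linked β (x % E) (y % E) (z % E)}
          (*-≢0 {agrees (x % E % β) (y % E / β) * agrees (y % E % β) (z % E / β)}
            (*-≢0 {agrees (x % E % β) (y % E / β)} (agrees-refl (proj₁ (split x y xy)))
                (agrees-refl (proj₁ (split y z yz)))) (agrees-refl (proj₁ (split z x zx))))
          (closed⇒count h _ _ _ (closed (prefix< x<) (prefix< y<) (prefix< z<) (at a x ax) (at b y by) (at c z cz)
            (proj₂ (split x y xy) , proj₂ (split y z yz) , proj₂ (split z x zx)))))))
      where
      split : ∀ x y → col (suc h) x ≡ row (suc h) y → x % E % β ≡ y % E / β × col h (x / E) ≡ row h (y / E)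
      split x y = digits-injective (m%n<n (x % E) β) (quot< (m%n<n y E))
      prefix< : ∀ {x} → x < lengthOf (suc h) → x / E < lengthOf h
      prefix< {x} x< = m<n*o⇒m/o<n {x} {lengthOf h} {E} x<
      at : ∀ a x → a x ≢ 0 → block a (x % E) (x / E) ≢ 0
      at a x = subst (λ z → a z ≢ 0) (trans (m≡m%n+[m/n]*n x E) (+-comm (x % E) (x / E * E)))

    -- Each level sums E³ terms. This crude bound determines the modulus.
    count≤ : ∀ h a b c → (∀ x → a x ≤ 1) → (∀ x → b x ≤ 1) → (∀ x → c x ≤ 1) → cnt h a b c ≤ (E * (E * E)) ^ h
    count≤ zero    a b c a≤ b≤ c≤ = *-mono-≤ (*-mono-≤ (a≤ 0) (b≤ 0)) (c≤ 0)
    count≤ (suc h) a b c a≤ b≤ c≤ = ≤-trans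
      (sumBelow-≤ E _ (E * (E * Y)) λ e → sumBelow-≤ E _ (E * Y) λ f → sumBelow-≤ E _ Y λ g →
        ≤-trans (*-mono-≤ (linked≤1 e f g) (count≤ h (block a e) (block b f) (block c g) (λ x → a≤ _) (λ x →
            b≤ _) (λ x → c≤ _))) (≤-reflexive (*-identityˡ Y)))
      (≤-reflexive (regroup E Y))
      where
      Y = (E * (E * E)) ^ h
      regroup : ∀ e y → e * (e * (e * y)) ≡ e * (e * e) * y
      regroup = solve-∀
      linked≤1 : ∀ e f g → linked β e f g ≤ 1
      linked≤1 e f g = *-mono-≤ (*-mono-≤ (agrees≤1 (e % β) (f / β)) (agrees≤1 (f % β) (g / β)))
          (agrees≤1 (g % β) (e / β))

  private
    leading< : ∀ h {i} → i < β ^ suc h → i / β < β ^ h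
    leading< h {i} i< = m<n*o⇒m/o<n {i} {β ^ h} {β} (subst (i <_) (*-comm β (β ^ h)) i<)

  position : ∀ h {i j} → i < β ^ h → j < β ^ h → ∃[ x ] (x < lengthOf h × row h x ≡ i × col h x ≡ j)
  position zero    i< j< = 0 , z<s , sym (n<1⇒n≡0 i<) , sym (n<1⇒n≡0 j<)
  position (suc h) {i} {j} i< j<
    with x , x< , rx , cx ← position h (leading< h i<) (leading< h j<)
    = x * E + e , extend< {h} x< e<
      , trans (row-extend h x e<) (trans (cong₂ (λ a b → a + β * b) e/β rx) (recombine i))
      , trans (col-extend h x e<) (trans (cong₂ (λ a b → a + β * b) e%β cx) (recombine j))
    where
    e : ℕ
    -- The row contributes the upper and the column the lower base β digit of the last base E digit.
    e = j % β + i % β * β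
    e< : e < E
    e< = subst (e <_) (sym E≡) (<-≤-trans (+-monoˡ-< (i % β * β) (m%n<n j β)) (*-monoˡ-≤ β (m%n<n i β)))
    e%β : e % β ≡ j % β
    e%β = trans ([m+kn]%n≡m%n (j % β) (i % β) β) (m%n%n≡m%n j β)
    e/β : e / β ≡ i % β
    e/β = trans (+-distrib-/-∣ʳ (j % β) (divides-refl (i % β))) (cong₂ _+_ (m<n⇒m/n≡0 (m%n<n j β)) (m*n/n≡m (i % β) β))
    recombine : ∀ i → i % β + β * (i / β) ≡ i
    recombine i = trans (cong (λ z → i % β + z) (*-comm β (i / β))) (sym (m≡m%n+[m/n]*n i β))

adjust-elim : ∀ (P : Fin 3 → ℕ → Set) f p x → P p x → (∀ i → P i (f i)) → ∀ i → P i (adjust f p x i)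
adjust-elim P f p x px pf i with i Fin.≟ p
... | yes refl = subst (P p) (sym (adjust-≡ f p x)) px
... | no i≢p   = subst (P i) (sym (adjust-≢ f p x i≢p)) (pf i)

adjust₂-elim : ∀ (P : Fin 3 → ℕ → ℕ → Set) f g p x y → P p x y → (∀ i → P i (f i) (g i)) →
               ∀ i → P i (adjust f p x i) (adjust g p y i)
adjust₂-elim P f g p x y px pf i with i Fin.≟ p
... | yes refl = subst₂ (P p) (sym (adjust-≡ f p x)) (sym (adjust-≡ g p y)) px
... | no i≢p   = subst₂ (P i) (sym (adjust-≢ f p x i≢p)) (sym (adjust-≢ g p y i≢p)) (pf i)

coefficient : (pos neg : ℕ → ℕ) → (E tag : ℕ) → ℕ → ℕ → ℤ
coefficient pos neg E tag r e = + pos i ℤ.- + neg i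
  where i = (r * 3 + tag) * E + e

-- The meaning of verdicts

module FormMeaning (c : Constants) (pos neg : ℕ → ℕ) where
  open Constants c
  open Congruence m′ using (_≈_; congruent; ≈-refl; ≈-trans; ≈-*; ≈-sum; ≈-%)
  open TrilinearForm E R using (mix; form)

  private
    tab : ℕ → ℕ
    tab = residue m′ pos neg

    coef : ℕ → ℕ → ℕ → ℤ
    coef = coefficient pos neg E

  -- Since m = 1 + m′, p + m′ n is p - n plus n times m.
  tab≈coef : ∀ tag r e → + tab ((r * 3 + tag) * E + e) ≈ coef tag r e
  tab≈coef tag r e = ≈-trans (≈-% _)
      (congruent (+ neg i) (trans (cong (λ z → + pos i ℤ.+ z) (ℤ.pos-* m′ (neg i))) (trans
    (regroup (+ pos i) (+ m′) (+ neg i)) (cong (λ z → + pos i ℤ.- + neg i ℤ.+ + neg i ℤ.* z) (sym (ℤ.pos-+ 1 m′))))))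
    where
    i = (r * 3 + tag) * E + e
    regroup : ∀ p m n → p ℤ.+ m ℤ.* n ≡ p ℤ.- n ℤ.+ n ℤ.* (+ 1 ℤ.+ m)
    regroup = ℤSolver.solve-∀

  private
    quot≡ : ∀ y q .{{_ : NonZero q}} → ⟦ quot ⟧ʷ y q ≡ y / q
    quot≡ y (suc q) = refl

  -- Concatenation of arrays and passage to a child are compatible: tag (q E) + (x E + e) = (tag q +
  -- x) E + e.
  child≈mix : ∀ q {{_ : NonZero q}} r tag f {A x} → x < q →
    (∀ {x} → x < q * E → + f (tag * (q * E) + x) ≈ A x) →
    + child c tab r q f (tag * q + x) ≈ mix (coef tag) r A x
  child≈mix q r tag f {A} {x} x<q f≈A = ≈-trans (≈-% _) (≈-sum E λ {e} e< →
    ≈-trans (≡⇒≈ (ℤ.pos-* (tab _) (f _)))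
      (≈-* (subst (λ z → + tab ((r * 3 + z) * E + e) ≈ coef tag r e) (sym tag≡) (tab≈coef tag r e))
           (subst (λ z → + f z ≈ A (x * E + e)) (index≡ e) (f≈A (inside e e<)))))
    where
    ≡⇒≈ : ∀ {a b} → a ≡ b → a ≈ b
    ≡⇒≈ refl = ≈-refl
    tag≡ : ⟦ quot ⟧ʷ (tag * q + x) q ≡ tag
    tag≡ = trans (quot≡ (tag * q + x) q) (trans (+-distrib-/-∣ˡ x (divides-refl tag))
      (trans (cong₂ _+_ (m*n/n≡m tag q) (m<n⇒m/n≡0 x<q)) (+-identityʳ tag)))
    index≡ : ∀ e → tag * (q * E) + (x * E + e) ≡ (tag * q + x) * E + e
    index≡ e = regroup tag q x E e
      where
      regroup : ∀ t q x E e → t * (q * E) + (x * E + e) ≡ (t * q + x) * E + e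
      regroup = solve-∀
    inside : ∀ e → e < E → x * E + e < q * E
    inside e e< = <-≤-trans (+-monoʳ-< (x * E) e<) (≤-trans (≤-reflexive (+-comm (x * E) E)) (*-monoˡ-≤ E x<q))

  value≈form : ∀ h f A B C →
    (∀ {x} → x < arrayLength c h → + f (0 * arrayLength c h + x) ≈ A x) →
    (∀ {x} → x < arrayLength c h → + f (1 * arrayLength c h + x) ≈ B x) →
    (∀ {x} → x < arrayLength c h → + f (2 * arrayLength c h + x) ≈ C x) →
    + formValue c tab h f ≈ form (coef 0) (coef 1) (coef 2) h A B C
  value≈form zero f A B C f≈A f≈B f≈C = subst (_≈ A 0 ℤ.* B 0 ℤ.* C 0)
    (sym (trans (ℤ.pos-* (f 0 * f 1) (f 2)) (cong (ℤ._* + f 2) (ℤ.pos-* (f 0) (f 1)))))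
    (≈-* (≈-* (f≈A z<s) (f≈B z<s)) (f≈C z<s))
  value≈form (suc h) f A B C f≈A f≈B f≈C = ≈-sum R λ {r} _ →
    value≈form h (child c tab r q f) _ _ _
      (λ x< → child≈mix q r 0 f x< f≈A) (λ x< → child≈mix q r 1 f x< f≈B) (λ x< → child≈mix q r 2 f x< f≈C)
    where
    q = arrayLength c h
    instance q≢0 = >-nonZero (arrayLength>0 c h)

-- A decomposition of D times the matrix multiplication tensor into R tensors of rank at most one.
Decomposes : Setting → Set
Decomposes σ = ∀ {e f g} → e < E → f < E → g < E →
    sumℤ R (λ r → coefficient pos neg E 0 r e ℤ.* coefficient pos neg E 1 r f ℤ.* coefficient pos neg E 2 r
        g) ≡ + (D * linked β e f g)
  where
  open Setting σ
  open Constants c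

module VerdictMeaning (σ : Setting) (1≤D : 1 ≤ Setting.D σ) (identity : Decomposes σ)
  (m′≡ : Constants.m′ (Setting.c σ) ≡
      (Setting.D σ * (Constants.E (Setting.c σ) * (Constants.E (Setting.c σ) * Constants.E (Setting.c σ))))
      ^ Constants.L (Setting.c σ))
  where

  open Setting σ
  open Constants c
  open Solver σ using (length#; vertices#; entryOf; combined; Verdict)
  open Indexing β′ E′ using (row; col)
  open Counting β′ E′ R E≡ using (lengthOf; Closed; closed; cnt; count⇒closed; closed⇒count; count≤; position)
  open FormMeaning c pos neg using (value≈form)
  open Congruence m′ using (_≈_; ≈-refl; ≈-trans; ≈⇒%)
  open TrilinearForm E R using (form-count)

  private
    coef : ℕ → ℕ → ℕ → ℤ
    coef = coefficient pos neg E

    lengthOf≡ : ∀ h → arrayLength c h ≡ lengthOf h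
    lengthOf≡ zero    = refl
    lengthOf≡ (suc h) = cong (_* E) (lengthOf≡ h)

    triangles : Query → ℕ
    triangles q = cnt (coef 0) (coef 1) (coef 2) D identity L (entryOf q zero) (entryOf q (suc zero))
        (entryOf q (suc (suc zero)))

    indicator≤1 : ∀ a b → indicator a b ≤ 1
    indicator≤1 zero    b       = z≤n
    indicator≤1 (suc a) zero    = ≤-refl
    indicator≤1 (suc a) (suc b) = z≤n

    combined₀ : ∀ q {x} → x < EL → combined q (0 * EL + x) ≡ entryOf q zero x
    combined₀ q {x} x< with x <? EL | x <? 2 * EL
    ... | yes _ | _ = refl
    ... | no x≮ | _ = contradiction x< x≮

    combined₁ : ∀ q {x} → x < EL → combined q (1 * EL + x) ≡ entryOf q (suc zero) x
    combined₁ q {x} x< with 1 * EL + x <? EL | 1 * EL + x <? 2 * EL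
    ... | yes lt | _ = contradiction lt (≤⇒≯ (≤-trans (≤-reflexive (sym (*-identityˡ EL))) (m≤m+n (1 * EL) x)))
    ... | no _ | yes _ = cong (entryOf q (suc zero)) (trans (cong (λ z → z + x ∸ EL) (*-identityˡ EL)) (m+n∸m≡n EL x))
    ... | no _ | no ≮ = contradiction (subst₂ _<_ (cong (_+ x) (sym (*-identityˡ EL)))
        (cong (λ z → EL + z) (sym (*-identityˡ EL))) (+-monoʳ-< EL x<)) ≮

    combined₂ : ∀ q {x} → x < EL → combined q (2 * EL + x) ≡ entryOf q (suc (suc zero)) x
    combined₂ q {x} x< with 2 * EL + x <? EL | 2 * EL + x <? 2 * EL
    ... | yes lt | _ = contradiction lt (≤⇒≯ (≤-trans (m≤n*m EL 2) (m≤m+n (2 * EL) x)))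
    ... | no _ | yes lt = contradiction lt (≤⇒≯ (m≤m+n (2 * EL) x))
    ... | no _ | no _ = cong (entryOf q (suc (suc zero))) (m+n∸m≡n (2 * EL) x)

  -- The modulus exceeds every value that the right-hand side can take, so the residue is the value
  -- itself.
  Verdict≡ : ∀ q → Verdict q ≡ D ^ L * triangles q
  Verdict≡ q = trans (≈⇒% (≈-trans
      (value≈form L (combined q) (+_ ∘ entryOf q zero) (+_ ∘ entryOf q (suc zero)) (+_ ∘ entryOf q (suc (suc zero)))
        (at 0 zero (combined₀ q)) (at 1 (suc zero) (combined₁ q)) (at 2 (suc (suc zero)) (combined₂ q)))
      (subst (_≈ + (D ^ L * triangles q))
          (sym (form-count (coef 0) (coef 1) (coef 2) D (linked β) identity L _ _ _)) ≈-refl)))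
    (m<n⇒m%n≡m (s≤s (≤-trans (*-monoʳ-≤ (D ^ L) (count≤ (coef 0) (coef 1) (coef 2) D identity L _ _ _
        (λ x → indicator≤1 _ _) (λ x → indicator≤1 _ _) (λ x → indicator≤1 _ _)))
      (≤-reflexive (trans (sym (^-distribʳ-* L D (E * (E * E)))) (sym m′≡))))))
    where
    at : ∀ k p → (∀ {x} → x < EL → combined q (k * EL + x) ≡ entryOf q p x) →
         ∀ {x} → x < arrayLength c L → + combined q (k * arrayLength c L + x) ≈ + entryOf q p x
    at k p eq {x} x< = subst (λ z → + z ≈ + entryOf q p x)
      (sym (trans (cong (λ z → combined q (k * z + x)) (sym EL≡)) (eq (subst (x <_) (sym EL≡) x<)))) ≈-refl

  mismatchOf : Query → Fin 3 → ℕ → ℕ → ℕ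
  mismatchOf (query τ α lo w) p = Entry.mismatch c X (length# p) (length# (next p))
    (vertices# p) (vertices# (next p)) (lo p) (w p) (α p) τ

  record Triangle (q : Query) : Set where
    constructor triangle
    field
      vertex : Fin 3 → ℕ
      vertex< : ∀ p → vertex p < vertices# p
      ≥corner : ∀ p → Query.lo q p ≤ vertex p
      <width : ∀ p → vertex p < Query.lo q p + Query.w q p
      matches : ∀ p → mismatchOf q p (vertex p) (vertex (next p)) ≡ 0

  private
    inRangeOf : Query → Fin 3 → ℕ → ℕ → ℕ
    inRangeOf (query τ α lo w) p = Entry.inRange c X (length# p) (length# (next p))
      (vertices# p) (vertices# (next p)) (lo p) (w p) (α p) τ

    indicator-inv : ∀ {a b} → indicator a b ≢ 0 → a ≢ 0 × b ≡ 0
    indicator-inv {zero}          ne = contradiction refl ne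
    indicator-inv {suc a} {zero}  ne = (λ ()) , refl
    indicator-inv {suc a} {suc b} ne = contradiction refl ne

    ∸-≢0 : ∀ {a b} → a ∸ b ≢ 0 → b < a
    ∸-≢0 {a} {b} ne = ≰⇒> (λ a≤b → ne (m≤n⇒m∸n≡0 a≤b))

    inRange-inv : ∀ q p {i j} → inRangeOf q p i j ≢ 0 →
      i < vertices# p × j < vertices# (next p) × Query.lo q p ≤ i × i < Query.lo q p + Query.w q p
    inRange-inv (query τ α lo w) p {i} {j} ne =
        ∸-≢0 (*-≢0ˡ {vertices# p ∸ i} (*-≢0ˡ {(vertices# p ∸ i) * (vertices# (next p) ∸ j)} ne₃))
      , ∸-≢0 (*-≢0ʳ {vertices# p ∸ i} (*-≢0ˡ {(vertices# p ∸ i) * (vertices# (next p) ∸ j)} ne₃))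
      , ≤-pred (subst (lo p <_) (+-comm i 1) (∸-≢0 (*-≢0ʳ {(vertices# p ∸ i) * (vertices# (next p) ∸ j)} ne₃)))
      , ∸-≢0 (*-≢0ʳ {(vertices# p ∸ i) * (vertices# (next p) ∸ j) * (i + 1 ∸ lo p)} ne)
      where
      ne₃ : (vertices# p ∸ i) * (vertices# (next p) ∸ j) * (i + 1 ∸ lo p) ≢ 0
      ne₃ = *-≢0ˡ ne

    inRange-≢0 : ∀ q p {i j} → i < vertices# p → j < vertices# (next p) → Query.lo q p ≤ i →
      i < Query.lo q p + Query.w q p → inRangeOf q p i j ≢ 0
    inRange-≢0 (query τ α lo w) p {i} {j} i< j< lo≤ <w =
      *-≢0 {(vertices# p ∸ i) * (vertices# (next p) ∸ j) * (i + 1 ∸ lo p)}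
        (*-≢0 {(vertices# p ∸ i) * (vertices# (next p) ∸ j)} (*-≢0 {vertices# p ∸ i} (m>n⇒m∸n≢0 i<) (m>n⇒m∸n≢0 j<))
          (m>n⇒m∸n≢0 (subst (lo p <_) (+-comm 1 i) (s≤s lo≤)))) (m>n⇒m∸n≢0 <w)

    entryOf≡ : ∀ q p x → entryOf q p x ≡ indicator (inRangeOf q p (row L x) (col L x))
        (mismatchOf q p (row L x) (col L x))
    entryOf≡ (query τ α lo w) p x = refl

  Verdict⇒triangle : ∀ q → Verdict q ≢ 0 → Triangle q
  Verdict⇒triangle q ne = fromClosed (count⇒closed (coef 0) (coef 1) (coef 2) D identity L _ _ _
        (λ eq → ne (trans (Verdict≡ q) (trans (cong (D ^ L *_) eq) (*-zeroʳ (D ^ L))))))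
    where
    entry-inv : ∀ p x → entryOf q p x ≢ 0 → inRangeOf q p (row L x) (col L x) ≢ 0 ×
        mismatchOf q p (row L x) (col L x) ≡ 0
    entry-inv p x ne = indicator-inv (subst (_≢ 0) (entryOf≡ q p x) ne)
    fromRows : ∀ {x : Fin 3 → ℕ} →
      (∀ p → inRangeOf q p (row L (x p)) (col L (x p)) ≢ 0 × mismatchOf q p (row L (x p)) (col L (x p)) ≡ 0) →
      (∀ p → col L (x p) ≡ row L (x (next p))) → Triangle q
    fromRows {x} entries chain = triangle (λ p → row L (x p))
      (λ p → proj₁ (ranges p)) (λ p → proj₁ (proj₂ (proj₂ (ranges p)))) (λ p → proj₂ (proj₂ (proj₂ (ranges p))))
      (λ p → subst (λ j → mismatchOf q p (row L (x p)) j ≡ 0) (chain p) (proj₂ (entries p)))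
      where
      ranges : ∀ p → row L (x p) < vertices# p × col L (x p) < vertices# (next p)
        × Query.lo q p ≤ row L (x p) × row L (x p) < Query.lo q p + Query.w q p
      ranges p = inRange-inv q p (proj₁ (entries p))
    fromClosed : Closed L (entryOf q zero) (entryOf q (suc zero)) (entryOf q (suc (suc zero))) → Triangle q
    fromClosed (closed {x} {y} {z} _ _ _ ax by cz (xy , yz , zx)) = fromRows {triple x y z}
        (λ { zero → entry-inv zero x ax ; (suc zero) → entry-inv (suc zero) y by ; (suc (suc zero)) →
            entry-inv (suc (suc zero)) z cz })
        (λ { zero → xy ; (suc zero) → yz ; (suc (suc zero)) → zx })

  module _ (vertices≤β^L : ∀ p → vertices# p ≤ β ^ L) where

    -- Here the matrices have to be large enough: an edge has an array index only if both its ends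
    -- are below β^L.
    triangle⇒Verdict : ∀ q → Triangle q → Verdict q ≢ 0
    triangle⇒Verdict q (triangle vertex vertex< ≥corner <width matches) eq =
      *-≢0 {D ^ L} (>⇒≢ (m^n>0 D {{>-nonZero 1≤D}} L))
        (closed⇒count (coef 0) (coef 1) (coef 2) D identity L _ _ _
          (closed (x< zero) (x< (suc zero)) (x< (suc (suc zero))) (entry≢0 zero) (entry≢0 (suc zero))
              (entry≢0 (suc (suc zero)))
            (link zero , link (suc zero) , link (suc (suc zero)))))
        (trans (sym (Verdict≡ q)) eq)
      where
      place : ∀ p → ∃[ x ] (x < lengthOf L × row L x ≡ vertex p × col L x ≡ vertex (next p))
      place p = position L (<-≤-trans (vertex< p) (vertices≤β^L p))
          (<-≤-trans (vertex< (next p)) (vertices≤β^L (next p)))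
      x : Fin 3 → ℕ
      x p = proj₁ (place p)
      x< : ∀ p → x p < lengthOf L
      x< p = proj₁ (proj₂ (place p))
      rows : ∀ p → row L (x p) ≡ vertex p
      rows p = proj₁ (proj₂ (proj₂ (place p)))
      cols : ∀ p → col L (x p) ≡ vertex (next p)
      cols p = proj₂ (proj₂ (proj₂ (place p)))
      link : ∀ p → col L (x p) ≡ row L (x (next p))
      link p = trans (cols p) (sym (rows (next p)))
      entry≢0 : ∀ p → entryOf q p (x p) ≢ 0
      entry≢0 p = subst (_≢ 0) (sym (trans (entryOf≡ q p (x p))
          (trans (cong₂ (λ i j → indicator (inRangeOf q p i j) (mismatchOf q p i j)) (rows p) (cols p))
            (sym (indicator-01 _ _ (inRange-≢0 q p (vertex< p) (vertex< (next p)) (≥corner p) (<width p))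
                (matches p))))))
        λ ()

    -- The vertex of a triangle in class `p` lies in one of the two halves; in the lower one it
    -- would contradict `miss`. The other two classes keep their boxes.
    split-verdict : ∀ τ α lo w p h → w p ≡ h + h → Verdict (query τ α lo w) ≢ 0 →
      Verdict (query τ α lo (adjust w p h)) ≡ 0 → Verdict (query τ α (adjust lo p (lo p + h)) (adjust w p h)) ≢ 0
    split-verdict τ α lo w p h w≡ ne miss = halves (Verdict⇒triangle (query τ α lo w) ne)
      where
      left right : Query
      left = query τ α lo (adjust w p h)
      right = query τ α (adjust lo p (lo p + h)) (adjust w p h)
      halves : Triangle (query τ α lo w) → Verdict right ≢ 0
      halves (triangle vertex vertex< ≥corner <width matches) = [ below , above ]′ (<-≤-connex (vertex p) (lo p + h))
        where
        below : vertex p < lo p + h → Verdict right ≢ 0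
        below lt = contradiction miss (triangle⇒Verdict left (triangle vertex vertex< ≥corner
          (adjust-elim (λ i b → vertex i < lo i + b) w p h lt <width) matches))
        above : lo p + h ≤ vertex p → Verdict right ≢ 0
        above le = triangle⇒Verdict right (triangle vertex vertex<
          (adjust-elim (λ i a → a ≤ vertex i) lo p (lo p + h) le ≥corner)
          (adjust₂-elim (λ i a b → vertex i < a + b) lo w p (lo p + h) h
            (subst (vertex p <_) (trans (cong (λ z → lo p + z) w≡) (sym (+-assoc (lo p) h h))) (<width p)) <width)
          matches)

-- Correctness of the program

module Assembly (β′ R′ D : ℕ) (pos neg : ℕ → ℕ) where

  β R E′ E growth : ℕ
  β = suc β′
  R = suc R′
  -- Its successor is β * β by computation.
  E′ = β′ + β′ * suc β′
  E = suc E′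
  growth = D * (E * E * E)

  open Program β R D pos neg using (tableSize; growBody; powers; fillTable; initialised; main)

  -- `arrayLength` and `steps` take the constants as an argument, and some of the constants are
  -- these very values; the copies break the circle.
  lengthOf stepsOf : ℕ → ℕ
  lengthOf zero    = 1
  lengthOf (suc h) = lengthOf h * E
  stepsOf zero    = 1
  stepsOf (suc h) = R * (2 + stepsOf h)

  constants : (n s M′ L : ℕ) → Constants
  constants n s M′ L = record
    { n = n ; s = s ; M′ = M′ ; β′ = β′ ; E′ = E′ ; R′ = R′ ; base = tableSize
    ; k₀ = (s + 2) / 3 ; k₁ = (s + 1) / 3 ; k₂ = s / 3
    ; N₀ = suc M′ ^ ((s + 2) / 3) ; N₁ = suc M′ ^ ((s + 1) / 3) ; N₂ = suc M′ ^ (s / 3)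
    ; L = L ; P = β ^ L ; EL = lengthOf L ; m′ = growth ^ L ; w₀ = (2 ^ β) ^ L ; J = stepsOf L
    ; V′ = n * s * s ; LB = L * β }

  -- What safety requires of one value of L. It has to be available for all values that the growing
  -- loop passes through, since the final one is known only at run time.
  record Grown (S B L : ℕ) : Set where
    field
      β^L≤B : β ^ L ≤ B
      R^L≤B : R ^ suc L ≤ B
      arrays≤B : tableSize + 6 * lengthOf L ≤ B
      arrays≤S : tableSize + 6 * lengthOf L ≤ S
      m≤B : suc (growth ^ L) ≤ B
      w₀≤B : (2 ^ β) ^ L ≤ B
      steps≤B : stepsOf L ≤ B
      L≤B : L ≤ B
      LB≤B : L * β ≤ B

  record Instance : Set where
    field
      W S B n s M′ : ℕ
      X : Vec (Cube n) (suc M′)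
      5≤B : 5 ≤ B
      B^<W : B ^ 12 < W
      1<β : 1 < β
      1≤D : 1 ≤ D
      n≤B : n ≤ B
      s≤B : s ≤ B
      M≤B : suc M′ ≤ B
      R≤B : R ≤ B
      E≤B : E ≤ B
      2^β≤B : 2 ^ β ≤ B
      growth≤B : growth ≤ B
      coefficients≤B : ∀ {i} → i < tableSize → pos i ≤ B × neg i ≤ B
      V≤B : suc (n * s * s) ≤ B
      k₀≤B : (s + 2) / 3 ≤ B
      N₀≤B : suc M′ ^ ((s + 2) / 3) ≤ B
      grown : ∀ L → β ^ L ≤ β * suc M′ ^ ((s + 2) / 3) → Grown S B L
      identity : ∀ {e f g} → e < E → f < E → g < E →
        sumℤ R (λ r → coefficient pos neg E 0 r e ℤ.* coefficient pos neg E 1 r f ℤ.* coefficient pos neg E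
            2 r g) ≡ + (D * linked β e f g)

  module Run (ι : Instance) where

    open Instance ι
    open Bounds B W 5≤B B^<W using (_≼_; ≼-≤; ≼-base; ≼-+; ≼-*; ≼-lit; fits; 1<W)
    open Logic W S X using (⟦_⟧; Safe; Post; upd-≡; upd-≢; Wp; ⟪_⟫; monoW; seqW; newAs; whenW; Invariant; Maintains; forW)

    M k₀ k₁ k₂ N₀ : ℕ
    M = suc M′
    k₀ = (s + 2) / 3
    k₁ = (s + 1) / 3
    k₂ = s / 3
    N₀ = M ^ k₀

    k₁≤k₀ : k₁ ≤ k₀
    k₁≤k₀ = /-monoˡ-≤ 3 (+-monoʳ-≤ s (s≤s z≤n))
    k₂≤k₀ : k₂ ≤ k₀
    k₂≤k₀ = /-monoˡ-≤ 3 (m≤m+n s 2)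

    powers≤B : ∀ {k} → k ≤ k₀ → M ^ k ≤ B
    powers≤B k≤ = ≤-trans (^-monoʳ-≤ M k≤) N₀≤B

    1<E : 1 < E
    1<E = *-mono-≤ 1<β (≤-trans (s≤s z≤n) 1<β)

    arrayLength≡ : ∀ L h → arrayLength (constants n s M′ L) h ≡ lengthOf h
    arrayLength≡ L zero    = refl
    arrayLength≡ L (suc h) = cong (_* E) (arrayLength≡ L h)

    steps≡ : ∀ L h → steps (constants n s M′ L) h ≡ stepsOf h
    steps≡ L zero    = refl
    steps≡ L (suc h) = cong (λ z → R * (2 + z)) (steps≡ L h)

    setting : ∀ L → Grown S B L → Setting
    setting L g = record
      { W = W ; S = S ; B = B ; D = D ; pos = pos ; neg = neg ; c = constants n s M′ L ; X = X
      ; 5≤B = 5≤B ; B^<W = B^<W ; 1<E = 1<E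
      ; 1<m = s≤s (m^n>0 growth {{>-nonZero (*-mono-≤ {1} 1≤D (s≤s z≤n))}} L)
      ; E≡ = refl ; base≡ = refl
      ; EL≡ = sym (arrayLength≡ L L)
      ; J≡ = sym (steps≡ L L)
      ; w₀≡ = trans (^-*-assoc 2 β L) (cong (2 ^_) (*-comm β L))
      ; n≤B = n≤B ; m≤B = Grown.m≤B g ; E≤B = E≤B ; V≤B = V≤B ; w₀≤B = Grown.w₀≤B g
      ; blockLengths≤B = k₀≤B , ≤-trans k₁≤k₀ k₀≤B , ≤-trans k₂≤k₀ k₀≤B
      ; vertices≤B = N₀≤B , powers≤B k₁≤k₀ , powers≤B k₂≤k₀
      ; β^L≤B = Grown.β^L≤B g ; R^L≤B = Grown.R^L≤B g
      ; arrays≤B = Grown.arrays≤B g ; arrays≤S = Grown.arrays≤S g }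

    environment : (j₀ j₁ j₂ L m : ℕ) → Vec ℕ 21
    environment j₀ j₁ j₂ L m = suc (n * s * s) ∷ stepsOf L ∷ (2 ^ β) ^ L ∷ m ∷ lengthOf L ∷ β ^ L ∷ L
      ∷ j₂ ∷ j₁ ∷ j₀ ∷ k₂ ∷ k₁ ∷ k₀ ∷ tableSize ∷ R ∷ E ∷ β ∷ 1 ∷ M ∷ s ∷ n ∷ []

    private
      power-step : ∀ {k x y} → suc k ≤ y → x * M ^ suc k ≡ M ^ y → M * x * M ^ k ≡ M ^ y
      power-step {k} {x} _ eq = trans (cong (_* M ^ k) (*-comm M x)) (trans (*-assoc x M (M ^ k)) eq)

      power≤ : ∀ {k x y} → y ≤ k₀ → x * M ^ k ≡ M ^ y → x ≼ 1
      power≤ {k} {x} y≤ eq = ≼-base (≤-trans (m≤m*n x (M ^ k) {{>-nonZero (m^n>0 M k)}})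
          (≤-trans (≤-reflexive eq) (powers≤B y≤)))

    PowersPost : (vec : ℕ → Vec ℕ 21) (k t : ℕ) (μ : Memory) (o : List ℕ) → Post 21
    PowersPost vec k t μ o t′ v′ μ′ o′ = t′ ≤ k * 10 + 3 + t × v′ ≡ vec (M ^ k) × μ′ ≡ μ × o′ ≡ o

    powerInv : (vec : ℕ → Vec ℕ 21) (k : ℕ) (μ : Memory) (o : List ℕ) → Invariant 21
    powerInv vec k μ₀ o₀ j v μ o = ∃[ x ] (v ≡ vec x × μ ≡ μ₀ × o ≡ o₀ × x * M ^ j ≡ M ^ k)

    finishPower : ∀ vec k {μ o t} {t′ v′ μ′ o′} → t′ ≤ k * (7 + 3) + 3 + t × powerInv vec k μ o 0 v′ μ′ o′ →
        PowersPost vec k t μ o t′ v′ μ′ o′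
    finishPower vec k (t≤ , x , refl , eqμ , eqo , eq) = t≤ , cong vec (trans (sym (*-identityʳ x)) eq) , eqμ , eqo

    power₀ : ∀ {t μ o} → Wp (for (var 8) (put 11 (var 2 ⊗ var 11)))
        (PowersPost (λ x → environment x 1 1 0 1) k₀ t μ o) t (environment 1 1 1 0 1) μ o
    power₀ {μ = μ} {o} = monoW (forW (powerInv vec k₀ μ o) 7 _
        (λ { {j} j< (x , refl , refl , refl , eq) → let eq′ = power-step {j} {x} j< eq in
          ⟪ (_ , _ , fits (power≤ {j} ≤-refl eq′)) , ≤-refl , refl , M * x , refl , refl , refl , eq′ ⟫ })
        (1 , refl , refl , refl , +-identityʳ (M ^ k₀))) (finishPower vec k₀)
      where
      vec : ℕ → Vec ℕ 21
      vec x = environment x 1 1 0 1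

    power₁ : ∀ {t μ o} → Wp (for (var 9) (put 12 (var 2 ⊗ var 12)))
        (PowersPost (λ x → environment N₀ x 1 0 1) k₁ t μ o) t (environment N₀ 1 1 0 1) μ o
    power₁ {μ = μ} {o} = monoW (forW (powerInv vec k₁ μ o) 7 _
        (λ { {j} j< (x , refl , refl , refl , eq) → let eq′ = power-step {j} {x} j< eq in
          ⟪ (_ , _ , fits (power≤ {j} k₁≤k₀ eq′)) , ≤-refl , refl , M * x , refl , refl , refl , eq′ ⟫ })
        (1 , refl , refl , refl , +-identityʳ (M ^ k₁))) (finishPower vec k₁)
      where
      vec : ℕ → Vec ℕ 21
      vec x = environment N₀ x 1 0 1

    power₂ : ∀ {t μ o} → Wp (for (var 10) (put 13 (var 2 ⊗ var 13)))
        (PowersPost (λ x → environment N₀ (M ^ k₁) x 0 1) k₂ t μ o) t (environment N₀ (M ^ k₁) 1 0 1) μ o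
    power₂ {μ = μ} {o} = monoW (forW (powerInv vec k₂ μ o) 7 _
        (λ { {j} j< (x , refl , refl , refl , eq) → let eq′ = power-step {j} {x} j< eq in
          ⟪ (_ , _ , fits (power≤ {j} k₂≤k₀ eq′)) , ≤-refl , refl , M * x , refl , refl , refl , eq′ ⟫ })
        (1 , refl , refl , refl , +-identityʳ (M ^ k₂))) (finishPower vec k₂)
      where
      vec : ℕ → Vec ℕ 21
      vec x = environment N₀ (M ^ k₁) x 0 1

    grownEnvironment : ℕ → Vec ℕ 21
    grownEnvironment L = environment N₀ (M ^ k₁) (M ^ k₂) L (growth ^ L)

    private
      n≤β^n : ∀ k → k < β ^ k
      n≤β^n zero    = z<s
      n≤β^n (suc k) = ≤-trans (+-mono-≤ (m^n>0 β k) (n≤β^n k))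
        (≤-trans (≤-reflexive (cong (λ z → β ^ k + z) (sym (+-identityʳ (β ^ k))))) (*-monoˡ-≤ (β ^ k) 1<β))

    -- The alternative measures progress: until β^L reaches N₀, every iteration so far has increased
    -- L.
    GrowInv : (μ : Memory) (o : List ℕ) → Invariant 21
    GrowInv μ₀ o₀ k v μ o = ∃[ L ] (v ≡ grownEnvironment L × μ ≡ μ₀ × o ≡ o₀ × β ^ L ≤ β * N₀ ×
        (N₀ ≤ β ^ L ⊎ L + k ≡ N₀))

    growStep : ∀ {μ₀ o₀ k} → Maintains growBody (GrowInv μ₀ o₀) 80 k
    growStep {μ₀} {o₀} {k} {t} (L , refl , refl , refl , L≤ , progress) = whenW _
      (λ short → ⟪ (_ , _ , fits (≼-base (Grown.L≤B (grownNext short))))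
        , (_ , _ , fits (≼-base (Grown.β^L≤B (grownNext short))))
        , (_ , _ , fits (≼-base (≤-trans (≤-trans (m≤n*m (lengthOf (suc L)) 6) (m≤n+m _ tableSize))
            (Grown.arrays≤B (grownNext short)))))
        , (fits (≼-base growth≤B) , _ , fits (≼-base (≤-trans (n≤1+n _) (Grown.m≤B (grownNext short)))))
        , (fits (≼-base 2^β≤B) , _ , fits (≼-base (Grown.w₀≤B (grownNext short))))
        , (_ , ((_ , _ , fits (≼-lit 2)) , _ , fits (≼-+ (≼-lit 2) (≼-base (Grown.steps≤B g)))) ,
            fits (≼-base (Grown.steps≤B (grownNext short))))
        , slack 52 80 , refl , suc L , refl , refl , refl , longer short , inj₂ (advance short progress) ⟫)
      (λ enough → ⟪ slack 7 80 , refl , L , refl , refl , refl , L≤ , inj₁ (m∸n≡0⇒m≤n enough) ⟫)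
      where
      g : Grown S B L
      g = grown L L≤
      shorter : N₀ ∸ β ^ L ≢ 0 → β ^ L < N₀
      shorter ne = ≰⇒> (λ le → ne (m≤n⇒m∸n≡0 le))
      longer : N₀ ∸ β ^ L ≢ 0 → β ^ suc L ≤ β * N₀
      longer ne = *-monoʳ-≤ β (<⇒≤ (shorter ne))
      grownNext : N₀ ∸ β ^ L ≢ 0 → Grown S B (suc L)
      grownNext ne = grown (suc L) (longer ne)
      advance : N₀ ∸ β ^ L ≢ 0 → N₀ ≤ β ^ L ⊎ L + suc k ≡ N₀ → suc L + k ≡ N₀
      advance ne (inj₁ enough) = contradiction enough (<⇒≱ (shorter ne))
      advance ne (inj₂ eq) = trans (sym (+-suc L k)) eq

    grows : ∀ {t μ o} → Wp (for (var 11) growBody)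
      (λ t′ v′ μ′ o′ → t′ ≤ N₀ * 83 + 3 + t ×
          (∃[ L ] (v′ ≡ grownEnvironment L × μ′ ≡ μ × o′ ≡ o × β ^ L ≤ β * N₀ × N₀ ≤ β ^ L)))
      t (grownEnvironment 0) μ o
    grows {μ = μ} {o} = monoW
      (forW (GrowInv μ o) 80 _ (λ _ → growStep) (0 , refl , refl , refl ,
          *-mono-≤ {1} {β} {1} {N₀} (s≤s z≤n) (m^n>0 M k₀) , inj₂ refl))
      λ { (t≤ , L , refl , refl , refl , L≤ , done) → t≤ , L , refl , refl , refl , L≤ , enough L done }
      where
      enough : ∀ L → N₀ ≤ β ^ L ⊎ L + 0 ≡ N₀ → N₀ ≤ β ^ L
      enough L (inj₁ le) = le
      enough L (inj₂ eq) = subst (_≤ β ^ L) (trans (sym (+-identityʳ L)) eq) (<⇒≤ (n≤β^n L))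

    powersTime : ℕ
    powersTime = (k₀ + k₁ + k₂) * 10 + N₀ * 83 + 30

    powersW : ∀ {t μ o} → Wp powers
      (λ t′ v′ μ′ o′ → t′ ≤ powersTime + t ×
          (∃[ L ] (v′ ≡ environment N₀ (M ^ k₁) (M ^ k₂) L (suc (growth ^ L)) × μ′ ≡ μ × o′ ≡ o
        × β ^ L ≤ β * N₀ × N₀ ≤ β ^ L)))
      t (environment 1 1 1 0 1) μ o
    powersW {t} {μ} {o} =
      seqW power₀ λ { (t₁≤ , refl , refl , refl) →
      seqW power₁ λ { (t₂≤ , refl , refl , refl) →
      seqW power₂ λ { (t₃≤ , refl , refl , refl) →
      seqW grows λ { (t₄≤ , L , refl , refl , refl , L≤ , N₀≤) →
      ⟪ (_ , _ , fits (≼-base (Grown.m≤B (grown L L≤)))) , total t₁≤ t₂≤ t₃≤ t₄≤ , L , refl , refl , refl ,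
          L≤ , N₀≤ ⟫ } } } }
      where
      total : ∀ {t₁ t₂ t₃ t₄} → t₁ ≤ k₀ * 10 + 3 + t → t₂ ≤ k₁ * 10 + 3 + t₁ → t₃ ≤ k₂ * 10 + 3 + t₂ →
          t₄ ≤ N₀ * 83 + 3 + t₃ →
              7 + t₄ ≤ powersTime + t
      total p₁ p₂ p₃ p₄ = ≤-trans (+-monoʳ-≤ 7 (≤-trans p₄ (+-monoʳ-≤ (N₀ * 83 + 3) (≤-trans p₃ (+-monoʳ-≤ (k₂ * 10 + 3)
          (≤-trans p₂ (+-monoʳ-≤ (k₁ * 10 + 3) p₁)))))))
        (≤-trans (≤-reflexive (arrange k₀ k₁ k₂ N₀ t))
            (+-monoˡ-≤ t (+-monoʳ-≤ ((k₀ + k₁ + k₂) * 10 + N₀ * 83) (≤ᵇ⇒≤ 19 30 _))))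
        where
        arrange : ∀ a b c d t → 7 + (d * 83 + 3 + (c * 10 + 3 + (b * 10 + 3 + (a * 10 + 3 + t)))) ≡
            (a + b + c) * 10 + d * 83 + 19 + t
        arrange = solve-∀

    module Tabulated (L : ℕ) (g : Grown S B L) where

      open Setting (setting L g) using (c; tab)

      fillsTable : ∀ k → k ≤ tableSize → ∀ {t μ o} →
        Wp (fillTable k) (λ t′ v′ μ′ o′ → t′ ≤ k * 14 + 1 + t × v′ ≡ Constants.globals c × o′ ≡ o ×
            (∀ {i} → i < k → μ′ i ≡ tab i))
          t (Constants.globals c) μ o
      fillsTable zero    k≤ = ⟪ ≤-refl , refl , refl , (λ ()) ⟫
      fillsTable (suc k) k< {t} = seqW (fillsTable k (<⇒≤ k<)) λ { {t₁} {μ = μ} (t₁≤ , refl , refl , filled) →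
        ⟪ address , ((pos< , (_ , neg< , fits product) , fits (≼-+ (≼-base pos≤) product)) , _)
        , <-≤-trans k< (≤-trans (m≤m+n tableSize _) (Grown.arrays≤S g))
        , total t₁≤ , refl , refl , extended filled ⟫ }
        where
        pos≤ : pos k ≤ B
        pos≤ = proj₁ (coefficients≤B k<)
        neg≤ : neg k ≤ B
        neg≤ = proj₂ (coefficients≤B k<)
        pos< : pos k < W
        pos< = fits (≼-base pos≤)
        neg< : neg k < W
        neg< = fits (≼-base neg≤)
        product : growth ^ L * neg k ≼ 2
        product = ≼-* (≼-base (≤-trans (n≤1+n _) (Grown.m≤B g))) (≼-base neg≤)
        address : k < W
        address = fits (≼-base (≤-trans (<⇒≤ k<) (≤-trans (m≤m+n tableSize _) (Grown.arrays≤B g))))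
        total : ∀ {t₁} → t₁ ≤ k * 14 + 1 + t → 14 + t₁ ≤ 14 + k * 14 + 1 + t
        total p = +-monoʳ-≤ 14 p
        extended : ∀ {μ} → (∀ {i} → i < k → μ i ≡ tab i) → ∀ {i} → i < suc k → (μ [ k ↦ tab k ]) i ≡ tab i
        extended {μ} filled {i} i≤k with i ≟ k
        ... | yes refl = upd-≡ μ k (tab k)
        ... | no i≢k   = trans (upd-≢ μ (tab k) i≢k) (filled (≤∧≢⇒< (≤-pred i≤k) i≢k))

    record Objective : Set where
      field
        countE : Exp 33
        τ₀E : Exp 34
        count τ₀ : ℕ
        τ₀+count≤B : τ₀ + count ≤ B
        count-value : ∀ L q v μ → ⟦ countE ⟧ (frame (constants n s M′ L) q v) μ ≡ count
        count-safe : ∀ L q v μ → Safe countE (frame (constants n s M′ L) q v) μ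
        τ₀-value : ∀ L k q v μ → ⟦ τ₀E ⟧ (k ∷ frame (constants n s M′ L) q v) μ ≡ τ₀
        τ₀-safe : ∀ L k q v μ → Safe τ₀E (k ∷ frame (constants n s M′ L) q v) μ

    module Mode (objective : Objective) where

      open Objective objective

      module Stage (L : ℕ) (g : Grown S B L) where
        open Labels X using (letters)
        open Searching (setting L g) countE τ₀E count τ₀ τ₀+count≤B using (Misses; Splits; module Solving) public
        open VerdictMeaning (setting L g) 1≤D identity (cong (_^ L) (cong (D *_) (*-assoc E E E))) using (split-verdict)
        open Solver (setting L g) using (vertices#)

        module _ (N₀≤β^L : N₀ ≤ β ^ L) where

          vertices≤ : ∀ p → vertices# p ≤ β ^ L
          vertices≤ zero             = N₀≤β^L
          vertices≤ (suc zero)       = ≤-trans (^-monoʳ-≤ M k₁≤k₀) N₀≤β^L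
          vertices≤ (suc (suc zero)) = ≤-trans (^-monoʳ-≤ M k₂≤k₀) N₀≤β^L

          splits : Splits
          splits τ α lo w p h _ = split-verdict vertices≤ τ α lo w p h

          open Solving (count-value L) (count-safe L) (τ₀-value L) (τ₀-safe L) splits using (Result; result; solveTime; solves) public

          Answer : List ℕ → Set
          Answer out = ∃[ τ ] ∃[ α ] ∃[ lo ]
            (out ≡ (encode (letters k₀ (lo zero)) ++ encode (letters k₁ (lo (suc zero)))) ++ encode
                (letters k₂ (lo (suc (suc zero))))
            × (Misses 0 ⊎ Result τ α lo))

      mainTime : ∀ L → Grown S B L → N₀ ≤ β ^ L → ℕ
      mainTime L g N₀≤ = Stage.solveTime L g N₀≤ + tableSize * 14 + powersTime + 300

      -- The lower bound on β^L makes the matrices large enough, while the upper bound means that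
      -- rounding up to a power of β costs only a constant factor.
      MainPost : ∀ {Γ} → Post Γ
      MainPost t′ v′ μ′ o′ = ∃[ L ] Σ (β ^ L ≤ β * N₀) λ L≤ → Σ (N₀ ≤ β ^ L) λ N₀≤ →
        t′ ≤ mainTime L (grown L L≤) N₀≤ × Stage.Answer L (grown L L≤) N₀≤ o′

      initialisedW : ∀ {t μ} → t ≤ 80 → Wp (initialised countE τ₀E) MainPost t (environment 1 1 1 0 1) μ []
      initialisedW {t} t≤ = seqW powersW λ { {t₁} (t₁≤ , L , refl , refl , refl , L≤ , N₀≤) →
        newAs (L * β) (_ , _ , fits (≼-base (Grown.LB≤B (grown L L≤)))) refl (seqW {Q = TablePost L L≤}
          (monoW (Tabulated.fillsTable L (grown L L≤) tableSize ≤-refl) λ (t₂≤ , rest) → t₂≤ , rest)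
          λ { {t₂} (t₂≤ , refl , refl , table) →
            newAs 0 _ refl (newAs 0 _ refl
                (newAs 0 _ refl (newAs 0 _ refl (newAs 0 _ refl (newAs 0 _ refl (newAs 0 _ refl
            (newAs ((2 ^ β) ^ L) _ refl (newAs ((2 ^ β) ^ L) _ refl (newAs ((2 ^ β) ^ L) _ refl (newAs 0 _ refl
              (monoW (Stage.solves L (grown L L≤) N₀≤ table)
                λ { (t₃≤ , τ , α , lo , out≡ , correct) → L , L≤ , N₀≤ , total {L} L≤ N₀≤ t₁≤ t₂≤ t₃≤ , τ ,
                    α , lo , out≡ , correct }))))))))))) }) }
        where
        TablePost : ∀ L → β ^ L ≤ β * N₀ → ∀ {t} → Post 22
        TablePost L L≤ {t} t′ v′ μ′ o′ = t′ ≤ tableSize * 14 + 1 + t ×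
            v′ ≡ Constants.globals (constants n s M′ L) × o′ ≡ []
          × (∀ {i} → i < tableSize → μ′ i ≡ residue (growth ^ L) pos neg i)
        total : ∀ {L} L≤ N₀≤ {t₁ t₂ t₃} → t₁ ≤ powersTime + t → t₂ ≤ tableSize * 14 + 1 + (5 + t₁) →
          t₃ ≤ Stage.solveTime L (grown L L≤) N₀≤ + (46 + t₂) → t₃ ≤ mainTime L (grown L L≤) N₀≤
        total {L} L≤ N₀≤ {t₁} {t₂} {t₃} p₁ p₂ p₃ = ≤-trans p₃ (≤-trans (+-monoʳ-≤ T₁ (+-monoʳ-≤ 46 (≤-trans p₂
            (+-monoʳ-≤ (tableSize * 14 + 1) (+-monoʳ-≤ 5 (≤-trans p₁ (+-monoʳ-≤ powersTime t≤)))))))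
          (≤-trans (≤-reflexive (arrange T₁ (tableSize * 14) powersTime))
              (+-monoʳ-≤ (T₁ + tableSize * 14 + powersTime) (≤ᵇ⇒≤ 132 300 _))))
          where
          T₁ : ℕ
          T₁ = Stage.solveTime L (grown L L≤) N₀≤
          arrange : ∀ a b p → a + (46 + (b + 1 + (5 + (p + 80)))) ≡ a + b + p + 132
          arrange = solve-∀

      mainW : Wp (main countE τ₀E) MainPost 0 (M ∷ s ∷ n ∷ []) (λ _ → 0) []
      mainW =
        newAs 1 1<W refl (newAs β (fits (≼-base β≤B)) refl (newAs E (fits (≼-base E≤B)) refl
        (newAs R (fits (≼-base R≤B)) refl (newAs tableSize (fits (≼-base tableSize≤B)) refl
        (newAs k₀ ((_ , fits (≼-lit 2) , fits (≼-+ (≼-base s≤B) (≼-lit 2))) , fits (≼-lit 3)) refl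
        (newAs k₁ ((_ , 1<W , fits (≼-+ (≼-base s≤B) (≼-lit 1))) , fits (≼-lit 3)) refl
        (newAs k₂ (_ , fits (≼-lit 3)) refl (newAs 1 _ refl (newAs 1 _ refl (newAs 1 _ refl
        (newAs 0 _ refl (newAs 1 _ refl (newAs 1 _ refl (newAs 1 _ refl (newAs 1 _ refl (newAs 1 _ refl
        (newAs (suc (n * s * s)) (_ , ((_ , _ , fits (≼-* (≼-base n≤B) (≼-base s≤B))) , _ ,
            fits (≼-≤ (n≤1+n _) (≼-base V≤B))) , fits (≼-base V≤B)) refl
          (initialisedW (≤ᵇ⇒≤ 53 80 _)))))))))))))))))))
        where
        β≤B : β ≤ B
        β≤B = ≤-trans (m≤m*n β β) E≤B
        tableSize≤B : tableSize ≤ B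
        tableSize≤B = ≤-trans (m≤m+n tableSize _)
            (Grown.arrays≤B (grown 0 (*-mono-≤ {1} {β} {1} {N₀} (s≤s z≤n) (m^n>0 M k₀))))

-- From straight-line programs to bilinear algorithms

-- The specification of a straight-line program is an equality of functions over ℚ. Its bilinear
-- part is extracted by comparing coefficients in a scaling factor, which is legitimate because a
-- polynomial that vanishes at all non-zero rationals has zero coefficients.
module Polynomials where
  open ℚSolver.+-*-Solver using (solve; _:+_; _:*_; _:-_; :-_; _:=_; con)

  evaluate : List ℚ → ℚ → ℚ
  evaluate []      t = 0ℚ
  evaluate (c ∷ l) t = c ℚ.+ t ℚ.* evaluate l t

  IsPolynomial : (ℚ → ℚ) → Set
  IsPolynomial f = ∃[ l ] (∀ t → f t ≡ evaluate l t)

  private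
    plus : List ℚ → List ℚ → List ℚ
    plus []      l       = l
    plus (c ∷ k) []      = c ∷ k
    plus (c ∷ k) (d ∷ l) = (c ℚ.+ d) ∷ plus k l

    plus-evaluate : ∀ k l t → evaluate (plus k l) t ≡ evaluate k t ℚ.+ evaluate l t
    plus-evaluate []      l       t = sym (ℚ.+-identityˡ _)
    plus-evaluate (c ∷ k) []      t = sym (ℚ.+-identityʳ _)
    plus-evaluate (c ∷ k) (d ∷ l) t = trans (cong (λ z → c ℚ.+ d ℚ.+ t ℚ.* z) (plus-evaluate k l t))
      (solve 5 (λ c d t x y → c :+ d :+ t :* (x :+ y) := c :+ t :* x :+ (d :+ t :* y)) refl c d t
          (evaluate k t) (evaluate l t))

    scale : ℚ → List ℚ → List ℚ
    scale c = List.map (c ℚ.*_)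

    scale-evaluate : ∀ c l t → evaluate (scale c l) t ≡ c ℚ.* evaluate l t
    scale-evaluate c []      t = sym (ℚ.*-zeroʳ c)
    scale-evaluate c (d ∷ l) t = trans (cong (λ z → c ℚ.* d ℚ.+ t ℚ.* z) (scale-evaluate c l t))
      (solve 4 (λ c d t x → c :* d :+ t :* (c :* x) := c :* (d :+ t :* x)) refl c d t (evaluate l t))

    multiply : List ℚ → List ℚ → List ℚ
    multiply []      l = []
    multiply (c ∷ k) l = plus (scale c l) (0ℚ ∷ multiply k l)

    multiply-evaluate : ∀ k l t → evaluate (multiply k l) t ≡ evaluate k t ℚ.* evaluate l t
    multiply-evaluate []      l t = sym (ℚ.*-zeroˡ (evaluate l t))
    multiply-evaluate (c ∷ k) l t = trans (plus-evaluate (scale c l) (0ℚ ∷ multiply k l) t)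
      (trans (cong₂ (λ x y → x ℚ.+ (0ℚ ℚ.+ t ℚ.* y)) (scale-evaluate c l t) (multiply-evaluate k l t))
        (solve 4 (λ c t x y → c :* x :+ (con 0ℚ :+ t :* (y :* x)) := (c :+ t :* y) :* x) refl c t
            (evaluate l t) (evaluate k t)))

  polynomial-const : ∀ c → IsPolynomial (λ _ → c)
  polynomial-const c = c ∷ [] , λ t → sym (trans (cong (c ℚ.+_) (ℚ.*-zeroʳ t)) (ℚ.+-identityʳ c))

  polynomial-t* : ∀ {f} → IsPolynomial f → IsPolynomial (λ t → t ℚ.* f t)
  polynomial-t* (l , eq) = 0ℚ ∷ l , λ t → trans (cong (t ℚ.*_) (eq t)) (sym (ℚ.+-identityˡ _))

  polynomial-+ : ∀ {f g} → IsPolynomial f → IsPolynomial g → IsPolynomial (λ t → f t ℚ.+ g t)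
  polynomial-+ (k , eq) (l , eq′) = plus k l , λ t → trans (cong₂ ℚ._+_ (eq t) (eq′ t)) (sym (plus-evaluate k l t))

  polynomial-* : ∀ {f g} → IsPolynomial f → IsPolynomial g → IsPolynomial (λ t → f t ℚ.* g t)
  polynomial-* (k , eq) (l , eq′) = multiply k l , λ t →
      trans (cong₂ ℚ._*_ (eq t) (eq′ t)) (sym (multiply-evaluate k l t))

  -- Arithmetic with the pair a, b is that of dual numbers; the polynomial remainder is the evidence
  -- that b is the linear coefficient.
  record Taylor (f : ℚ → ℚ) (a b : ℚ) : Set where
    constructor taylor
    field
      {rest} : ℚ → ℚ
      polynomial : IsPolynomial rest
      expansion : ∀ t → f t ≡ a ℚ.+ t ℚ.* (b ℚ.+ t ℚ.* rest t)

  taylor-const : ∀ c → Taylor (λ _ → c) c 0ℚ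
  taylor-const c = taylor (polynomial-const 0ℚ)
    λ t → solve 2 (λ c t → c := c :+ t :* (con 0ℚ :+ t :* con 0ℚ)) refl c t

  taylor-var : ∀ c → Taylor (λ t → t ℚ.* c) 0ℚ c
  taylor-var c = taylor (polynomial-const 0ℚ)
    λ t → solve 2 (λ c t → t :* c := con 0ℚ :+ t :* (c :+ t :* con 0ℚ)) refl c t

  taylor-+ : ∀ {f g a b a′ b′} → Taylor f a b → Taylor g a′ b′ → Taylor (λ t → f t ℚ.+ g t) (a ℚ.+ a′) (b ℚ.+ b′)
  taylor-+ {a = a} {b} {a′} {b′} (taylor {h} p eq) (taylor {h′} p′ eq′) = taylor (polynomial-+ p p′) λ t →
    trans (cong₂ ℚ._+_ (eq t) (eq′ t))
      (solve 7 (λ a b a′ b′ t x y → a :+ t :* (b :+ t :* x) :+ (a′ :+ t :* (b′ :+ t :* y))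
        := a :+ a′ :+ t :* (b :+ b′ :+ t :* (x :+ y))) refl a b a′ b′ t (h t) (h′ t))

  taylor-neg : ∀ {f a b} → Taylor f a b → Taylor (λ t → ℚ.- f t) (ℚ.- a) (ℚ.- b)
  taylor-neg {a = a} {b} (taylor {h} p eq) = taylor (polynomial-* (polynomial-const (ℚ.- 1ℚ)) p) λ t →
    trans (cong (λ z → ℚ.- z) (eq t))
      (solve 4 (λ a b t x → :- (a :+ t :* (b :+ t :* x)) := :- a :+ t :*
          (:- b :+ t :* (con (ℚ.- 1ℚ) :* x))) refl a b t (h t))

  taylor-* : ∀ {f g a b a′ b′} → Taylor f a b → Taylor g a′ b′ →
      Taylor (λ t → f t ℚ.* g t) (a ℚ.* a′) (a ℚ.* b′ ℚ.+ b ℚ.* a′)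
  taylor-* {a = a} {b} {a′} {b′} (taylor {h} p eq) (taylor {h′} p′ eq′) =
    taylor (polynomial-+ (polynomial-+ (polynomial-+ (polynomial-const (b ℚ.* b′))
        (polynomial-* (polynomial-const a) p′))
                            (polynomial-* (polynomial-const a′) p))
             (polynomial-t* (polynomial-+ (polynomial-+ (polynomial-* (polynomial-const b) p′)
                 (polynomial-* (polynomial-const b′) p))
               (polynomial-t* (polynomial-* p p′))))) λ t →
    trans (cong₂ ℚ._*_ (eq t) (eq′ t))
      (solve 7 (λ a b a′ b′ t x y → (a :+ t :* (b :+ t :* x)) :* (a′ :+ t :* (b′ :+ t :* y))
        := a :* a′ :+ t :* (a :* b′ :+ b :* a′ :+ t :*
            (b :* b′ :+ a :* y :+ a′ :* x :+ t :* (b :* y :+ b′ :* x :+ t :* (x :* y)))))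
        refl a b a′ b′ t (h t) (h′ t))

  *-cancel-0 : ∀ {x y} → x ≢ 0ℚ → x ℚ.* y ≡ 0ℚ → y ≡ 0ℚ
  *-cancel-0 {x} {y} x≢0 eq = begin
    y                          ≡⟨ ℚ.*-identityˡ y ⟨
    1ℚ ℚ.* y                   ≡⟨ cong (ℚ._* y) (ℚ.*-inverseˡ x) ⟨
    ℚ.1/ x ℚ.* x ℚ.* y         ≡⟨ ℚ.*-assoc (ℚ.1/ x) x y ⟩
    ℚ.1/ x ℚ.* (x ℚ.* y)       ≡⟨ cong (ℚ.1/ x ℚ.*_) eq ⟩
    ℚ.1/ x ℚ.* 0ℚ              ≡⟨ ℚ.*-zeroʳ (ℚ.1/ x) ⟩
    0ℚ                         ∎
    where
    open ≡-Reasoning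
    instance x-nonZero = ℚ.≢-nonZero x≢0

  fromℤ : ℤ → ℚ
  fromℤ z = ℚ.mkℚ z 0 (Coprimality.sym (Coprimality.1-coprimeTo ℤ.∣ z ∣))

  fromℤ-injective : ∀ {y z} → fromℤ y ≡ fromℤ z → y ≡ z
  fromℤ-injective eq = cong ℚ.ℚ.numerator eq

  fromℤ-+ : ∀ y z → fromℤ (y ℤ.+ z) ≡ fromℤ y ℚ.+ fromℤ z
  fromℤ-+ y z = ℚ.toℚᵘ-injective (ℚᵘ.≃-trans (ℚᵘ.*≡* (cong (ℤ._* ℤ.1ℤ)
    (sym (cong₂ ℤ._+_ (ℤ.*-identityʳ y) (ℤ.*-identityʳ z))))) (ℚᵘ.≃-sym (ℚ.toℚᵘ-homo-+ (fromℤ y) (fromℤ z))))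

  fromℤ-* : ∀ y z → fromℤ (y ℤ.* z) ≡ fromℤ y ℚ.* fromℤ z
  fromℤ-* y z = ℚ.toℚᵘ-injective (ℚᵘ.≃-trans (ℚᵘ.*≡* refl) (ℚᵘ.≃-sym (ℚ.toℚᵘ-homo-* (fromℤ y) (fromℤ z))))

  private
    two : ℚ
    two = 1ℚ ℚ.+ 1ℚ

    -- The polynomial (k + 1) l(2 t) - l(t), whose coefficients are non-zero
    -- multiples of those of l.
    twist : ℕ → List ℚ → List ℚ
    twist k []      = []
    twist k (c ∷ l) = fromℤ (+ k) ℚ.* c ∷ twist (suc (k + k)) l

    twist-evaluate : ∀ k l t → evaluate (twist k l) t ≡ (1ℚ ℚ.+ fromℤ (+ k)) ℚ.* evaluate l (two ℚ.* t) ℚ.- evaluate l t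
    twist-evaluate k []      t = sym (trans (cong (ℚ._- 0ℚ) (ℚ.*-zeroʳ (1ℚ ℚ.+ fromℤ (+ k)))) refl)
    twist-evaluate k (c ∷ l) t = trans (cong (λ z → fromℤ (+ k) ℚ.* c ℚ.+ t ℚ.* z)
        (trans (twist-evaluate (suc (k + k)) l t)
        (cong (λ z → (1ℚ ℚ.+ z) ℚ.* evaluate l (two ℚ.* t) ℚ.- evaluate l t)
            (trans (fromℤ-+ (+ 1) (+ (k + k))) (cong (1ℚ ℚ.+_) (fromℤ-+ (+ k) (+ k)))))))
      (solve 5 (λ k c t x y → k :* c :+ t :* ((con 1ℚ :+ (con 1ℚ :+ (k :+ k))) :* x :- y)
        := (con 1ℚ :+ k) :* (c :+ con two :* t :* x) :- (c :+ t :* y)) refl (fromℤ (+ k)) c t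
            (evaluate l (two ℚ.* t)) (evaluate l t))

    untwist : ∀ k l → ListAll.All (_≡ 0ℚ) (twist (suc k) l) → ListAll.All (_≡ 0ℚ) l
    untwist k []      [] = []
    untwist k (c ∷ l) (z ∷ zs) = *-cancel-0 {fromℤ (+ suc k)} {c} (λ eq → case cong ℚ.ℚ.numerator eq of λ ()) z ∷ untwist _ l zs

    twist-length : ∀ k l → List.length (twist k l) ≡ List.length l
    twist-length k []      = refl
    twist-length k (c ∷ l) = cong suc (twist-length _ l)

    zeros-evaluate : ∀ {l} t → ListAll.All (_≡ 0ℚ) l → evaluate l t ≡ 0ℚ
    zeros-evaluate t [] = refl
    zeros-evaluate t (refl ∷ zs) = trans (cong (λ z → 0ℚ ℚ.+ t ℚ.* z) (zeros-evaluate t zs))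
        (trans (ℚ.+-identityˡ _) (ℚ.*-zeroʳ t))

  -- For f = c + t l the difference f(2t) - f(t) has no constant term. Dividing it by t leaves
  -- `twist 1 l`, which is shorter and vanishes again; by induction all coefficients of l are zero,
  -- and then c is.
  vanishing : ∀ n l → List.length l ≡ n → (∀ t → t ≢ 0ℚ → evaluate l t ≡ 0ℚ) → ListAll.All (_≡ 0ℚ) l
  vanishing zero    []      _   _ = []
  vanishing (suc n) (c ∷ l) len v = c≡0 ∷ zs
    where
    open ≡-Reasoning
    two*≢0 : ∀ t → t ≢ 0ℚ → two ℚ.* t ≢ 0ℚ
    two*≢0 t t≢0 eq = t≢0 (*-cancel-0 {two} {t} (λ ()) eq)
    twisted : ∀ t → t ≢ 0ℚ → evaluate (twist 1 l) t ≡ 0ℚ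
    twisted t t≢0 = *-cancel-0 t≢0 (begin
      t ℚ.* evaluate (twist 1 l) t ≡⟨ cong (t ℚ.*_) (twist-evaluate 1 l t) ⟩
      t ℚ.* (two ℚ.* evaluate l (two ℚ.* t) ℚ.- evaluate l t)
        ≡⟨ solve 4 (λ c t x y → t :* (con two :* x :- y) := (c :+ con two :* t :* x) :-
            (c :+ t :* y)) refl c t (evaluate l (two ℚ.* t)) (evaluate l t) ⟩
      evaluate (c ∷ l) (two ℚ.* t) ℚ.- evaluate (c ∷ l) t ≡⟨ cong₂ ℚ._-_ (v (two ℚ.* t) (two*≢0 t t≢0)) (v t t≢0) ⟩
      0ℚ ∎)
    zs : ListAll.All (_≡ 0ℚ) l
    zs = untwist 0 l (vanishing n (twist 1 l) (trans (twist-length 1 l) (suc-injective len)) twisted)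
    c≡0 : c ≡ 0ℚ
    c≡0 = trans (sym (trans (cong (λ z → c ℚ.+ 1ℚ ℚ.* z) (zeros-evaluate 1ℚ zs)) (ℚ.+-identityʳ c))) (v 1ℚ (λ ()))

  -- The expansion minus t P is a polynomial that vanishes everywhere, and b - P is its coefficient
  -- at t.
  taylor-linear : ∀ {f a b} → Taylor f a b → ∀ P → (∀ t → f t ≡ t ℚ.* P) → b ≡ P
  taylor-linear {f} {a} {b} (taylor {h} (l , h≡) eq) P linear =
    second (vanishing _ (a ∷ b ℚ.- P ∷ l) refl λ t _ → begin
      a ℚ.+ t ℚ.* (b ℚ.- P ℚ.+ t ℚ.* evaluate l t) ≡⟨ cong (λ z → a ℚ.+ t ℚ.* (b ℚ.- P ℚ.+ t ℚ.* z)) (h≡ t) ⟨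
      a ℚ.+ t ℚ.* (b ℚ.- P ℚ.+ t ℚ.* h t)
        ≡⟨ solve 5 (λ a b p t x → a :+ t :* (b :- p :+ t :* x) := (a :+ t :* (b :+ t :* x)) :- t :* p) refl
            a b P t (h t) ⟩
      (a ℚ.+ t ℚ.* (b ℚ.+ t ℚ.* h t)) ℚ.- t ℚ.* P ≡⟨ cong (ℚ._- t ℚ.* P) (trans (sym (eq t)) (linear t)) ⟩
      t ℚ.* P ℚ.- t ℚ.* P ≡⟨ ℚ.+-inverseʳ (t ℚ.* P) ⟩
      0ℚ ∎)
    where
    open ≡-Reasoning
    second : ListAll.All (_≡ 0ℚ) (a ∷ b ℚ.- P ∷ l) → b ≡ P
    second (_ ∷ b-P≡0 ∷ _) = begin
      b                     ≡⟨ solve 2 (λ b p → b := b :- p :+ p) refl b P ⟩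
      b ℚ.- P ℚ.+ P         ≡⟨ cong (ℚ._+ P) b-P≡0 ⟩
      0ℚ ℚ.+ P              ≡⟨ ℚ.+-identityˡ P ⟩
      P                     ∎

dot : ∀ {k} → Vec ℚ k → Vec ℚ k → Vec ℚ k → ℚ
dot []      []      []      = 0ℚ
dot (w ∷ ws) (a ∷ as) (b ∷ bs) = w ℚ.* a ℚ.* b ℚ.+ dot ws as bs

∑-scaled : ∀ n t (f h : Fin n → ℚ) → (∀ k → h k ≡ t ℚ.* f k) → ∑ h ≡ t ℚ.* ∑ f
∑-scaled zero    t f h eq = sym (ℚ.*-zeroʳ t)
∑-scaled (suc n) t f h eq = trans (cong₂ ℚ._+_ (eq zero) (∑-scaled n t (f ∘ suc) (h ∘ suc) (eq ∘ suc)))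
  (sym (ℚ.*-distribˡ-+ t (f zero) (∑ (f ∘ suc))))

-- The part of a straight-line program that is linear in A and linear in B
-- needs at most two products of linear forms per instruction.
module Bilinear {N : ℕ} where
  open Polynomials using (Taylor; taylor-const; taylor-var; taylor-+; taylor-neg; taylor-*; taylor-linear)
  open ℚSolver.+-*-Solver using (solve; _:+_; _:*_; _:-_; _:=_; con)

  private
    variable
      g : ℕ

  zeroMatrix : Matrix N
  zeroMatrix _ _ = 0ℚ

  scaled : ℚ → Matrix N → Matrix N
  scaled t A i j = t ℚ.* A i j

  product-rule : ArithOp → (x x′ y y′ : ℚ) → ℚ
  product-rule add x x′ y y′ = x′ ℚ.+ y′
  product-rule sub x x′ y y′ = x′ ℚ.- y′
  product-rule mul x x′ y y′ = x ℚ.* y′ ℚ.+ x′ ℚ.* y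

  -- The mixed derivative of an operation. For `mul`, the factors x and y are constants of the
  -- program, so xB yA and xA yB are the only products of two linear forms that it adds.
  second-rule : ArithOp → (x xA xB xAB y yA yB yAB : ℚ) → ℚ
  second-rule add x xA xB xAB y yA yB yAB = xAB ℚ.+ yAB
  second-rule sub x xA xB xAB y yA yB yAB = xAB ℚ.- yAB
  second-rule mul x xA xB xAB y yA yB yAB =
    (x ℚ.* yAB ℚ.+ xB ℚ.* yA) ℚ.+ (xA ℚ.* yB ℚ.+ xAB ℚ.* y)

  operand : (a b : Matrix N) (k : ℚ → ℚ) → Vec ℚ g → Operand N g → ℚ
  operand a b k vs (entryA i j) = a i j
  operand a b k vs (entryB i j) = b i j
  operand a b k vs (scalar c)   = k c
  operand a b k vs (result r)   = lookup vs r

  none : ℚ → ℚ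
  none _ = 0ℚ

  -- Coefficients at A = 0 and B = 0: at0 of A⁰, dA of A¹, dB of A⁰ B¹, dAB of A¹ B¹.
  at0 : Matrix N → SLP N g → Vec ℚ g
  at0 B P = results zeroMatrix B P

  at0ᵒ : Matrix N → SLP N g → Operand N g → ℚ
  at0ᵒ B P = value zeroMatrix B (at0 B P)

  dA : (A B : Matrix N) → SLP N g → Vec ℚ g
  dAᵒ : (A B : Matrix N) → SLP N g → Operand N g → ℚ
  dA A B []              = []
  dA A B (P ▷ a ⟨ ⊙ ⟩ b) = product-rule ⊙ (at0ᵒ B P a) (dAᵒ A B P a) (at0ᵒ B P b) (dAᵒ A B P b) ∷ dA A B P
  dAᵒ A B P = operand A zeroMatrix none (dA A B P)

  dB : Matrix N → SLP N g → Vec ℚ g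
  dBᵒ : Matrix N → SLP N g → Operand N g → ℚ
  dB B []              = []
  dB B (P ▷ a ⟨ ⊙ ⟩ b) = product-rule ⊙ (at0ᵒ zeroMatrix P a) (dBᵒ B P a) (at0ᵒ zeroMatrix P b) (dBᵒ B P b) ∷ dB B P
  dBᵒ B P = operand zeroMatrix B none (dB B P)

  dAB : (A B : Matrix N) → SLP N g → Vec ℚ g
  dABᵒ : (A B : Matrix N) → SLP N g → Operand N g → ℚ
  dAB A B []              = []
  dAB A B (P ▷ a ⟨ ⊙ ⟩ b) = second-rule ⊙
    (at0ᵒ zeroMatrix P a) (dAᵒ A zeroMatrix P a) (dBᵒ B P a) (dABᵒ A B P a)
    (at0ᵒ zeroMatrix P b) (dAᵒ A zeroMatrix P b) (dBᵒ B P b) (dABᵒ A B P b) ∷ dAB A B P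
  dABᵒ A B P = operand zeroMatrix zeroMatrix none (dAB A B P)

  private
    taylor-product : ∀ ⊙ {f h a b a′ b′} → Taylor f a b → Taylor h a′ b′ →
      Taylor (λ t → ⟦ ⊙ ⟧ᵃ (f t) (h t)) (⟦ ⊙ ⟧ᵃ a a′) (product-rule ⊙ a b a′ b′)
    taylor-product add p q = taylor-+ p q
    taylor-product sub p q = taylor-+ p (taylor-neg q)
    taylor-product mul p q = taylor-* p q

    taylor-second : ∀ ⊙ {x x′ y y′ xC xB xA xAB yC yB yA yAB} →
      Taylor x xC xB → Taylor x′ xA xAB → Taylor y yC yB → Taylor y′ yA yAB →
      Taylor (λ u → product-rule ⊙ (x u) (x′ u) (y u) (y′ u)) (product-rule ⊙ xC xA yC yA)
        (second-rule ⊙ xC xA xB xAB yC yA yB yAB)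
    taylor-second add _ p _ q = taylor-+ p q
    taylor-second sub _ p _ q = taylor-+ p (taylor-neg q)
    taylor-second mul p p′ q q′ = taylor-+ (taylor-* p q′) (taylor-* p′ q)

  taylor-A : ∀ (A B : Matrix N) (P : SLP N g) k →
    Taylor (λ t → lookup (results (scaled t A) B P) k) (lookup (at0 B P) k) (lookup (dA A B P) k)
  taylor-Aᵒ : ∀ (A B : Matrix N) (P : SLP N g) a →
    Taylor (λ t → value (scaled t A) B (results (scaled t A) B P) a) (at0ᵒ B P a) (dAᵒ A B P a)
  taylor-A A B (P ▷ a ⟨ ⊙ ⟩ b) zero    = taylor-product ⊙ (taylor-Aᵒ A B P a) (taylor-Aᵒ A B P b)
  taylor-A A B (P ▷ a ⟨ ⊙ ⟩ b) (suc k) = taylor-A A B P k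
  taylor-Aᵒ A B P (entryA i j) = taylor-var (A i j)
  taylor-Aᵒ A B P (entryB i j) = taylor-const (B i j)
  taylor-Aᵒ A B P (scalar c)   = taylor-const c
  taylor-Aᵒ A B P (result k)   = taylor-A A B P k

  taylor-B : ∀ (B : Matrix N) (P : SLP N g) k →
    Taylor (λ u → lookup (at0 (scaled u B) P) k) (lookup (at0 zeroMatrix P) k) (lookup (dB B P) k)
  taylor-Bᵒ : ∀ (B : Matrix N) (P : SLP N g) a →
    Taylor (λ u → at0ᵒ (scaled u B) P a) (at0ᵒ zeroMatrix P a) (dBᵒ B P a)
  taylor-B B (P ▷ a ⟨ ⊙ ⟩ b) zero    = taylor-product ⊙ (taylor-Bᵒ B P a) (taylor-Bᵒ B P b)
  taylor-B B (P ▷ a ⟨ ⊙ ⟩ b) (suc k) = taylor-B B P k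
  taylor-Bᵒ B P (entryA i j) = taylor-const 0ℚ
  taylor-Bᵒ B P (entryB i j) = taylor-var (B i j)
  taylor-Bᵒ B P (scalar c)   = taylor-const c
  taylor-Bᵒ B P (result k)   = taylor-B B P k

  taylor-AB : ∀ (A B : Matrix N) (P : SLP N g) k →
    Taylor (λ u → lookup (dA A (scaled u B) P) k) (lookup (dA A zeroMatrix P) k) (lookup (dAB A B P) k)
  taylor-ABᵒ : ∀ (A B : Matrix N) (P : SLP N g) a →
    Taylor (λ u → dAᵒ A (scaled u B) P a) (dAᵒ A zeroMatrix P a) (dABᵒ A B P a)
  taylor-AB A B (P ▷ a ⟨ ⊙ ⟩ b) zero    =
    taylor-second ⊙ (taylor-Bᵒ B P a) (taylor-ABᵒ A B P a) (taylor-Bᵒ B P b) (taylor-ABᵒ A B P b)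
  taylor-AB A B (P ▷ a ⟨ ⊙ ⟩ b) (suc k) = taylor-AB A B P k
  taylor-ABᵒ A B P (entryA i j) = taylor-const (A i j)
  taylor-ABᵒ A B P (entryB i j) = taylor-const 0ℚ
  taylor-ABᵒ A B P (scalar c)   = taylor-const 0ℚ
  taylor-ABᵒ A B P (result k)   = taylor-AB A B P k

  -- The A-factors of the two products in `second-rule`, listed for every instruction to keep the
  -- length uniform; additions and subtractions give them weight 0.
  formsA : Matrix N → SLP N g → Vec ℚ (g * 2)
  formsA A []              = []
  formsA A (P ▷ a ⟨ ⊙ ⟩ b) = dAᵒ A zeroMatrix P a ∷ dAᵒ A zeroMatrix P b ∷ formsA A P

  formsB : Matrix N → SLP N g → Vec ℚ (g * 2)
  formsB B []              = []
  formsB B (P ▷ a ⟨ ⊙ ⟩ b) = dBᵒ B P b ∷ dBᵒ B P a ∷ formsB B P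

  linear : ∀ {k} → ℚ → Vec ℚ k → ℚ → Vec ℚ k → Vec ℚ k
  linear c u d v = zipWith (λ x y → c ℚ.* x ℚ.+ d ℚ.* y) u v

  instruction-weights : ArithOp → (x y : ℚ) → ∀ {k} → (u v : Vec ℚ k) → Vec ℚ (2 + k)
  instruction-weights add x y u v = 0ℚ ∷ 0ℚ ∷ linear 1ℚ u 1ℚ v
  instruction-weights sub x y u v = 0ℚ ∷ 0ℚ ∷ linear 1ℚ u (ℚ.- 1ℚ) v
  instruction-weights mul x y u v = 1ℚ ∷ 1ℚ ∷ linear y u x v

  weights : SLP N g → Vec (Vec ℚ (g * 2)) g
  weightsᵒ : SLP N g → Operand N g → Vec ℚ (g * 2)
  weights []              = []
  weights (P ▷ a ⟨ ⊙ ⟩ b) =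
    instruction-weights ⊙ (at0ᵒ zeroMatrix P a) (at0ᵒ zeroMatrix P b) (weightsᵒ P a) (weightsᵒ P b)
      ∷ Vec.map (λ w → 0ℚ ∷ 0ℚ ∷ w) (weights P)
  weightsᵒ P (result k) = lookup (weights P) k
  weightsᵒ P _          = Vec.replicate _ 0ℚ

  private
    dot-linear : ∀ {k} c (u : Vec ℚ k) d v as bs → dot (linear c u d v) as bs ≡ c ℚ.* dot u as bs ℚ.+ d ℚ.* dot v as bs
    dot-linear c []      d []      []       []       = solve 2 (λ c d → con 0ℚ := c :* con 0ℚ :+ d :* con 0ℚ) refl c d
    dot-linear c (x ∷ u) d (y ∷ v) (a ∷ as) (b ∷ bs) = trans
      (cong (λ z → (c ℚ.* x ℚ.+ d ℚ.* y) ℚ.* a ℚ.* b ℚ.+ z) (dot-linear c u d v as bs))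
      (solve 8 (λ c x d y a b p q → (c :* x :+ d :* y) :* a :* b :+ (c :* p :+ d :* q)
        := c :* (x :* a :* b :+ p) :+ d :* (y :* a :* b :+ q)) refl c x d y a b (dot u as bs) (dot v as bs))

    dot-zeros : ∀ {k} (as bs : Vec ℚ k) → dot (Vec.replicate k 0ℚ) as bs ≡ 0ℚ
    dot-zeros []       []       = refl
    dot-zeros (a ∷ as) (b ∷ bs) = trans (cong (λ z → 0ℚ ℚ.* a ℚ.* b ℚ.+ z) (dot-zeros as bs))
      (solve 2 (λ a b → con 0ℚ :* a :* b :+ con 0ℚ := con 0ℚ) refl a b)

    dot-00 : ∀ {k} a b a′ b′ (w as bs : Vec ℚ k) → dot (0ℚ ∷ 0ℚ ∷ w) (a ∷ a′ ∷ as) (b ∷ b′ ∷ bs) ≡ dot w as bs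
    dot-00 a b a′ b′ w as bs = solve 5 (λ a b a′ b′ x →
        con 0ℚ :* a :* b :+ (con 0ℚ :* a′ :* b′ :+ x) := x) refl a b a′ b′ (dot w as bs)

    dot-instruction : ∀ ⊙ x y {k} (u v as bs : Vec ℚ k) xA xB yA yB →
      dot (instruction-weights ⊙ x y u v) (xA ∷ yA ∷ as) (yB ∷ xB ∷ bs)
        ≡ second-rule ⊙ x xA xB (dot u as bs) y yA yB (dot v as bs)
    dot-instruction add x y u v as bs xA xB yA yB = trans (dot-00 xA yB yA xB (linear 1ℚ u 1ℚ v) as bs)
      (trans (dot-linear 1ℚ u 1ℚ v as bs) (cong₂ ℚ._+_ (ℚ.*-identityˡ (dot u as bs)) (ℚ.*-identityˡ (dot v as bs))))
    dot-instruction sub x y u v as bs xA xB yA yB = trans (dot-00 xA yB yA xB (linear 1ℚ u (ℚ.- 1ℚ) v) as bs)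
      (trans (dot-linear 1ℚ u (ℚ.- 1ℚ) v as bs)
        (solve 2 (λ p q → con 1ℚ :* p :+ con (ℚ.- 1ℚ) :* q := p :- q) refl (dot u as bs) (dot v as bs)))
    dot-instruction mul x y u v as bs xA xB yA yB = trans
      (cong (λ z → 1ℚ ℚ.* xA ℚ.* yB ℚ.+ (1ℚ ℚ.* yA ℚ.* xB ℚ.+ z)) (dot-linear y u x v as bs))
      (solve 8 (λ x y xA xB yA yB p q → con 1ℚ :* xA :* yB :+ (con 1ℚ :* yA :* xB :+ (y :* p :+ x :* q))
        := (x :* q :+ xB :* yA) :+ (xA :* yB :+ p :* y)) refl x y xA xB yA yB (dot u as bs) (dot v as bs))

  dAB-dot : ∀ (A B : Matrix N) (P : SLP N g) k → lookup (dAB A B P) k ≡ dot (lookup (weights P) k)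
      (formsA A P) (formsB B P)
  dAB-dotᵒ : ∀ (A B : Matrix N) (P : SLP N g) a → dABᵒ A B P a ≡ dot (weightsᵒ P a) (formsA A P) (formsB B P)
  dAB-dot A B (P ▷ a ⟨ ⊙ ⟩ b) zero = sym (trans
    (dot-instruction ⊙ _ _ (weightsᵒ P a) (weightsᵒ P b) (formsA A P) (formsB B P) _ _ _ _)
    (cong₂ (λ p q → second-rule ⊙ (at0ᵒ zeroMatrix P a) (dAᵒ A zeroMatrix P a) (dBᵒ B P a) p
                                  (at0ᵒ zeroMatrix P b) (dAᵒ A zeroMatrix P b) (dBᵒ B P b) q)
      (sym (dAB-dotᵒ A B P a)) (sym (dAB-dotᵒ A B P b))))
  dAB-dot A B (P ▷ a ⟨ ⊙ ⟩ b) (suc k) = trans (dAB-dot A B P k)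
    (sym (trans (cong (λ w → dot w (formsA A (P ▷ a ⟨ ⊙ ⟩ b)) (formsB B (P ▷ a ⟨ ⊙ ⟩ b))) (lookup-map k _ (weights P)))
      (dot-00 (dAᵒ A zeroMatrix P a) (dBᵒ B P b) (dAᵒ A zeroMatrix P b) (dBᵒ B P a) (lookup (weights P) k)
          (formsA A P) (formsB B P))))
  dAB-dotᵒ A B P (entryA i j) = sym (dot-zeros (formsA A P) (formsB B P))
  dAB-dotᵒ A B P (entryB i j) = sym (dot-zeros (formsA A P) (formsB B P))
  dAB-dotᵒ A B P (scalar c)   = sym (dot-zeros (formsA A P) (formsB B P))
  dAB-dotᵒ A B P (result k)   = dAB-dot A B P k

  private
    ·-scaledˡ : ∀ t A B i j → (scaled t A · B) i j ≡ t ℚ.* (A · B) i j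
    ·-scaledˡ t A B i j = ∑-scaled N t (λ k → A i k ℚ.* B k j) _ λ k → ℚ.*-assoc t (A i k) (B k j)

    ·-scaledʳ : ∀ t A B i j → (A · scaled t B) i j ≡ t ℚ.* (A · B) i j
    ·-scaledʳ t A B i j = ∑-scaled N t (λ k → A i k ℚ.* B k j) _ λ k →
      solve 3 (λ a t b → a :* (t :* b) := t :* (a :* b)) refl (A i k) t (B k j)

  -- Scaling A by t and B by u scales the product by t u. The coefficient at t u of the program is
  -- `dAB`, so this must be the product itself.
  bilinear : ∀ (P : SLP N g) (out : Operand N g) i j →
    (∀ A B → value A B (results A B P) out ≡ (A · B) i j) →
    ∀ A B → dot (weightsᵒ P out) (formsA A P) (formsB B P) ≡ (A · B) i j
  bilinear P out i j spec A B = trans (sym (dAB-dotᵒ A B P out))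
    (taylor-linear (taylor-ABᵒ A B P out) ((A · B) i j) λ u →
      trans (taylor-linear (taylor-Aᵒ A (scaled u B) P out) ((A · scaled u B) i j) λ t →
        trans (spec (scaled t A) (scaled u B)) (·-scaledˡ t A (scaled u B) i j)) (·-scaledʳ u A B i j))

-- Matrix units

kronecker : ∀ {n} → Fin n → Fin n → ℚ
kronecker zero    zero    = 1ℚ
kronecker zero    (suc j) = 0ℚ
kronecker (suc i) zero    = 0ℚ
kronecker (suc i) (suc j) = kronecker i j

kronecker-agrees : ∀ {n} (i j : Fin n) → kronecker i j ≡ Polynomials.fromℤ (+ agrees (toℕ i) (toℕ j))
kronecker-agrees zero    zero    = refl
kronecker-agrees zero    (suc j) = refl
kronecker-agrees (suc i) zero    = refl
kronecker-agrees (suc i) (suc j) = kronecker-agrees i j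

kronecker-refl : ∀ {n} (i : Fin n) → kronecker i i ≡ 1ℚ
kronecker-refl zero    = refl
kronecker-refl (suc i) = kronecker-refl i

kronecker-≡ : ∀ {n} (i j : Fin n) → kronecker i j ≢ 0ℚ → i ≡ j
kronecker-≡ zero    zero    ne = refl
kronecker-≡ zero    (suc j) ne = contradiction refl ne
kronecker-≡ (suc i) zero    ne = contradiction refl ne
kronecker-≡ (suc i) (suc j) ne = cong suc (kronecker-≡ i j ne)

∑-kronecker : ∀ {n} (i : Fin n) (f : Fin n → ℚ) → ∑ (λ k → kronecker i k ℚ.* f k) ≡ f i
∑-kronecker {suc n} zero    f = trans (cong₂ ℚ._+_ (ℚ.*-identityˡ (f zero))
    (trans (∑-scaled n 0ℚ (f ∘ suc) _ (λ k → refl)) (ℚ.*-zeroˡ (∑ (f ∘ suc)))))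
  (ℚ.+-identityʳ (f zero))
∑-kronecker {suc n} (suc i) f = trans (cong₂ ℚ._+_ (ℚ.*-zeroˡ (f zero)) (∑-kronecker i (f ∘ suc)))
    (ℚ.+-identityˡ (f (suc i)))

unit : ∀ {N} → Fin N → Fin N → Matrix N
unit i j a b = kronecker i a ℚ.* kronecker j b

unit-· : ∀ {N} (i j k l a b : Fin N) →
  (unit i j · unit k l) a b ≡ kronecker j k ℚ.* kronecker l b ℚ.* kronecker i a
unit-· {N} i j k l a b = begin
  ∑ (λ x → kronecker i a ℚ.* kronecker j x ℚ.* (kronecker k x ℚ.* kronecker l b))
    ≡⟨ ∑-scaled N (kronecker i a ℚ.* kronecker l b) (λ x → kronecker j x ℚ.* kronecker k x) _
         (λ x → solve 4 (λ p q r s → p :* q :* (r :* s) := p :* s :* (q :* r)) refl (kronecker i a)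
             (kronecker j x) (kronecker k x) (kronecker l b)) ⟩
  kronecker i a ℚ.* kronecker l b ℚ.* ∑ (λ x → kronecker j x ℚ.* kronecker k x)
    ≡⟨ cong (kronecker i a ℚ.* kronecker l b ℚ.*_) (∑-kronecker j (kronecker k)) ⟩
  kronecker i a ℚ.* kronecker l b ℚ.* kronecker k j
    ≡⟨ cong (kronecker i a ℚ.* kronecker l b ℚ.*_) (symmetric k j) ⟩
  kronecker i a ℚ.* kronecker l b ℚ.* kronecker j k
    ≡⟨ solve 3 (λ p q r → p :* q :* r := r :* q :* p) refl (kronecker i a) (kronecker l b) (kronecker j k) ⟩
  kronecker j k ℚ.* kronecker l b ℚ.* kronecker i a ∎
  where
  open ≡-Reasoning
  open ℚSolver.+-*-Solver using (solve; _:*_; _:=_)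
  symmetric : ∀ {n} (i j : Fin n) → kronecker i j ≡ kronecker j i
  symmetric zero    zero    = refl
  symmetric zero    (suc j) = refl
  symmetric (suc i) zero    = refl
  symmetric (suc i) (suc j) = symmetric i j

-- Different entries of a product are different results, so N² instructions are needed.
module _ {N g : ℕ} (P : SLP N g) (out : Fin N → Fin N → Operand N g)
  (spec : ∀ A B i j → value A B (results A B P) (out i j) ≡ (A · B) i j) where
  open Bilinear {N} using (zeroMatrix)

  private
    one-entry : ∀ i j → (unit i i · unit i j) i j ≡ 1ℚ
    one-entry i j = trans (unit-· {N} i i i j i j)
      (cong₂ ℚ._*_ (cong₂ ℚ._*_ (kronecker-refl i) (kronecker-refl j)) (kronecker-refl i))

    zero-· : ∀ B i j → (zeroMatrix · B) i j ≡ 0ℚ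
    zero-· B i j = trans (∑-scaled N 0ℚ (λ k → B k j) (λ k → 0ℚ ℚ.* B k j) (λ k → refl)) (ℚ.*-zeroˡ (∑ (λ k → B k j)))

    ·-zero : ∀ A i j → (A · zeroMatrix) i j ≡ 0ℚ
    ·-zero A i j = trans (∑-scaled N 0ℚ (λ k → A i k) (λ k → A i k ℚ.* 0ℚ) (λ k → ℚ.*-comm (A i k) 0ℚ))
        (ℚ.*-zeroˡ (∑ (λ k → A i k)))

  -- An input entry is excluded by multiplying the all-ones matrix with the zero matrix, from either
  -- side; a scalar would have to be both 0 and 1.
  out-result : ∀ i j → ∃[ k ] out i j ≡ result k
  out-result i j = go (out i j) refl
    where
    go : ∀ a → out i j ≡ a → ∃[ k ] out i j ≡ result k
    go (entryA a b) eq = contradiction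
      (trans (sym (cong (value (λ _ _ → 1ℚ) zeroMatrix (results (λ _ _ → 1ℚ) zeroMatrix P)) eq))
          (trans (spec (λ _ _ → 1ℚ) zeroMatrix i j) (·-zero (λ _ _ → 1ℚ) i j))) λ ()
    go (entryB a b) eq = contradiction
      (trans (sym (cong (value zeroMatrix (λ _ _ → 1ℚ) (results zeroMatrix (λ _ _ → 1ℚ) P)) eq))
          (trans (spec zeroMatrix (λ _ _ → 1ℚ) i j) (zero-· (λ _ _ → 1ℚ) i j))) λ ()
    go (scalar c) eq = contradiction (trans (sym (trans (is-c (unit i i) (unit i j)) (one-entry i j)))
        (trans (is-c zeroMatrix zeroMatrix) (zero-· zeroMatrix i j))) λ ()
      where
      is-c : ∀ A B → c ≡ (A · B) i j
      is-c A B = trans (sym (cong (value A B (results A B P)) eq)) (spec A B i j)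
    go (result k) eq = k , eq

  N²≤g : N * N ≤ g
  N²≤g = injective⇒≤ {f = λ x → proj₁ (out-result (proj₁ (remQuot {N} N x)) (proj₂ (remQuot {N} N x)))} inj
    where
    inj : ∀ {x y} → proj₁ (out-result (proj₁ (remQuot {N} N x)) (proj₂ (remQuot {N} N x)))
                  ≡ proj₁ (out-result (proj₁ (remQuot {N} N y)) (proj₂ (remQuot {N} N y))) → x ≡ y
    inj {x} {y} eq = trans (sym (combine-remQuot {N} N x)) (trans (cong₂ combine i≡k j≡l) (combine-remQuot {N} N y))
      where
      i = proj₁ (remQuot {N} N x)
      j = proj₂ (remQuot {N} N x)
      k = proj₁ (remQuot {N} N y)
      l = proj₂ (remQuot {N} N y)
      same : out i j ≡ out k l
      same = trans (proj₂ (out-result i j)) (trans (cong result eq) (sym (proj₂ (out-result k l))))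
      both : 1ℚ ≡ kronecker i i ℚ.* kronecker j l ℚ.* kronecker i k
      both = trans (sym (one-entry i j)) (trans (sym (spec (unit i i) (unit i j) i j))
        (trans (cong (value (unit i i) (unit i j) (results (unit i i) (unit i j) P)) same)
          (trans (spec (unit i i) (unit i j) k l) (unit-· {N} i i i j k l))))
      i≡k : i ≡ k
      i≡k = kronecker-≡ i k λ z →
          contradiction (trans both (trans (cong (kronecker i i ℚ.* kronecker j l ℚ.*_) z)
          (ℚ.*-zeroʳ (kronecker i i ℚ.* kronecker j l)))) λ ()
      j≡l : j ≡ l
      j≡l = kronecker-≡ j l λ z →
          contradiction (trans both (trans (cong (λ w → kronecker i i ℚ.* w ℚ.* kronecker i k) z)
        (trans (cong (ℚ._* kronecker i k) (ℚ.*-zeroʳ (kronecker i i))) (ℚ.*-zeroˡ (kronecker i k))))) λ ()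

module _ where
  open Polynomials using (fromℤ; fromℤ-+; fromℤ-*; fromℤ-injective)

  sumℚ : ℕ → (ℕ → ℚ) → ℚ
  sumℚ zero    f = 0ℚ
  sumℚ (suc k) f = f k ℚ.+ sumℚ k f

  sumℚ-cong : ∀ k {f g : ℕ → ℚ} → (∀ {i} → i < k → f i ≡ g i) → sumℚ k f ≡ sumℚ k g
  sumℚ-cong zero    eq = refl
  sumℚ-cong (suc k) eq = cong₂ ℚ._+_ (eq ≤-refl) (sumℚ-cong k (λ i<k → eq (m≤n⇒m≤1+n i<k)))

  sumℚ-front : ∀ k f → sumℚ (suc k) f ≡ f 0 ℚ.+ sumℚ k (f ∘ suc)
  sumℚ-front zero    f = refl
  sumℚ-front (suc k) f = trans (cong (λ z → f (suc k) ℚ.+ z) (sumℚ-front k f))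
    (solve 3 (λ a b c → a :+ (b :+ c) := b :+ (a :+ c)) refl (f (suc k)) (f 0) (sumℚ k (f ∘ suc)))
    where open ℚSolver.+-*-Solver using (solve; _:+_; _:=_)

  sumℚ-*ˡ : ∀ k c f → sumℚ k (λ i → c ℚ.* f i) ≡ c ℚ.* sumℚ k f
  sumℚ-*ˡ zero    c f = sym (ℚ.*-zeroʳ c)
  sumℚ-*ˡ (suc k) c f = trans (cong (λ z → c ℚ.* f k ℚ.+ z) (sumℚ-*ˡ k c f)) (sym (ℚ.*-distribˡ-+ c (f k) (sumℚ k f)))

  fromℤ-sum : ∀ k f → fromℤ (sumℤ k f) ≡ sumℚ k (fromℤ ∘ f)
  fromℤ-sum zero    f = refl
  fromℤ-sum (suc k) f = trans (fromℤ-+ (f k) (sumℤ k f)) (cong (λ z → fromℤ (f k) ℚ.+ z) (fromℤ-sum k f))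

  at : ∀ {k} → Vec ℚ k → ℕ → ℚ
  at []      _       = 0ℚ
  at (x ∷ v) zero    = x
  at (x ∷ v) (suc i) = at v i

  dot-sum : ∀ {k} (w a b : Vec ℚ k) → dot w a b ≡ sumℚ k (λ r → at w r ℚ.* at a r ℚ.* at b r)
  dot-sum []      []      []      = refl
  dot-sum {suc k} (x ∷ w) (y ∷ a) (z ∷ b) = trans (cong (λ s → x ℚ.* y ℚ.* z ℚ.+ s) (dot-sum w a b))
    (sym (sumℚ-front k (λ r → at (x ∷ w) r ℚ.* at (y ∷ a) r ℚ.* at (z ∷ b) r)))

  denominator-* : ∀ x → fromℤ (ℚ.ℚ.denominator x) ℚ.* x ≡ fromℤ (ℚ.ℚ.numerator x)
  denominator-* x@(ℚ.mkℚ z d _) = ℚ.toℚᵘ-injective (ℚᵘ.≃-trans (ℚ.toℚᵘ-homo-* (fromℤ (ℚ.ℚ.denominator x)) x)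
    (ℚᵘ.*≡* (trans (ℤ.*-identityʳ _)
        (trans (ℤ.*-comm (+ suc d) z) (cong (z ℤ.*_) (cong +_ (sym (*-identityˡ (suc d)))))))))

  common-denominator : ∀ K (x : ℕ → ℚ) →
      ∃[ δ ] (1 ≤ δ × (Σ (ℕ → ℤ) λ z → ∀ {i} → i < K → fromℤ (z i) ≡ fromℤ (+ δ) ℚ.* x i))
  common-denominator zero    x = 1 , ≤-refl , (λ _ → ℤ.0ℤ) , λ ()
  common-denominator (suc K) x with δ , δ≥1 , z , eq ← common-denominator K x =
    δ * d , *-mono-≤ δ≥1 (s≤s z≤n) , z′ , eq′
    where
    d = ℚ.ℚ.denominatorℕ (x K)
    z′ : ℕ → ℤ
    z′ i = if i ≡ᵇ K then + δ ℤ.* ℚ.ℚ.numerator (x K) else z i ℤ.* + d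
    δd : fromℤ (+ (δ * d)) ≡ fromℤ (+ δ) ℚ.* fromℤ (+ d)
    δd = trans (cong fromℤ (ℤ.pos-* δ d)) (fromℤ-* (+ δ) (+ d))
    eq′ : ∀ {i} → i < suc K → fromℤ (z′ i) ≡ fromℤ (+ (δ * d)) ℚ.* x i
    eq′ {i} i≤K with i ≡ᵇ K in test
    ... | true with refl ← ≡ᵇ⇒≡ i K (subst T (sym test) tt) = begin
      fromℤ (+ δ ℤ.* ℚ.ℚ.numerator (x K))          ≡⟨ fromℤ-* (+ δ) (ℚ.ℚ.numerator (x K)) ⟩
      fromℤ (+ δ) ℚ.* fromℤ (ℚ.ℚ.numerator (x K))  ≡⟨ cong (fromℤ (+ δ) ℚ.*_) (denominator-* (x K)) ⟨
      fromℤ (+ δ) ℚ.* (fromℤ (+ d) ℚ.* x K)        ≡⟨ ℚ.*-assoc (fromℤ (+ δ)) (fromℤ (+ d)) (x K) ⟨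
      fromℤ (+ δ) ℚ.* fromℤ (+ d) ℚ.* x K          ≡⟨ cong (ℚ._* x K) δd ⟨
      fromℤ (+ (δ * d)) ℚ.* x K                    ∎
      where open ≡-Reasoning
    ... | false = begin
      fromℤ (z i ℤ.* + d)                          ≡⟨ fromℤ-* (z i) (+ d) ⟩
      fromℤ (z i) ℚ.* fromℤ (+ d)
        ≡⟨ cong (ℚ._* fromℤ (+ d)) (eq (≤∧≢⇒< (≤-pred i≤K) λ { refl → subst T test (≡⇒≡ᵇ i i refl) })) ⟩
      fromℤ (+ δ) ℚ.* x i ℚ.* fromℤ (+ d)
        ≡⟨ solve 3 (λ a b c → a :* b :* c := a :* c :* b) refl (fromℤ (+ δ)) (x i) (fromℤ (+ d)) ⟩
      fromℤ (+ δ) ℚ.* fromℤ (+ d) ℚ.* x i          ≡⟨ cong (ℚ._* x i) δd ⟨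
      fromℤ (+ (δ * d)) ℚ.* x i                    ∎
      where
      open ≡-Reasoning
      open ℚSolver.+-*-Solver using (solve; _:*_; _:=_)

positivePart negativePart : ℤ → ℕ
positivePart (+ k)    = k
positivePart -[1+ k ] = 0
negativePart (+ k)    = 0
negativePart -[1+ k ] = suc k

positive-negative : ∀ z → + positivePart z ℤ.- + negativePart z ≡ z
positive-negative (+ k)    = ℤ.+-identityʳ (+ k)
positive-negative -[1+ k ] = ℤ.+-identityˡ -[1+ k ]

record BaseAlgorithm (β′ g : ℕ) : Set where
  field
    R′ D : ℕ
    pos neg : ℕ → ℕ
    R≡ : suc R′ ≡ g * 2
    1≤D : 1 ≤ D
    -- Ensures that filling arrays of E^L entries takes no longer, up to the allowed factors, than
    -- visiting R^L leaves.
    E≤R : suc β′ * suc β′ ≤ suc R′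
    identity : ∀ {e f h} → e < suc β′ * suc β′ → f < suc β′ * suc β′ → h < suc β′ * suc β′ →
      sumℤ (suc R′) (λ r → coefficient pos neg (suc β′ * suc β′) 0 r e ℤ.* coefficient pos neg (suc β′ * suc β′) 1 r f
        ℤ.* coefficient pos neg (suc β′ * suc β′) 2 r h) ≡ + (D * linked (suc β′) e f h)

base-algorithm : ∀ β′ {g} → MultipliableWith (suc β′) g → BaseAlgorithm β′ g
base-algorithm β′ {zero} (P , out , spec) with () ← N²≤g P out spec
base-algorithm β′ {suc g′} (P , out , spec) = record
  -- Each of the three coefficients in a product is cleared by δ, hence the cube.
  { R′ = suc (g′ * 2) ; D = δ * δ * δ ; pos = positivePart ∘ z ; neg = negativePart ∘ z
  ; R≡ = refl
  ; 1≤D = *-mono-≤ (*-mono-≤ δ≥1 δ≥1) δ≥1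
  ; E≤R = ≤-trans (N²≤g P out spec) (m≤m*n (suc g′) 2)
  ; identity = identity }
  where
  open Polynomials using (fromℤ; fromℤ-+; fromℤ-*; fromℤ-injective)
  open Bilinear {suc β′} using (formsA; formsB; weightsᵒ; bilinear)
  β E R : ℕ
  β = suc β′
  E = β * β
  R = suc g′ * 2

  rowOf colOf : ℕ → Fin β
  rowOf e = (e / β) mod β
  colOf e = e mod β

  matrixUnit : ℕ → Matrix β
  matrixUnit e = unit (rowOf e) (colOf e)

  -- In the trace, an entry of the third matrix meets the entry of the product at the transposed
  -- position, so the third family reads the output with row and column exchanged.
  form : ℕ → ℕ → ℕ → ℚ
  form 0 r e = at (formsA (matrixUnit e) P) r
  form 1 r e = at (formsB (matrixUnit e) P) r
  form _ r e = at (weightsᵒ P (out (colOf e) (rowOf e))) r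

  flat : ℕ → ℚ
  flat i = form ((i / E) % 3) (i / E / 3) (i % E)

  cleared : ∃[ δ ] (1 ≤ δ × (Σ (ℕ → ℤ) λ z → ∀ {i} → i < R * 3 * E → fromℤ (z i) ≡ fromℤ (+ δ) ℚ.* flat i))
  cleared = common-denominator (R * 3 * E) flat
  δ : ℕ
  δ = proj₁ cleared
  δ≥1 : 1 ≤ δ
  δ≥1 = proj₁ (proj₂ cleared)
  z : ℕ → ℤ
  z = proj₁ (proj₂ (proj₂ cleared))

  coef : ℕ → ℕ → ℕ → ℤ
  coef = coefficient (positivePart ∘ z) (negativePart ∘ z) E

  flat-at : ∀ {tag r e} → tag < 3 → e < E → flat ((r * 3 + tag) * E + e) ≡ form tag r e
  flat-at {tag} {r} {e} tag< e< = trans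
    (cong₂ (λ a b → form (a % 3) (a / 3) b) quotE remE)
    (cong₂ (λ a b → form a b e) rem3 quot3)
    where
    quotE : ((r * 3 + tag) * E + e) / E ≡ r * 3 + tag
    quotE = trans (+-distrib-/-∣ˡ e (divides-refl (r * 3 + tag)))
        (trans (cong₂ _+_ (m*n/n≡m (r * 3 + tag) E) (m<n⇒m/n≡0 e<)) (+-identityʳ _))
    remE : ((r * 3 + tag) * E + e) % E ≡ e
    remE = trans (cong (_% E) (+-comm ((r * 3 + tag) * E) e)) (trans ([m+kn]%n≡m%n e (r * 3 + tag) E) (m<n⇒m%n≡m e<))
    quot3 : (r * 3 + tag) / 3 ≡ r
    quot3 = trans (+-distrib-/-∣ˡ tag (divides-refl r)) (trans (cong₂ _+_ (m*n/n≡m r 3) (m<n⇒m/n≡0 tag<))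
        (+-identityʳ r))
    rem3 : (r * 3 + tag) % 3 ≡ tag
    rem3 = trans (cong (_% 3) (+-comm (r * 3) tag)) (trans ([m+kn]%n≡m%n tag r 3) (m<n⇒m%n≡m tag<))

  index< : ∀ {tag r e} → tag < 3 → r < R → e < E → (r * 3 + tag) * E + e < R * 3 * E
  index< {tag} {r} {e} tag< r< e< = begin-strict
    (r * 3 + tag) * E + e   <⟨ +-monoʳ-< ((r * 3 + tag) * E) e< ⟩
    (r * 3 + tag) * E + E   ≡⟨ +-comm _ E ⟩
    suc (r * 3 + tag) * E
      ≤⟨ *-monoˡ-≤ E (≤-trans (+-monoʳ-< (r * 3) tag<) (≤-trans (≤-reflexive (+-comm (r * 3) 3))
          (*-monoˡ-≤ 3 r<))) ⟩
    R * 3 * E               ∎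
    where open ≤-Reasoning

  coef≡ : ∀ {tag r e} → tag < 3 → r < R → e < E → fromℤ (coef tag r e) ≡ fromℤ (+ δ) ℚ.* form tag r e
  coef≡ {tag} {r} {e} tag< r< e< = trans (cong fromℤ (positive-negative (z ((r * 3 + tag) * E + e))))
    (trans (proj₂ (proj₂ (proj₂ cleared)) (index< tag< r< e<)) (cong (fromℤ (+ δ) ℚ.*_) (flat-at {tag} {r} tag< e<)))

  toℕ-mod : ∀ {a} → a < β → toℕ (a mod β) ≡ a
  toℕ-mod {a} a< = trans (toℕ-fromℕ< (m%n<n a β)) (m<n⇒m%n≡m a<)

  quot< : ∀ {e} → e < E → e / β < β
  quot< {e} e< = m<n*o⇒m/o<n {e} {β} {β} e<

  agree : ∀ {a b} → a < β → b < β → kronecker (a mod β) (b mod β) ≡ fromℤ (+ agrees a b)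
  agree {a} {b} a< b< = trans (kronecker-agrees (a mod β) (b mod β))
      (cong₂ (λ x y → fromℤ (+ agrees x y)) (toℕ-mod a<) (toℕ-mod b<))

  colOf≡ : ∀ e → colOf e ≡ (e % β) mod β
  colOf≡ e = toℕ-injective (trans (toℕ-fromℕ< (m%n<n e β)) (sym (toℕ-mod (m%n<n e β))))

  trace : ∀ {e f h} → e < E → f < E → h < E →
    sumℚ R (λ r → form 0 r e ℚ.* form 1 r f ℚ.* form 2 r h) ≡ fromℤ (+ linked β e f h)
  trace {e} {f} {h} e< f< h< = begin
    sumℚ R (λ r → form 0 r e ℚ.* form 1 r f ℚ.* form 2 r h)
      ≡⟨ sumℚ-cong R (λ {r} _ → solve 3 (λ a b c → a :* b :* c := c :* a :* b) refl (form 0 r e)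
          (form 1 r f) (form 2 r h)) ⟩
    sumℚ R (λ r → form 2 r h ℚ.* form 0 r e ℚ.* form 1 r f)
      ≡⟨ dot-sum (weightsᵒ P (out (colOf h) (rowOf h))) (formsA (matrixUnit e) P) (formsB (matrixUnit f) P) ⟨
    dot (weightsᵒ P (out (colOf h) (rowOf h))) (formsA (matrixUnit e) P) (formsB (matrixUnit f) P)
      ≡⟨ bilinear P (out (colOf h) (rowOf h)) (colOf h) (rowOf h) (λ A B → spec A B (colOf h) (rowOf h))
          (matrixUnit e) (matrixUnit f) ⟩
    (matrixUnit e · matrixUnit f) (colOf h) (rowOf h)
      ≡⟨ unit-· (rowOf e) (colOf e) (rowOf f) (colOf f) (colOf h) (rowOf h) ⟩
    kronecker (colOf e) (rowOf f) ℚ.* kronecker (colOf f) (rowOf h) ℚ.* kronecker (rowOf e) (colOf h)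
      ≡⟨ cong₂ ℚ._*_ (cong₂ ℚ._*_ (entry e f< ) (entry f h<)) (trans (swap (rowOf e) (colOf h)) (entry h e<)) ⟩
    fromℤ (+ agrees (e % β) (f / β)) ℚ.* fromℤ (+ agrees (f % β) (h / β)) ℚ.* fromℤ (+ agrees (h % β) (e / β))
      ≡⟨ cong (ℚ._* fromℤ (+ agrees (h % β) (e / β))) (homo (agrees (e % β) (f / β)) (agrees (f % β) (h / β))) ⟩
    fromℤ (+ (agrees (e % β) (f / β) * agrees (f % β) (h / β))) ℚ.* fromℤ (+ agrees (h % β) (e / β))
      ≡⟨ homo (agrees (e % β) (f / β) * agrees (f % β) (h / β)) (agrees (h % β) (e / β)) ⟩
    fromℤ (+ linked β e f h) ∎
    where
    open ≡-Reasoning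
    open ℚSolver.+-*-Solver using (solve; _:*_; _:=_)
    homo : ∀ a b → fromℤ (+ a) ℚ.* fromℤ (+ b) ≡ fromℤ (+ (a * b))
    homo a b = sym (trans (cong fromℤ (ℤ.pos-* a b)) (fromℤ-* (+ a) (+ b)))
    entry : ∀ e {f} → f < E → kronecker (colOf e) (rowOf f) ≡ fromℤ (+ agrees (e % β) (f / β))
    entry e {f} f< = trans (cong (λ x → kronecker x (rowOf f)) (colOf≡ e)) (agree (m%n<n e β) (quot< f<))
    swap : ∀ {n} (i j : Fin n) → kronecker i j ≡ kronecker j i
    swap zero    zero    = refl
    swap zero    (suc j) = refl
    swap (suc i) zero    = refl
    swap (suc i) (suc j) = swap i j

  identity : ∀ {e f h} → e < E → f < E → h < E →
    sumℤ R (λ r → coef 0 r e ℤ.* coef 1 r f ℤ.* coef 2 r h) ≡ + (δ * δ * δ * linked β e f h)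
  identity {e} {f} {h} e< f< h< = fromℤ-injective (begin
    fromℤ (sumℤ R (λ r → coef 0 r e ℤ.* coef 1 r f ℤ.* coef 2 r h)) ≡⟨ fromℤ-sum R _ ⟩
    sumℚ R (λ r → fromℤ (coef 0 r e ℤ.* coef 1 r f ℤ.* coef 2 r h)) ≡⟨ sumℚ-cong R (λ {r} r< → term r r<) ⟩
    sumℚ R (λ r → c ℚ.* (form 0 r e ℚ.* form 1 r f ℚ.* form 2 r h))
      ≡⟨ sumℚ-*ˡ R c (λ r → form 0 r e ℚ.* form 1 r f ℚ.* form 2 r h) ⟩
    c ℚ.* sumℚ R (λ r → form 0 r e ℚ.* form 1 r f ℚ.* form 2 r h)   ≡⟨ cong (c ℚ.*_) (trace e< f< h<) ⟩
    c ℚ.* fromℤ (+ linked β e f h)                                  ≡⟨ cong (ℚ._* fromℤ (+ linked β e f h)) c≡ ⟩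
    fromℤ (+ (δ * δ * δ)) ℚ.* fromℤ (+ linked β e f h)              ≡⟨ fromℤ-* (+ (δ * δ * δ)) (+ linked β e f h) ⟨
    fromℤ (+ (δ * δ * δ) ℤ.* + linked β e f h)
      ≡⟨ cong fromℤ (ℤ.pos-* (δ * δ * δ) (linked β e f h)) ⟨
    fromℤ (+ (δ * δ * δ * linked β e f h))                          ∎)
    where
    open ≡-Reasoning
    open ℚSolver.+-*-Solver using (solve; _:*_; _:=_)
    c : ℚ
    c = fromℤ (+ δ) ℚ.* fromℤ (+ δ) ℚ.* fromℤ (+ δ)
    c≡ : c ≡ fromℤ (+ (δ * δ * δ))
    c≡ = sym (trans (cong fromℤ (trans (ℤ.pos-* (δ * δ) δ) (cong (ℤ._* + δ) (ℤ.pos-* δ δ))))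
      (trans (fromℤ-* (+ δ ℤ.* + δ) (+ δ)) (cong (ℚ._* fromℤ (+ δ)) (fromℤ-* (+ δ) (+ δ)))))
    term : ∀ r → r < R → fromℤ (coef 0 r e ℤ.* coef 1 r f ℤ.* coef 2 r h) ≡ c ℚ.*
        (form 0 r e ℚ.* form 1 r f ℚ.* form 2 r h)
    term r r< = trans (fromℤ-* (coef 0 r e ℤ.* coef 1 r f) (coef 2 r h))
      (trans (cong (ℚ._* fromℤ (coef 2 r h)) (fromℤ-* (coef 0 r e) (coef 1 r f)))
        (trans (cong₂ ℚ._*_ (cong₂ ℚ._*_ (coef≡ {0} z<s r< e<) (coef≡ {1} (s<s z<s) r< f<))
            (coef≡ {2} (s<s (s<s z<s)) r< h<))
          (solve 4 (λ d x y w → (d :* x) :* (d :* y) :* (d :* w) := d :* d :* d :* (x :* y :* w)) refl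
            (fromℤ (+ δ)) (form 0 r e) (form 1 r f) (form 2 r h))))

^-cancelʳ-≤ : ∀ k .{{_ : NonZero k}} {x y} → x ^ k ≤ y ^ k → x ≤ y
^-cancelʳ-≤ k {x} {y} le with x ≤? y
... | yes x≤y = x≤y
... | no x≰y = contradiction le (<⇒≱ (^-monoˡ-< k (≰⇒> x≰y)))

-- A base size large enough for the gap between the exponents to absorb the
-- constant factors.
base-size : ∀ (p q c : ℕ) .{{_ : NonZero q}} → ω< p / q →
  ∃[ β′ ] ∃[ g ] (1 ≤ β′ × MultipliableWith (suc β′) g × (c * g) ^ q ≤ suc β′ ^ p)
base-size p q c (p′ , q′ , q′≢0 , (C , mult) , p′q<pq′) = suc x , g , s≤s z≤n , proj₁ (proj₂ (mult N)) ,
  ^-cancelʳ-≤ q′ {{q′≢0}} (begin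
    ((c * g) ^ q) ^ q′                   ≡⟨ ^-*-assoc (c * g) q q′ ⟩
    (c * g) ^ (q * q′)                   ≡⟨ ^-distribʳ-* (q * q′) c g ⟩
    c ^ (q * q′) * g ^ (q * q′)          ≡⟨ cong (λ z → c ^ (q * q′) * g ^ z) (*-comm q q′) ⟩
    c ^ (q * q′) * g ^ (q′ * q)          ≡⟨ cong (c ^ (q * q′) *_) (^-*-assoc g q′ q) ⟨
    c ^ (q * q′) * (g ^ q′) ^ q          ≤⟨ *-monoʳ-≤ (c ^ (q * q′)) (^-monoˡ-≤ q (proj₂ (proj₂ (mult N)))) ⟩
    c ^ (q * q′) * (C * N ^ p′) ^ q      ≡⟨ cong (c ^ (q * q′) *_) (^-distribʳ-* q C (N ^ p′)) ⟩
    c ^ (q * q′) * (C ^ q * (N ^ p′) ^ q) ≡⟨ *-assoc (c ^ (q * q′)) (C ^ q) ((N ^ p′) ^ q) ⟨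
    x * (N ^ p′) ^ q                     ≤⟨ *-monoˡ-≤ ((N ^ p′) ^ q) (≤-trans (n≤1+n x) (n≤1+n (suc x))) ⟩
    N * (N ^ p′) ^ q                     ≡⟨ cong (N *_) (^-*-assoc N p′ q) ⟩
    N ^ suc (p′ * q)                     ≤⟨ ^-monoʳ-≤ N p′q<pq′ ⟩
    N ^ (p * q′)                         ≡⟨ ^-*-assoc N p q′ ⟨
    (N ^ p) ^ q′                         ∎)
  where
  open ≤-Reasoning
  x N g : ℕ
  -- All constants of the estimate collected. As p′ q < p q′ is strict, one factor N is left over to
  -- absorb them.
  x = c ^ (q * q′) * C ^ q
  N = 2 + x
  g = proj₁ (mult N)

-- Size and time estimates

total : List ℕ → ℕ
total []       = 0
total (x ∷ xs) = x + total xs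

nth : List ℕ → ℕ → ℕ
nth []       _       = 0
nth (x ∷ xs) zero    = x
nth (x ∷ xs) (suc i) = nth xs i

nth≤total : ∀ xs i → nth xs i ≤ total xs
nth≤total []       i       = z≤n
nth≤total (x ∷ xs) zero    = m≤m+n x (total xs)
nth≤total (x ∷ xs) (suc i) = ≤-trans (nth≤total xs i) (m≤n+m (total xs) x)

⌈/3⌉≤ : ∀ s → (s + 2) / 3 ≤ s
⌈/3⌉≤ zero    = z≤n
⌈/3⌉≤ (suc s) = ≤-trans (/-monoˡ-≤ 3 (≤-trans (≤-reflexive (regroup s)) (m≤n+m (s + 3) (s + s))))
    (≤-reflexive (trans (cong (_/ 3) (threefold s)) (m*n/n≡m (suc s) 3)))
  where
  regroup : ∀ s → suc s + 2 ≡ s + 3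
  regroup = solve-∀
  threefold : ∀ s → s + s + (s + 3) ≡ suc s * 3
  threefold = solve-∀

module Sizes (β′ R′ D : ℕ) (pos neg : ℕ → ℕ) (1<β : 1 < suc β′) where
  open Assembly β′ R′ D pos neg using (β; R; E; growth; lengthOf; stepsOf; Grown)

  tableSize coefficientBound κ : ℕ
  tableSize = R * 3 * E
  coefficientBound = sumBelow tableSize (λ i → pos i + neg i)
  κ = β + 1

  -- Each entry is an exponent with which some quantity is bounded by a power of Q, and their total
  -- serves for all of them at once. `κ` belongs to β^L ≤ β N₀, where β is at most Q^β.
  exponents : List ℕ
  exponents = κ ∷ (R + κ * R) ∷ suc (tableSize ⊔ (6 + κ * E)) ∷ suc (1 ⊔ κ * growth) ∷ κ * (2 ^ β) ∷ κ * (3 * R)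
    ∷ κ * 2 ∷ (κ * 2 + β) ∷ R ∷ E ∷ 2 ^ β ∷ growth ∷ coefficientBound ∷ 5 ∷ []

  e₀ : ℕ
  e₀ = total exponents

  coefficient≤ : ∀ k {i} → i < k → pos i ≤ sumBelow k (λ i → pos i + neg i) × neg i ≤ sumBelow k (λ i → pos i + neg i)
  coefficient≤ (suc k) {i} i<k with i ≟ k
  ... | yes refl = ≤-trans (m≤m+n (pos i) (neg i)) (m≤m+n _ _) , ≤-trans (m≤n+m (neg i) (pos i)) (m≤m+n _ _)
  ... | no i≢k with p , q ← coefficient≤ k (≤∧≢⇒< (≤-pred i<k) i≢k) = ≤-trans p (m≤n+m _ _) , ≤-trans q (m≤n+m _ _)

  lengthOf≡ : ∀ L → lengthOf L ≡ E ^ L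
  lengthOf≡ zero    = refl
  lengthOf≡ (suc L) = trans (*-comm (lengthOf L) E) (cong (E *_) (lengthOf≡ L))

  stepsOf>0 : ∀ L → 1 ≤ stepsOf L
  stepsOf>0 zero    = ≤-refl
  stepsOf>0 (suc L) = s≤s z≤n

  stepsOf≤ : ∀ L → stepsOf L ≤ (3 * R) ^ L
  stepsOf≤ zero    = ≤-refl
  stepsOf≤ (suc L) = begin
    R * (2 + stepsOf L)              ≤⟨ *-monoʳ-≤ R (+-monoˡ-≤ (stepsOf L) (*-monoʳ-≤ 2 (stepsOf>0 L))) ⟩
    R * (2 * stepsOf L + stepsOf L)  ≡⟨ regroup R (stepsOf L) ⟩
    3 * R * stepsOf L                ≤⟨ *-monoʳ-≤ (3 * R) (stepsOf≤ L) ⟩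
    (3 * R) ^ suc L                  ∎
    where
    open ≤-Reasoning
    regroup : ∀ r j → r * (2 * j + j) ≡ 3 * r * j
    regroup = solve-∀

  n<^ : ∀ b → 1 < b → ∀ n → n < b ^ n
  n<^ b 1<b n = <-≤-trans (n<2^n n) (^-monoˡ-≤ n 1<b)
    where
    n<2^n : ∀ n → n < 2 ^ n
    n<2^n zero    = z<s
    n<2^n (suc n) = ≤-trans (+-mono-≤ (m^n>0 2 n) (n<2^n n))
        (≤-reflexive (cong (λ z → 2 ^ n + z) (sym (+-identityʳ (2 ^ n)))))

  module _ (n s M′ : ℕ) where

    M N₀ Q B : ℕ
    M = suc M′
    N₀ = M ^ ((s + 2) / 3)
    Q = 2 + n + s + M + N₀
    B = Q ^ e₀

    2≤Q : 2 ≤ Q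
    2≤Q = s≤s (s≤s z≤n)

    open Magnitudes Q 2≤Q using (_≼_; ≼-elim; ≼-raise; ≼-≤; ≼-base; ≼-+; ≼-*; ≼-constant; ≼-^)

    ≼⇒≤B : ∀ {x} i → x ≼ nth exponents i → x ≤ B
    ≼⇒≤B i p = ≼-elim (≼-raise (nth≤total exponents i) p)

    private
      1≤e₀ : 1 ≤ e₀
      1≤e₀ = ≤-trans (m≤n+m 1 β) (nth≤total exponents 0)

      4≤e₀ : 4 ≤ e₀
      4≤e₀ = ≤-trans (≤ᵇ⇒≤ 4 5 _) (nth≤total exponents 13)

    n≼ : n ≼ 1
    n≼ = ≼-base (≤-trans (m≤n+m n 2) (≤-trans (m≤m+n _ s) (≤-trans (m≤m+n _ M) (m≤m+n _ N₀))))
    s≼ : s ≼ 1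
    s≼ = ≼-base (≤-trans (m≤n+m s (2 + n)) (≤-trans (m≤m+n _ M) (m≤m+n _ N₀)))
    M≼ : M ≼ 1
    M≼ = ≼-base (≤-trans (m≤n+m M (2 + n + s)) (m≤m+n _ N₀))
    N₀≼ : N₀ ≼ 1
    N₀≼ = ≼-base (m≤n+m N₀ (2 + n + s + M))

    once : ∀ {x} → x ≼ 1 → x ≤ B
    once p = ≼-elim (≼-raise 1≤e₀ p)

    V≤B : suc (n * s * s) ≤ B
    V≤B = ≼-elim (≼-raise 4≤e₀ (≼-+ {1} {n * s * s} {1} {3} (≼-base (≤-trans (s≤s z≤n) 2≤Q)) (≼-* (≼-* n≼ s≼) s≼)))

    3+n≤B : 3 + n ≤ B
    3+n≤B = ≼-elim (≼-raise 4≤e₀ (≼-+ {3} {n} {3} {1} (≼-constant 3) n≼))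

    module _ {L : ℕ} (L≤ : β ^ L ≤ β * N₀) where

      β^L≼ : β ^ L ≼ κ
      β^L≼ = ≼-≤ L≤ (≼-* (≼-constant β) N₀≼)

      -- From c ≤ β^c it follows that c^L ≤ (β^L)^c. So everything exponential in L is polynomial in
      -- N₀ and fits a word.
      power≼ : ∀ c → c ^ L ≼ κ * c
      power≼ c = ≼-≤ (begin
        c ^ L          ≤⟨ ^-monoˡ-≤ L (<⇒≤ (n<^ β 1<β c)) ⟩
        (β ^ c) ^ L    ≡⟨ ^-*-assoc β c L ⟩
        β ^ (c * L)    ≡⟨ cong (β ^_) (*-comm c L) ⟩
        β ^ (L * c)    ≡⟨ ^-*-assoc β L c ⟨
        (β ^ L) ^ c    ∎) (≼-^ c β^L≼)
        where open ≤-Reasoning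

      lengthOf≼ : lengthOf L ≼ κ * E
      lengthOf≼ = subst (_≼ κ * E) (sym (lengthOf≡ L)) (power≼ E)

      L≼ : L ≼ κ * 2
      L≼ = ≼-≤ (<⇒≤ (n<^ 2 ≤-refl L)) (power≼ 2)

      is-grown : ∀ {S} → tableSize + 6 * lengthOf L ≤ S → Grown S B L
      is-grown arrays≤S = record
        { β^L≤B = ≼⇒≤B 0 β^L≼
        ; R^L≤B = ≼⇒≤B 1 (≼-* (≼-constant R) (power≼ R))
        ; arrays≤B = ≼⇒≤B 2 (≼-+ (≼-constant tableSize) (≼-* (≼-constant 6) lengthOf≼))
        ; arrays≤S = arrays≤S
        ; m≤B = ≼⇒≤B 3 (≼-+ {1} {growth ^ L} {1} {κ * growth} (≼-base (≤-trans (s≤s z≤n) 2≤Q)) (power≼ growth))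
        ; w₀≤B = ≼⇒≤B 4 (power≼ (2 ^ β))
        ; steps≤B = ≼⇒≤B 5 (≼-≤ (stepsOf≤ L) (power≼ (3 * R)))
        ; L≤B = ≼⇒≤B 6 L≼
        ; LB≤B = ≼⇒≤B 7 (≼-* L≼ (≼-constant β)) }

-- Running time

module Timing (β′ R′ D : ℕ) (pos neg : ℕ → ℕ) (1<β : 1 < suc β′) (E≤R : suc β′ * suc β′ ≤ suc R′) where
  open Assembly β′ R′ D pos neg using (β; R; E; lengthOf; constants)
  open Sizes β′ R′ D pos neg 1<β using (lengthOf≡; n<^; tableSize)

  traversal c₀ : ℕ
  traversal = 147 * E + 499
  c₀ = 1000 + (traversal + (β + tableSize * 14))

  -- The cost of handling one child is at most 147 E + 499 times (2 R)^h, hence no more than the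
  -- bound for its subtree. Doubling R on each level pays for it, and no geometric sum has to be
  -- evaluated.
  traverseTime≤ : ∀ n s M′ L h → traverseTime (constants n s M′ L) h ≤ traversal * (2 * R) ^ h
  traverseTime≤ n s M′ L zero    = ≤-trans (≤ᵇ⇒≤ 200 499 _)
      (≤-trans (m≤n+m 499 (147 * E)) (≤-reflexive (sym (*-identityʳ traversal))))
  traverseTime≤ n s M′ L (suc h) = begin
    R * (3 * len * (E * 49 + 33) + 100 + T₀ + 300)
      ≤⟨ *-monoʳ-≤ R (+-monoˡ-≤ 300 (+-mono-≤ (+-monoˡ-≤ 100 (*-monoˡ-≤ (E * 49 + 33) (*-monoʳ-≤ 3 len≤)))
          (traverseTime≤ n s M′ L h))) ⟩
    R * (3 * Y * (E * 49 + 33) + 100 + traversal * Y + 300)  ≡⟨ cong (R *_) (regroup₁ Y E (traversal * Y)) ⟩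
    R * (Y * (147 * E + 99) + 400 * 1 + traversal * Y)
      ≤⟨ *-monoʳ-≤ R (+-monoˡ-≤ (traversal * Y) (+-monoʳ-≤ (Y * (147 * E + 99)) (*-monoʳ-≤ 400 Y≥1))) ⟩
    R * (Y * (147 * E + 99) + 400 * Y + traversal * Y)       ≡⟨ regroup₂ R E Y ⟩
    traversal * ((2 * R) * Y)                                ∎
    where
    open ≤-Reasoning
    len Y T₀ : ℕ
    len = arrayLength (constants n s M′ L) h
    Y = (2 * R) ^ h
    T₀ = traverseTime (constants n s M′ L) h
    Y≥1 : 1 ≤ Y
    Y≥1 = m^n>0 (2 * R) h
    len≡ : ∀ h → arrayLength (constants n s M′ L) h ≡ E ^ h
    len≡ zero    = refl
    len≡ (suc h) = trans (cong (_* E) (len≡ h)) (*-comm (E ^ h) E)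
    len≤ : len ≤ Y
    len≤ = ≤-trans (≤-reflexive (len≡ h)) (^-monoˡ-≤ h (≤-trans E≤R (m≤n*m R 2)))
    regroup₁ : ∀ y e t → 3 * y * (e * 49 + 33) + 100 + t + 300 ≡ y * (147 * e + 99) + 400 * 1 + t
    regroup₁ = solve-∀
    regroup₂ : ∀ r e y → r * (y * (147 * e + 99) + 400 * y + (147 * e + 499) * y) ≡ (147 * e + 499) * (2 * r * y)
    regroup₂ = solve-∀

  module Bound (n s M′ L H : ℕ) (N₀≤ : suc M′ ^ ((s + 2) / 3) ≤ β ^ L) (1000≤H : 1000 ≤ H) (traversal≤H : traversal ≤ H)
    (β≤H : β ≤ H) (table≤H : tableSize * 14 ≤ H) (U≤H : 1 + n + s ≤ H) where

    private
      2≤H : 2 ≤ H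
      2≤H = ≤-trans (≤ᵇ⇒≤ 2 1000 _) 1000≤H

    open Magnitudes H 2≤H using (_≼_; ≼-elim; ≼-intro; ≼-raise; ≼-≤; ≼-base; ≼-+; ≼-*)

    literal : ∀ x {_ : T (x ≤ᵇ 1000)} → x ≼ 1
    literal x {p} = ≼-base (≤-trans (≤ᵇ⇒≤ x 1000 p) 1000≤H)

    private
      U≤ : ∀ {x} → x ≤ 1 + n + s → x ≼ 1
      U≤ x≤ = ≼-base (≤-trans x≤ U≤H)

    n≼ : n ≼ 1
    n≼ = U≤ (≤-trans (m≤n+m n 1) (m≤m+n (1 + n) s))
    s≼ : s ≼ 1
    s≼ = U≤ (m≤n+m s (1 + n))
    1+n≼ : 1 + n ≼ 1
    1+n≼ = U≤ (m≤m+n (1 + n) s)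
    k₀≼ : (s + 2) / 3 ≼ 1
    k₀≼ = ≼-≤ (⌈/3⌉≤ s) s≼
    k₁≼ : (s + 1) / 3 ≼ 1
    k₁≼ = ≼-≤ (/-monoˡ-≤ 3 (+-monoʳ-≤ s (s≤s z≤n))) k₀≼
    k₂≼ : s / 3 ≼ 1
    k₂≼ = ≼-≤ (/-monoˡ-≤ 3 (m≤m+n s 2)) k₀≼
    V≼ : suc (n * s * s) ≼ 4
    V≼ = ≼-+ (literal 1) (≼-* (≼-* n≼ s≼) s≼)
    traversal≼ : traversal ≼ 1
    traversal≼ = ≼-base traversal≤H
    β≼ : β ≼ 1
    β≼ = ≼-base β≤H
    table≼ : tableSize * 14 ≼ 1
    table≼ = ≼-base table≤H

    -- Splits a bound into a polynomial factor H^j and an exponential factor Y, so that the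
    -- estimates only have to keep track of j.
    module Scaled (Y : ℕ) (Y≥1 : 1 ≤ Y) where

      infix 4 _⊑_
      record _⊑_ (x j : ℕ) : Set where
        constructor ⊑-intro
        field ⊑-elim : x ≤ H ^ j * Y

      open _⊑_ public

      ⊑-≼ : ∀ {x j} → x ≼ j → x ⊑ j
      ⊑-≼ {j = j} (≼-intro p) = ⊑-intro (≤-trans p (m≤m*n (H ^ j) Y {{>-nonZero Y≥1}}))

      ⊑-one : ∀ {x} → x ≤ Y → x ⊑ 0
      ⊑-one x≤ = ⊑-intro (≤-trans x≤ (≤-reflexive (sym (*-identityˡ Y))))

      ⊑-+ : ∀ {x y i j} → x ⊑ i → y ⊑ j → x + y ⊑ suc (i ⊔ j)
      ⊑-+ {x} {y} {i} {j} (⊑-intro p) (⊑-intro q) = ⊑-intro (begin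
        x + y                            ≤⟨ +-mono-≤ p q ⟩
        H ^ i * Y + H ^ j * Y            ≡⟨ *-distribʳ-+ Y (H ^ i) (H ^ j) ⟨
        (H ^ i + H ^ j) * Y
          ≤⟨ *-monoˡ-≤ Y (≼-elim (≼-+ {H ^ i} {H ^ j} {i} {j} (≼-intro ≤-refl) (≼-intro ≤-refl))) ⟩
        H ^ suc (i ⊔ j) * Y              ∎)
        where open ≤-Reasoning

      ⊑-* : ∀ {x y i j} → x ≼ i → y ⊑ j → x * y ⊑ i + j
      ⊑-* {x} {y} {i} {j} (≼-intro p) (⊑-intro q) = ⊑-intro (≤-trans (*-mono-≤ p q)
        (≤-reflexive (trans (sym (*-assoc (H ^ i) (H ^ j) Y)) (cong (_* Y) (sym (^-distribˡ-+-* H i j))))))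

      ⊑-raise : ∀ {x i j} → i ≤ j → x ⊑ i → x ⊑ j
      ⊑-raise i≤j (⊑-intro p) = ⊑-intro
          (≤-trans p (*-monoˡ-≤ Y (^-monoʳ-≤ H {{>-nonZero (≤-trans (s≤s z≤n) 2≤H)}} i≤j)))

    -- (2 R)^L covers one detection, including the L digits decoded per entry. The L β rounds of
    -- bisection bring another factor L, for which the second base pays.
    module Stage₁ = Scaled ((2 * R) ^ L) (m^n>0 (2 * R) L)
    module Stage₂ = Scaled ((4 * R) ^ L) (m^n>0 (4 * R) L)

    private
      E^L≤R^L : E ^ L ≤ R ^ L
      E^L≤R^L = ^-monoˡ-≤ L E≤R

      doubled : ∀ b → 2 ^ L * b ^ L ≡ (2 * b) ^ L
      doubled b = sym (^-distribʳ-* L 2 b)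

      L*≤ : ∀ {x} b → x ≤ b ^ L → L * x ≤ (2 * b) ^ L
      L*≤ b x≤ = ≤-trans (*-mono-≤ (<⇒≤ (n<^ 2 ≤-refl L)) x≤) (≤-reflexive (doubled b))

    len≤ : lengthOf L ≤ R ^ L
    len≤ = ≤-trans (≤-reflexive (lengthOf≡ L)) E^L≤R^L

    fillTimeOf : ℕ → ℕ → ℕ
    fillTimeOf k k′ = lengthOf L * (L * 49 + k * ((k + k′) * (n * 31 + 60 + 3) + 60 + 3) + 200 + 3) + 50

    fillTime⊑ : ∀ {k k′} → k ≼ 1 → k′ ≼ 1 → fillTimeOf k k′ Stage₁.⊑ 30
    fillTime⊑ {k} {k′} k≼ k′≼ = subst (Stage₁._⊑ 30) (sym (regroup (lengthOf L) L pairs))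
      (⊑-raise (≤ᵇ⇒≤ 15 30 _) (⊑-+ (⊑-+ (⊑-* (literal 49) (⊑-one (L*≤ R len≤)))
          (⊑-* (≼-+ pairs≼ (literal 203)) (⊑-one (≤-trans len≤ (^-monoˡ-≤ L (m≤n*m R 2))))))
        (⊑-≼ (literal 50))))
      where
      open Stage₁
      pairs : ℕ
      pairs = k * ((k + k′) * (n * 31 + 60 + 3) + 60 + 3)
      pairs≼ : pairs ≼ 12
      pairs≼ = ≼-raise (≤ᵇ⇒≤ 9 12 _)
          (≼-* k≼ (≼-+ (≼-+ (≼-* (≼-+ k≼ k′≼) (≼-+ (≼-+ (≼-* n≼ (literal 31)) (literal 60)) (literal 3)))
          (literal 60)) (literal 3)))
      regroup : ∀ a l p → a * (l * 49 + p + 200 + 3) + 50 ≡ 49 * (l * a) + (p + 203) * a + 50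
      regroup = solve-∀

    detectTimeOf : ℕ
    detectTimeOf = fillTimeOf ((s + 2) / 3) ((s + 1) / 3) + fillTimeOf ((s + 1) / 3) (s / 3) + fillTimeOf
        (s / 3) ((s + 2) / 3)
      + traverseTime (constants n s M′ L) L + 24

    detectTime⊑ : detectTimeOf Stage₁.⊑ 34
    detectTime⊑ = ⊑-+ (⊑-+ (⊑-+ (⊑-+ (fillTime⊑ k₀≼ k₁≼) (fillTime⊑ k₁≼ k₂≼)) (fillTime⊑ k₂≼ k₀≼))
        (⊑-intro {j = 1} (≤-trans (traverseTime≤ n s M′ L L) (*-monoˡ-≤ ((2 * R) ^ L) (≼-elim traversal≼)))))
      (⊑-≼ (literal 24))
      where open Stage₁

    lift : ∀ {x j} → x Stage₁.⊑ j → x Stage₂.⊑ j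
    lift {j = j} (Stage₁.⊑-intro p) = Stage₂.⊑-intro
        (≤-trans p (*-monoʳ-≤ (H ^ j) (^-monoˡ-≤ L (*-monoˡ-≤ R (≤ᵇ⇒≤ 2 4 _)))))

    L*-lift : ∀ {x j} → x Stage₁.⊑ j → L * x Stage₂.⊑ j
    L*-lift {x} {j} (Stage₁.⊑-intro p) = Stage₂.⊑-intro (begin
      L * x                        ≤⟨ *-monoʳ-≤ L p ⟩
      L * (H ^ j * (2 * R) ^ L)    ≡⟨ exchange L (H ^ j) ((2 * R) ^ L) ⟩
      H ^ j * (L * (2 * R) ^ L)    ≤⟨ *-monoʳ-≤ (H ^ j) (L*≤ (2 * R) ≤-refl) ⟩
      H ^ j * (2 * (2 * R)) ^ L    ≡⟨ cong (λ z → H ^ j * z ^ L) (sym (*-assoc 2 2 R)) ⟩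
      H ^ j * (4 * R) ^ L          ∎)
      where
      open ≤-Reasoning
      exchange : ∀ a b c → a * (b * c) ≡ b * (a * c)
      exchange = solve-∀

    reportTimeOf : ℕ → ℕ
    reportTimeOf k = k * (n * 18 + 23) + 5

    totalTime : (count costτ costc : ℕ) → ℕ
    totalTime count costτ costc =
      count * (suc (n * s * s) * suc (n * s * s) * suc (n * s * s)) * (detectTimeOf + (costτ + 90) + 3) + (costc + 20)
        + 3 * (L * β * (detectTimeOf + 60 + 3) + 3)
        + (reportTimeOf ((s + 2) / 3) + reportTimeOf ((s + 1) / 3) + reportTimeOf (s / 3))
      + tableSize * 14 + (((s + 2) / 3 + (s + 1) / 3 + s / 3) * 10 + suc M′ ^ ((s + 2) / 3) * 83 + 30) + 300

    totalTime≤ : ∀ {count costτ costc} → count ≤ 1 + n → costτ ≤ 10 → costc ≤ 10 →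
      totalTime count costτ costc ≤ H ^ 60 * (4 * R) ^ L
    totalTime≤ {count} {costτ} {costc} count≤ costτ≤ costc≤ = ⊑-elim (⊑-raise (≤ᵇ⇒≤ 55 60 _)
      (⊑-+ (⊑-+ (⊑-+ (⊑-+ (⊑-+ (⊑-+ searching (⊑-≼ (≼-+ (≼-≤ costc≤ (literal 10)) (literal 20)))) bisecting)
          reporting) (⊑-≼ table≼)) preparing) (⊑-≼ (literal 300))))
      where
      open Stage₂
      searching : count * (suc (n * s * s) * suc (n * s * s) * suc (n * s * s)) * (detectTimeOf + (costτ + 90) + 3) ⊑ 49
      searching = ⊑-* (≼-* (≼-≤ count≤ 1+n≼) (≼-* (≼-* V≼ V≼) V≼))
        (⊑-+ (⊑-+ (lift detectTime⊑) (⊑-≼ (≼-+ (≼-≤ costτ≤ (literal 10)) (literal 90)))) (⊑-≼ (literal 3)))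
      bisecting : 3 * (L * β * (detectTimeOf + 60 + 3) + 3) ⊑ 39
      bisecting = ⊑-* (literal 3) (⊑-+ (subst (_⊑ 37) (sym (regroup L β (detectTimeOf + 60 + 3)))
          (⊑-* β≼ (L*-lift (Stage₁.⊑-+ (Stage₁.⊑-+ detectTime⊑ (Stage₁.⊑-≼ (literal 60)))
              (Stage₁.⊑-≼ (literal 3)))))) (⊑-≼ (literal 3)))
        where
        regroup : ∀ a b c → a * b * c ≡ b * (a * c)
        regroup = solve-∀
      report≼ : ∀ {k} → k ≼ 1 → reportTimeOf k ≼ 5
      report≼ k≼ = ≼-+ (≼-* k≼ (≼-+ (≼-* n≼ (literal 18)) (literal 23))) (literal 5)
      reporting : reportTimeOf ((s + 2) / 3) + reportTimeOf ((s + 1) / 3) + reportTimeOf (s / 3) ⊑ 7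
      reporting = ⊑-≼ (≼-+ (≼-+ (report≼ k₀≼) (report≼ k₁≼)) (report≼ k₂≼))
      N₀⊑ : suc M′ ^ ((s + 2) / 3) ⊑ 0
      N₀⊑ = ⊑-one (≤-trans N₀≤ (^-monoˡ-≤ L (≤-trans (m≤m*n β β) (≤-trans E≤R (m≤n*m R 4)))))
      preparing : ((s + 2) / 3 + (s + 1) / 3 + s / 3) * 10 + suc M′ ^ ((s + 2) / 3) * 83 + 30 ⊑ 6
      preparing = ⊑-+ (⊑-+ (⊑-≼ (≼-* (≼-+ (≼-+ k₀≼ k₁≼) k₂≼) (literal 10)))
          (subst (_⊑ 1) (*-comm 83 (suc M′ ^ ((s + 2) / 3))) (⊑-* (literal 83) N₀⊑))) (⊑-≼ (literal 30))

-- Distances and optima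

private
  variable
    n′ j k l : ℕ

toAll : ∀ (φ : ℕ → ℕ) (z : Cube n′) → Vec (Cube n′) k → ℕ
toAll φ z []       = 0
toAll φ z (y ∷ ys) = φ (d_H z y) + toAll φ z ys

between : (φ : ℕ → ℕ) → Vec (Cube n′) j → Vec (Cube n′) k → ℕ
between φ []       ys = 0
between φ (x ∷ xs) ys = toAll φ x ys + between φ xs ys

within : (φ : ℕ → ℕ) → Vec (Cube n′) k → ℕ
within φ []       = 0
within φ (x ∷ xs) = toAll φ x xs + within φ xs

d_H-sym : ∀ (x y : Cube n′) → d_H x y ≡ d_H y x
d_H-sym []      []      = refl
d_H-sym (a ∷ x) (b ∷ y) = cong₂ _+_ (cong (if_then 1 else 0) (Bool.xor-comm a b)) (d_H-sym x y)

toAll-++ : ∀ (φ : ℕ → ℕ) (z : Cube n′) (xs : Vec _ j) (ys : Vec _ k) →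
    toAll φ z (xs Vec.++ ys) ≡ toAll φ z xs + toAll φ z ys
toAll-++ φ z []       ys = refl
toAll-++ φ z (x ∷ xs) ys = trans (cong (λ s → φ (d_H z x) + s) (toAll-++ φ z xs ys)) (sym (+-assoc (φ (d_H z x)) _ _))

between-++ʳ : ∀ (φ : ℕ → ℕ) (xs : Vec (Cube n′) j) (ys : Vec _ k) (zs : Vec _ l) →
  between φ xs (ys Vec.++ zs) ≡ between φ xs ys + between φ xs zs
between-++ʳ φ []       ys zs = refl
between-++ʳ φ (x ∷ xs) ys zs = trans (cong₂ _+_ (toAll-++ φ x ys zs) (between-++ʳ φ xs ys zs))
  (interchange (toAll φ x ys) (toAll φ x zs) (between φ xs ys) (between φ xs zs))
  where
  interchange : ∀ a b c d → a + b + (c + d) ≡ a + c + (b + d)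
  interchange = solve-∀

between-[]ʳ : ∀ (φ : ℕ → ℕ) (xs : Vec (Cube n′) j) → between φ xs [] ≡ 0
between-[]ʳ φ []       = refl
between-[]ʳ φ (x ∷ xs) = between-[]ʳ φ xs

between-∷ʳ : ∀ (φ : ℕ → ℕ) (xs : Vec (Cube n′) j) y (ys : Vec _ k) →
    between φ xs (y ∷ ys) ≡ toAll φ y xs + between φ xs ys
between-∷ʳ φ []       y ys = refl
between-∷ʳ φ (x ∷ xs) y ys = trans (cong₂ (λ a b → φ a + toAll φ x ys + b) (d_H-sym x y) (between-∷ʳ φ xs y ys))
  (interchange (φ (d_H y x)) (toAll φ x ys) (toAll φ y xs) (between φ xs ys))
  where
  interchange : ∀ a b c d → a + b + (c + d) ≡ a + c + (b + d)
  interchange = solve-∀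

between-sym : ∀ (φ : ℕ → ℕ) (xs : Vec (Cube n′) j) (ys : Vec _ k) → between φ xs ys ≡ between φ ys xs
between-sym φ []       ys = sym (between-[]ʳ φ ys)
between-sym φ (x ∷ xs) ys = trans (cong (λ s → toAll φ x ys + s) (between-sym φ xs ys)) (sym (between-∷ʳ φ ys x xs))

within-++ : ∀ (φ : ℕ → ℕ) (xs : Vec (Cube n′) j) (ys : Vec _ k) →
    within φ (xs Vec.++ ys) ≡ within φ xs + between φ xs ys + within φ ys
within-++ φ []       ys = refl
within-++ φ (x ∷ xs) ys = trans (cong₂ _+_ (toAll-++ φ x xs ys) (within-++ φ xs ys))
  (interchange (toAll φ x xs) (toAll φ x ys) (within φ xs) (between φ xs ys) (within φ ys))
  where
  interchange : ∀ a b c d e → a + b + (c + d + e) ≡ a + c + (b + d) + e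
  interchange = solve-∀

-- Every pair of three blocks is counted on one edge of the triangle.
within-triangle : ∀ (φ : ℕ → ℕ) (xs : Vec (Cube n′) j) (ys : Vec _ k) (zs : Vec _ l) →
  within φ (xs Vec.++ (ys Vec.++ zs)) ≡
    (within φ xs + between φ xs ys) + (within φ ys + between φ ys zs) + (within φ zs + between φ zs xs)
within-triangle φ xs ys zs = trans (within-++ φ xs (ys Vec.++ zs))
  (trans (cong₂ (λ a b → within φ xs + a + b)
      (trans (between-++ʳ φ xs ys zs) (cong (λ s → between φ xs ys + s) (between-sym φ xs zs)))
      (within-++ φ ys zs))
    (regroup (within φ xs) (between φ xs ys) (between φ zs xs) (within φ ys) (between φ ys zs) (within φ zs)))
  where
  regroup : ∀ a b c d e f → a + (b + c) + (d + e + f) ≡ a + b + (d + e) + (f + c)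
  regroup = solve-∀

sum-toAll : ∀ (z : Cube n′) (ys : Vec _ k) → sum (toList (Vec.map (d_H z) ys)) ≡ toAll id z ys
sum-toAll z []       = refl
sum-toAll z (y ∷ ys) = cong (λ s → d_H z y + s) (sum-toAll z ys)

sumPD≡within : ∀ (zs : Vec (Cube n′) k) → sumPD zs ≡ within id zs
sumPD≡within []       = refl
sumPD≡within (z ∷ zs) = trans (sum-++ (toList (Vec.map (d_H z) zs)) (pairDistances zs))
    (cong₂ _+_ (sum-toAll z zs) (sumPD≡within zs))

within≤ : ∀ {b} (φ : ℕ → ℕ) (zs : Vec (Cube n′) k) → (∀ x y → φ (d_H {n′} x y) ≤ b) → within φ zs ≤ k * (k * b)
within≤ φ [] φ≤ = z≤n
within≤ {k = suc k} {b} φ (z ∷ zs) φ≤ = +-mono-≤ (≤-trans (toAll≤ zs) (*-monoˡ-≤ b (n≤1+n k)))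
    (≤-trans (within≤ φ zs φ≤) (*-monoʳ-≤ k (*-monoˡ-≤ b (n≤1+n k))))
  where
  toAll≤ : ∀ {k} (ys : Vec _ k) → toAll φ z ys ≤ k * b
  toAll≤ []       = z≤n
  toAll≤ (y ∷ ys) = +-mono-≤ (φ≤ z y) (toAll≤ ys)

-- A sum of shortfalls instead of a conjunction: like the total distance, it can be distributed over
-- the three edges of the triangle.
Separated : ℕ → Vec (Cube n′) k → Set
Separated τ zs = within (τ ∸_) zs ≡ 0

private
  toAll-≤ : ∀ {τ} (z : Cube n′) (ys : Vec _ k) → toAll (τ ∸_) z ys ≡ 0 →
      ListAll.All (τ ≤_) (toList (Vec.map (d_H z) ys))
  toAll-≤ z []       eq = ListAll.[]
  toAll-≤ {τ = τ} z (y ∷ ys) eq = m∸n≡0⇒m≤n (m+n≡0⇒m≡0 (τ ∸ d_H z y) eq) ListAll.∷ toAll-≤ z ys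
      (m+n≡0⇒n≡0 (τ ∸ d_H z y) eq)

  ≤-toAll : ∀ {τ} (z : Cube n′) (ys : Vec _ k) → ListAll.All (τ ≤_) (toList (Vec.map (d_H z) ys)) →
      toAll (τ ∸_) z ys ≡ 0
  ≤-toAll z []       _ = refl
  ≤-toAll z (y ∷ ys) (le ListAll.∷ les) = cong₂ _+_ (m≤n⇒m∸n≡0 le) (≤-toAll z ys les)

separated⇒≤ : ∀ {τ} (zs : Vec (Cube n′) k) → Separated τ zs → ListAll.All (τ ≤_) (pairDistances zs)
separated⇒≤ []       eq = ListAll.[]
separated⇒≤ {τ = τ} (z ∷ zs) eq = ListAll.++⁺ (toAll-≤ z zs (m+n≡0⇒m≡0 (toAll (τ ∸_) z zs) eq))
    (separated⇒≤ zs (m+n≡0⇒n≡0 (toAll (τ ∸_) z zs) eq))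

≤⇒separated : ∀ {τ} (zs : Vec (Cube n′) k) → ListAll.All (τ ≤_) (pairDistances zs) → Separated τ zs
≤⇒separated []       _ = refl
≤⇒separated (z ∷ zs) les = cong₂ _+_ (≤-toAll z zs (ListAll.++⁻ˡ (toList (Vec.map (d_H z) zs)) les))
  (≤⇒separated zs (ListAll.++⁻ʳ (toList (Vec.map (d_H z) zs)) les))

separated-0 : ∀ (zs : Vec (Cube n′) k) → Separated 0 zs
separated-0 zs = ≤⇒separated zs (ListAll.universal (λ _ → z≤n) (pairDistances zs))

separated-minPD : ∀ (zs : Vec (Cube n′) k) → Separated (minPD zs) zs
separated-minPD {n′} zs = ≤⇒separated zs (min≤xs n′ (pairDistances zs))

minPD≤n : ∀ (zs : Vec (Cube n′) k) → minPD zs ≤ n′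
minPD≤n {n′} zs = min≤⊤ n′ (pairDistances zs)

-- The bound `τ ≤ n′` matters when there are no pairs, where the minimum is n′ by convention.
separated⇒minPD : ∀ {τ} (zs : Vec (Cube n′) k) → τ ≤ n′ → Separated τ zs → τ ≤ minPD zs
separated⇒minPD zs τ≤n sep = v≤min⁺ τ≤n (separated⇒≤ zs sep)

d_H-refl : ∀ (x : Cube n′) → d_H x x ≡ 0
d_H-refl []      = refl
d_H-refl (a ∷ x) = trans (cong (λ b → (if b then 1 else 0) + d_H x x) (Bool.xor-same a)) (d_H-refl x)

d_H-≢ : ∀ (x y : Cube n′) → x ≢ y → 1 ≤ d_H x y
d_H-≢ []      []      x≢y = contradiction refl x≢y
d_H-≢ (a ∷ x) (b ∷ y) x≢y with a Bool.≟ b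
... | yes refl = ≤-trans (d_H-≢ x y (λ { refl → x≢y refl })) (m≤n+m (d_H x y) _)
... | no a≢b   = ≤-trans (differ a b a≢b) (m≤m+n _ (d_H x y))
  where
  open import Data.Bool.Base using (_xor_)
  differ : ∀ a b → a ≢ b → 1 ≤ (if a xor b then 1 else 0)
  differ false false a≢b = contradiction refl a≢b
  differ false true  _   = ≤-refl
  differ true  false _   = ≤-refl
  differ true  true  a≢b = contradiction refl a≢b

-- Distinctness amounts to the lower bound 1, which turns the problem on sets into an instance of
-- the general search.
separated⇒unique : ∀ (zs : Vec (Cube n′) k) → Separated 1 zs → Unique zs
separated⇒unique []       sep = []
separated⇒unique (z ∷ zs) sep = distinct zs (m+n≡0⇒m≡0 (toAll (1 ∸_) z zs) sep) ∷ separated⇒unique zs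
    (m+n≡0⇒n≡0 (toAll (1 ∸_) z zs) sep)
  where
  distinct : ∀ {k} (ys : Vec _ k) → toAll (1 ∸_) z ys ≡ 0 → VecAll.All (z ≢_) ys
  distinct []       eq = VecAll.[]
  distinct (y ∷ ys) eq = (λ { refl →
      contradiction (trans (sym (cong (1 ∸_) (d_H-refl z))) (m+n≡0⇒m≡0 (1 ∸ d_H z y) eq)) λ () })
    VecAll.∷ distinct ys (m+n≡0⇒n≡0 (1 ∸ d_H z y) eq)

unique⇒separated : ∀ (zs : Vec (Cube n′) k) → Unique zs → Separated 1 zs
unique⇒separated []       []       = refl
unique⇒separated (z ∷ zs) (z∉ ∷ u) = cong₂ _+_ (distinct zs z∉) (unique⇒separated zs u)
  where
  distinct : ∀ {k} (ys : Vec _ k) → VecAll.All (z ≢_) ys → toAll (1 ∸_) z ys ≡ 0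
  distinct []       _ = refl
  distinct (y ∷ ys) (z≢y VecAll.∷ ne) = cong₂ _+_ (m≤n⇒m∸n≡0 (d_H-≢ z y z≢y)) (distinct ys ne)

module _ {n M : ℕ} (X : Vec (Cube n) M) where

  ∈-multisets⁺ : ∀ {s} {zs : Vec (Cube n) s} → VecAll.All (_∈ X) zs → zs List.∈ multisets X s
  ∈-multisets⁺ VecAll.[]        = here refl
  ∈-multisets⁺ (z∈ VecAll.∷ zs) = ∈-cartesianProductWith⁺ _∷_ (∈-toList⁺ z∈) (∈-multisets⁺ zs)

  ∈-multisets⁻ : ∀ s {zs : Vec (Cube n) s} → zs List.∈ multisets X s → VecAll.All (_∈ X) zs
  ∈-multisets⁻ zero    {[]} _ = VecAll.[]
  ∈-multisets⁻ (suc s) zs∈ with _ , _ , z∈ , zs′∈ , refl ← ∈-cartesianProductWith⁻ _∷_ (toList X) (multisets X s) zs∈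
    = ∈-toList⁻ z∈ VecAll.∷ ∈-multisets⁻ s zs′∈

  private
    maximum : ∀ {s} (f : Vec (Cube n) s → ℕ) xs {z} → z List.∈ xs → (∀ {y} → y List.∈ xs → f y ≤ f z) →
        f z ≡ max 0 (List.map f xs)
    maximum f xs {z} z∈ best = sym (max≈v⁺ (∈-map⁺ f z∈) (ListAll.map⁺ (ListAll.tabulate best)) z≤n)

  OptSum-maximum : ∀ {s} {zs : Vec (Cube n) s} → VecAll.All (_∈ X) zs →
    (∀ ys → VecAll.All (_∈ X) ys → sumPD ys ≤ sumPD zs) → sumPD zs ≡ OptSum X s
  OptSum-maximum {s} zs∈ best = maximum sumPD (multisets X s) (∈-multisets⁺ zs∈) λ {y} y∈ → best y (∈-multisets⁻ s y∈)

  OptSum≢-maximum : ∀ {s} {zs : Vec (Cube n) s} → VecAll.All (_∈ X) zs → Unique zs →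
    (∀ ys → VecAll.All (_∈ X) ys → Unique ys → sumPD ys ≤ sumPD zs) → sumPD zs ≡ OptSum≢ X s
  OptSum≢-maximum {s} zs∈ u best = maximum sumPD (sets X s) (∈-filter⁺ unique? (∈-multisets⁺ zs∈) u)
    λ {y} y∈ → let y∈′ , u′ = ∈-filter⁻ unique? {xs = multisets X s} y∈ in best y (∈-multisets⁻ s y∈′) u′

  -- Maximality over multisets is enough even where sets are asked for. If the maximiser has a
  -- repetition, its minimum is 0, so no set can do better than 0 either.
  OptMin-maximum : ∀ {s} {zs : Vec (Cube n) s} → VecAll.All (_∈ X) zs →
    (∀ ys → VecAll.All (_∈ X) ys → minPD ys ≤ minPD zs) → minPD zs ≡ OptMin X s
  OptMin-maximum {s} {zs} zs∈ best with s ≤ᵇ M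
  ... | false = maximum minPD (multisets X s) (∈-multisets⁺ zs∈) λ {y} y∈ → best y (∈-multisets⁻ s y∈)
  ... | true with unique? zs
  ...   | yes u = maximum minPD (sets X s) (∈-filter⁺ unique? (∈-multisets⁺ zs∈) u)
            λ {y} y∈ → best y (∈-multisets⁻ s (proj₁ (∈-filter⁻ unique? {xs = multisets X s} y∈)))
  ...   | no ¬u = trans minPD≡0 (sym (n≤0⇒n≡0 (subst (max 0 (List.map minPD (sets X s)) ≤_) minPD≡0 bound)))
    where
    minPD≡0 : minPD zs ≡ 0
    minPD≡0 = n<1⇒n≡0 (≰⇒> λ 1≤ → ¬u (separated⇒unique zs
      (≤⇒separated zs (ListAll.map (≤-trans 1≤) (min≤xs n (pairDistances zs))))))
    bound : max 0 (List.map minPD (sets X s)) ≤ minPD zs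
    bound = max≤v⁺ z≤n (ListAll.map⁺ (ListAll.tabulate λ {y} y∈ →
      best y (∈-multisets⁻ s (proj₁ (∈-filter⁻ unique? {xs = multisets X s} y∈)))))

-- Solutions as triangles

module Lettering {n M′ : ℕ} (X : Vec (Cube n) (suc M′)) where
  open Labels X using (letter; letters; cross; heads)

  private
    M = suc M′

    letter-cong : ∀ {a b} → a % M ≡ b % M → letter a ≡ letter b
    letter-cong {a} {b} eq = cong (lookup X) (toℕ-injective
      (trans (toℕ-fromℕ< (m%n<n a M)) (trans eq (sym (toℕ-fromℕ< (m%n<n b M))))))

    shift : ∀ k i j → i + M ^ suc k * j ≡ i + (M ^ k * j) * M
    shift k i j = cong (λ z → i + z) (trans (*-assoc M (M ^ k) j) (*-comm M (M ^ k * j)))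

    first-letter : ∀ k i j → letter (i + M ^ suc k * j) ≡ letter i
    first-letter k i j = letter-cong {i + M ^ suc k * j} {i}
        (trans (cong (_% M) (shift k i j)) ([m+kn]%n≡m%n i (M ^ k * j) M))

    rest-letters : ∀ k i j → (i + M ^ suc k * j) / M ≡ i / M + M ^ k * j
    rest-letters k i j = trans (cong (_/ M) (shift k i j)) (trans (+-distrib-/-∣ʳ i (divides-refl (M ^ k * j)))
      (cong (λ z → i / M + z) (m*n/n≡m (M ^ k * j) M)))

    quotient< : ∀ k {i} → i < M ^ suc k → i / M < M ^ k
    quotient< k {i} i< = m<n*o⇒m/o<n {i} {M ^ k} {M} (subst (i <_) (*-comm M (M ^ k)) i<)

    nothing : ∀ {i} j → i < 1 → i + 1 * j ≡ j
    nothing {zero} j _ = +-identityʳ j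
    nothing {suc i} j (s≤s ())

  letters-++ : ∀ k k′ {i} j → i < M ^ k → letters (k + k′) (i + M ^ k * j) ≡ letters k i Vec.++ letters k′ j
  letters-++ zero    k′ j i< = cong (letters k′) (nothing j i<)
  letters-++ (suc k) k′ {i} j i< = cong₂ _∷_ (first-letter k i j)
    (trans (cong (letters (k + k′)) (rest-letters k i j)) (letters-++ k k′ j (quotient< k i<)))

  cross-letters : ∀ φ k a y → cross φ k a y ≡ toAll φ (letter a) (letters k y)
  cross-letters φ zero    a y = refl
  cross-letters φ (suc k) a y = cong (λ z → φ (d_H (letter a) (letter y)) + z) (cross-letters φ k a (y / M))

  -- Because `i` is below M^k, its k digits end exactly where those of `j` begin.
  heads-letters : ∀ φ k k′ {i} j → i < M ^ k →
    heads φ k (k + k′) (i + M ^ k * j) ≡ within φ (letters k i) + between φ (letters k i) (letters k′ j)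
  heads-letters φ zero    k′ j i< = refl
  heads-letters φ (suc k) k′ {i} j i< = begin
    cross φ (k + k′) y (y / M) + heads φ k (k + k′) (y / M)
      ≡⟨ cong₂ _+_ (cross-letters φ (k + k′) y (y / M)) (cong (heads φ k (k + k′)) (rest-letters k i j)) ⟩
    toAll φ (letter y) (letters (k + k′) (y / M)) + heads φ k (k + k′) (i / M + M ^ k * j)
      ≡⟨ cong₂ _+_ (cong₂ (toAll φ) (first-letter k i j)
          (trans (cong (letters (k + k′)) (rest-letters k i j)) (letters-++ k k′ j (quotient< k i<))))
           (heads-letters φ k k′ j (quotient< k i<)) ⟩
    toAll φ (letter i) (xs Vec.++ ys) + (within φ xs + between φ xs ys)
      ≡⟨ cong (_+ (within φ xs + between φ xs ys)) (toAll-++ φ (letter i) xs ys) ⟩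
    toAll φ (letter i) xs + toAll φ (letter i) ys + (within φ xs + between φ xs ys)
      ≡⟨ interchange (toAll φ (letter i) xs) (toAll φ (letter i) ys) (within φ xs) (between φ xs ys) ⟩
    within φ (letters (suc k) i) + between φ (letters (suc k) i) ys ∎
    where
    open ≡-Reasoning
    y = i + M ^ suc k * j
    xs = letters k (i / M)
    ys = letters k′ j
    interchange : ∀ a b c d → a + b + (c + d) ≡ a + c + (b + d)
    interchange = solve-∀

  letters-∈ : ∀ k y → VecAll.All (_∈ X) (letters k y)
  letters-∈ zero    y = VecAll.[]
  letters-∈ (suc k) y = ∈-lookup (y mod M) X VecAll.∷ letters-∈ k (y / M)

  letters-surjective : ∀ {k} {xs : Vec (Cube n) k} → VecAll.All (_∈ X) xs → ∃[ y ] (y < M ^ k × letters k y ≡ xs)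
  letters-surjective VecAll.[] = 0 , z<s , refl
  letters-surjective {suc k} {x ∷ xs} (x∈ VecAll.∷ xs∈) with y , y< , refl ← letters-surjective xs∈ =
    toℕ d + y * M , bound , cong₂ _∷_ head≡ (cong (letters k) tail≡)
    where
    d : Fin M
    d = index x∈
    bound : toℕ d + y * M < M ^ suc k
    bound = <-≤-trans (+-monoˡ-< (y * M) (toℕ<n d)) (≤-trans (*-monoˡ-≤ M y<) (≤-reflexive (*-comm (M ^ k) M)))
    rem≡ : (toℕ d + y * M) % M ≡ toℕ d
    rem≡ = trans ([m+kn]%n≡m%n (toℕ d) y M) (m<n⇒m%n≡m (toℕ<n d))
    head≡ : letter (toℕ d + y * M) ≡ x
    head≡ = trans (cong (lookup X) (toℕ-injective (trans (toℕ-fromℕ< (m%n<n (toℕ d + y * M) M)) rem≡)))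
        (sym (lookup-index x∈))
    tail≡ : (toℕ d + y * M) / M ≡ y
    tail≡ = trans (+-distrib-/-∣ʳ (toℕ d) (divides-refl y)) (cong₂ _+_ (m<n⇒m/n≡0 (toℕ<n d)) (m*n/n≡m y M))

encode-++ : ∀ {n j k} (xs : Vec (Cube n) j) (ys : Vec (Cube n) k) → encode (xs Vec.++ ys) ≡ encode xs ++ encode ys
encode-++ []       ys = refl
encode-++ (x ∷ xs) ys = trans (map-++ bit (toList x) (List.concatMap toList (toList (xs Vec.++ ys))))
  (trans (cong (List.map bit (toList x) ++_) (encode-++ xs ys))
      (trans (sym (++-assoc (List.map bit (toList x)) (encode xs) (encode ys)))
    (cong (_++ encode ys) (sym (map-++ bit (toList x) (List.concatMap toList (toList xs)))))))

module Certificate (c : Constants) (X : Vec (Cube (Constants.n c)) (Constants.M c)) (τ₀ count : ℕ)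
  (Verdict : Query → ℕ) where

  open Constants c
  open Labels X using (letters; heads)
  open Lettering X using (heads-letters; letters-∈; letters-surjective)

  blocks : Fin 3 → ℕ
  blocks = triple k₀ k₁ k₂

  pairLabel : (ℕ → ℕ) → (Fin 3 → ℕ) → Fin 3 → ℕ
  pairLabel φ v p = heads φ (blocks p) (blocks p + blocks (next p)) (v p + M ^ blocks p * v (next p))

  record Match (q : Query) : Set where
    constructor match
    field
      vertex : Fin 3 → ℕ
      vertex< : ∀ p → vertex p < M ^ blocks p
      ≥corner : ∀ p → Query.lo q p ≤ vertex p
      <width : ∀ p → vertex p < Query.lo q p + Query.w q p
      labels : ∀ p → pairLabel id vertex p ≡ Query.α q p
      separated : ∀ p → pairLabel (Query.τ q ∸_) vertex p ≡ 0

  solution : (Fin 3 → ℕ) → Vec (Cube n) (k₀ + (k₁ + k₂))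
  solution v = letters k₀ (v zero) Vec.++ (letters k₁ (v (suc zero)) Vec.++ letters k₂ (v (suc (suc zero))))

  solution-∈ : ∀ v → VecAll.All (_∈ X) (solution v)
  solution-∈ v = AllProperties.++⁺ (letters-∈ k₀ (v zero)) (AllProperties.++⁺ (letters-∈ k₁ (v (suc zero)))
      (letters-∈ k₂ (v (suc (suc zero)))))

  within-solution : ∀ φ v → (∀ p → v p < M ^ blocks p) →
    within φ (solution v) ≡ pairLabel φ v zero + pairLabel φ v (suc zero) + pairLabel φ v (suc (suc zero))
  within-solution φ v v< = trans
    (within-triangle φ (letters k₀ (v zero)) (letters k₁ (v (suc zero))) (letters k₂ (v (suc (suc zero)))))
    (sym (cong₂ _+_ (cong₂ _+_ (heads-letters φ k₀ k₁ (v (suc zero)) (v< zero))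
        (heads-letters φ k₁ k₂ (v (suc (suc zero))) (v< (suc zero))))
      (heads-letters φ k₂ k₀ (v zero) (v< (suc (suc zero))))))

  solution-surjective : ∀ {zs} → VecAll.All (_∈ X) zs → ∃[ v ] ((∀ p → v p < M ^ blocks p) × solution v ≡ zs)
  solution-surjective {zs} zs∈ with Vec.splitAt k₀ zs
  ... | xs , ys₀ , refl with Vec.splitAt k₁ ys₀
  ...   | ys , ws , refl
    with xs∈ , rest∈ ← AllProperties.++⁻ xs zs∈
    with ys∈ , ws∈ ← AllProperties.++⁻ ys rest∈
    with a , a< , refl ← letters-surjective xs∈ | b , b< , refl ← letters-surjective ys∈ | d , d< , refl ← letters-surjective ws∈
    = triple a b d , (λ { zero → a< ; (suc zero) → b< ; (suc (suc zero)) → d< }) , refl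

  K : ℕ
  K = count * (V * V * V)

  -- A lexicographic comparison, first by the excess over `τ₀` and then by the sum of distances,
  -- expressed as base V numerals. A competitor may enter with any excess that it achieves.
  Optimal : Vec (Cube n) (k₀ + (k₁ + k₂)) → Set
  Optimal zs = ∀ (ys : Vec (Cube n) (k₀ + (k₁ + k₂))) {τ′} → τ′ < count → VecAll.All (_∈ X) ys →
      Separated (τ₀ + τ′) ys →
    ∃[ τ* ] (τ′ ≤ τ* × τ* < count × Separated (τ₀ + τ*) zs × τ′ * V + sumPD ys ≤ τ* * V + sumPD zs)

  module _ (Verdict⇒match : ∀ q → Verdict q ≢ 0 → Match q) (match⇒Verdict : ∀ q → Match q → Verdict q ≢ 0)
    (sumPD<V : ∀ (zs : Vec (Cube n) (k₀ + (k₁ + k₂))) → sumPD zs < V) (blocks≤w₀ : ∀ p → M ^ blocks p ≤ w₀) where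

    code : (τ′ σ a b : ℕ) → ℕ
    code τ′ σ a b = ((τ′ * V + σ) * V + a) * V + b

    private
      digit-/ : ∀ x {b} → b < V → (x * V + b) / V ≡ x
      digit-/ x {b} b< = trans (+-distrib-/-∣ˡ b (divides-refl x))
          (trans (cong₂ _+_ (m*n/n≡m x V) (m<n⇒m/n≡0 b<)) (+-identityʳ x))

      digit-% : ∀ x {b} → b < V → (x * V + b) % V ≡ b
      digit-% x {b} b< = trans (cong (_% V) (+-comm (x * V) b)) (trans ([m+kn]%n≡m%n b x V) (m<n⇒m%n≡m b<))

      /V² : ∀ κ → κ / (V * V) ≡ κ / V / V
      /V² κ = sym (m/n/o≡m/[n*o] κ V V)

      /V³ : ∀ κ → κ / (V * V * V) ≡ κ / V / V / V
      /V³ κ = trans (sym (m/n/o≡m/[n*o] κ (V * V) V)) (cong (_/ V) (/V² κ))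

      top< : ∀ {x y b} → x < y → b < V → x * V + b < y * V
      top< {x} {y} {b} x< b< = <-≤-trans (+-monoʳ-< (x * V) b<) (≤-trans (≤-reflexive (+-comm (x * V) V))
          (*-monoˡ-≤ V x<))

    -- The labels of the competitor itself serve as the guess. They are digits in base V since their
    -- sum is below V.
    candidate-found : ∀ (ys : Vec (Cube n) (k₀ + (k₁ + k₂))) {τ′} → τ′ < count → VecAll.All (_∈ X) ys →
        Separated (τ₀ + τ′) ys →
      ∃[ κ ] (κ < K × Verdict (candidateQuery c τ₀ κ) ≢ 0 × κ / V / V ≡ τ′ * V + sumPD ys × κ / V / V / V ≡ τ′)
    candidate-found ys {τ′} τ′< ys∈ sep with v , v< , refl ← solution-surjective ys∈ =
      κ , κ<K , match⇒Verdict (candidateQuery c τ₀ κ)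
        (match v v< (λ { zero → z≤n ; (suc zero) → z≤n ; (suc (suc zero)) → z≤n })
          (λ { zero → <-≤-trans (v< zero) (blocks≤w₀ zero) ; (suc zero) →
              <-≤-trans (v< (suc zero)) (blocks≤w₀ (suc zero))
             ; (suc (suc zero)) → <-≤-trans (v< (suc (suc zero))) (blocks≤w₀ (suc (suc zero))) })
          (λ { zero → sym κ-a ; (suc zero) → sym κ-b
             ; (suc (suc zero)) → sym (trans (cong₂ _∸_ (cong₂ _∸_ κ-σ κ-a) κ-b) last-label) })
          (λ p → trans (cong (λ z → pairLabel ((τ₀ + z) ∸_) v p) (trans (/V³ κ) κ-τ)) (no-penalty p)))
        , κ-top , κ-τ
      where
      a b d σ κ : ℕ
      a = pairLabel id v zero
      b = pairLabel id v (suc zero)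
      d = pairLabel id v (suc (suc zero))
      σ = sumPD (solution v)
      κ = code τ′ σ a b
      σ≡ : σ ≡ a + b + d
      σ≡ = trans (sumPD≡within (solution v)) (within-solution id v v<)
      σ< : σ < V
      σ< = sumPD<V (solution v)
      a< : a < V
      a< = ≤-<-trans (≤-trans (≤-trans (m≤m+n a b) (m≤m+n (a + b) d)) (≤-reflexive (sym σ≡))) σ<
      b< : b < V
      b< = ≤-<-trans (≤-trans (≤-trans (m≤n+m b a) (m≤m+n (a + b) d)) (≤-reflexive (sym σ≡))) σ<
      κ/V : κ / V ≡ (τ′ * V + σ) * V + a
      κ/V = digit-/ ((τ′ * V + σ) * V + a) b<
      κ-top : κ / V / V ≡ τ′ * V + σ
      κ-top = trans (cong (_/ V) κ/V) (digit-/ (τ′ * V + σ) a<)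
      κ-τ : κ / V / V / V ≡ τ′
      κ-τ = trans (cong (_/ V) κ-top) (digit-/ τ′ σ<)
      κ-a : (κ / V) % V ≡ a
      κ-a = trans (cong (_% V) κ/V) (digit-% (τ′ * V + σ) a<)
      κ-b : κ % V ≡ b
      κ-b = digit-% ((τ′ * V + σ) * V + a) b<
      κ-σ : (κ / (V * V)) % V ≡ σ
      κ-σ = trans (cong (_% V) (trans (/V² κ) κ-top)) (digit-% τ′ σ<)
      last-label : σ ∸ a ∸ b ≡ d
      last-label = trans (∸-+-assoc σ a b) (trans (cong (_∸ (a + b)) σ≡) (m+n∸m≡n (a + b) d))
      κ<K : κ < K
      κ<K = <-≤-trans (top< (top< (top< τ′< σ<) a<) b<) (≤-reflexive (regroup count V))
        where
        regroup : ∀ c v → c * v * v * v ≡ c * (v * v * v)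
        regroup = solve-∀
      no-penalty : ∀ p → pairLabel ((τ₀ + τ′) ∸_) v p ≡ 0
      no-penalty = parts (trans (sym (within-solution ((τ₀ + τ′) ∸_) v v<)) sep)
        where
        penalty : Fin 3 → ℕ
        penalty = pairLabel ((τ₀ + τ′) ∸_) v
        parts : penalty zero + penalty (suc zero) + penalty (suc (suc zero)) ≡ 0 → ∀ p → penalty p ≡ 0
        parts eq zero             = m+n≡0⇒m≡0 (penalty zero) (m+n≡0⇒m≡0 (penalty zero + penalty (suc zero)) eq)
        parts eq (suc zero)       = m+n≡0⇒n≡0 (penalty zero) (m+n≡0⇒m≡0 (penalty zero + penalty (suc zero)) eq)
        parts eq (suc (suc zero)) = m+n≡0⇒n≡0 (penalty zero + penalty (suc zero)) eq

    -- Every competitor has a code that is hit and thus is at most `κ`. Division by V² is monotone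
    -- and leaves excess and total label, which are the quantities to be compared.
    greatest-optimal : ∀ {κ lo} {α : Fin 3 → ℕ} {w} → κ < K →
      (∀ {κ′} → suc κ ≤ κ′ → κ′ < K → Verdict (candidateQuery c τ₀ κ′) ≡ 0) →
      (∀ p → α p ≡ Query.α (candidateQuery c τ₀ κ) p) → (∀ p → w p ≡ 1) →
      Verdict (query (Query.τ (candidateQuery c τ₀ κ)) α lo w) ≢ 0 → Optimal (solution lo)
    greatest-optimal {κ} {lo} {α} {w} κ<K greatest α≡ w≡1 found ys {τ′} τ′< ys∈ sep
      with κ′ , κ′<K , κ′-found , κ′-top , κ′-τ ← candidate-found ys τ′< ys∈ sep
      with match v v< ≥lo <w labels separated ← Verdict⇒match _ found
      = τ* , τ′≤τ* , τ*<count , zs-separated , top≤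
      where
      κ′≤κ : κ′ ≤ κ
      κ′≤κ = ≮⇒≥ λ κ<κ′ → κ′-found (greatest κ<κ′ κ′<K)
      τ* : ℕ
      τ* = κ / V / V / V
      lo≡v : ∀ p → lo p ≡ v p
      lo≡v p = ≤-antisym (≥lo p)
          (≤-pred (≤-trans (<w p) (≤-reflexive (trans (cong (λ z → lo p + z) (w≡1 p)) (+-comm (lo p) 1)))))
      τ′≤τ* : τ′ ≤ τ*
      τ′≤τ* = ≤-trans (≤-reflexive (sym κ′-τ)) (/-monoˡ-≤ V (/-monoˡ-≤ V (/-monoˡ-≤ V κ′≤κ)))
      τ*<count : τ* < count
      τ*<count = ≤-<-trans (≤-reflexive (sym (/V³ κ))) (m<n*o⇒m/o<n {κ} {count} {V * V * V} κ<K)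
      solution≡ : solution lo ≡ solution v
      solution≡ = cong₂ (λ a (b , d) → letters k₀ a Vec.++ (letters k₁ b Vec.++ letters k₂ d)) (lo≡v zero)
          (cong₂ _,_ (lo≡v (suc zero)) (lo≡v (suc (suc zero))))
      zs-separated : Separated (τ₀ + τ*) (solution lo)
      zs-separated = subst₂ (λ z zs → Separated (τ₀ + z) zs) (/V³ κ) (sym solution≡)
        (trans (within-solution ((τ₀ + κ / (V * V * V)) ∸_) v v<)
          (cong₂ _+_ (cong₂ _+_ (separated zero) (separated (suc zero))) (separated (suc (suc zero)))))
      a b σ : ℕ
      a = (κ / V) % V
      b = κ % V
      σ = (κ / (V * V)) % V
      -- Truncated subtraction only increases the total label beyond σ.
      σ≤ : σ ≤ sumPD (solution lo)
      σ≤ = begin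
        σ                               ≤⟨ m≤n+m∸n σ a ⟩
        a + (σ ∸ a)                     ≤⟨ +-monoʳ-≤ a (m≤n+m∸n (σ ∸ a) b) ⟩
        a + (b + (σ ∸ a ∸ b))           ≡⟨ +-assoc a b (σ ∸ a ∸ b) ⟨
        a + b + (σ ∸ a ∸ b)
          ≡⟨ cong₂ _+_ (cong₂ _+_ (label≡ zero) (label≡ (suc zero))) (label≡ (suc (suc zero))) ⟨
        pairLabel id v zero + pairLabel id v (suc zero) + pairLabel id v (suc (suc zero))
                                        ≡⟨ within-solution id v v< ⟨
        within id (solution v)          ≡⟨ sumPD≡within (solution v) ⟨
        sumPD (solution v)              ≡⟨ cong sumPD solution≡ ⟨
        sumPD (solution lo)             ∎
        where
        open ≤-Reasoning
        label≡ : ∀ p → pairLabel id v p ≡ Query.α (candidateQuery c τ₀ κ) p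
        label≡ p = trans (labels p) (α≡ p)
      top≤ : τ′ * V + sumPD ys ≤ τ* * V + sumPD (solution lo)
      top≤ = begin
        τ′ * V + sumPD ys               ≡⟨ κ′-top ⟨
        κ′ / V / V                      ≤⟨ /-monoˡ-≤ V (/-monoˡ-≤ V κ′≤κ) ⟩
        κ / V / V                       ≡⟨ m≡m%n+[m/n]*n (κ / V / V) V ⟩
        (κ / V / V) % V + τ* * V        ≡⟨ +-comm ((κ / V / V) % V) (τ* * V) ⟩
        τ* * V + (κ / V / V) % V        ≡⟨ cong (λ z → τ* * V + z % V) (/V² κ) ⟨
        τ* * V + σ                      ≤⟨ +-monoʳ-≤ (τ* * V) σ≤ ⟩
        τ* * V + sumPD (solution lo)    ∎
        where open ≤-Reasoning

    -- A competitor would have been found, so there is none.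
    missing-optimal : ∀ lo → (∀ {κ} → 0 ≤ κ → κ < K → Verdict (candidateQuery c τ₀ κ) ≡ 0) → Optimal (solution lo)
    missing-optimal lo misses ys τ′< ys∈ sep with κ , κ<K , found , _ ← candidate-found ys τ′< ys∈ sep =
      contradiction (misses z≤n κ<K) found

block-lengths : ∀ s → (s + 2) / 3 + ((s + 1) / 3 + s / 3) ≡ s
block-lengths 0 = refl
block-lengths 1 = refl
block-lengths 2 = refl
block-lengths (suc (suc (suc s))) = trans (cong₂ _+_ (three (s + 2)) (cong₂ _+_ (three (s + 1)) (three s)))
  (trans (regroup ((s + 2) / 3) ((s + 1) / 3) (s / 3)) (cong (λ z → 3 + z) (block-lengths s)))
  where
  three : ∀ m → (3 + m) / 3 ≡ 1 + m / 3
  three m = +-distrib-/-∣ˡ {3} m {3} (divides-refl 1)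
  regroup : ∀ a b c → 1 + a + (1 + b + (1 + c)) ≡ 3 + (a + (b + c))
  regroup = solve-∀

-- Guarantees that the search for distinct elements has a competitor when s ≤ M, and so that its
-- answer is a set.
distinct-vectors : ∀ {n M} s (X : Vec (Cube n) M) → s ≤ M → Unique X → ∃[ ys ] (VecAll.All (_∈ X) {s} ys × Unique ys)
distinct-vectors zero    X       _         _        = [] , VecAll.[] , []
distinct-vectors (suc s) (x ∷ X) (s≤s s≤M) (x∉ ∷ u) with ys , ys∈ , u′ ← distinct-vectors s X s≤M u =
  x ∷ ys , here refl VecAll.∷ VecAll.map there ys∈ , VecAll.map (VecAll.lookup x∉) ys∈ ∷ u′

-- The three optimisation problems

data Task : Set where
  sumTask minTask setTask : Task

-- Lower bounds run through this many values from `leastOf` on: only 0 for the sum, all of 0 to n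
-- for the minimum, and only 1 for sets.
countOf : Task → ℕ → ℕ
countOf sumTask n = 1
countOf minTask n = n + 1
countOf setTask n = 1

leastOf : Task → ℕ
leastOf sumTask = 0
leastOf minTask = 0
leastOf setTask = 1

countExp : Task → Exp 33
countExp sumTask = var 3
countExp minTask = var 0 ⊕ var 3
countExp setTask = var 3

leastExp : Task → Exp 34
leastExp sumTask = var 3 ⊖ var 3
leastExp minTask = var 3 ⊖ var 3
leastExp setTask = var 3

Goal : Task → Behaviour
Goal sumTask {n} X s out = ∃[ zs ] (out ≡ encode {n} {s} zs × VecAll.All (_∈ X) zs × sumPD zs ≡ OptSum X s)
Goal minTask {n} X s out = ∃[ zs ] (out ≡ encode {n} {s} zs × VecAll.All (_∈ X) zs × minPD zs ≡ OptMin X s)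
Goal setTask {n} {M} X s out = s ≤ M →
  ∃[ zs ] (out ≡ encode {n} {s} zs × VecAll.All (_∈ X) zs × Unique zs × sumPD zs ≡ OptSum≢ X s)

Dominates : Task → ∀ {n M s} → ℕ → Vec (Cube n) M → Vec (Cube n) s → Set
Dominates mode {n} {s = s} V X zs = ∀ (ys : Vec (Cube n) s) {τ′} → τ′ < countOf mode n → VecAll.All (_∈ X) ys →
  Separated (leastOf mode + τ′) ys →
  ∃[ τ* ] (τ′ ≤ τ* × τ* < countOf mode n × Separated (leastOf mode + τ*) zs × τ′ * V + sumPD ys ≤ τ* * V + sumPD zs)

achieves : ∀ mode {n M s V} (X : Vec (Cube n) M) → Unique X → ∀ {out} (zs : Vec (Cube n) s) → out ≡ encode zs →
  VecAll.All (_∈ X) zs → Dominates mode V X zs → Goal mode X s out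
achieves sumTask {V = V} X u zs out≡ zs∈ dom = zs , out≡ , zs∈ , OptSum-maximum X zs∈ λ ys ys∈ →
    dominated (dom ys z<s ys∈ (separated-0 ys))
  where
  dominated : ∀ {a b} → ∃[ τ* ] (0 ≤ τ* × τ* < 1 × Separated (0 + τ*) zs × 0 * V + a ≤ τ* * V + b) → a ≤ b
  dominated (zero , _ , _ , _ , le) = le
  dominated (suc _ , _ , s≤s () , _)
achieves minTask {n} X u zs out≡ zs∈ dom = zs , out≡ , zs∈ , OptMin-maximum X zs∈ λ ys ys∈ →
  -- A competitor enters with its own minimum distance, which is at most n and therefore among the n
  -- + 1 values tried.
  let τ* , τ≤ , τ*< , sep , _ = dom ys (≤-<-trans (minPD≤n ys) (m<m+n n z<s)) ys∈ (separated-minPD ys) in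
  ≤-trans τ≤ (separated⇒minPD zs (≤-pred (≤-trans τ*< (≤-reflexive (+-comm n 1)))) sep)
achieves setTask {n} {M} {s} {V} X u zs out≡ zs∈ dom s≤M
  with ys , ys∈ , u′ ← distinct-vectors s X s≤M u
  = zs , out≡ , zs∈ , unique (dom ys z<s ys∈ (unique⇒separated ys u′))
    , OptSum≢-maximum X zs∈ (unique (dom ys z<s ys∈ (unique⇒separated ys u′)))
        λ ws ws∈ u″ → dominated (dom ws z<s ws∈ (unique⇒separated ws u″))
  where
  unique : ∀ {a b} → ∃[ τ* ] (0 ≤ τ* × τ* < 1 × Separated (1 + τ*) zs × 0 * V + a ≤ τ* * V + b) → Unique zs
  unique (zero , _ , _ , sep , _) = separated⇒unique zs sep
  unique (suc _ , _ , s≤s () , _)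
  dominated : ∀ {a b} → ∃[ τ* ] (0 ≤ τ* × τ* < 1 × Separated (1 + τ*) zs × 0 * V + a ≤ τ* * V + b) → a ≤ b
  dominated (zero , _ , _ , _ , le) = le
  dominated (suc _ , _ , s≤s () , _)

label-inv : ∀ {a b h} → (a ∸ b) + (b ∸ a) + h ≡ 0 → a ≡ b × h ≡ 0
label-inv {a} {b} {h} eq = ≤-antisym (m∸n≡0⇒m≤n (m+n≡0⇒m≡0 (a ∸ b) both)) (m∸n≡0⇒m≤n (m+n≡0⇒n≡0 (a ∸ b) both))
  , m+n≡0⇒n≡0 ((a ∸ b) + (b ∸ a)) eq
  where
  both : (a ∸ b) + (b ∸ a) ≡ 0
  both = m+n≡0⇒m≡0 ((a ∸ b) + (b ∸ a)) eq

label-≡0 : ∀ {a b h} → a ≡ b → h ≡ 0 → (a ∸ b) + (b ∸ a) + h ≡ 0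
label-≡0 {a} refl refl = trans (+-identityʳ ((a ∸ a) + (a ∸ a))) (cong₂ _+_ (n∸n≡0 a) (n∸n≡0 a))

module Extraction (σ : Setting) (1≤D : 1 ≤ Setting.D σ) (identity : Decomposes σ)
  (m′≡ : Constants.m′ (Setting.c σ) ≡
      (Setting.D σ * (Constants.E (Setting.c σ) * (Constants.E (Setting.c σ) * Constants.E (Setting.c σ))))
      ^ Constants.L (Setting.c σ))
  (τ₀ count : ℕ) where

  open Setting σ
  open Constants c
  open Labels X using (letters)
  private
    module Meaning = VerdictMeaning σ 1≤D identity m′≡

  open Solver σ using (Verdict; vertices#)
  open Certificate c X τ₀ count Verdict using (blocks; pairLabel; Match; match; solution; K; Optimal; greatest-optimal; missing-optimal)

  Missing : Set
  Missing = ∀ κ → κ < K → Verdict (candidateQuery c τ₀ κ) ≡ 0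

  Recorded : (τ : ℕ) (α lo : Fin 3 → ℕ) → Set
  Recorded τ α lo = ∃[ κ ] ∃[ w ] (κ < K × (∀ {κ′} → suc κ ≤ κ′ → κ′ < K → Verdict (candidateQuery c τ₀ κ′) ≡ 0)
    × τ ≡ Query.τ (candidateQuery c τ₀ κ) × (∀ p → α p ≡ Query.α (candidateQuery c τ₀ κ) p) × (∀ p → w p ≡ 1)
    × Verdict (query τ α lo w) ≢ 0)

  module _ (powers : N₀ ≡ M ^ k₀ × N₁ ≡ M ^ k₁ × N₂ ≡ M ^ k₂) where

    private
      vertices≡ : ∀ p → vertices# p ≡ M ^ blocks p
      vertices≡ zero             = proj₁ powers
      vertices≡ (suc zero)       = proj₁ (proj₂ powers)
      vertices≡ (suc (suc zero)) = proj₂ (proj₂ powers)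

      mismatch≡ : ∀ q p v → Meaning.mismatchOf q p (v p) (v (next p)) ≡
        (pairLabel id v p ∸ Query.α q p) + (Query.α q p ∸ pairLabel id v p) + pairLabel (Query.τ q ∸_) v p
      mismatch≡ q p v = trans (unfold p) (cong (shape p) (vertices≡ p))
        where
        shape : Fin 3 → ℕ → ℕ
        shape p N = (label ∸ Query.α q p) + (Query.α q p ∸ label) + heads (Query.τ q ∸_) (blocks p)
            (blocks p + blocks (next p)) (v p + N * v (next p))
          where
          open Labels X using (heads)
          label : ℕ
          label = heads id (blocks p) (blocks p + blocks (next p)) (v p + N * v (next p))
        unfold : ∀ p → Meaning.mismatchOf q p (v p) (v (next p)) ≡ shape p (vertices# p)
        unfold zero             = refl
        unfold (suc zero)       = refl
        unfold (suc (suc zero)) = refl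

    Verdict⇒match : ∀ q → Verdict q ≢ 0 → Match q
    Verdict⇒match q ne = fromTriangle (Meaning.Verdict⇒triangle q ne)
      where
      fromTriangle : Meaning.Triangle q → Match q
      fromTriangle (Meaning.triangle v v< ≥lo <w matches) = match v (λ p → subst (v p <_) (vertices≡ p) (v< p)) ≥lo <w
        (λ p → proj₁ (inverted p)) (λ p → proj₂ (inverted p))
        where
        inverted : ∀ p → pairLabel id v p ≡ Query.α q p × pairLabel (Query.τ q ∸_) v p ≡ 0
        inverted p = label-inv (trans (sym (mismatch≡ q p v)) (matches p))

    module _ (vertices≤β^L : ∀ p → vertices# p ≤ β ^ L) where

      match⇒Verdict : ∀ q → Match q → Verdict q ≢ 0
      match⇒Verdict q (match v v< ≥lo <w labels separated) = Meaning.triangle⇒Verdict vertices≤β^L q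
        (Meaning.triangle v (λ p → subst (v p <_) (sym (vertices≡ p)) (v< p)) ≥lo <w
          (λ p → trans (mismatch≡ q p v) (label-≡0 (labels p) (separated p))))

      module _ (lengths : k₀ + (k₁ + k₂) ≡ s) (n*s*s≤V′ : n * s * s ≤ V′) (β^L≤w₀ : β ^ L ≤ w₀) where

        private
          sumPD<V : ∀ (zs : Vec (Cube n) (k₀ + (k₁ + k₂))) → sumPD zs < V
          sumPD<V zs = s≤s (≤-trans (≤-reflexive (sumPD≡within zs)) (≤-trans (within≤ id zs d_H≤)
            (≤-trans (≤-reflexive (trans (cong (λ k → k * (k * n)) lengths) (regroup s n))) n*s*s≤V′)))
            where
            regroup : ∀ s n → s * (s * n) ≡ n * s * s
            regroup = solve-∀

          blocks≤w₀ : ∀ p → M ^ blocks p ≤ w₀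
          blocks≤w₀ p = ≤-trans (≤-reflexive (sym (vertices≡ p))) (≤-trans (vertices≤β^L p) β^L≤w₀)

        answer-optimal : ∀ {τ α lo} → Missing ⊎ Recorded τ α lo → Optimal (solution lo)
        answer-optimal {lo = lo} (inj₁ misses) = missing-optimal Verdict⇒match match⇒Verdict sumPD<V
            blocks≤w₀ lo (λ {κ} _ → misses κ)
        answer-optimal (inj₂ (κ , w , κ<K , greatest , refl , α≡ , w≡1 , found)) =
          greatest-optimal Verdict⇒match match⇒Verdict sumPD<V blocks≤w₀ {κ = κ} κ<K greatest α≡ w≡1 found

  encode-solution : ∀ lo → encode (solution lo) ≡
    (encode (letters k₀ (lo zero)) ++ encode (letters k₁ (lo (suc zero)))) ++ encode (letters k₂ (lo (suc (suc zero))))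
  encode-solution lo = trans (encode-++ (letters k₀ (lo zero)) _)
    (trans (cong (encode (letters k₀ (lo zero)) ++_) (encode-++ (letters k₁ (lo (suc zero))) _))
      (sym (++-assoc (encode (letters k₀ (lo zero))) _ _)))

-- The three algorithms

-- (r^L)^q = (r^q)^L ≤ (b^p)^L = (b^L)^p ≤ (b N)^p. Taking q-th powers throughout avoids the
-- rational exponent.
time-bound : ∀ p q d {b r c C N} .{{_ : NonZero q}} {l M k L t} → 1 ≤ b → r ^ q ≤ b ^ p → b ^ L ≤ b * N → N ≡ M ^ k →
  c ^ d * b ^ p ≤ C → d ≤ C → t ≤ (c * suc l) ^ d * r ^ L → t ^ q ≤ (C * suc l ^ C) ^ q * M ^ (p * k)
time-bound p q d {b} {r} {c} {C} {l = l} {M} {k} {L} {t} b>0 r^q≤b^p b^L≤ refl c≤C d≤C t≤ = begin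
  t ^ q                                                   ≤⟨ ^-monoˡ-≤ q t≤ ⟩
  ((c * suc l) ^ d * r ^ L) ^ q                           ≡⟨ ^-distribʳ-* q ((c * suc l) ^ d) (r ^ L) ⟩
  ((c * suc l) ^ d) ^ q * (r ^ L) ^ q                     ≤⟨ *-monoʳ-≤ (((c * suc l) ^ d) ^ q) leaves ⟩
  ((c * suc l) ^ d) ^ q * ((b ^ p) ^ q * M ^ (p * k))
    ≡⟨ *-assoc (((c * suc l) ^ d) ^ q) ((b ^ p) ^ q) (M ^ (p * k)) ⟨
  ((c * suc l) ^ d) ^ q * (b ^ p) ^ q * M ^ (p * k)
    ≡⟨ cong (_* M ^ (p * k)) (^-distribʳ-* q ((c * suc l) ^ d) (b ^ p)) ⟨
  ((c * suc l) ^ d * b ^ p) ^ q * M ^ (p * k)             ≤⟨ *-monoˡ-≤ (M ^ (p * k)) (^-monoˡ-≤ q constants) ⟩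
  (C * suc l ^ C) ^ q * M ^ (p * k)                       ∎
  where
  open ≤-Reasoning
  leaves : (r ^ L) ^ q ≤ (b ^ p) ^ q * M ^ (p * k)
  leaves = begin
    (r ^ L) ^ q                     ≡⟨ ^-swap r L q ⟩
    (r ^ q) ^ L                     ≤⟨ ^-monoˡ-≤ L r^q≤b^p ⟩
    (b ^ p) ^ L                     ≡⟨ ^-swap b p L ⟩
    (b ^ L) ^ p                     ≤⟨ ^-monoˡ-≤ p b^L≤ ⟩
    (b * M ^ k) ^ p                 ≡⟨ ^-distribʳ-* p b (M ^ k) ⟩
    b ^ p * (M ^ k) ^ p
      ≤⟨ *-mono-≤ (≤-trans (≤-reflexive (sym (*-identityʳ (b ^ p))))
          (^-monoʳ-≤ (b ^ p) {{>-nonZero b^p>0}} (>-nonZero⁻¹ q)))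
                                               (≤-reflexive (trans (^-*-assoc M k p) (cong (M ^_) (*-comm k p)))) ⟩
    (b ^ p) ^ q * M ^ (p * k)       ∎
    where
    b^p>0 : 1 ≤ b ^ p
    b^p>0 = m^n>0 b {{>-nonZero b>0}} p
    ^-swap : ∀ x i j → (x ^ i) ^ j ≡ (x ^ j) ^ i
    ^-swap x i j = trans (^-*-assoc x i j) (trans (cong (x ^_) (*-comm i j)) (sym (^-*-assoc x j i)))
  constants : (c * suc l) ^ d * b ^ p ≤ C * suc l ^ C
  constants = begin
    (c * suc l) ^ d * b ^ p        ≡⟨ cong (_* b ^ p) (^-distribʳ-* d c (suc l)) ⟩
    c ^ d * suc l ^ d * b ^ p     ≡⟨ regroup (c ^ d) (suc l ^ d) (b ^ p) ⟩
    c ^ d * b ^ p * suc l ^ d     ≤⟨ *-mono-≤ c≤C (^-monoʳ-≤ (suc l) d≤C) ⟩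
    C * suc l ^ C                   ∎
    where
    regroup : ∀ x y z → x * y * z ≡ x * z * y
    regroup = solve-∀

above : ∀ w x y z → ∃[ C ] (w < C × x ≤ C × y ≤ C × z ≤ C)
above w x y z = suc w + x + y + z , ≤-trans (m≤m+n (suc w) x) (≤-trans (m≤m+n (suc w + x) y) (m≤m+n _ z))
  , ≤-trans (m≤n+m x (suc w)) (≤-trans (m≤m+n (suc w + x) y) (m≤m+n _ z)) ,
      ≤-trans (m≤n+m y (suc w + x)) (m≤m+n _ z) , m≤n+m z _

module Realisation (β′ R′ D : ℕ) (pos neg : ℕ → ℕ) (1<β : 1 < suc β′) (1≤D : 1 ≤ D)
  (E≤R : suc β′ * suc β′ ≤ suc R′)
  (identity : ∀ {e f g} → e < suc β′ * suc β′ → f < suc β′ * suc β′ → g < suc β′ * suc β′ →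
    sumℤ (suc R′) (λ r → coefficient pos neg (suc β′ * suc β′) 0 r e ℤ.* coefficient pos neg (suc β′ * suc β′) 1 r f
      ℤ.* coefficient pos neg (suc β′ * suc β′) 2 r g) ≡ + (D * linked (suc β′) e f g))
  where

  open Assembly β′ R′ D pos neg using (β; R; E; growth; lengthOf; constants; Grown; Instance; module Run)
  open Sizes β′ R′ D pos neg 1<β using (tableSize; coefficientBound; exponents; e₀; coefficient≤; lengthOf≡; n<^; ≼⇒≤B; n≼; s≼; M≼; N₀≼; once; V≤B; 3+n≤B; is-grown)
  open Timing β′ R′ D pos neg 1<β E≤R using (traversal; module Bound)
  open Program β R D pos neg using (main)

  module Input (C : ℕ) (words : e₀ * 12 < C) (cells : tableSize + 6 * (β * β) ≤ C)
    {n M′ : ℕ} (X : Vec (Cube n) (suc M′)) (s : ℕ) where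

    M N₀ Q W S B : ℕ
    M = suc M′
    N₀ = M ^ ((s + 2) / 3)
    Q = 2 + n + s + M + N₀
    W = Q ^ C
    S = C * M ^ (2 * ((s + 2) / 3))
    B = Sizes.B β′ R′ D pos neg 1<β n s M′

    private
      1<Q : 1 < Q
      1<Q = s≤s (s≤s z≤n)

    5≤B : 5 ≤ B
    5≤B = ≼⇒≤B n s M′ 13 (Magnitudes.≼-constant Q 1<Q 5)

    B^12<W : B ^ 12 < W
    B^12<W = ≤-<-trans (≤-reflexive (^-*-assoc Q e₀ 12)) (^-monoʳ-< Q 1<Q words)

    N₀² : N₀ * N₀ ≡ M ^ (2 * ((s + 2) / 3))
    N₀² = trans (sym (^-distribˡ-+-* M e e)) (cong (M ^_) (cong (λ z → e + z) (sym (+-identityʳ e))))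
      where
      e : ℕ
      e = (s + 2) / 3

    -- The arrays have E^L = (β^L)² ≤ (β N₀)² entries, and the constant size of the table is
    -- absorbed because N₀ is positive.
    arrays≤S : ∀ {L} → β ^ L ≤ β * N₀ → tableSize + 6 * lengthOf L ≤ S
    arrays≤S {L} L≤ = begin
      tableSize + 6 * lengthOf L
        ≡⟨ cong (λ z → tableSize + 6 * z) (trans (lengthOf≡ L) (^-distribʳ-* L β β)) ⟩
      tableSize + 6 * (β ^ L * β ^ L)                       ≤⟨ +-monoʳ-≤ tableSize (*-monoʳ-≤ 6 (*-mono-≤ L≤ L≤)) ⟩
      tableSize + 6 * (β * N₀ * (β * N₀))                   ≡⟨ cong (λ z → tableSize + z) (regroup β N₀) ⟩
      tableSize + 6 * (β * β) * (N₀ * N₀)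
        ≤⟨ +-monoˡ-≤ _ (m≤m*n tableSize (N₀ * N₀) {{>-nonZero (*-mono-≤ N₀>0 N₀>0)}}) ⟩
      tableSize * (N₀ * N₀) + 6 * (β * β) * (N₀ * N₀)       ≡⟨ *-distribʳ-+ (N₀ * N₀) tableSize (6 * (β * β)) ⟨
      (tableSize + 6 * (β * β)) * (N₀ * N₀)                 ≤⟨ *-monoˡ-≤ (N₀ * N₀) cells ⟩
      C * (N₀ * N₀)                                         ≡⟨ cong (C *_) N₀² ⟩
      S                                                     ∎
      where
      open ≤-Reasoning
      N₀>0 : 1 ≤ N₀
      N₀>0 = m^n>0 M ((s + 2) / 3)
      regroup : ∀ b x → 6 * (b * x * (b * x)) ≡ 6 * (b * b) * (x * x)
      regroup = solve-∀

    private
      constant≤B : ∀ i → ∀ x → nth exponents i ≡ x → x ≤ B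
      constant≤B i x refl = ≼⇒≤B n s M′ i (Magnitudes.≼-constant Q 1<Q (nth exponents i))

      coefficients≤B : ∀ {i} → i < tableSize → pos i ≤ B × neg i ≤ B
      coefficients≤B i< = ≤-trans (proj₁ (coefficient≤ tableSize i<)) (constant≤B 12 coefficientBound refl)
        , ≤-trans (proj₂ (coefficient≤ tableSize i<)) (constant≤B 12 coefficientBound refl)

      n≤B : n ≤ B
      n≤B = once n s M′ (n≼ n s M′)
      s≤B : s ≤ B
      s≤B = once n s M′ (s≼ n s M′)
      M≤B : M ≤ B
      M≤B = once n s M′ (M≼ n s M′)

      grown : ∀ L → β ^ L ≤ β * N₀ → Grown S B L
      grown L L≤ = is-grown n s M′ {L} L≤ (arrays≤S {L} L≤)

    private
      ι : Instance
      ι = record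
        { W = W ; S = S ; B = B ; n = n ; s = s ; M′ = M′ ; X = X ; 5≤B = 5≤B ; B^<W = B^12<W ; 1<β = 1<β ; 1≤D = 1≤D
        ; n≤B = n≤B ; s≤B = s≤B ; M≤B = M≤B ; R≤B = constant≤B 8 R refl ; E≤B = constant≤B 9 E refl
        ; 2^β≤B = constant≤B 10 (2 ^ β) refl ; growth≤B = constant≤B 11 growth refl ; coefficients≤B = coefficients≤B
        ; V≤B = V≤B n s M′ ; k₀≤B = ≤-trans (⌈/3⌉≤ s) s≤B ; N₀≤B = once n s M′ (N₀≼ n s M′) ; grown = grown
        ; identity = identity }

    open Run ι using (setting; Objective; module Mode)
    open Logic W S X using (⟦_⟧; Safe; Fits; soundness; Wp)
    open Bounds B W 5≤B B^12<W using (fits; ≼-+; ≼-base; ≼-lit; 1<W)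


    module _ (task : Task) where

      private
        least+count≤B : leastOf task + countOf task n ≤ B
        least+count≤B = ≤-trans (bound task) (3+n≤B n s M′)
          where
          bound : ∀ task → leastOf task + countOf task n ≤ 3 + n
          bound sumTask = s≤s z≤n
          bound minTask = ≤-trans (≤-reflexive (+-comm n 1)) (m≤n+m (1 + n) 2)
          bound setTask = s≤s (s≤s z≤n)

        count-value : ∀ task L q v μ → ⟦ countExp task ⟧ (frame (constants n s M′ L) q v) μ ≡ countOf task n
        count-value sumTask L q v μ = refl
        count-value minTask L q v μ = refl
        count-value setTask L q v μ = refl

        count-safe : ∀ task L q v μ → Safe (countExp task) (frame (constants n s M′ L) q v) μ
        count-safe sumTask L q v μ = _
        count-safe minTask L q v μ = _ , _ , fits (≼-+ (≼-base n≤B) (≼-lit 1))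
        count-safe setTask L q v μ = _

        least-value : ∀ task L k q v μ → ⟦ leastExp task ⟧ (k ∷ frame (constants n s M′ L) q v) μ ≡ leastOf task
        least-value sumTask L k q v μ = refl
        least-value minTask L k q v μ = refl
        least-value setTask L k q v μ = refl

        least-safe : ∀ task L k q v μ → Safe (leastExp task) (k ∷ frame (constants n s M′ L) q v) μ
        least-safe sumTask L k q v μ = _
        least-safe minTask L k q v μ = _
        least-safe setTask L k q v μ = _

        cost-least : ∀ task → cost (leastExp task) ≤ 10
        cost-least sumTask = ≤ᵇ⇒≤ 5 10 _
        cost-least minTask = ≤ᵇ⇒≤ 5 10 _
        cost-least setTask = ≤ᵇ⇒≤ 2 10 _

        cost-count : ∀ task → cost (countExp task) ≤ 10
        cost-count sumTask = ≤ᵇ⇒≤ 2 10 _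
        cost-count minTask = ≤ᵇ⇒≤ 5 10 _
        cost-count setTask = ≤ᵇ⇒≤ 2 10 _

        count≤ : ∀ task → countOf task n ≤ 1 + n
        count≤ sumTask = s≤s z≤n
        count≤ minTask = ≤-reflexive (+-comm n 1)
        count≤ setTask = s≤s z≤n

      private
        objective : Objective
        objective = record
          { countE = countExp task ; τ₀E = leastExp task ; count = countOf task n ; τ₀ = leastOf task
          ; τ₀+count≤B = least+count≤B ; count-value = count-value task ; count-safe = count-safe task
          ; τ₀-value = least-value task ; τ₀-safe = least-safe task }

      open Mode objective using (MainPost; mainW; mainTime; module Stage)

      execution : ∃[ t ] ∃[ σ ] (Machine._,_⇓[_]_ W S X (compile (main (countExp task) (leastExp task)))
          (initial n s M) t σ
        × (∃[ v′ ] MainPost t v′ (mem σ) (output σ)))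
      execution = soundness 1<W (main (countExp task) (leastExp task)) MainPost start (Wp.run mainW)
        where
        start : Fits (initReg n s M) (M ∷ s ∷ n ∷ []) (λ _ → 0)
        start = record
          { agree = λ { {0} _ → refl ; {1} _ → refl ; {2} _ → refl ; {suc (suc (suc _))} (s≤s (s≤s (s≤s ()))) }
          ; small = bounded
          ; smallᵐ = λ _ → fits (≼-lit 0) }
          where
          bounded : ∀ ℓ → look (M ∷ s ∷ n ∷ []) ℓ < W
          bounded 0 = fits (≼-base n≤B)
          bounded 1 = fits (≼-base s≤B)
          bounded 2 = fits (≼-base M≤B)
          bounded (suc (suc (suc _))) = fits (≼-lit 0)

      mainTime≤ : ∀ {L} L≤ N₀≤ {H} → 1000 ≤ H → traversal ≤ H → β ≤ H → tableSize * 14 ≤ H → 1 + n + s ≤ H →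
        mainTime L (grown L L≤) N₀≤ ≤ H ^ 60 * (4 * R) ^ L
      mainTime≤ {L} L≤ N₀≤ {H} a b c d e = Bound.totalTime≤ n s M′ L H N₀≤ a b c d e (count≤ task)
          (cost-least task) (cost-count task)

      private
        module Certified L (L≤ : β ^ L ≤ β * N₀) = Extraction (setting L (grown L L≤)) 1≤D identity
          (cong (_^ L) (cong (D *_) (*-assoc E E E))) (leastOf task) (countOf task n)

        lengths : (s + 2) / 3 + ((s + 1) / 3 + s / 3) ≡ s
        lengths = block-lengths s

        goal : ∀ {out} → Unique X → (∃[ L ] Σ (β ^ L ≤ β * N₀) λ L≤ → Σ (N₀ ≤ β ^ L) λ N₀≤ →
            Stage.Answer L (grown L L≤) N₀≤ out) → Goal task X s out
        -- The blocks yield a vector of length k₀ + (k₁ + k₂), which is s only up to a proof.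
        goal {out} u (L , L≤ , N₀≤ , τ , α , lo , out≡ , correct) = subst (λ z → Goal task X z out) lengths
          (achieves task {V = suc (n * s * s)} X u (solution lo)
              (trans out≡ (sym (Certified.encode-solution L L≤ lo))) (solution-∈ lo)
            (Certified.answer-optimal L L≤ (refl , refl , refl)
                (Stage.vertices≤ L (grown L L≤) N₀≤) lengths ≤-refl (^-monoˡ-≤ L β≤2^β) {τ} {α} {lo}
                (recorded correct)))
          where
          open Certificate (constants n s M′ L) X (leastOf task) (countOf task n) (λ _ → 0) using (solution; solution-∈)
          β≤2^β : β ≤ 2 ^ β
          β≤2^β = <⇒≤ (n<^ 2 ≤-refl β)
          recorded : Stage.Misses L (grown L L≤) 0 ⊎ Stage.Result L (grown L L≤) N₀≤ τ α lo →
              Certified.Missing L L≤ ⊎ Certified.Recorded L L≤ τ α lo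
          recorded (inj₁ misses) = inj₁ (λ κ → misses {κ} z≤n)
          recorded (inj₂ (Stage.result κ κ<K greatest τ≡ α≡ w w≡1 found)) = inj₂ (κ , w , κ<K , greatest ,
              τ≡ , α≡ , w≡1 , found)

      run : ∀ p q {c₀} .{{_ : NonZero q}} → 1000 + (traversal + (β + tableSize * 14)) ≡ c₀ → (4 * R) ^ q ≤ β ^ p →
        c₀ ^ 60 * β ^ p ≤ C → 60 ≤ C → Unique X →
        ∃₂ λ t σ → Machine._,_⇓[_]_ W S X (compile (main (countExp task) (leastExp task))) (initial n s M) t σ
          × t ^ q ≤ (C * (1 + n + s) ^ C) ^ q * M ^ (p * ⌈ s /3⌉) × Goal task X s (output σ)
      run p q {c₀} c₀≡ size c₀≤C 60≤C u = finish execution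
        where
        scaled : ∀ {x} → x ≤ c₀ → x ≤ c₀ * suc (n + s)
        scaled x≤ = ≤-trans x≤ (m≤m*n c₀ (suc (n + s)))
        summands≤ : ∀ a b c d → a + (b + (c + d)) ≡ c₀ → a ≤ c₀ × b ≤ c₀ × c ≤ c₀ × d ≤ c₀
        summands≤ a b c d refl = m≤m+n a _ , ≤-trans (m≤m+n b _) (m≤n+m _ a) ,
            ≤-trans (≤-trans (m≤m+n c d) (m≤n+m _ b)) (m≤n+m _ a)
          , ≤-trans (≤-trans (m≤n+m d c) (m≤n+m _ b)) (m≤n+m _ a)
        below : 1000 ≤ c₀ × traversal ≤ c₀ × β ≤ c₀ × tableSize * 14 ≤ c₀
        below = summands≤ 1000 traversal β (tableSize * 14) c₀≡
        finish : ∃[ t ] ∃[ σ ] (Machine._,_⇓[_]_ W S X (compile (main (countExp task) (leastExp task)))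
            (initial n s M) t σ
            × (∃[ v′ ] MainPost t v′ (mem σ) (output σ))) →
          ∃₂ λ t σ → Machine._,_⇓[_]_ W S X (compile (main (countExp task) (leastExp task))) (initial n s M) t σ
            × t ^ q ≤ (C * (1 + n + s) ^ C) ^ q * M ^ (p * ⌈ s /3⌉) × Goal task X s (output σ)
        finish (t , σ , run , v′ , L , L≤ , N₀≤ , t≤ , answer) = t , σ , run
          , time-bound p q 60 {β} {4 * R} {c₀} {C} {N₀} {l = n + s} {M} {⌈ s /3⌉} {L} (s≤s z≤n) size L≤ refl c₀≤C 60≤C
              (≤-trans t≤ (mainTime≤ {L} L≤ N₀≤ (scaled (proj₁ below)) (scaled (proj₁ (proj₂ below)))
                (scaled (proj₁ (proj₂ (proj₂ below)))) (scaled (proj₂ (proj₂ (proj₂ below))))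
                (m≤n*m (suc (n + s)) c₀ {{>-nonZero (≤-trans (s≤s z≤n) (proj₁ below))}})))
          , goal u (L , L≤ , N₀≤ , answer)

  runs : ∀ task p q .{{_ : NonZero q}} → (4 * R) ^ q ≤ β ^ p →
      RunsWith p q (compile (main (countExp task) (leastExp task))) (Goal task)
  runs task p q size = with-constants (1000 + (traversal + (β + tableSize * 14))) refl
    where
    -- Putting a variable in place of the sum keeps its 60th power from being unfolded.
    with-constants : ∀ c₀ → 1000 + (traversal + (β + tableSize * 14)) ≡ c₀ →
        RunsWith p q (compile (main (countExp task) (leastExp task))) (Goal task)
    with-constants c₀ c₀≡ = with-bound (above (e₀ * 12) (tableSize + 6 * (β * β)) (c₀ ^ 60 * β ^ p) 60)
      where
      with-bound : ∃[ C ] (e₀ * 12 < C × tableSize + 6 * (β * β) ≤ C × c₀ ^ 60 * β ^ p ≤ C × 60 ≤ C) →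
        RunsWith p q (compile (main (countExp task) (leastExp task))) (Goal task)
      with-bound (C , words , cells , c₀≤C , 60≤C) = C , on
        where
        on : ∀ {n M} .{{_ : NonZero M}} (X : Vec (Cube n) M) → Unique X → ∀ s → ∃₂ λ t σ →
          Machine._,_⇓[_]_ ((2 + n + s + M + M ^ ⌈ s /3⌉) ^ C) (C * M ^ (2 * ⌈ s /3⌉)) X
            (compile (main (countExp task) (leastExp task))) (initial n s M) t σ
          × t ^ q ≤ (C * (1 + n + s) ^ C) ^ q * M ^ (p * ⌈ s /3⌉) × Goal task X s (output σ)
        on {M = zero} {{()}}
        on {M = suc M′} X u s = Input.run C words cells X s task p q c₀≡ size c₀≤C 60≤C u

theorem12 : (p q : ℕ) → .{{_ : NonZero q}} → ω< p / q →
    ∃[ 𝒜₁ ] ∃[ 𝒜₂ ] ∃[ 𝒜₃ ]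
      ( RunsWith p q 𝒜₁ (λ {n} X s out →
          ∃[ zs ] (out ≡ encode {n} {s} zs × All (_∈ X) zs × sumPD zs ≡ OptSum X s))
      × RunsWith p q 𝒜₂ (λ {n} X s out →
          ∃[ zs ] (out ≡ encode {n} {s} zs × All (_∈ X) zs × minPD zs ≡ OptMin X s))
      × RunsWith p q 𝒜₃ (λ {n} {M} X s out → s ≤ M →
          ∃[ zs ] (out ≡ encode {n} {s} zs × All (_∈ X) zs × Unique zs
                   × sumPD zs ≡ OptSum≢ X s)))
-- As R = 2 g, the factor 8 gives (4 R)^q ≤ β^p, which is what the time estimate needs.
theorem12 p q ω<p/q = algorithms (base-size p q 8 ω<p/q)
  where
  Algorithms : Set
  Algorithms = ∃[ 𝒜₁ ] ∃[ 𝒜₂ ] ∃[ 𝒜₃ ]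
    (RunsWith p q 𝒜₁ (Goal sumTask) × RunsWith p q 𝒜₂ (Goal minTask) × RunsWith p q 𝒜₃ (Goal setTask))

  algorithms : ∃[ β′ ] ∃[ g ] (1 ≤ β′ × MultipliableWith (suc β′) g × (8 * g) ^ q ≤ suc β′ ^ p) → Algorithms
  algorithms (β′ , g , 1≤β′ , mult , size) = assembled (base-algorithm β′ mult)
    where
    assembled : BaseAlgorithm β′ g → Algorithms
    assembled record
      { R′ = R′ ; D = D ; pos = pos ; neg = neg ; R≡ = R≡ ; 1≤D = 1≤D ; E≤R = E≤R ; identity = identity } =
      _ , _ , _ , runs sumTask p q size′ , runs minTask p q size′ , runs setTask p q size′
      where
      open Realisation β′ R′ D pos neg (s≤s 1≤β′) 1≤D E≤R identity using (runs)
      size′ : (4 * suc R′) ^ q ≤ suc β′ ^ p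
      size′ = subst (λ x → x ^ q ≤ suc β′ ^ p) (trans (trans (*-assoc 4 2 g) (cong (4 *_) (*-comm 2 g)))
          (cong (4 *_) (sym R≡))) size
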